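{- Let $Q$ be a minimal mutation-infinite quiver with $4$ vertices. Then $\Psi(Q)$ is a proper subgraph of $\Gamma(Q)$, and the connected component of $\Psi(Q)$ containing $Q$ is finite and contains the entire move-class of $Q$.
   Context: A quiver is a finite directed multigraph with no loops and no oriented 2-cycles. Mutation $\mu_k$: for every path $i\to k\to j$ add an arrow $i\to j$, reverse all arrows at $k$, delete a maximal collection of oriented 2-cycles. $\mathrm{mut}(Q)$ is the set of quivers obtained from $Q$ by mutation sequences. $Q$ is minimal mutation-infinite if $\mathrm{mut}(Q)$ is infinite up to isomorphism while every induced subquiver on a proper subset of the vertices has finite mutation class. The unlabelled exchange graph $\Gamma(Q)$ has as vertices the quivers of $\mathrm{mut}(Q)$ up to isomorphism, with an edge between two vertices iff the quivers are related by a single mutation. $\Psi(Q)$ is the subgraph of $\Gamma(Q)$ induced on the quivers that admit a maximal green sequence. (Maximal green sequence: with $\hat Q$ the framed quiver obtained by adding frozen vertices $i'$ and arrows $i\to i'$, a sequence $(i_1,\dots,i_l)$ of non-frozen vertices is a maximal green sequence if each $i_t$ is green, i.e. has no incoming arrow from a frozen vertex, in $\mu_{i_{t-1}}\cdots\mu_{i_1}(\hat Q)$, and every non-frozen vertex of $\mu_{i_l}\cdots\mu_{i_1}(\hat Q)$ is red, i.e. has no outgoing arrow to a frozen vertex.) A minimal mutation-infinite move is a sequence of mutations of a minimal mutation-infinite quiver which preserves the property of being minimal mutation-infinite; two minimal mutation-infinite quivers are move-equivalent if a sequence of moves takes one to the other, and the move-class of $Q$ is its equivalence class under this relation. -}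

module Defs where

open import Data.Nat as ℕ using (ℕ; _<_)
open import Data.Integer as ℤ using (ℤ; _+_; _*_; -_; _≤_; _⊔_; +_; 0ℤ; 1ℤ)
open import Data.Fin using (Fin)
open import Data.Fin.Properties using () renaming (_≟_ to _≟ᶠ_)
open import Data.Fin.Permutation using (Permutation′; _⟨$⟩ʳ_)
open import Data.Sum using (_⊎_; inj₁; inj₂)
open import Data.Sum.Properties using (≡-dec)
open import Data.Product using (Σ; ∃; _×_; _,_)
open import Data.List using (List; []; _∷_)
open import Data.List.Relation.Unary.Any using (Any)
open import Relation.Binary.PropositionalEquality using (_≡_)
open import Relation.Binary.Definitions using (DecidableEquality)
open import Relation.Binary.Construct.Closure.ReflexiveTransitive using (Star)
open import Relation.Nullary using (¬_; yes; no)
open import Function.Definitions using (Injective)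

-- Quivers (no loops, no oriented 2-cycles) on a vertex set V are encoded,
-- as usual, by their skew-symmetric exchange matrix:
--   B i j = (#arrows i → j) − (#arrows j → i).

Mat : Set → Set
Mat V = V → V → ℤ

IsQuiver : {V : Set} → Mat V → Set
IsQuiver {V} B = ∀ (i j : V) → B i j ≡ - B j i

pos : ℤ → ℤ
pos x = x ⊔ 0ℤ

-- Mutation at k: for every path i → k → j add an arrow i → j, reverse the
-- arrows at k, cancel 2-cycles.  In matrix form:
--   μ_k(B) i j = − B i j                     if i = k or j = k
--              = B i j + [B i k]₊ [B k j]₊ − [−B i k]₊ [−B k j]₊   otherwise
mutate : {V : Set} → DecidableEquality V → V → Mat V → Mat V
mutate _≟_ k B i j with i ≟ k | j ≟ k
... | yes _ | _     = - B i j
... | no _  | yes _ = - B i j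
... | no _  | no _  = B i j + pos (B i k) * pos (B k j)
                            + - (pos (- B i k) * pos (- B k j))

Q : ℕ → Set
Q n = Mat (Fin n)

μ : {n : ℕ} → Fin n → Q n → Q n
μ = mutate _≟ᶠ_

μs : {n : ℕ} → List (Fin n) → Q n → Q n
μs []       B = B
μs (k ∷ ks) B = μs ks (μ k B)

_≅_ : {n : ℕ} → Q n → Q n → Set
_≅_ {n} B C = Σ (Permutation′ n) λ σ → ∀ i j → C (σ ⟨$⟩ʳ i) (σ ⟨$⟩ʳ j) ≡ B i j

MutFinite : {n : ℕ} → Q n → Set
MutFinite {n} B = Σ (List (Q n)) λ L → ∀ (ks : List (Fin n)) → Any (μs ks B ≅_) L

restrict : {m n : ℕ} → (Fin m → Fin n) → Q n → Q m
restrict f B i j = B (f i) (f j)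

MinMutInf : {n : ℕ} → Q n → Set
MinMutInf {n} B =
  IsQuiver B × ¬ MutFinite B ×
  (∀ (m : ℕ) (f : Fin m → Fin n) → m < n → Injective _≡_ _≡_ f → MutFinite (restrict f B))

-- Framed quiver: vertices inj₁ i (mutable) and inj₂ i = i' (frozen),
-- with one arrow i → i' for each i.

decV : {n : ℕ} → DecidableEquality (Fin n ⊎ Fin n)
decV = ≡-dec _≟ᶠ_ _≟ᶠ_

δ : {n : ℕ} → Fin n → Fin n → ℤ
δ i j with i ≟ᶠ j
... | yes _ = 1ℤ
... | no _  = 0ℤ

framed : {n : ℕ} → Q n → Mat (Fin n ⊎ Fin n)
framed B (inj₁ i) (inj₁ j) = B i j
framed B (inj₁ i) (inj₂ j) = δ i j
framed B (inj₂ i) (inj₁ j) = - δ i j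
framed B (inj₂ i) (inj₂ j) = 0ℤ

Green : {n : ℕ} → Mat (Fin n ⊎ Fin n) → Fin n → Set
Green {n} M k = ∀ (j : Fin n) → M (inj₂ j) (inj₁ k) ≤ 0ℤ

Red : {n : ℕ} → Mat (Fin n ⊎ Fin n) → Fin n → Set
Red {n} M k = ∀ (j : Fin n) → M (inj₁ k) (inj₂ j) ≤ 0ℤ

GreenSeq : {n : ℕ} → Mat (Fin n ⊎ Fin n) → List (Fin n) → Set
GreenSeq M []       = ∀ k → Red M k
GreenSeq M (k ∷ ks) = Green M k × GreenSeq (mutate decV (inj₁ k) M) ks

IsMGS : {n : ℕ} → Q n → List (Fin n) → Set
IsMGS B ks = GreenSeq (framed B) ks

HasMGS : {n : ℕ} → Q n → Set
HasMGS {n} B = ∃ λ (ks : List (Fin n)) → IsMGS B ks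

data InPsiComp {n : ℕ} (B₀ : Q n) : Q n → Set where
  here : HasMGS B₀ → InPsiComp B₀ B₀
  step : ∀ {B} → InPsiComp B₀ B → (k : Fin n) → HasMGS (μ k B) → InPsiComp B₀ (μ k B)

-- Ψ(Q) is a proper subgraph of Γ(Q) (Ψ is induced, so: some vertex is missing)
PsiProper : {n : ℕ} → Q n → Set
PsiProper {n} B = ∃ λ (ks : List (Fin n)) → ¬ HasMGS (μs ks B)

PsiCompFinite : {n : ℕ} → Q n → Set
PsiCompFinite {n} B = Σ (List (Q n)) λ L → ∀ C → InPsiComp B C → Any (C ≅_) L

Move : {n : ℕ} → Q n → Q n → Set
Move {n} B C = MinMutInf B × MinMutInf C ×
  (∃ λ (ks : List (Fin n)) → ∀ i j → μs ks B i j ≡ C i j)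

MoveEquiv : {n : ℕ} → Q n → Q n → Set
MoveEquiv = Star Move

MoveClassInComp : {n : ℕ} → Q n → Set
MoveClassInComp {n} B = ∀ (C : Q n) → MoveEquiv B C → ∃ λ D → InPsiComp B D × (D ≅ C)

-- To an exchange matrix B one attaches a series p in the quantum torus y^a y^b = v^{B(a,b)} y^{a+b}: on the coordinate axes
-- it is the quantum dilogarithm, elsewhere it has no incoming terms (in the sense of scattering diagrams). Mutation at k
-- reflects p. A maximal green sequence therefore factors p into dilogarithms E(y^x), one for each c-vector, beginning and
-- ending with simple ones; positivity at v = 2 keeps the factors apart and replaces sign-coherence. Comparing coefficients,
-- an arrow a → b of multiplicity w ≥ 2 forces E(y_a) to stand before E(y_b), since [w]_v is not an integer. Hence no
-- maximal green sequence exists if there is a cyclic triangle of such arrows, and a variant with coefficients of degree 3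
-- covers the remaining quivers on the boundary of the components of Ψ.
-- The minimal mutation-infinite quivers with 4 vertices have entries at most 2, which leaves a finite enumeration: 16
-- isomorphism classes in 5 components. Components in different mutation classes are told apart by |Pf B| and, for the two
-- with |Pf B| = 1, by the residues of the entries modulo 3.
module Submission where

-- A move may pass through quivers without a maximal green sequence, so it cannot be followed inside
-- Ψ. Of a move-equivalent quiver only minimality and mutation equivalence are kept; the
-- classification and the invariants of the mutation class then locate it. The hard half is the
-- non-existence of maximal green sequences. Mutation acts on exponents by a reflection, which does
-- not preserve nonnegative entries. It applies to power series only after E(y_k) has been split
-- off: along every line in direction k the rest is a polynomial, its degree bounded by the weight
-- of the arrows into (or out of) k. Proving this bound is the core, and it is what the absence of
-- incoming terms is for. A factorization with E(y_k) at one end then passes to the mutated quiver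
-- with E(y_k) at the other end, so a cyclic triangle of multiple arrows in the mutation at k
-- already forbids k as first or last factor. At v = 2 all coefficients are nonnegative rationals,
-- and non-integrality of [w]_v is a question of parity.

open import Data.Nat as ℕ using (ℕ; zero; suc)
import Data.Nat.Properties as ℕP
open import Data.Integer as ℤ using (ℤ; 0ℤ; 1ℤ; -[1+_]) renaming (+_ to ⁺_)
import Data.Integer.Properties as ℤP
open import Data.Integer.Tactic.RingSolver using (solve-∀)
open import Data.Fin using (Fin; zero; suc)
open import Data.Fin.Properties using () renaming (_≟_ to _≟ᶠ_)
open import Data.Vec using (Vec; []; _∷_; lookup; insertAt; removeAt)
open import Data.List as List using (List; []; _∷_)
open import Data.Product using (Σ; _×_; _,_; proj₁; proj₂)
open import Data.Sum using (_⊎_; inj₁; inj₂)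
open import Data.Empty using (⊥; ⊥-elim)
open import Data.Unit using (⊤; tt)
open import Data.Bool using (Bool; true; false; not)
open import Relation.Nullary using (¬_; Dec; yes; no)
open import Relation.Binary.PropositionalEquality hiding (J; trans; sym; cong; cong₂; subst; subst₂; _≢_; _≗_)

-- The library versions are universe polymorphic; everything here lives in Set.
infix 4 _≢_ _≗_

_≢_ : {A : Set} → A → A → Set
x ≢ y = ¬ (x ≡ y)

_≗_ : {A B : Set} → (A → B) → (A → B) → Set
f ≗ g = ∀ x → f x ≡ g x

∃ : {A : Set} → (A → Set) → Set
∃ {A} = Σ A

trans : {A : Set} {x y z : A} → x ≡ y → y ≡ z → x ≡ z
trans refl e = e

sym : {A : Set} {x y : A} → x ≡ y → y ≡ x
sym refl = refl

cong : {A B : Set} (f : A → B) {x y : A} → x ≡ y → f x ≡ f y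
cong f refl = refl

cong₂ : {A B C : Set} (f : A → B → C) {x y : A} {u v : B} → x ≡ y → u ≡ v → f x u ≡ f y v
cong₂ f refl refl = refl

subst : {A : Set} (P : A → Set) {x y : A} → x ≡ y → P x → P y
subst P refl p = p

subst₂ : {A B : Set} (P : A → B → Set) {x y : A} {u v : B} → x ≡ y → u ≡ v → P x u → P y v
subst₂ P refl refl p = p

private

 -- Rational scalars: powers of v and the coefficients of the quantum dilogarithm.

 module Scalars where
  open import Level using (0ℓ)
  open import Data.Nat.Divisibility using (_∣_; divides; m∣m*n; n∣m*n; ∣m+n∣m⇒∣n; ∣m∣n⇒∣m+n; ∣-trans; ∣1⇒≡1)
  open import Data.Integer using (_⊖_)
  import Data.Rational as ℚ
  import Data.Rational.Properties as ℚP
  open import Data.Rational.Solver using (module +-*-Solver)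
  open import Algebra.Bundles using (CommutativeRing)
  open import Algebra.Structures using (IsCommutativeRing)
  open import Algebra.Properties.Group ℚP.+-0-group using () renaming (∙-cancelˡ to +-cancelˡ-ℚ)

  open ≡-Reasoning
  open +-*-Solver using (solve; _:=_; _:+_; _:*_; _:-_; :-_; con)

  infixl 6 _+_
  infixl 7 _*_
  infix  8 -_

  abstract
   F : Set
   F = ℚ.ℚ

   _+_ _*_ : F → F → F
   _+_ = ℚ._+_
   _*_ = ℚ._*_

   -_ : F → F
   -_ = ℚ.-_

   0F 1F : F
   0F = ℚ.0ℚ
   1F = ℚ.1ℚ

   isCommutativeRing : IsCommutativeRing _≡_ _+_ _*_ -_ 0F 1F
   isCommutativeRing = ℚP.+-*-isCommutativeRing

  commutativeRing : CommutativeRing 0ℓ 0ℓ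
  commutativeRing = record { isCommutativeRing = isCommutativeRing }

  abstract
   pow : F → ℕ → F
   pow x zero    = 1F
   pow x (suc n) = x * pow x n

   two half : F
   two  = ⁺ 2 ℚ./ 1
   half = ⁺ 1 ℚ./ 2

   -- The powers of v = q^(1/2), specialised to v = 2.
   pw : ℤ → F
   pw (⁺ n)     = pow two n
   pw -[1+ n ]  = pow half (suc n)

   pw-0 : pw (⁺ 0) ≡ 1F
   pw-0 = refl

   private
    pw-⊖ : ∀ m n → pw (m ⊖ n) ≡ pow two m * pow half n
    pw-⊖ m       zero    = sym (ℚP.*-identityʳ _)
    pw-⊖ zero    (suc n) = sym (ℚP.*-identityˡ _)
    pw-⊖ (suc m) (suc n) = begin
     pw (suc m ⊖ suc n)  ≡⟨ cong pw (ℤP.[1+m]⊖[1+n]≡m⊖n m n) ⟩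
     pw (m ⊖ n)          ≡⟨ pw-⊖ m n ⟩
     pow two m * pow half n ≡⟨ solve 2 (λ a b → a :* b := (con two :* a) :* (con half :* b)) refl (pow two m) (pow half n) ⟩
     pow two (suc m) * pow half (suc n) ∎

    pow-+ : ∀ x m n → pow x (m ℕ.+ n) ≡ pow x m * pow x n
    pow-+ x zero    n = sym (ℚP.*-identityˡ _)
    pow-+ x (suc m) n = trans (cong (x *_) (pow-+ x m n)) (sym (ℚP.*-assoc x (pow x m) (pow x n)))

   pw-+ : ∀ i j → pw (i ℤ.+ j) ≡ pw i * pw j
   pw-+ (⁺ m)    (⁺ n)    = pow-+ two m n
   pw-+ (⁺ m)    -[1+ n ] = pw-⊖ m (suc n)
   pw-+ -[1+ m ] (⁺ n)    = trans (pw-⊖ n (suc m)) (ℚP.*-comm (pow two n) (pow half (suc m)))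
   pw-+ -[1+ m ] -[1+ n ] = trans (cong (pow half) (sym (ℕP.+-suc (suc m) n))) (pow-+ half (suc m) (suc n))

   NonNeg Pos : F → Set
   NonNeg x = ℚ.0ℚ ℚ.≤ x
   Pos x    = ℚ.0ℚ ℚ.< x

   Pos⇒NonNeg : ∀ {x} → Pos x → NonNeg x
   Pos⇒NonNeg = ℚP.<⇒≤

   Pos⇒≢0 : ∀ {x} → Pos x → x ≢ 0F
   Pos⇒≢0 p refl = ℚP.<-irrefl refl p

   NonNeg-0 : NonNeg 0F
   NonNeg-0 = ℚP.≤-refl

   Pos-1 : Pos 1F
   Pos-1 = ℚP.positive⁻¹ ℚ.1ℚ

   NonNeg-+ : ∀ {x y} → NonNeg x → NonNeg y → NonNeg (x + y)
   NonNeg-+ = ℚP.+-mono-≤ {ℚ.0ℚ} {_} {ℚ.0ℚ}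

   Pos-+ˡ : ∀ {x y} → Pos x → NonNeg y → Pos (x + y)
   Pos-+ˡ = ℚP.+-mono-<-≤ {ℚ.0ℚ} {_} {ℚ.0ℚ}

   Pos-* : ∀ {x y} → Pos x → Pos y → Pos (x * y)
   Pos-* {x} {y} p q = ℚP.positive⁻¹ (x ℚ.* y) {{ℚP.pos*pos⇒pos x {{ℚ.positive p}} y {{ℚ.positive q}}}}

   NonNeg-* : ∀ {x y} → NonNeg x → NonNeg y → NonNeg (x * y)
   NonNeg-* {x} {y} p q = ℚP.nonNegative⁻¹ (x ℚ.* y)
    {{ℚP.nonNeg*nonNeg⇒nonNeg x {{ℚ.nonNegative p}} y {{ℚ.nonNegative q}}}}

   private
    Pos-pow : ∀ {x} → Pos x → ∀ n → Pos (pow x n)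
    Pos-pow p zero    = Pos-1
    Pos-pow p (suc n) = Pos-* p (Pos-pow p n)

   Pos-pw : ∀ i → Pos (pw i)
   Pos-pw (⁺ n)    = Pos-pow (ℚP.positive⁻¹ two) n
   Pos-pw -[1+ n ] = Pos-pow (ℚP.positive⁻¹ half) (suc n)

   private
    gap : ℕ → F
    gap j = pw (⁺ suc j) + - pw -[1+ j ]

    3/2 : F
    3/2 = ⁺ 3 ℚ./ 2

    -- `gap j` is v^(j+1) - v^(-j-1), the denominator in the recursion for `ε`. Written as this
    -- positive combination, its positivity follows by induction.
    gap-suc : ∀ j → gap (suc j) ≡ half * gap j + 3/2 * pow two (suc j)
    gap-suc j = solve 2 (λ a b → (con two :* a) :+ (:- (con half :* b)) := (con half :* (a :+ (:- b))) :+ (con 3/2 :* a)) refl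
     (pow two (suc j)) (pow half (suc j))

    Pos-gap : ∀ j → Pos (gap j)
    Pos-gap zero    = ℚP.positive⁻¹ (gap zero)
    Pos-gap (suc j) = subst Pos (sym (gap-suc j))
     (Pos-+ˡ (Pos-* (ℚP.positive⁻¹ half) (Pos-gap j))
         (Pos⇒NonNeg (Pos-* (ℚP.positive⁻¹ 3/2) (Pos-pow (ℚP.positive⁻¹ two) (suc j)))))

    recip : ℕ → F
    recip j = ℚ.1/_ (gap j) {{ℚP.pos⇒nonZero (gap j) {{ℚ.positive (Pos-gap j)}}}}

    Pos-recip : ∀ j → Pos (recip j)
    Pos-recip j = ℚP.positive⁻¹ _ {{ℚP.1/pos⇒pos (gap j) {{ℚ.positive (Pos-gap j)}}}}

    recip-gap : ∀ j → recip j * gap j ≡ 1F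
    recip-gap j = ℚP.*-inverseˡ (gap j) {{ℚP.pos⇒nonZero (gap j) {{ℚ.positive (Pos-gap j)}}}}

   private
    ε-aux : ∀ (e r a b : F) → r * (a + - b) ≡ 1F → (e * r) * a ≡ (e * r) * b + e
    ε-aux e r a b h = begin
     (e * r) * a                      ≡⟨ solve 4 (λ e r a b → (e :* r) :* a := (e :* r) :* b :+ e :* (r :* (a :+ (:- b)))) refl e r a b ⟩
     (e * r) * b + e * (r * (a + - b)) ≡⟨ cong (λ z → (e * r) * b + e * z) h ⟩
     (e * r) * b + e * 1F             ≡⟨ cong ((e * r) * b +_) (ℚP.*-identityʳ e) ⟩
     (e * r) * b + e ∎

   -- The coefficients of the quantum dilogarithm E(y) = Σ ε j y^j at q^{1/2} = 2, i.e. E(4 y) = (1 + 2 y) E(y).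
   ε : ℕ → F
   ε zero    = 1F
   ε (suc j) = (ε j * pw (ℤ.- ⁺ j)) * recip j

   ε-0 : ε 0 ≡ 1F
   ε-0 = refl

   -- The functional equation E(v y) = (1 + y) E(v⁻¹ y), compared at degree j + 1.
   ε-suc : ∀ j → ε (suc j) * pw (⁺ suc j) ≡ ε (suc j) * pw (ℤ.- ⁺ suc j) + ε j * pw (ℤ.- ⁺ j)
   ε-suc j = ε-aux (ε j * pw (ℤ.- ⁺ j)) (recip j) (pw (⁺ suc j)) (pw -[1+ j ]) (recip-gap j)

   Pos-ε : ∀ j → Pos (ε j)
   Pos-ε zero    = Pos-1
   Pos-ε (suc j) = Pos-* (Pos-* (Pos-ε j) (Pos-pw (ℤ.- ⁺ j))) (Pos-recip j)

  natF : ℕ → F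
  natF zero    = 0F
  natF (suc n) = 1F + natF n

  abstract
   private
    natF-+ : ∀ m n → natF (m ℕ.+ n) ≡ natF m + natF n
    natF-+ zero    n = sym (ℚP.+-identityˡ _)
    natF-+ (suc m) n = trans (cong (1F +_) (natF-+ m n)) (sym (ℚP.+-assoc 1F (natF m) (natF n)))

    natF-* : ∀ m n → natF (m ℕ.* n) ≡ natF m * natF n
    natF-* zero    n = sym (ℚP.*-zeroˡ (natF n))
    natF-* (suc m) n = trans (natF-+ n (m ℕ.* n)) (trans (cong (λ z → natF n + z) (natF-* m n))
     (solve 2 (λ a b → b :+ a :* b := (con 1F :+ a) :* b) refl (natF m) (natF n)))

    NonNeg-natF : ∀ n → NonNeg (natF n)
    NonNeg-natF zero    = NonNeg-0
    NonNeg-natF (suc n) = NonNeg-+ (Pos⇒NonNeg Pos-1) (NonNeg-natF n)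

    natF-injective : ∀ m n → natF m ≡ natF n → m ≡ n
    natF-injective zero    zero    e = refl
    natF-injective zero    (suc n) e = ⊥-elim (Pos⇒≢0 (Pos-+ˡ Pos-1 (NonNeg-natF n)) (sym e))
    natF-injective (suc m) zero    e = ⊥-elim (Pos⇒≢0 (Pos-+ˡ Pos-1 (NonNeg-natF m)) e)
    natF-injective (suc m) (suc n) e = cong suc (natF-injective m n (+-cancelˡ-ℚ 1F (natF m) (natF n) e))

    pow-two : ∀ n → pow two n ≡ natF (2 ℕ.^ n)
    pow-two zero    = refl
    pow-two (suc n) = trans (cong (two *_) (pow-two n)) (sym (natF-* 2 (2 ℕ.^ n)))

    half-two : ∀ n → pow half n * pow two n ≡ 1F
    half-two zero    = refl
    half-two (suc n) = trans (solve 2 (λ a b → (con half :* a) :* (con two :* b) := a :* b) refl (pow half n) (pow two n)) (half-two n)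

    odd≢even : ∀ a b → suc (2 ℕ.* a) ≢ 2 ℕ.* b
    odd≢even a b e with ∣1⇒≡1 (∣m+n∣m⇒∣n (subst (2 ∣_) (trans (sym e) (ℕP.+-comm 1 (2 ℕ.* a))) (m∣m*n b)) (m∣m*n a))
    ... | ()

    -- `ε 1` is 2/3, so the factor 9 T with T = 2^w clears every denominator on the two sides of the
    -- equation in `quantum-nonintegral`, where the multiplicity is 2 + w.
    lhs-aux : ∀ e n H T → e ≡ ε 1 →
     (n * e + (e * e) * (half * (half * H))) * (natF 9 * T) ≡ (natF 6 * n) * T + H * T
    lhs-aux e n H T refl = solve 3 (λ n H T → (n :* con (ε 1) :+ (con (ε 1) :* con (ε 1)) :* (con half :* (con half :* H))) :* (con (natF 9) :* T)
             := (con (natF 6) :* n) :* T :+ H :* T) refl n H T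

    rhs-aux : ∀ e T → e ≡ ε 1 → ((e * e) * (two * (two * T))) * (natF 9 * T) ≡ natF 16 * (T * T)
    rhs-aux e T refl = solve 1 (λ T → ((con (ε 1) :* con (ε 1)) :* (con two :* (con two :* T))) :* (con (natF 9) :* T) := con (natF 16) :* (T :* T)) refl T

    split-aux : ∀ n T → natF 1 + natF 2 * ((natF 3 * n) * T) ≡ (natF 6 * n) * T + natF 1
    split-aux = solve 2 (λ n T → con (natF 1) :+ con (natF 2) :* ((con (natF 3) :* n) :* T) := (con (natF 6) :* n) :* T :+ con (natF 1)) refl

    -- The left side is odd and the right side even; the rational equation is pulled back to ℕ along
    -- the injection `natF`.
    parity : ∀ N t → (natF 6 * natF N) * natF t + natF 1 ≡ natF 16 * (natF t * natF t) → ⊥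
    parity N t e = odd≢even (3 ℕ.* N ℕ.* t) (8 ℕ.* (t ℕ.* t)) (natF-injective (suc (2 ℕ.* (3 ℕ.* N ℕ.* t))) (2 ℕ.* (8 ℕ.* (t ℕ.* t)))
     (trans (natF-+ 1 (2 ℕ.* (3 ℕ.* N ℕ.* t)))
     (trans (cong (λ z → natF 1 + z) (trans (natF-* 2 (3 ℕ.* N ℕ.* t)) (cong (λ z → natF 2 * z)
      (trans (natF-* (3 ℕ.* N) t) (cong (λ z → z * natF t) (natF-* 3 N))))))
     (trans (split-aux (natF N) (natF t))
     (trans e
     (trans (cong (λ z → natF 16 * z) (sym (natF-* t t)))
     (trans (sym (natF-* 16 (t ℕ.* t))) (cong natF (ℕP.*-assoc 2 8 (t ℕ.* t))))))))))

   -- The quantum integer (v^w − v^{-w}) / (v − v^{-1}) is not an integer at v = 2 when w ≥ 2.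
   quantum-nonintegral : ∀ N w → natF N * ε 1 + (ε 1 * ε 1) * pw (ℤ.- ⁺ (2 ℕ.+ w)) ≢ (ε 1 * ε 1) * pw (⁺ (2 ℕ.+ w))
   quantum-nonintegral N w e = parity N (2 ℕ.^ w)
    (trans (cong (λ z → (natF 6 * natF N) * z + natF 1) (sym (pow-two w)))
    (trans (cong (λ z → (natF 6 * natF N) * pow two w + z) (sym (half-two w)))
    (trans (sym (lhs-aux (ε 1) (natF N) (pow half w) (pow two w) refl))
    (trans (cong (λ z → z * (natF 9 * pow two w)) e)
    (trans (rhs-aux (ε 1) (pow two w) refl)
    (cong (λ z → natF 16 * (z * z)) (pow-two w)))))))

   -- `3/2` is the inverse of `ε 1`. This reads the multiplicity of a factor off a linear
   -- coefficient.
   natF-cancel : ∀ c → natF c * ε 1 ≡ ε 1 → c ≡ 1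
   natF-cancel c e = natF-injective c 1 (trans (sym (ℚP.*-identityʳ (natF c)))
    (trans (cong (λ z → natF c * z) (sym 3/2-ε)) (trans (sym (ℚP.*-assoc (natF c) (ε 1) 3/2)) (trans (cong (λ z → z * 3/2) e) 3/2-ε))))
    where
    3/2-ε : ε 1 * 3/2 ≡ 1F
    3/2-ε = refl

   natF-sum : ∀ m n → natF (m ℕ.+ n) ≡ natF m + natF n
   natF-sum = natF-+

   natF-1 : natF 1 ≡ 1F
   natF-1 = refl

   natF-prod : ∀ m n → natF (m ℕ.* n) ≡ natF m * natF n
   natF-prod = natF-*

 -- Sums over splittings of exponents, and series defined by recursion on the degree.

 module Sums where
  open Scalars
  open import Algebra.Bundles using (CommutativeRing)
  import Algebra.Solver.Ring.NaturalCoefficients.Default (CommutativeRing.commutativeSemiring commutativeRing) as FS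
  open import Data.Vec using (zipWith; replicate; sum)
  open import Data.Vec.Properties using (insertAt-lookup; removeAt-insertAt; insertAt-removeAt; zipWith-assoc; zipWith-identityˡ; zipWith-identityʳ)

  open CommutativeRing commutativeRing public using (+-identityˡ; +-identityʳ; *-identityˡ; *-identityʳ; +-assoc; *-assoc; *-comm; +-comm; distribˡ; distribʳ)
   renaming (zeroˡ to *-zeroˡ; zeroʳ to *-zeroʳ; -‿inverseˡ to +-inverseˡ; -‿inverseʳ to +-inverseʳ)
  open FS using (solve; _:=_; _:+_; _:*_)
  open ≡-Reasoning

  +ˡ : ∀ {a b c} → b ≡ c → a + b ≡ a + c
  +ˡ {a} = cong (a +_)

  +ʳ : ∀ {a b c} → a ≡ b → a + c ≡ b + c
  +ʳ {c = c} = cong (_+ c)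

  *ˡ : ∀ {a b c} → b ≡ c → a * b ≡ a * c
  *ˡ {a} = cong (a *_)

  *ʳ : ∀ {a b c} → a ≡ b → a * c ≡ b * c
  *ʳ {c = c} = cong (_* c)

  -- Runs over the ordered splittings i + j = n and hands on both parts, so that truncated
  -- subtraction never enters.
  ∑₁ : ℕ → (ℕ → ℕ → F) → F
  ∑₁ zero    F = F 0 0
  ∑₁ (suc n) F = F 0 (suc n) + ∑₁ n (λ i j → F (suc i) j)

  ∑₁-cong : ∀ n {F G : ℕ → ℕ → F} → (∀ i j → i ℕ.+ j ≡ n → F i j ≡ G i j) → ∑₁ n F ≡ ∑₁ n G
  ∑₁-cong zero    h = h 0 0 refl
  ∑₁-cong (suc n) h = cong₂ _+_ (h 0 (suc n) refl) (∑₁-cong n (λ i j e → h (suc i) j (cong suc e)))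

  ∑₁-0 : ∀ n → ∑₁ n (λ _ _ → 0F) ≡ 0F
  ∑₁-0 zero    = refl
  ∑₁-0 (suc n) = trans (+-identityˡ _) (∑₁-0 n)

  +-interchange : ∀ a b c d → (a + b) + (c + d) ≡ (a + c) + (b + d)
  +-interchange = solve 4 (λ a b c d → (a :+ b) :+ (c :+ d) := (a :+ c) :+ (b :+ d)) refl

  ∑₁-+ : ∀ n (F G : ℕ → ℕ → F) → ∑₁ n (λ i j → F i j + G i j) ≡ ∑₁ n F + ∑₁ n G
  ∑₁-+ zero    F G = refl
  ∑₁-+ (suc n) F G = trans (+ˡ (∑₁-+ n _ _)) (+-interchange _ _ _ _)

  ∑₁-*ˡ : ∀ c n (F : ℕ → ℕ → F) → c * ∑₁ n F ≡ ∑₁ n (λ i j → c * F i j)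
  ∑₁-*ˡ c zero    F = refl
  ∑₁-*ˡ c (suc n) F = trans (distribˡ c _ _) (+ˡ (∑₁-*ˡ c n _))

  ∑₁-swap : ∀ n m (F : ℕ → ℕ → ℕ → ℕ → F) →
   ∑₁ n (λ i j → ∑₁ m (λ k l → F i j k l)) ≡ ∑₁ m (λ k l → ∑₁ n (λ i j → F i j k l))
  ∑₁-swap zero    m F = refl
  ∑₁-swap (suc n) m F = trans (+ˡ (∑₁-swap n m _)) (sym (∑₁-+ m _ _))

  ∑₁-assoc : ∀ n (F : ℕ → ℕ → ℕ → F) →
   ∑₁ n (λ a b → ∑₁ a (λ c d → F c d b)) ≡ ∑₁ n (λ a b → ∑₁ b (λ c d → F a c d))
  ∑₁-assoc zero    F = refl
  ∑₁-assoc (suc n) F = begin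
   F 0 0 (suc n) + ∑₁ n (λ a b → F 0 (suc a) b + ∑₁ a (λ c d → F (suc c) d b))
    ≡⟨ +ˡ (∑₁-+ n _ _) ⟩
   F 0 0 (suc n) + (∑₁ n (λ a b → F 0 (suc a) b) + ∑₁ n (λ a b → ∑₁ a (λ c d → F (suc c) d b)))
    ≡⟨ sym (+-assoc (F 0 0 (suc n)) _ _) ⟩
   F 0 0 (suc n) + ∑₁ n (λ a b → F 0 (suc a) b) + ∑₁ n (λ a b → ∑₁ a (λ c d → F (suc c) d b))
    ≡⟨ +ˡ (∑₁-assoc n _) ⟩
   F 0 0 (suc n) + ∑₁ n (λ a b → F 0 (suc a) b) + ∑₁ n (λ a b → ∑₁ b (λ c d → F (suc a) c d)) ∎

  ∑₁-first : ∀ n (F : ℕ → ℕ → F) → (∀ i j → F (suc i) j ≡ 0F) → ∑₁ n F ≡ F 0 n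
  ∑₁-first zero    F h = refl
  ∑₁-first (suc n) F h = trans (+ˡ (trans (∑₁-cong n (λ i j _ → h i j)) (∑₁-0 n))) (+-identityʳ _)

  ∑₁-last : ∀ n (F : ℕ → ℕ → F) → ∑₁ (suc n) F ≡ ∑₁ n (λ i j → F i (suc j)) + F (suc n) 0
  ∑₁-last zero    F = refl
  ∑₁-last (suc n) F = trans (+ˡ (∑₁-last n (λ i j → F (suc i) j))) (sym (+-assoc (F 0 (suc (suc n))) _ _))

  ∑₁-final : ∀ n (F : ℕ → ℕ → F) → (∀ i j → F i (suc j) ≡ 0F) → ∑₁ n F ≡ F n 0
  ∑₁-final zero    F h = refl
  ∑₁-final (suc n) F h = trans (∑₁-last n F)
   (trans (cong (_+ F (suc n) 0) (trans (∑₁-cong n (λ i j _ → h i j)) (∑₁-0 n))) (+-identityˡ _))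

  infixl 6 _⊕_
  _⊕_ : ∀ {n} → Vec ℕ n → Vec ℕ n → Vec ℕ n
  _⊕_ = zipWith ℕ._+_

  𝟘 : ∀ {n} → Vec ℕ n
  𝟘 = replicate _ 0

  ⊕-identityˡ : ∀ {n} (a : Vec ℕ n) → 𝟘 ⊕ a ≡ a
  ⊕-identityˡ = zipWith-identityˡ (λ _ → refl)

  ⊕-identityʳ : ∀ {n} (a : Vec ℕ n) → a ⊕ 𝟘 ≡ a
  ⊕-identityʳ = zipWith-identityʳ ℕP.+-identityʳ

  ∑ : ∀ {n} → Vec ℕ n → (Vec ℕ n → Vec ℕ n → F) → F
  ∑ []       F = F [] []
  ∑ (x ∷ xs) F = ∑₁ x (λ i j → ∑ xs (λ a b → F (i ∷ a) (j ∷ b)))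

  ∑-cong : ∀ {n} (x : Vec ℕ n) {F G : Vec ℕ n → Vec ℕ n → F} →
   (∀ a b → a ⊕ b ≡ x → F a b ≡ G a b) → ∑ x F ≡ ∑ x G
  ∑-cong []       h = h [] [] refl
  ∑-cong (x ∷ xs) h = ∑₁-cong x (λ i j e → ∑-cong xs (λ a b e′ → h (i ∷ a) (j ∷ b) (cong₂ _∷_ e e′)))

  ∑-0 : ∀ {n} (x : Vec ℕ n) → ∑ x (λ _ _ → 0F) ≡ 0F
  ∑-0 []       = refl
  ∑-0 (x ∷ xs) = trans (∑₁-cong x (λ _ _ _ → ∑-0 xs)) (∑₁-0 x)

  ∑-zero : ∀ {n} (x : Vec ℕ n) {F : Vec ℕ n → Vec ℕ n → F} →
   (∀ a b → a ⊕ b ≡ x → F a b ≡ 0F) → ∑ x F ≡ 0F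
  ∑-zero x h = trans (∑-cong x h) (∑-0 x)

  ∑-+ : ∀ {n} (x : Vec ℕ n) (F G : Vec ℕ n → Vec ℕ n → F) → ∑ x (λ a b → F a b + G a b) ≡ ∑ x F + ∑ x G
  ∑-+ []       F G = refl
  ∑-+ (x ∷ xs) F G = trans (∑₁-cong x (λ i j _ → ∑-+ xs _ _)) (∑₁-+ x _ _)

  ∑-*ˡ : ∀ {n} c (x : Vec ℕ n) (F : Vec ℕ n → Vec ℕ n → F) → c * ∑ x F ≡ ∑ x (λ a b → c * F a b)
  ∑-*ˡ c []       F = refl
  ∑-*ˡ c (x ∷ xs) F = trans (∑₁-*ˡ c x _) (∑₁-cong x (λ i j _ → ∑-*ˡ c xs _))

  ∑-*ʳ : ∀ {n} c (x : Vec ℕ n) (F : Vec ℕ n → Vec ℕ n → F) → ∑ x F * c ≡ ∑ x (λ a b → F a b * c)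
  ∑-*ʳ c x F = trans (*-comm (∑ x F) c) (trans (∑-*ˡ c x F) (∑-cong x (λ a b _ → *-comm c _)))

  ∑₁-∑-swap : ∀ {n} m (x : Vec ℕ n) (F : ℕ → ℕ → Vec ℕ n → Vec ℕ n → F) →
   ∑₁ m (λ i j → ∑ x (λ a b → F i j a b)) ≡ ∑ x (λ a b → ∑₁ m (λ i j → F i j a b))
  ∑₁-∑-swap m []       F = refl
  ∑₁-∑-swap m (x ∷ xs) F = trans (∑₁-swap m x _) (∑₁-cong x (λ i j _ → ∑₁-∑-swap m xs _))

  ∑-assoc : ∀ {n} (x : Vec ℕ n) (F : Vec ℕ n → Vec ℕ n → Vec ℕ n → F) →
   ∑ x (λ a b → ∑ a (λ c d → F c d b)) ≡ ∑ x (λ a b → ∑ b (λ c d → F a c d))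
  ∑-assoc []       F = refl
  ∑-assoc (x ∷ xs) F = begin
   ∑₁ x (λ i j → ∑ xs (λ a b → ∑₁ i (λ k l → ∑ a (λ c d → F (k ∷ c) (l ∷ d) (j ∷ b)))))
    ≡⟨ ∑₁-cong x (λ i j _ → sym (∑₁-∑-swap i xs _)) ⟩
   ∑₁ x (λ i j → ∑₁ i (λ k l → ∑ xs (λ a b → ∑ a (λ c d → F (k ∷ c) (l ∷ d) (j ∷ b)))))
    ≡⟨ ∑₁-assoc x _ ⟩
   ∑₁ x (λ i j → ∑₁ j (λ k l → ∑ xs (λ a b → ∑ a (λ c d → F (i ∷ c) (k ∷ d) (l ∷ b)))))
    ≡⟨ ∑₁-cong x (λ i j _ → ∑₁-cong j (λ k l _ → ∑-assoc xs _)) ⟩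
   ∑₁ x (λ i j → ∑₁ j (λ k l → ∑ xs (λ a b → ∑ b (λ c d → F (i ∷ a) (k ∷ c) (l ∷ d)))))
    ≡⟨ ∑₁-cong x (λ i j _ → ∑₁-∑-swap j xs _) ⟩
   ∑₁ x (λ i j → ∑ xs (λ a b → ∑₁ j (λ k l → ∑ b (λ c d → F (i ∷ a) (k ∷ c) (l ∷ d))))) ∎

  -- Isolates the coordinate k, so that a series can be treated as a family of one-variable series
  -- in y_k.
  ∑-insert : ∀ {n} (k : Fin (suc n)) J (x : Vec ℕ n) (F : Vec ℕ (suc n) → Vec ℕ (suc n) → F) →
   ∑ (insertAt x k J) F ≡ ∑₁ J (λ i j → ∑ x (λ a b → F (insertAt a k i) (insertAt b k j)))
  ∑-insert zero    J x        F = refl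
  ∑-insert (suc k) J (x ∷ xs) F =
   trans (∑₁-cong x (λ i j _ → ∑-insert k J xs _)) (∑₁-swap x J _)

  δ : ∀ {n} → Vec ℕ n → F
  δ []           = 1F
  δ (zero ∷ xs)  = δ xs
  δ (suc _ ∷ _)  = 0F

  δ-𝟘 : ∀ n → δ (𝟘 {n}) ≡ 1F
  δ-𝟘 zero    = refl
  δ-𝟘 (suc n) = δ-𝟘 n

  δ-≢ : ∀ {n} (x : Vec ℕ n) → x ≢ 𝟘 → δ x ≡ 0F
  δ-≢ []           h = ⊥-elim (h refl)
  δ-≢ (zero ∷ xs)  h = δ-≢ xs (λ e → h (cong (0 ∷_) e))
  δ-≢ (suc _ ∷ _)  h = refl

  ∑-δˡ : ∀ {n} (x : Vec ℕ n) (G : Vec ℕ n → Vec ℕ n → F) → ∑ x (λ a b → δ a * G a b) ≡ G 𝟘 x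
  ∑-δˡ []       G = *-identityˡ _
  ∑-δˡ (x ∷ xs) G = trans (∑₁-first x _ (λ i j → ∑-zero xs (λ a b _ → *-zeroˡ _))) (∑-δˡ xs _)

  ∑-δʳ : ∀ {n} (x : Vec ℕ n) (G : Vec ℕ n → Vec ℕ n → F) → ∑ x (λ a b → δ b * G a b) ≡ G x 𝟘
  ∑-δʳ []       G = *-identityˡ _
  ∑-δʳ (x ∷ xs) G = trans (∑₁-final x _ (λ i j → ∑-zero xs (λ a b _ → *-zeroˡ _))) (∑-δʳ xs _)

  sum-⊕ : ∀ {n} (a b : Vec ℕ n) → sum (a ⊕ b) ≡ sum a ℕ.+ sum b
  sum-⊕ []       []       = refl
  sum-⊕ (x ∷ xs) (y ∷ ys) = trans (cong ((x ℕ.+ y) ℕ.+_) (sum-⊕ xs ys)) (lem x y (sum xs) (sum ys))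
   where
   lem : ∀ a b c d → (a ℕ.+ b) ℕ.+ (c ℕ.+ d) ≡ (a ℕ.+ c) ℕ.+ (b ℕ.+ d)
   lem a b c d = trans (ℕP.+-assoc a b _) (trans (cong (a ℕ.+_) (trans (sym (ℕP.+-assoc b c d))
    (trans (cong (ℕ._+ d) (ℕP.+-comm b c)) (ℕP.+-assoc c b d)))) (sym (ℕP.+-assoc a c _)))

  sum≡0 : ∀ {n} (a : Vec ℕ n) → sum a ≡ 0 → a ≡ 𝟘
  sum≡0 []       e = refl
  sum≡0 (zero ∷ a) e = cong (0 ∷_) (sum≡0 a e)

  ≢𝟘⇒sum>0 : ∀ {n} {a : Vec ℕ n} → a ≢ 𝟘 → 0 ℕ.< sum a
  ≢𝟘⇒sum>0 h = ℕP.n≢0⇒n>0 (λ e → h (sum≡0 _ e))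

  left-smaller : ∀ {n} {a b x : Vec ℕ n} → a ⊕ b ≡ x → b ≢ 𝟘 → sum a ℕ.< sum x
  left-smaller {a = a} {b} refl h = subst (sum a ℕ.<_) (sym (sum-⊕ a b)) (ℕP.m<m+n (sum a) (≢𝟘⇒sum>0 h))

  right-smaller : ∀ {n} {a b x : Vec ℕ n} → a ⊕ b ≡ x → a ≢ 𝟘 → sum b ℕ.< sum x
  right-smaller {a = a} {b} refl h = subst (sum b ℕ.<_) (sym (sum-⊕ a b)) (ℕP.m<n+m (sum b) (≢𝟘⇒sum>0 h))

  𝟘? : ∀ {n} (a : Vec ℕ n) → a ≡ 𝟘 ⊎ a ≢ 𝟘
  𝟘? []          = inj₁ refl
  𝟘? (suc x ∷ a) = inj₂ (λ ())
  𝟘? (zero ∷ a) with 𝟘? a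
  ... | inj₁ e = inj₁ (cong (0 ∷_) e)
  ... | inj₂ h = inj₂ (λ { refl → h refl })

  Series : ℕ → Set
  Series n = Vec ℕ n → F

  AgreeBelow : ∀ {n} → ℕ → Series n → Series n → Set
  AgreeBelow d f g = ∀ m → sum m ℕ.< d → f m ≡ g m

  Local : ∀ {n} → (Series n → Series n) → Set
  Local {n} T = ∀ (f g : Series n) x → AgreeBelow (sum x) f g → T f x ≡ T g x

  iter : ∀ {n} → ℕ → (Series n → Series n) → Series n
  iter zero    T = λ _ → 0F
  iter (suc k) T = T (iter k T)

  -- Solves f = T f when `T f x` depends only on coefficients of smaller degree: after `suc (sum x)`
  -- iterations, from whatever start, the coefficient at x has settled.
  fix : ∀ {n} → (Series n → Series n) → Series n
  fix T x = iter (suc (sum x)) T x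

  iter-agree : ∀ {n} (T : Series n → Series n) → Local T → ∀ k l x → sum x ℕ.< k → sum x ℕ.< l → iter k T x ≡ iter l T x
  iter-agree T loc (suc k) (suc l) x p q = loc _ _ x (λ m m< →
   iter-agree T loc k l m (ℕP.<-≤-trans m< (ℕP.≤-pred p)) (ℕP.<-≤-trans m< (ℕP.≤-pred q)))

  fix-eq : ∀ {n} (T : Series n → Series n) → Local T → ∀ x → fix T x ≡ T (fix T) x
  fix-eq T loc x = loc _ _ x (λ m m< → iter-agree T loc (sum x) (suc (sum m)) m m< ℕP.≤-refl)

  -- The truncated form of uniqueness. It shows that the factors of a series depend on its
  -- coefficients degree by degree, which is what a series defined through its own factorization
  -- requires.
  fix-agree : ∀ {n} (T U : Series n → Series n) d → Local T → Local U →
   (∀ f x → sum x ℕ.< d → T f x ≡ U f x) → AgreeBelow d (fix T) (fix U)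
  fix-agree T U d lT lU h x x<d = go (suc (sum x)) x ℕP.≤-refl x<d
   where
   go : ∀ k x → sum x ℕ.< k → sum x ℕ.< d → fix T x ≡ fix U x
   go (suc k) x p q = begin
    fix T x     ≡⟨ fix-eq T lT x ⟩
    T (fix T) x ≡⟨ lT _ _ x (λ m m< → go k m (ℕP.<-≤-trans m< (ℕP.≤-pred p)) (ℕP.<-trans m< q)) ⟩
    T (fix U) x ≡⟨ h _ x q ⟩
    U (fix U) x ≡⟨ sym (fix-eq U lU x) ⟩
    fix U x     ∎

 -- The twisted product of power series, and factorizations.

 module Convolution where
  open Scalars
  open Sums
  open import Data.Vec using (sum)
  open import Data.Vec.Properties using (zipWith-assoc)
  open import Algebra.Bundles using (CommutativeRing)
  import Algebra.Solver.Ring.NaturalCoefficients.Default (CommutativeRing.commutativeSemiring commutativeRing) as FS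

  open FS using (solve; _:=_; _:+_; _:*_)
  open ≡-Reasoning

  ⊕-assoc : ∀ {n} (a b c : Vec ℕ n) → (a ⊕ b) ⊕ c ≡ a ⊕ (b ⊕ c)
  ⊕-assoc = zipWith-assoc ℕP.+-assoc

  -- A bicharacter, with product y^a y^b = χ(a,b) y^(a+b). Associativity rests on the two
  -- multiplicativity laws, the unit laws on the values at `𝟘`.
  record Twist (n : ℕ) : Set where
   field
    χ    : Vec ℕ n → Vec ℕ n → F
    χ-0ˡ : ∀ b → χ 𝟘 b ≡ 1F
    χ-0ʳ : ∀ a → χ a 𝟘 ≡ 1F
    χ-⊕ˡ : ∀ a b c → χ (a ⊕ b) c ≡ χ a c * χ b c
    χ-⊕ʳ : ∀ a b c → χ a (b ⊕ c) ≡ χ a b * χ a c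

  reduced : ∀ {n} → Series n → Series n
  reduced f x with 𝟘? x
  ... | inj₁ _ = 0F
  ... | inj₂ _ = f x

  reduced-≢ : ∀ {n} (f : Series n) {x} → x ≢ 𝟘 → reduced f x ≡ f x
  reduced-≢ f {x} h with 𝟘? x
  ... | inj₁ e = ⊥-elim (h e)
  ... | inj₂ _ = refl

  reduced-𝟘 : ∀ {n} (f : Series n) → reduced f 𝟘 ≡ 0F
  reduced-𝟘 {n} f = go (𝟘 {n}) refl
   where
   go : ∀ x → x ≡ 𝟘 → reduced f x ≡ 0F
   go x e with 𝟘? x
   ... | inj₁ _ = refl
   ... | inj₂ h = ⊥-elim (h e)

  unit-split : ∀ {n} (f : Series n) → f 𝟘 ≡ 1F → ∀ x → f x ≡ δ x + reduced f x
  unit-split {n} f f0 x with 𝟘? x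
  ... | inj₁ refl = trans f0 (sym (trans (+-identityʳ _) (δ-𝟘 n)))
  ... | inj₂ h    = sym (trans (+ʳ (δ-≢ x h)) (+-identityˡ _))

  module Conv {n : ℕ} (τ : Twist n) where
   open Twist τ

   infixl 7 _⋆_
   _⋆_ : Series n → Series n → Series n
   (f ⋆ g) x = ∑ x (λ a b → f a * g b * χ a b)

   ⋆-cong : ∀ {f f′ g g′ : Series n} → f ≗ f′ → g ≗ g′ → f ⋆ g ≗ f′ ⋆ g′
   ⋆-cong p q x = ∑-cong x (λ a b _ → *ʳ (cong₂ _*_ (p a) (q b)))

   ⋆-zero : ∀ (f g : Series n) x → (∀ a b → a ⊕ b ≡ x → f a ≡ 0F ⊎ g b ≡ 0F) → (f ⋆ g) x ≡ 0F
   ⋆-zero f g x h = ∑-zero x (λ a b e → go a b (h a b e))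
    where
    go : ∀ a b → f a ≡ 0F ⊎ g b ≡ 0F → f a * g b * χ a b ≡ 0F
    go a b (inj₁ z) = trans (*ʳ (trans (*ʳ z) (*-zeroˡ _))) (*-zeroˡ _)
    go a b (inj₂ z) = trans (*ʳ (trans (*ˡ z) (*-zeroʳ _))) (*-zeroˡ _)

   ⋆-assoc : ∀ (f g h : Series n) → (f ⋆ g) ⋆ h ≗ f ⋆ (g ⋆ h)
   ⋆-assoc f g h x = begin
    ∑ x (λ a b → ∑ a (λ c d → f c * g d * χ c d) * h b * χ a b)
     ≡⟨ ∑-cong x (λ a b _ → trans (*-assoc _ (h b) (χ a b)) (trans (∑-*ʳ (h b * χ a b) a _)
        (∑-cong a (λ c d e → trans (*ˡ (*ˡ (trans (cong (λ z → χ z b) (sym e)) (χ-⊕ˡ c d b))))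
         (rearr₁ (f c) (g d) (χ c d) (h b) (χ c b) (χ d b)))))) ⟩
    ∑ x (λ a b → ∑ a (λ c d → f c * (g d * h b * χ d b) * (χ c d * χ c b)))
     ≡⟨ ∑-assoc x (λ c d b → f c * (g d * h b * χ d b) * (χ c d * χ c b)) ⟩
    ∑ x (λ a b → ∑ b (λ c d → f a * (g c * h d * χ c d) * (χ a c * χ a d)))
     ≡⟨ ∑-cong x (λ a b _ → sym (trans (rearr₂ (f a) _ (χ a b)) (trans (∑-*ˡ (f a * χ a b) b _)
        (∑-cong b (λ c d e → trans (*ʳ (*ˡ (trans (cong (χ a) (sym e)) (χ-⊕ʳ a c d))))
         (rearr₃ (f a) (χ a c) (χ a d) (g c * h d * χ c d))))))) ⟩
    ∑ x (λ a b → f a * ∑ b (λ c d → g c * h d * χ c d) * χ a b) ∎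
    where
    rearr₁ : ∀ a b c d e f → (a * b * c) * (d * (e * f)) ≡ a * (b * d * f) * (c * e)
    rearr₁ = solve 6 (λ a b c d e f → (a :* b :* c) :* (d :* (e :* f)) := a :* (b :* d :* f) :* (c :* e)) refl
    rearr₂ : ∀ a b c → a * b * c ≡ (a * c) * b
    rearr₂ = solve 3 (λ a b c → a :* b :* c := (a :* c) :* b) refl
    rearr₃ : ∀ a b c d → (a * (b * c)) * d ≡ a * d * (b * c)
    rearr₃ = solve 4 (λ a b c d → (a :* (b :* c)) :* d := a :* d :* (b :* c)) refl

   ⋆-identityˡ : ∀ (f : Series n) → δ ⋆ f ≗ f
   ⋆-identityˡ f x = trans (∑-cong x (λ a b _ → *-assoc (δ a) (f b) (χ a b)))
    (trans (∑-δˡ x (λ a b → f b * χ a b)) (trans (*ˡ (χ-0ˡ x)) (*-identityʳ _)))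

   ⋆-identityʳ : ∀ (f : Series n) → f ⋆ δ ≗ f
   ⋆-identityʳ f x = trans (∑-cong x (λ a b _ → trans (*ʳ (*-comm (f a) (δ b))) (*-assoc (δ b) (f a) (χ a b))))
    (trans (∑-δʳ x (λ a b → f a * χ a b)) (trans (*ˡ (χ-0ʳ x)) (*-identityʳ _)))

   infixl 6 _⊞_
   _⊞_ : Series n → Series n → Series n
   (f ⊞ g) x = f x + g x

   ⋆-distribʳ : ∀ (f g h : Series n) → (f ⊞ g) ⋆ h ≗ (f ⋆ h) ⊞ (g ⋆ h)
   ⋆-distribʳ f g h x = trans (∑-cong x (λ a b _ → dist (f a) (g a) (h b) (χ a b))) (∑-+ x _ _)
    where
    dist : ∀ a b c d → (a + b) * c * d ≡ a * c * d + b * c * d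
    dist = solve 4 (λ a b c d → (a :+ b) :* c :* d := a :* c :* d :+ b :* c :* d) refl

   ⋆-distribˡ : ∀ (f g h : Series n) → f ⋆ (g ⊞ h) ≗ (f ⋆ g) ⊞ (f ⋆ h)
   ⋆-distribˡ f g h x = trans (∑-cong x (λ a b _ → dist (f a) (g b) (h b) (χ a b))) (∑-+ x _ _)
    where
    dist : ∀ a b c d → a * (b + c) * d ≡ a * b * d + a * c * d
    dist = solve 4 (λ a b c d → a :* (b :+ c) :* d := a :* b :* d :+ a :* c :* d) refl

   ⋆-splitˡ : ∀ (f g : Series n) → f 𝟘 ≡ 1F → ∀ x → (f ⋆ g) x ≡ g x + (reduced f ⋆ g) x
   ⋆-splitˡ f g f0 x = trans (⋆-cong {g = g} (unit-split f f0) (λ _ → refl) x)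
    (trans (⋆-distribʳ δ (reduced f) g x) (+ʳ (⋆-identityˡ g x)))

   ⋆-splitʳ : ∀ (f g : Series n) → g 𝟘 ≡ 1F → ∀ x → (f ⋆ g) x ≡ f x + (f ⋆ reduced g) x
   ⋆-splitʳ f g g0 x = trans (⋆-cong {f = f} (λ _ → refl) (unit-split g g0) x)
    (trans (⋆-distribˡ f δ (reduced g) x) (+ʳ (⋆-identityʳ f x)))

   ⋆-split : ∀ (f g : Series n) → f 𝟘 ≡ 1F → g 𝟘 ≡ 1F → ∀ x →
    (f ⋆ g) x ≡ g x + (reduced f x + (reduced f ⋆ reduced g) x)
   ⋆-split f g f0 g0 x = trans (⋆-splitˡ f g f0 x) (+ˡ (⋆-splitʳ (reduced f) g g0 x))

   reduced-⋆-𝟘 : ∀ (f g : Series n) → (reduced f ⋆ g) 𝟘 ≡ 0F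
   reduced-⋆-𝟘 f g = ⋆-zero (reduced f) g 𝟘 go
    where
    lem : ∀ {m} (a b : Vec ℕ m) → a ⊕ b ≡ 𝟘 → a ≡ 𝟘
    lem []         []         _ = refl
    lem (zero ∷ a) (zero ∷ b) e = cong (0 ∷_) (lem a b (cong Data.Vec.tail e))
    go : ∀ a b → a ⊕ b ≡ 𝟘 → reduced f a ≡ 0F ⊎ g b ≡ 0F
    go a b e with lem a b e
    ... | refl = inj₁ (reduced-𝟘 f)

   ⋆-𝟘 : ∀ (f g : Series n) → f 𝟘 ≡ 1F → g 𝟘 ≡ 1F → (f ⋆ g) 𝟘 ≡ 1F
   ⋆-𝟘 f g f0 g0 = trans (⋆-splitˡ f g f0 𝟘) (trans (+ˡ (reduced-⋆-𝟘 f g)) (trans (+-identityʳ _) g0))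

   -- `reduced f` has no constant term, so every contributing split leaves a strictly smaller
   -- exponent to the other factor. Inverses and factorizations become solvable degree by degree.
   reduced-⋆-cong : ∀ {f g g′ : Series n} x → AgreeBelow (sum x) g g′ → (reduced f ⋆ g) x ≡ (reduced f ⋆ g′) x
   reduced-⋆-cong {f} {g} {g′} x h = ∑-cong x go
    where
    go : ∀ a b → a ⊕ b ≡ x → reduced f a * g b * χ a b ≡ reduced f a * g′ b * χ a b
    go a b e with 𝟘? a
    ... | inj₁ _ = *ʳ (trans (*-zeroˡ _) (sym (*-zeroˡ _)))
    ... | inj₂ p = *ʳ (*ˡ (h b (right-smaller e p)))

   ⋆-reduced-cong : ∀ {f f′ g : Series n} x → AgreeBelow (sum x) f f′ → (f ⋆ reduced g) x ≡ (f′ ⋆ reduced g) x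
   ⋆-reduced-cong {f} {f′} {g} x h = ∑-cong x go
    where
    go : ∀ a b → a ⊕ b ≡ x → f a * reduced g b * χ a b ≡ f′ a * reduced g b * χ a b
    go a b e with 𝟘? b
    ... | inj₁ _ = *ʳ (trans (*-zeroʳ _) (sym (*-zeroʳ _)))
    ... | inj₂ p = *ʳ (*ʳ (h a (left-smaller e p)))

   reduced-agree : ∀ {f f′ : Series n} d → AgreeBelow d f f′ → AgreeBelow d (reduced f) (reduced f′)
   reduced-agree d h m m< with 𝟘? m
   ... | inj₁ _ = refl
   ... | inj₂ _ = h m m<

   private
    cancel-+ : ∀ a b → (a + - b) + b ≡ a
    cancel-+ a b = trans (+-assoc a (- b) b) (trans (+ˡ (+-inverseˡ b)) (+-identityʳ a))

   private
    invʳ : Series n → Series n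
    invʳ f = fix (λ g x → δ x + - (reduced f ⋆ g) x)

    invʳ-eq : ∀ f x → invʳ f x ≡ δ x + - (reduced f ⋆ invʳ f) x
    invʳ-eq f = fix-eq _ (λ g g′ x h → +ˡ (cong -_ (reduced-⋆-cong x h)))

    invˡ : Series n → Series n
    invˡ f = fix (λ g x → δ x + - (g ⋆ reduced f) x)

    invˡ-eq : ∀ f x → invˡ f x ≡ δ x + - (invˡ f ⋆ reduced f) x
    invˡ-eq f = fix-eq _ (λ g g′ x h → +ˡ (cong -_ (⋆-reduced-cong x h)))

   record Inverse (f : Series n) : Set where
    field
     inv      : Series n
     inverseʳ : f ⋆ inv ≗ δ
     inverseˡ : inv ⋆ f ≗ δ

   invertible : ∀ f → f 𝟘 ≡ 1F → Inverse f
   invertible f f0 = record { inv = invʳ f ; inverseʳ = r ; inverseˡ = λ x → trans (⋆-cong {g = f} same (λ _ → refl) x) (l x) }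
    where
    r : f ⋆ invʳ f ≗ δ
    r x = trans (⋆-splitˡ f (invʳ f) f0 x) (trans (+ʳ (invʳ-eq f x)) (cancel-+ _ _))
    l : invˡ f ⋆ f ≗ δ
    l x = trans (⋆-splitʳ (invˡ f) f f0 x) (trans (+ʳ (invˡ-eq f x)) (cancel-+ _ _))
    same : invʳ f ≗ invˡ f
    same x = begin
     invʳ f x                  ≡⟨ sym (⋆-identityˡ (invʳ f) x) ⟩
     (δ ⋆ invʳ f) x            ≡⟨ ⋆-cong {g = invʳ f} (λ y → sym (l y)) (λ _ → refl) x ⟩
     ((invˡ f ⋆ f) ⋆ invʳ f) x ≡⟨ ⋆-assoc (invˡ f) f (invʳ f) x ⟩
     (invˡ f ⋆ (f ⋆ invʳ f)) x ≡⟨ ⋆-cong {f = invˡ f} (λ _ → refl) r x ⟩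
     (invˡ f ⋆ δ) x            ≡⟨ ⋆-identityʳ (invˡ f) x ⟩
     invˡ f x ∎

   -- The splitting of a unipotent group along a half-space, as at a point of a scattering diagram:
   -- one factor carries the exponents on the nonnegative side, the other those on the negative
   -- side.
   record Factor (neg : Vec ℕ n → Bool) (p : Series n) : Set where
    no-eta-equality
    field
     u w   : Series n
     u-𝟘   : u 𝟘 ≡ 1F
     w-𝟘   : w 𝟘 ≡ 1F
     u-neg : ∀ x → neg x ≡ true → u x ≡ 0F
     w-pos : ∀ x → x ≢ 𝟘 → neg x ≡ false → w x ≡ 0F
     prod  : p ≗ u ⋆ w

   part : Bool → (Vec ℕ n → Bool) → Series n → Series n
   part b neg h x with neg x | b
   ... | true  | true  = h x
   ... | false | false = h x
   ... | true  | false = 0F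
   ... | false | true  = 0F

   part-agree : ∀ b neg {h h′ : Series n} d → AgreeBelow d h h′ → AgreeBelow d (part b neg h) (part b neg h′)
   part-agree b neg d e x x< with neg x | b
   ... | true  | true  = e x x<
   ... | false | false = e x x<
   ... | true  | false = refl
   ... | false | true  = refl

   -- The coefficients of both factors of a factorization, collected in one series.
   factor-coeff : (Vec ℕ n → Bool) → Series n → Series n
   factor-coeff neg p = fix (λ h x → p x + - (reduced (part false neg h) ⋆ reduced (part true neg h)) x)

   private
    factor-local : ∀ (neg : Vec ℕ n → Bool) (p : Series n) → Local (λ h x → p x + - (reduced (part false neg h) ⋆ reduced (part true neg h)) x)
    factor-local neg p h h′ x e = +ˡ (cong -_ (trans
     (reduced-⋆-cong x (reduced-agree (sum x) (part-agree true neg (sum x) e)))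
     (⋆-reduced-cong x (reduced-agree (sum x) (part-agree false neg (sum x) e)))))

   factor-coeff-eq : ∀ (neg : Vec ℕ n → Bool) (p : Series n) x → factor-coeff neg p x ≡
    p x + - (reduced (part false neg (factor-coeff neg p)) ⋆ reduced (part true neg (factor-coeff neg p))) x
   factor-coeff-eq neg p = fix-eq _ (factor-local neg p)

   factor-coeff-agree : ∀ neg {p q : Series n} d → AgreeBelow d p q → AgreeBelow d (factor-coeff neg p) (factor-coeff neg q)
   factor-coeff-agree neg {p} {q} d e = fix-agree _ _ d (factor-local neg p) (factor-local neg q) (λ h x x< → +ʳ (e x x<))

   -- The contribution of the splits into two nonzero exponents, which involves lower degrees only.
   -- What is left of `p x` is the new coefficient, and the sign of x decides which factor receives
   -- it.
   factor-proper : (Vec ℕ n → Bool) → Series n → Series n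
   factor-proper neg p = reduced (part false neg (factor-coeff neg p)) ⋆ reduced (part true neg (factor-coeff neg p))

   factor-proper-agree : ∀ neg {p q : Series n} x → AgreeBelow (sum x) p q → factor-proper neg p x ≡ factor-proper neg q x
   factor-proper-agree neg {p} {q} x e = trans
    (reduced-⋆-cong x (reduced-agree (sum x) (part-agree true neg (sum x) (factor-coeff-agree neg (sum x) e))))
    (⋆-reduced-cong x (reduced-agree (sum x) (part-agree false neg (sum x) (factor-coeff-agree neg (sum x) e))))

   factor : ∀ neg p → neg 𝟘 ≡ false → p 𝟘 ≡ 1F → Factor neg p
   factor neg p neg0 p0 = record
    { u = u ; w = w
    ; u-𝟘 = u0 ; w-𝟘 = w0
    ; u-neg = λ x e → trans (cong₂ _+_ (δ-≢ x (pos⇒≢ e)) (trans (reduced-≢ _ (pos⇒≢ e)) (part≢ true false x e (λ ())))) (+-identityʳ _)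
    ; w-pos = λ x x≢ e → trans (cong₂ _+_ (δ-≢ x x≢) (trans (reduced-≢ _ x≢) (part≢ false true x e (λ ())))) (+-identityʳ _)
    ; prod = prod′ }
    where
    h = factor-coeff neg p
    u w : Series n
    u x = δ x + reduced (part false neg h) x
    w x = δ x + reduced (part true neg h) x
    u0 : u 𝟘 ≡ 1F
    u0 = trans (+ˡ (reduced-𝟘 (part false neg h))) (trans (+-identityʳ _) (δ-𝟘 n))
    w0 : w 𝟘 ≡ 1F
    w0 = trans (+ˡ (reduced-𝟘 (part true neg h))) (trans (+-identityʳ _) (δ-𝟘 n))
    pos⇒≢ : ∀ {x} → neg x ≡ true → x ≢ 𝟘
    pos⇒≢ e refl with trans (sym e) neg0
    ... | ()
    part≢ : ∀ b c x → neg x ≡ b → b ≢ c → part c neg h x ≡ 0F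
    part≢ b c x e b≢c with neg x | c
    part≢ _ _ _ refl b≢c | true  | true  = ⊥-elim (b≢c refl)
    part≢ _ _ _ refl b≢c | false | false = ⊥-elim (b≢c refl)
    part≢ _ _ _ refl b≢c | true  | false = refl
    part≢ _ _ _ refl b≢c | false | true  = refl
    red-of : ∀ (g : Series n) → reduced (λ x → δ x + reduced g x) ≗ reduced g
    red-of g x = go (𝟘? x)
     where
     go : x ≡ 𝟘 ⊎ x ≢ 𝟘 → reduced (λ x → δ x + reduced g x) x ≡ reduced g x
     go (inj₁ refl) = trans (reduced-𝟘 (λ x → δ x + reduced g x)) (sym (reduced-𝟘 g))
     go (inj₂ q)    = trans (reduced-≢ _ q) (trans (+ʳ (δ-≢ x q)) (+-identityˡ _))
    parts : ∀ x → part true neg h x + part false neg h x ≡ h x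
    parts x with neg x
    ... | true  = +-identityʳ _
    ... | false = +-identityˡ _
    prod′ : p ≗ u ⋆ w
    prod′ x with 𝟘? x
    ... | inj₁ refl = trans p0 (sym (⋆-𝟘 u w u0 w0))
    ... | inj₂ x≢ = sym (begin
     (u ⋆ w) x ≡⟨ ⋆-split u w u0 w0 x ⟩
     w x + (reduced u x + (reduced u ⋆ reduced w) x)
      ≡⟨ cong₂ _+_ (trans (+ʳ (δ-≢ x x≢)) (trans (+-identityˡ _) (reduced-≢ _ x≢)))
         (cong₂ _+_ (trans (red-of _ x) (reduced-≢ _ x≢)) (⋆-cong (red-of (part false neg h)) (red-of (part true neg h)) x)) ⟩
     part true neg h x + (part false neg h x + factor-proper neg p x) ≡⟨ sym (+-assoc _ _ _) ⟩
     (part true neg h x + part false neg h x) + factor-proper neg p x ≡⟨ +ʳ (parts x) ⟩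
     h x + factor-proper neg p x ≡⟨ +ʳ (factor-coeff-eq neg p x) ⟩
     (p x + - factor-proper neg p x) + factor-proper neg p x ≡⟨ cancel-+ _ _ ⟩
     p x ∎)

   -- For x on the nonnegative side `u x` is what remains of `p x` after the proper products, so
   -- setting `p x` equal to them is a way to create a series without incoming term at x.
   factor-u : ∀ neg p (neg0 : neg 𝟘 ≡ false) (p0 : p 𝟘 ≡ 1F) x → x ≢ 𝟘 → neg x ≡ false →
    p x ≡ factor-proper neg p x → Factor.u (factor neg p neg0 p0) x ≡ 0F
   factor-u neg p neg0 p0 x x≢ e eq = trans (cong₂ _+_ (δ-≢ x x≢) (reduced-≢ _ x≢)) (trans (+-identityˡ _) lem)
    where
    h0 : factor-coeff neg p x ≡ 0F
    h0 = trans (factor-coeff-eq neg p x) (trans (+ʳ eq) (+-inverseʳ _))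
    lem : part false neg (factor-coeff neg p) x ≡ 0F
    lem rewrite e = h0

   -- If R = z ⋆ w where off 𝟘 at most one of z, w is nonzero at each exponent, then the
   -- vanishing of R off a submonoid K propagates to z and w, since nothing can cancel there.
   module Support (K : Vec ℕ n → Set) (K? : ∀ x → K x ⊎ ¬ K x) (K-𝟘 : K 𝟘) (K-⊕ : ∀ {a b} → K a → K b → K (a ⊕ b))
    {R z w : Series n} (z0 : z 𝟘 ≡ 1F) (w0 : w 𝟘 ≡ 1F) (eq : R ≗ z ⋆ w)
    (disj : ∀ x → x ≢ 𝟘 → z x ≡ 0F ⊎ w x ≡ 0F) where

    -- A split of an exponent outside the submonoid `K` has a part outside `K`, where the
    -- corresponding factor vanishes by hypothesis; only the two trivial splits survive.
    sum-off-K : ∀ x → ¬ K x → (∀ a b → a ⊕ b ≡ x → a ≢ 𝟘 → b ≢ 𝟘 → (¬ K a → z a ≡ 0F) × (¬ K b → w b ≡ 0F)) →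
     R x ≡ w x + z x
    sum-off-K x ¬Kx h = trans (eq x) (trans (⋆-split z w z0 w0 x)
     (+ˡ (trans (cong₂ _+_ (reduced-≢ z x≢) (⋆-zero (reduced z) (reduced w) x go)) (+-identityʳ _))))
     where
     x≢ : x ≢ 𝟘
     x≢ refl = ¬Kx K-𝟘
     go : ∀ a b → a ⊕ b ≡ x → reduced z a ≡ 0F ⊎ reduced w b ≡ 0F
     go a b e with 𝟘? a | 𝟘? b
     ... | inj₁ _ | _ = inj₁ refl
     ... | inj₂ _ | inj₁ _ = inj₂ refl
     ... | inj₂ p | inj₂ q with K? a | K? b
     ...   | inj₁ Ka | inj₁ Kb = ⊥-elim (¬Kx (subst K e (K-⊕ Ka Kb)))
     ...   | inj₂ ¬Ka | _ = inj₁ (proj₁ (h a b e p q) ¬Ka)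
     ...   | inj₁ _ | inj₂ ¬Kb = inj₂ (proj₂ (h a b e p q) ¬Kb)

    -- `D` is a downward closed region where `R` is known to vanish outside `K`. With `D` the
    -- exponents below some x, this serves an induction that has not yet reached x.
    off-K : (D : Vec ℕ n → Set) → (∀ a b → D (a ⊕ b) → D a × D b) → (∀ x → D x → ¬ K x → R x ≡ 0F) →
     ∀ x → D x → ¬ K x → z x ≡ 0F × w x ≡ 0F
    off-K D down R0 x = go (suc (sum x)) x ℕP.≤-refl
     where
     go : ∀ d x → sum x ℕ.< d → D x → ¬ K x → z x ≡ 0F × w x ≡ 0F
     go (suc d) x x<d Dx ¬Kx = fin (disj x (λ { refl → ¬Kx K-𝟘 }))
      where
      s : w x + z x ≡ 0F
      s = trans (sym (sum-off-K x ¬Kx (λ a b e p q →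
         (λ ¬Ka → proj₁ (go d a (ℕP.<-≤-trans (left-smaller e q) (ℕP.≤-pred x<d)) (proj₁ (down a b (subst D (sym e) Dx))) ¬Ka)) ,
         (λ ¬Kb → proj₂ (go d b (ℕP.<-≤-trans (right-smaller e p) (ℕP.≤-pred x<d)) (proj₂ (down a b (subst D (sym e) Dx))) ¬Kb)))))
        (R0 x Dx ¬Kx)
      fin : z x ≡ 0F ⊎ w x ≡ 0F → z x ≡ 0F × w x ≡ 0F
      fin (inj₁ zx) = zx , trans (sym (trans (+ˡ zx) (+-identityʳ _))) s
      fin (inj₂ wx) = trans (sym (trans (+ʳ wx) (+-identityˡ _))) s , wx

    off-K-everywhere : (∀ x → ¬ K x → R x ≡ 0F) → ∀ x → ¬ K x → z x ≡ 0F × w x ≡ 0F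
    off-K-everywhere R0 x = off-K (λ _ → ⊤) (λ _ _ _ → tt , tt) (λ x _ → R0 x) x tt

 -- Series in one variable: the functional equation and palindromic products.

 module Lines where
  open Scalars
  open Sums
  open import Algebra.Bundles using (CommutativeRing)
  open import Algebra.Properties.Group (CommutativeRing.+-group commutativeRing) using () renaming (∙-cancelʳ to +-cancelʳ)
  import Algebra.Solver.Ring.NaturalCoefficients.Default (CommutativeRing.commutativeSemiring commutativeRing) as FS

  open FS using (solve; _:=_; _:+_; _:*_)
  open ≡-Reasoning

  pw-inv : ∀ t → pw t * pw (ℤ.- t) ≡ 1F
  pw-inv t = trans (sym (pw-+ t (ℤ.- t))) (trans (cong pw (ℤP.+-inverseʳ t)) pw-0)

  Line : Set
  Line = ℕ → F

  infixl 7 _∗_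
  _∗_ : Line → Line → Line
  (f ∗ g) J = ∑₁ J (λ i j → f i * g j)

  ∗-cong : ∀ {f f′ g g′ : Line} → f ≗ f′ → g ≗ g′ → f ∗ g ≗ f′ ∗ g′
  ∗-cong p q J = ∑₁-cong J (λ i j _ → cong₂ _*_ (p i) (q j))

  E : ℤ → Line
  E t i = ε i * pw (t ℤ.* ⁺ i)

  -- Multiplication by 1 + v^t y.
  T : ℤ → Line → Line
  T t f zero    = f 0
  T t f (suc j) = f (suc j) + pw t * f j

  T-cong : ∀ t {f g : Line} → f ≗ g → T t f ≗ T t g
  T-cong t e zero    = e 0
  T-cong t e (suc j) = cong₂ _+_ (e (suc j)) (*ˡ (e j))

  T-comm : ∀ s t f → T s (T t f) ≗ T t (T s f)
  T-comm s t f zero          = refl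
  T-comm s t f (suc zero)    = solve 4 (λ a b p q → a :+ q :* b :+ p :* b := a :+ p :* b :+ q :* b) refl (f 1) (f 0) (pw s) (pw t)
  T-comm s t f (suc (suc j)) = solve 5 (λ a b c p q → a :+ q :* b :+ p :* (b :+ q :* c) := a :+ p :* b :+ q :* (b :+ p :* c)) refl
   (f (suc (suc j))) (f (suc j)) (f j) (pw s) (pw t)

  T-shift : ∀ t e f → T t e ∗ f ≗ e ∗ T t f
  T-shift t e f zero    = refl
  T-shift t e f (suc J) = begin
   e 0 * f (suc J) + ∑₁ J (λ i j → (e (suc i) + pw t * e i) * f j)
    ≡⟨ +ˡ (trans (∑₁-cong J (λ i j _ → lem₁ (e (suc i)) (pw t) (e i) (f j))) (∑₁-+ J _ _)) ⟩
   e 0 * f (suc J) + (∑₁ J (λ i j → e (suc i) * f j) + ∑₁ J (λ i j → pw t * (e i * f j)))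
    ≡⟨ sym (+-assoc _ _ _) ⟩
   (e ∗ f) (suc J) + ∑₁ J (λ i j → pw t * (e i * f j))
    ≡⟨ +ʳ (∑₁-last J (λ i j → e i * f j)) ⟩
   ∑₁ J (λ i j → e i * f (suc j)) + e (suc J) * f 0 + ∑₁ J (λ i j → pw t * (e i * f j))
    ≡⟨ solve 3 (λ a b c → a :+ b :+ c := (a :+ c) :+ b) refl _ _ _ ⟩
   (∑₁ J (λ i j → e i * f (suc j)) + ∑₁ J (λ i j → pw t * (e i * f j))) + e (suc J) * f 0
    ≡⟨ +ʳ (trans (sym (∑₁-+ J _ _)) (∑₁-cong J (λ i j _ → lem₂ (e i) (f (suc j)) (pw t) (f j)))) ⟩
   ∑₁ J (λ i j → e i * (f (suc j) + pw t * f j)) + e (suc J) * f 0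
    ≡⟨ sym (∑₁-last J (λ i j → e i * T t f j)) ⟩
   (e ∗ T t f) (suc J) ∎
   where
   lem₁ : ∀ a b c d → (a + b * c) * d ≡ a * d + b * (c * d)
   lem₁ = solve 4 (λ a b c d → (a :+ b :* c) :* d := a :* d :+ b :* (c :* d)) refl
   lem₂ : ∀ a b c d → a * b + c * (a * d) ≡ a * (b + c * d)
   lem₂ = solve 4 (λ a b c d → a :* b :+ c :* (a :* d) := a :* (b :+ c :* d)) refl

  -- `ε-suc` with y rescaled by v^t: E(v^(t+1) y) = (1 + v^t y) E(v^(t-1) y).
  E-step : ∀ t → E (t ℤ.+ ⁺ 1) ≗ T t (E (t ℤ.- ⁺ 1))
  E-step t zero    = cong (λ z → ε 0 * pw z) (trans (ℤP.*-zeroʳ (t ℤ.+ ⁺ 1)) (sym (ℤP.*-zeroʳ (t ℤ.- ⁺ 1))))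
  E-step t (suc j) = begin
   ε (suc j) * pw ((t ℤ.+ ⁺ 1) ℤ.* k)    ≡⟨ *ˡ (trans (cong pw (e₁ t k)) (pw-+ k (t ℤ.* k))) ⟩
   ε (suc j) * (pw k * pw (t ℤ.* k))     ≡⟨ trans (sym (*-assoc _ _ _)) (*ʳ (ε-suc j)) ⟩
   (ε (suc j) * pw (ℤ.- k) + ε j * pw (ℤ.- ⁺ j)) * pw (t ℤ.* k)
    ≡⟨ trans (distribʳ _ _ _) (cong₂ _+_ (trans (*-assoc _ _ _) (*ˡ (trans (sym (pw-+ _ _)) (cong pw (e₂ t k)))))
       (trans (*-assoc _ _ _) (trans (*ˡ (trans (sym (pw-+ _ _)) (trans (cong pw e₃) (pw-+ t _)))) (lem (ε j) _ _)))) ⟩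
   ε (suc j) * pw ((t ℤ.- ⁺ 1) ℤ.* k) + pw t * (ε j * pw ((t ℤ.- ⁺ 1) ℤ.* ⁺ j)) ∎
   where
   k = ⁺ suc j
   e₁ : ∀ t k → (t ℤ.+ ⁺ 1) ℤ.* k ≡ k ℤ.+ t ℤ.* k
   e₁ = solve-∀
   e₂ : ∀ t k → ℤ.- k ℤ.+ t ℤ.* k ≡ (t ℤ.- ⁺ 1) ℤ.* k
   e₂ = solve-∀
   e₄ : ∀ t j → ℤ.- j ℤ.+ t ℤ.* (⁺ 1 ℤ.+ j) ≡ t ℤ.+ (t ℤ.- ⁺ 1) ℤ.* j
   e₄ = solve-∀
   e₃ : ℤ.- ⁺ j ℤ.+ t ℤ.* k ≡ t ℤ.+ (t ℤ.- ⁺ 1) ℤ.* ⁺ j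
   e₃ = e₄ t (⁺ j)
   lem : ∀ a b c → a * (b * c) ≡ b * (a * c)
   lem = solve 3 (λ a b c → a :* (b :* c) := b :* (a :* c)) refl

  -- The constant term of `E t` is 1, so the coefficients are recovered one after another.
  ∗-cancel : ∀ t {x y : Line} → E t ∗ x ≗ E t ∗ y → x ≗ y
  ∗-cancel t {x} {y} e j = go j j ℕP.≤-refl
   where
   E0 : ∀ a → E t 0 * a ≡ a
   E0 a = trans (*ʳ (trans (cong₂ _*_ ε-0 (trans (cong pw (ℤP.*-zeroʳ t)) pw-0)) (*-identityˡ 1F))) (*-identityˡ a)
   go : ∀ J j → j ℕ.≤ J → x j ≡ y j
   go J       zero    _ = trans (sym (E0 _)) (trans (e 0) (E0 _))
   go (suc J) (suc j) p = trans (sym (E0 _)) (trans (+-cancelʳ _ _ _ (trans (e (suc j))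
    (+ˡ (∑₁-cong j (λ i k q → *ˡ (sym (go J k (ℕP.≤-trans (ℕP.m+n≤o⇒n≤o i (ℕP.≤-reflexive q)) (ℕP.≤-pred p))))))))) (E0 _))

  -- Multiplication by the product of 1 + v^(t+2i) y over i < m. The step 2 matches `E-step`, which
  -- moves the argument of E by v².
  chain : ℤ → ℕ → Line → Line
  chain t zero    f = f
  chain t (suc m) f = T t (chain (t ℤ.+ ⁺ 2) m f)

  chain-E : ∀ t m f → E (t ℤ.- ⁺ 1) ∗ chain t m f ≗ E (t ℤ.- ⁺ 1 ℤ.+ ⁺ 2 ℤ.* ⁺ m) ∗ f
  chain-E t zero    f J = cong (λ z → (E z ∗ f) J) (e (t ℤ.- ⁺ 1))
   where
   e : ∀ u → u ≡ u ℤ.+ ⁺ 2 ℤ.* ⁺ 0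
   e = solve-∀
  chain-E t (suc m) f J = begin
   (E (t ℤ.- ⁺ 1) ∗ T t (chain (t ℤ.+ ⁺ 2) m f)) J
    ≡⟨ sym (T-shift t (E (t ℤ.- ⁺ 1)) (chain (t ℤ.+ ⁺ 2) m f) J) ⟩
   (T t (E (t ℤ.- ⁺ 1)) ∗ chain (t ℤ.+ ⁺ 2) m f) J
    ≡⟨ ∗-cong {g = chain (t ℤ.+ ⁺ 2) m f} (λ i → sym (E-step t i)) (λ _ → refl) J ⟩
   (E (t ℤ.+ ⁺ 1) ∗ chain (t ℤ.+ ⁺ 2) m f) J
    ≡⟨ cong (λ z → (E z ∗ chain (t ℤ.+ ⁺ 2) m f) J) (e₁ t) ⟩
   (E ((t ℤ.+ ⁺ 2) ℤ.- ⁺ 1) ∗ chain (t ℤ.+ ⁺ 2) m f) J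
    ≡⟨ chain-E (t ℤ.+ ⁺ 2) m f J ⟩
   (E ((t ℤ.+ ⁺ 2) ℤ.- ⁺ 1 ℤ.+ ⁺ 2 ℤ.* ⁺ m) ∗ f) J
    ≡⟨ cong (λ z → (E z ∗ f) J) (e₂ t (⁺ m)) ⟩
   (E (t ℤ.- ⁺ 1 ℤ.+ ⁺ 2 ℤ.* ⁺ suc m) ∗ f) J ∎
   where
   e₁ : ∀ t → t ℤ.+ ⁺ 1 ≡ (t ℤ.+ ⁺ 2) ℤ.- ⁺ 1
   e₁ = solve-∀
   e₂ : ∀ t m → (t ℤ.+ ⁺ 2) ℤ.- ⁺ 1 ℤ.+ ⁺ 2 ℤ.* m ≡ t ℤ.- ⁺ 1 ℤ.+ ⁺ 2 ℤ.* (⁺ 1 ℤ.+ m)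
   e₂ = solve-∀

  chain-degree : ∀ t m N f → (∀ i → N ℕ.< i → f i ≡ 0F) → ∀ i → N ℕ.+ m ℕ.< i → chain t m f i ≡ 0F
  chain-degree t zero    N f h i p = h i (subst (ℕ._< i) (ℕP.+-identityʳ N) p)
  chain-degree t (suc m) N f h (suc i) p = trans (cong₂ _+_
   (chain-degree (t ℤ.+ ⁺ 2) m N f h (suc i) (ℕP.m<n⇒m<1+n N+m<i))
   (trans (*ˡ (chain-degree (t ℤ.+ ⁺ 2) m N f h i N+m<i)) (*-zeroʳ _))) (+-identityʳ _)
   where
   N+m<i : N ℕ.+ m ℕ.< i
   N+m<i = ℕP.≤-pred (subst (ℕ._< suc i) (ℕP.+-suc N m) p)

  chain-last : ∀ t m f → chain t (suc m) f ≗ T (t ℤ.+ ⁺ 2 ℤ.* ⁺ m) (chain t m f)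
  chain-last t zero    f j = cong (λ z → T z f j) (e t)
   where
   e : ∀ t → t ≡ t ℤ.+ ⁺ 2 ℤ.* ⁺ 0
   e = solve-∀
  chain-last t (suc m) f j = begin
   T t (chain (t ℤ.+ ⁺ 2) (suc m) f) j ≡⟨ T-cong t (chain-last (t ℤ.+ ⁺ 2) m f) j ⟩
   T t (T ((t ℤ.+ ⁺ 2) ℤ.+ ⁺ 2 ℤ.* ⁺ m) (chain (t ℤ.+ ⁺ 2) m f)) j ≡⟨ T-comm t _ _ j ⟩
   T ((t ℤ.+ ⁺ 2) ℤ.+ ⁺ 2 ℤ.* ⁺ m) (T t (chain (t ℤ.+ ⁺ 2) m f)) j ≡⟨ cong (λ z → T z (chain t (suc m) f) j) (e t (⁺ m)) ⟩
   T (t ℤ.+ ⁺ 2 ℤ.* ⁺ suc m) (chain t (suc m) f) j ∎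
   where
   e : ∀ t m → (t ℤ.+ ⁺ 2) ℤ.+ ⁺ 2 ℤ.* m ≡ t ℤ.+ ⁺ 2 ℤ.* (⁺ 1 ℤ.+ m)
   e = solve-∀

  -- The factors of `chain` with v inverted, in the order in which reversing them one at a time
  -- produces them.
  downchain : ℤ → ℕ → Line → Line
  downchain t zero    f = f
  downchain t (suc m) f = T (ℤ.- t) (downchain (t ℤ.+ ⁺ 2) m f)

  chain≗downchain : ∀ t m f → chain (ℤ.- (t ℤ.- ⁺ 2 ℤ.+ ⁺ 2 ℤ.* ⁺ m)) m f ≗ downchain t m f
  chain≗downchain t zero    f j = refl
  chain≗downchain t (suc m) f j = begin
   chain u (suc m) f j                         ≡⟨ chain-last u m f j ⟩
   T (u ℤ.+ ⁺ 2 ℤ.* ⁺ m) (chain u m f) j       ≡⟨ cong₂ (λ z z′ → T z (chain z′ m f) j) (e₁ t (⁺ m)) (e₂ t (⁺ m)) ⟩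
   T (ℤ.- t) (chain (ℤ.- ((t ℤ.+ ⁺ 2) ℤ.- ⁺ 2 ℤ.+ ⁺ 2 ℤ.* ⁺ m)) m f) j ≡⟨ T-cong (ℤ.- t) (chain≗downchain (t ℤ.+ ⁺ 2) m f) j ⟩
   T (ℤ.- t) (downchain (t ℤ.+ ⁺ 2) m f) j ∎
   where
   u = ℤ.- (t ℤ.- ⁺ 2 ℤ.+ ⁺ 2 ℤ.* ⁺ suc m)
   e₁ : ∀ t m → ℤ.- (t ℤ.- ⁺ 2 ℤ.+ ⁺ 2 ℤ.* (⁺ 1 ℤ.+ m)) ℤ.+ ⁺ 2 ℤ.* m ≡ ℤ.- t
   e₁ = solve-∀
   e₂ : ∀ t m → ℤ.- (t ℤ.- ⁺ 2 ℤ.+ ⁺ 2 ℤ.* (⁺ 1 ℤ.+ m)) ≡ ℤ.- ((t ℤ.+ ⁺ 2) ℤ.- ⁺ 2 ℤ.+ ⁺ 2 ℤ.* m)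
   e₂ = solve-∀

  -- f′ is y^N f(1/y) for a polynomial f of degree at most N.
  record Mirror (N : ℕ) (f f′ : Line) : Set where
   constructor mirror
   field
    swap  : ∀ i j → i ℕ.+ j ≡ N → f i ≡ f′ j
    bound : ∀ i → N ℕ.< i → f i ≡ 0F
    bound′ : ∀ i → N ℕ.< i → f′ i ≡ 0F
  open Mirror

  -- Reversing 1 + v^t y gives v^t (1 + v^(-t) y): one degree more, and a scalar that has to be
  -- carried along.
  T-mirror : ∀ t c N f f′ → Mirror N f (λ j → c * f′ j) → Mirror (suc N) (T t f) (λ j → (pw t * c) * T (ℤ.- t) f′ j)
  T-mirror t c N f f′ m = mirror sw (T-bound t N f (bound m)) bd
   where
   T-bound : ∀ t N f → (∀ i → N ℕ.< i → f i ≡ 0F) → ∀ i → suc N ℕ.< i → T t f i ≡ 0F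
   T-bound t N f h (suc i) p = trans (cong₂ _+_ (h (suc i) (ℕP.m<n⇒m<1+n (ℕP.≤-pred p))) (trans (*ˡ (h i (ℕP.≤-pred p))) (*-zeroʳ _))) (+-identityʳ _)
   expand : ∀ j → (pw t * c) * T (ℤ.- t) f′ (suc j) ≡ pw t * (c * f′ (suc j)) + c * f′ j
   expand j = trans (solve 5 (λ p c a q b → (p :* c) :* (a :+ q :* b) := p :* (c :* a) :+ (p :* q) :* (c :* b)) refl (pw t) c (f′ (suc j)) (pw (ℤ.- t)) (f′ j))
    (+ˡ (trans (*ʳ (pw-inv t)) (*-identityˡ _)))
   bd : ∀ i → suc N ℕ.< i → (pw t * c) * T (ℤ.- t) f′ i ≡ 0F
   bd (suc i) p = trans (expand i) (trans (cong₂ _+_ (trans (*ˡ (bound′ m (suc i) (ℕP.m<n⇒m<1+n (ℕP.≤-pred p)))) (*-zeroʳ _)) (bound′ m i (ℕP.≤-pred p))) (+-identityʳ _))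
   sw : ∀ i j → i ℕ.+ j ≡ suc N → T t f i ≡ (pw t * c) * T (ℤ.- t) f′ j
   sw zero    (suc j) e = trans (swap m 0 j (ℕP.suc-injective e))
    (sym (trans (expand j) (trans (+ʳ (trans (*ˡ (bound′ m (suc j) (ℕP.≤-reflexive (sym e)))) (*-zeroʳ _))) (+-identityˡ _))))
   sw (suc i) zero    e = trans (cong₂ _+_ (bound m (suc i) (ℕP.≤-reflexive (trans (sym e) (ℕP.+-identityʳ _)))) (*ˡ (swap m i 0 (ℕP.suc-injective e))))
    (trans (+-identityˡ _) (sym (*-assoc _ _ _)))
   sw (suc i) (suc j) e = trans (cong₂ _+_ (swap m (suc i) j (trans (sym (ℕP.+-suc i j)) (ℕP.suc-injective e))) (*ˡ (swap m i (suc j) (ℕP.suc-injective e))))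
    (trans (+-comm _ _) (sym (expand j)))

  -- The product of the scalars v^t, v^(t+2), ... that `T-mirror` collects along a chain.
  weight : ℤ → ℕ → F
  weight t zero    = 1F
  weight t (suc m) = pw t * weight (t ℤ.+ ⁺ 2) m

  weight-pw : ∀ t m → weight t m ≡ pw (⁺ m ℤ.* t ℤ.+ ⁺ m ℤ.* (⁺ m ℤ.- ⁺ 1))
  weight-pw t zero    = sym (trans (cong pw (e t)) pw-0)
   where
   e : ∀ t → ⁺ 0 ℤ.* t ℤ.+ ⁺ 0 ℤ.* (⁺ 0 ℤ.- ⁺ 1) ≡ ⁺ 0
   e = solve-∀
  weight-pw t (suc m) = trans (*ˡ (weight-pw (t ℤ.+ ⁺ 2) m)) (trans (sym (pw-+ t _)) (cong pw (e t (⁺ m))))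
   where
   e : ∀ t m → t ℤ.+ (m ℤ.* (t ℤ.+ ⁺ 2) ℤ.+ m ℤ.* (m ℤ.- ⁺ 1)) ≡ (⁺ 1 ℤ.+ m) ℤ.* t ℤ.+ (⁺ 1 ℤ.+ m) ℤ.* ((⁺ 1 ℤ.+ m) ℤ.- ⁺ 1)
   e = solve-∀

  chain-mirror : ∀ t m N f f′ → Mirror N f f′ → Mirror (m ℕ.+ N) (chain t m f) (λ j → weight t m * downchain t m f′ j)
  chain-mirror t zero    N f f′ h = mirror (λ i j e → trans (swap h i j e) (sym (*-identityˡ _))) (bound h) (λ i p → trans (*-identityˡ _) (bound′ h i p))
  chain-mirror t (suc m) N f f′ h = T-mirror t (weight (t ℤ.+ ⁺ 2) m) (m ℕ.+ N) _ _ (chain-mirror (t ℤ.+ ⁺ 2) m N f f′ h)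

  -- E(v^s y) / E(v^{-s} y) is the polynomial ∏ (1 + v^t y), t = 1-s, 3-s, …, s-1.
  line-chain : ∀ s {g x : Line} → E (⁺ s) ∗ g ≗ E (ℤ.- ⁺ s) ∗ x → x ≗ chain (⁺ 1 ℤ.- ⁺ s) s g
  line-chain s {g} {x} h = ∗-cancel (ℤ.- ⁺ s) (λ J → trans (sym (h J)) (sym (trans (cong (λ z → (E z ∗ chain (⁺ 1 ℤ.- ⁺ s) s g) J) (e₁ (⁺ s)))
   (trans (chain-E (⁺ 1 ℤ.- ⁺ s) s g J) (cong (λ z → (E z ∗ g) J) (e₂ (⁺ s)))))))
   where
   e₁ : ∀ s → ℤ.- s ≡ (⁺ 1 ℤ.- s) ℤ.- ⁺ 1
   e₁ = solve-∀
   e₂ : ∀ s → (⁺ 1 ℤ.- s) ℤ.- ⁺ 1 ℤ.+ ⁺ 2 ℤ.* s ≡ s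
   e₂ = solve-∀

  -- By `line-chain`, x is g times a polynomial of degree s.
  line-degree : ∀ s N {g x : Line} → E (⁺ s) ∗ g ≗ E (ℤ.- ⁺ s) ∗ x → (∀ i → N ℕ.< i → g i ≡ 0F) → ∀ i → N ℕ.+ s ℕ.< i → x i ≡ 0F
  line-degree s N h g0 i p = trans (line-chain s h i) (chain-degree _ s N _ g0 i p)

  -- The polynomial ∏ (1 + v^t y) above is palindromic, so the relation survives reversing both lines.
  line-mirror : ∀ s N {g g′ x x′ : Line} → E (⁺ s) ∗ g ≗ E (ℤ.- ⁺ s) ∗ x → Mirror N g g′ → Mirror (s ℕ.+ N) x x′ →
   E (ℤ.- ⁺ s) ∗ x′ ≗ E (⁺ s) ∗ g′
  line-mirror s N {g} {g′} {x} {x′} h mg mx J = trans (∗-cong {f = E (ℤ.- ⁺ s)} (λ _ → refl) x′-chain J)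
   (trans (cong (λ z → (E z ∗ chain t s g′) J) (e₁ (⁺ s))) (trans (chain-E t s g′ J) (cong (λ z → (E z ∗ g′) J) (e₂ (⁺ s)))))
   where
   t = ⁺ 1 ℤ.- ⁺ s
   e₁ : ∀ s → ℤ.- s ≡ (⁺ 1 ℤ.- s) ℤ.- ⁺ 1
   e₁ = solve-∀
   e₂ : ∀ s → (⁺ 1 ℤ.- s) ℤ.- ⁺ 1 ℤ.+ ⁺ 2 ℤ.* s ≡ s
   e₂ = solve-∀
   e₃ : ∀ s → s ℤ.* (⁺ 1 ℤ.- s) ℤ.+ s ℤ.* (s ℤ.- ⁺ 1) ≡ ⁺ 0
   e₃ = solve-∀
   e₄ : ∀ s → ⁺ 1 ℤ.- s ≡ ℤ.- ((⁺ 1 ℤ.- s) ℤ.- ⁺ 2 ℤ.+ ⁺ 2 ℤ.* s)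
   e₄ = solve-∀
   -- For t = 1 - s the exponents 1 - s, 3 - s, ..., s - 1 are symmetric about 0, so the scalars
   -- multiply to 1.
   w≡1 : weight t s ≡ 1F
   w≡1 = trans (weight-pw t s) (trans (cong pw (e₃ (⁺ s))) pw-0)
   m = chain-mirror t s N g g′ mg
   down : ∀ j → weight t s * downchain t s g′ j ≡ chain t s g′ j
   down j = trans (*ʳ w≡1) (trans (*-identityˡ _) (sym (trans (cong (λ z → chain z s g′ j) (e₄ (⁺ s))) (chain≗downchain t s g′ j))))
   x′-chain : x′ ≗ chain t s g′
   x′-chain j with j ℕ.≤? s ℕ.+ N
   ... | Relation.Nullary.yes p = trans (sym (swap mx i j e)) (trans (line-chain s h i) (trans (swap m i j e) (down j)))
    where
    i = (s ℕ.+ N) ℕ.∸ j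
    e : i ℕ.+ j ≡ s ℕ.+ N
    e = ℕP.m∸n+n≡m p
   ... | Relation.Nullary.no p = trans (bound′ mx j (ℕP.≰⇒> p)) (sym (trans (sym (down j)) (bound′ m j (ℕP.≰⇒> p))))

 -- The lattice of exponents, and mutation as an isometry.

 module Forms where
  open import Defs
  open Scalars hiding (_+_; _*_; -_)
  open Sums using (_⊕_; 𝟘)
  open Convolution using (Twist)
  open import Data.Integer using (_+_; _*_; -_; _-_)
  open import Data.Vec.Properties using (lookup-zipWith; lookup-replicate)
  import Algebra.Properties.Semiring.Sum ℤP.+-*-semiring as Sum

  open ≡-Reasoning

  Lattice : ℕ → Set
  Lattice n = Fin n → ℤ

  dot : ∀ {n} → Lattice n → Lattice n → ℤ
  dot φ x = Sum.sum (λ i → φ i * x i)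

  dot-cong : ∀ {n} {φ ψ x y : Lattice n} → φ ≗ ψ → x ≗ y → dot φ x ≡ dot ψ y
  dot-cong p q = Sum.sum-cong-≗ (λ i → cong₂ _*_ (p i) (q i))

  dot-+ʳ : ∀ {n} (φ x y : Lattice n) → dot φ (λ i → x i + y i) ≡ dot φ x + dot φ y
  dot-+ʳ φ x y = trans (Sum.sum-cong-≗ (λ i → ℤP.*-distribˡ-+ (φ i) (x i) (y i))) (Sum.∑-distrib-+ (λ i → φ i * x i) (λ i → φ i * y i))

  dot-comm : ∀ {n} (φ x : Lattice n) → dot φ x ≡ dot x φ
  dot-comm φ x = Sum.sum-cong-≗ (λ i → ℤP.*-comm (φ i) (x i))

  dot-+ˡ : ∀ {n} (φ ψ x : Lattice n) → dot (λ i → φ i + ψ i) x ≡ dot φ x + dot ψ x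
  dot-+ˡ φ ψ x = trans (dot-comm _ x) (trans (dot-+ʳ x φ ψ) (cong₂ _+_ (dot-comm x φ) (dot-comm x ψ)))

  dot-*ʳ : ∀ {n} c (φ x : Lattice n) → dot φ (λ i → c * x i) ≡ c * dot φ x
  dot-*ʳ c φ x = trans (Sum.sum-cong-≗ (λ i → lem (φ i) c (x i))) (sym (Sum.*-distribˡ-sum c (λ i → φ i * x i)))
   where
   lem : ∀ a b d → a * (b * d) ≡ b * (a * d)
   lem = solve-∀

  dot-*ˡ : ∀ {n} c (φ x : Lattice n) → dot (λ i → c * φ i) x ≡ c * dot φ x
  dot-*ˡ c φ x = trans (dot-comm _ x) (trans (dot-*ʳ c x φ) (cong (c *_) (dot-comm x φ)))

  dot-0ʳ : ∀ {n} (φ : Lattice n) → dot φ (λ _ → 0ℤ) ≡ 0ℤ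
  dot-0ʳ {n} φ = trans (Sum.sum-cong-≗ (λ i → ℤP.*-zeroʳ (φ i))) (Sum.sum-replicate-zero n)

  dot-dot : ∀ {m n} (x : Lattice m) (A : Fin m → Lattice n) (y : Lattice n) →
   dot x (λ i → dot (A i) y) ≡ dot (λ j → dot x (λ i → A i j)) y
  dot-dot x A y = begin
   Sum.sum (λ i → x i * Sum.sum (λ j → A i j * y j))
    ≡⟨ Sum.sum-cong-≗ (λ i → trans (Sum.*-distribˡ-sum (x i) (λ j → A i j * y j)) (Sum.sum-cong-≗ (λ j → sym (ℤP.*-assoc (x i) (A i j) (y j))))) ⟩
   Sum.sum (λ i → Sum.sum (λ j → x i * A i j * y j))
    ≡⟨ Sum.∑-comm (λ i j → x i * A i j * y j) ⟩
   Sum.sum (λ j → Sum.sum (λ i → x i * A i j * y j))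
    ≡⟨ Sum.sum-cong-≗ (λ j → sym (Sum.*-distribʳ-sum (y j) (λ i → x i * A i j))) ⟩
   Sum.sum (λ j → Sum.sum (λ i → x i * A i j) * y j) ∎

  unit : ∀ {n} → Fin n → Lattice n
  unit k i with i ≟ᶠ k
  ... | yes _ = 1ℤ
  ... | no _  = 0ℤ

  unit-same : ∀ {n} (k : Fin n) → unit k k ≡ 1ℤ
  unit-same k with k ≟ᶠ k
  ... | yes _ = refl
  ... | no h  = ⊥-elim (h refl)

  unit-≢ : ∀ {n} {k i : Fin n} → i ≢ k → unit k i ≡ 0ℤ
  unit-≢ {k = k} {i} h with i ≟ᶠ k
  ... | yes e = ⊥-elim (h e)
  ... | no _  = refl

  unit-suc : ∀ {n} (k i : Fin n) → unit (suc k) (suc i) ≡ unit k i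
  unit-suc k i with i ≟ᶠ k
  ... | yes _ = refl
  ... | no _  = refl

  dot-unitʳ : ∀ {n} (φ : Lattice n) k → dot φ (unit k) ≡ φ k
  dot-unitʳ {suc n} φ zero = trans (cong₂ _+_ (ℤP.*-identityʳ (φ zero))
   (trans (Sum.sum-cong-≗ (λ i → ℤP.*-zeroʳ (φ (suc i)))) (Sum.sum-replicate-zero n))) (ℤP.+-identityʳ _)
  dot-unitʳ {suc n} φ (suc k) = trans (cong₂ _+_ (ℤP.*-zeroʳ (φ zero))
   (trans (dot-cong {φ = λ i → φ (suc i)} (λ _ → refl) (unit-suc k)) (dot-unitʳ (λ i → φ (suc i)) k))) (ℤP.+-identityˡ _)

  dot-unitˡ : ∀ {n} k (x : Lattice n) → dot (unit k) x ≡ x k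
  dot-unitˡ k x = trans (dot-comm (unit k) x) (dot-unitʳ x k)

  form : ∀ {n} → Q n → Lattice n → Lattice n → ℤ
  form B x y = dot x (λ i → dot (B i) y)

  form-cong : ∀ {n} (B : Q n) {x x′ y y′ : Lattice n} → x ≗ x′ → y ≗ y′ → form B x y ≡ form B x′ y′
  form-cong B p q = dot-cong p (λ i → dot-cong {φ = B i} (λ _ → refl) q)

  form-+ˡ : ∀ {n} (B : Q n) x y z → form B (λ i → x i + y i) z ≡ form B x z + form B y z
  form-+ˡ B x y z = dot-+ˡ x y _

  form-+ʳ : ∀ {n} (B : Q n) x y z → form B x (λ i → y i + z i) ≡ form B x y + form B x z
  form-+ʳ B x y z = trans (dot-cong {φ = x} (λ _ → refl) (λ i → dot-+ʳ (B i) y z)) (dot-+ʳ x _ _)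

  form-*ˡ : ∀ {n} (B : Q n) c x y → form B (λ i → c * x i) y ≡ c * form B x y
  form-*ˡ B c x y = dot-*ˡ c x _

  form-*ʳ : ∀ {n} (B : Q n) c x y → form B x (λ i → c * y i) ≡ c * form B x y
  form-*ʳ B c x y = trans (dot-cong {φ = x} (λ _ → refl) (λ i → dot-*ʳ c (B i) y)) (dot-*ʳ c x _)

  form-unitˡ : ∀ {n} (B : Q n) k y → form B (unit k) y ≡ dot (B k) y
  form-unitˡ B k y = dot-unitˡ k _

  form-unitʳ : ∀ {n} (B : Q n) x k → form B x (unit k) ≡ dot x (λ i → B i k)
  form-unitʳ B x k = dot-cong {φ = x} (λ _ → refl) (λ i → dot-unitʳ (B i) k)

  form-units : ∀ {n} (B : Q n) i j → form B (unit i) (unit j) ≡ B i j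
  form-units B i j = trans (form-unitˡ B i _) (dot-unitʳ (B i) j)

  neg-sum : ∀ {n} (f : Lattice n) → Sum.sum (λ i → - f i) ≡ - Sum.sum f
  neg-sum f = trans (Sum.sum-cong-≗ (λ i → lem (f i))) (trans (sym (Sum.*-distribˡ-sum (- 1ℤ) f)) (sym (lem _)))
   where
   lem : ∀ a → - a ≡ - 1ℤ * a
   lem = solve-∀

  dot-negˡ : ∀ {n} (φ x : Lattice n) → dot (λ i → - φ i) x ≡ - dot φ x
  dot-negˡ φ x = trans (Sum.sum-cong-≗ (λ i → sym (ℤP.neg-distribˡ-* (φ i) (x i)))) (neg-sum (λ i → φ i * x i))

  form-skew : ∀ {n} {B : Q n} → IsQuiver B → ∀ x y → form B x y ≡ - form B y x
  form-skew {B = B} q x y = begin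
   dot x (λ i → dot (B i) y) ≡⟨ dot-dot x B y ⟩
   dot (λ j → dot x (λ i → B i j)) y
    ≡⟨ dot-cong {x = y} (λ j → trans (trans (dot-cong {φ = x} (λ _ → refl) (λ i → q i j)) (trans (dot-comm x _) (dot-negˡ (B j) x))) refl) (λ _ → refl) ⟩
   dot (λ j → - dot (B j) x) y ≡⟨ dot-negˡ (λ j → dot (B j) x) y ⟩
   - dot (λ j → dot (B j) x) y ≡⟨ cong -_ (dot-comm _ y) ⟩
   - form B y x ∎

  self-zero : ∀ z → z ≡ - z → z ≡ 0ℤ
  self-zero (⁺ zero)    _ = refl
  self-zero (⁺ suc n)   ()
  self-zero ℤ.-[1+ n ] ()

  form-self : ∀ {n} {B : Q n} → IsQuiver B → ∀ x → form B x x ≡ 0ℤ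
  form-self q x = self-zero _ (form-skew q x x)

  diag-zero : ∀ {n} {B : Q n} → IsQuiver B → ∀ k → B k k ≡ 0ℤ
  diag-zero q k = self-zero _ (q k k)

  ⟦_⟧ : ∀ {n} → Vec ℕ n → Lattice n
  ⟦ a ⟧ i = ⁺ lookup a i

  ⟦⊕⟧ : ∀ {n} (a b : Vec ℕ n) i → ⟦ a ⊕ b ⟧ i ≡ ⟦ a ⟧ i + ⟦ b ⟧ i
  ⟦⊕⟧ a b i = trans (cong ⁺_ (lookup-zipWith ℕ._+_ i a b)) (ℤP.pos-+ (lookup a i) (lookup b i))

  ⟦𝟘⟧ : ∀ {n} (i : Fin n) → ⟦ 𝟘 ⟧ i ≡ 0ℤ
  ⟦𝟘⟧ i = cong ⁺_ (lookup-replicate i 0)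

  ⟦⟧-injective : ∀ {n} (a b : Vec ℕ n) → ⟦ a ⟧ ≗ ⟦ b ⟧ → a ≡ b
  ⟦⟧-injective []      []      h = refl
  ⟦⟧-injective (x ∷ a) (y ∷ b) h = cong₂ _∷_ (ℤP.+-injective (h zero)) (⟦⟧-injective a b (λ i → h (suc i)))

  twist : ∀ {n} → Q n → Twist n
  twist {n} B = record
   { χ = χ
   ; χ-0ˡ = λ b → trans (cong pw (trans (dot-cong {x = λ i → dot (B i) ⟦ b ⟧} ⟦𝟘⟧ (λ _ → refl)) (trans (dot-comm (λ _ → 0ℤ) (λ i → dot (B i) ⟦ b ⟧)) (dot-0ʳ (λ i → dot (B i) ⟦ b ⟧))))) pw-0
   ; χ-0ʳ = λ a → trans (cong pw (trans (dot-cong {φ = ⟦ a ⟧} (λ _ → refl) (λ i → trans (dot-cong {φ = B i} (λ _ → refl) ⟦𝟘⟧) (dot-0ʳ (B i)))) (dot-0ʳ ⟦ a ⟧))) pw-0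
   ; χ-⊕ˡ = λ a b c → trans (cong pw (trans (form-cong B {y = ⟦ c ⟧} (⟦⊕⟧ a b) (λ _ → refl)) (form-+ˡ B ⟦ a ⟧ ⟦ b ⟧ ⟦ c ⟧))) (pw-+ _ _)
   ; χ-⊕ʳ = λ a b c → trans (cong pw (trans (form-cong B {x = ⟦ a ⟧} (λ _ → refl) (⟦⊕⟧ b c)) (form-+ʳ B ⟦ a ⟧ ⟦ b ⟧ ⟦ c ⟧))) (pw-+ _ _)
   }
   where
   χ : Vec ℕ n → Vec ℕ n → F
   χ a b = pw (form B ⟦ a ⟧ ⟦ b ⟧)

  pos-neg : ∀ a → a ≡ pos a - pos (- a)
  pos-neg (⁺ zero)   = refl
  pos-neg (⁺ suc n)  = sym (ℤP.+-identityʳ _)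
  pos-neg ℤ.-[1+ n ] = refl

  -- When `w k` is 0 this sends e_k to -e_k and e_i to e_i + w_i e_k: the change of basis of a
  -- lattice mutation.
  reflect : ∀ {n} → Lattice n → Fin n → Lattice n → Lattice n
  reflect w k x i = x i + (dot w x - ⁺ 2 * x k) * unit k i

  module _ {n : ℕ} {B : Q n} (q : IsQuiver B) (k : Fin n) where
   -- The two sign conventions for mutating a basis, by the arrows into k or out of k. Both give
   -- isometries from `μ k B` to `B`; the first serves E(y_k) split off on the left, the second on
   -- the right.
   weightIn weightOut : Lattice n
   weightIn  i = pos (B i k)
   weightOut i = pos (B k i)

   private
    -- One formula for all cases of mutation: the terms with -2 at k reverse the arrows there, and
    -- the hypothesis on w identifies the remaining correction with the paths through k.
    entry : (w : Lattice n) → (∀ i j → w j * B i k - w i * B j k ≡ pos (B i k) * pos (B k j) - pos (- B i k) * pos (- B k j)) →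
     ∀ i j → μ k B i j ≡ B i j + (w j - ⁺ 2 * unit k j) * B i k - (w i - ⁺ 2 * unit k i) * B j k
    entry w h i j with i ≟ᶠ k | j ≟ᶠ k
    ... | yes refl | yes refl = lem₁ (B i i) (w i) (diag-zero q i)
     where
     lem₁ : ∀ b w → b ≡ 0ℤ → - b ≡ b + (w - ⁺ 2 * 1ℤ) * b - (w - ⁺ 2 * 1ℤ) * b
     lem₁ _ w refl = lem w
      where
      lem : ∀ w → 0ℤ ≡ 0ℤ + (w - ⁺ 2 * 1ℤ) * 0ℤ - (w - ⁺ 2 * 1ℤ) * 0ℤ
      lem = solve-∀
    ... | yes refl | no _ = begin
     - B i j ≡⟨ lem (B i j) (pos (- B i j)) (B i i) (w j) (w i) ⟩
     B i j + (w j - ⁺ 2 * 0ℤ) * B i i - (w i - ⁺ 2 * 1ℤ) * (- B i j) + (w i * (- B i j) - w j * B i i)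
      ≡⟨ cong (λ z → B i j + (w j - ⁺ 2 * 0ℤ) * B i i - (w i - ⁺ 2 * 1ℤ) * z + (w i * z - w j * B i i)) (sym (q j i)) ⟩
     B i j + (w j - ⁺ 2 * 0ℤ) * B i i - (w i - ⁺ 2 * 1ℤ) * B j i + (w i * B j i - w j * B i i)
      ≡⟨ cong (λ z → B i j + (w j - ⁺ 2 * 0ℤ) * B i i - (w i - ⁺ 2 * 1ℤ) * B j i + z) zeroterm ⟩
     B i j + (w j - ⁺ 2 * 0ℤ) * B i i - (w i - ⁺ 2 * 1ℤ) * B j i + 0ℤ ≡⟨ ℤP.+-identityʳ _ ⟩
     B i j + (w j - ⁺ 2 * 0ℤ) * B i i - (w i - ⁺ 2 * 1ℤ) * B j i ∎
     where
     lem : ∀ b p d wj wi → - b ≡ b + (wj - ⁺ 2 * 0ℤ) * d - (wi - ⁺ 2 * 1ℤ) * (- b) + (wi * (- b) - wj * d)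
     lem = solve-∀
     zeroterm : w i * B j i - w j * B i i ≡ 0ℤ
     zeroterm = trans (cong (λ z → w i * B j i - w j * z) (diag-zero q i))
      (trans (neg₁ (w i) (B j i) (w j)) (trans (cong -_ (trans (cong (λ z → w j * z - w i * B j i) (sym (diag-zero q i))) (h i j)))
       (trans (cong (λ z → - (pos z * pos (B i j) - pos (- z) * pos (- B i j))) (diag-zero q i)) (z₀ (pos (B i j)) (pos (- B i j))))))
      where
      neg₁ : ∀ a b c → a * b - c * 0ℤ ≡ - (c * 0ℤ - a * b)
      neg₁ = solve-∀
      z₀ : ∀ a b → - (0ℤ * a - 0ℤ * b) ≡ 0ℤ
      z₀ = solve-∀
    ... | no _ | yes refl = begin
     - B i j ≡⟨ lem (B i j) (B j j) (w j) (w i) ⟩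
     B i j + (w j - ⁺ 2 * 1ℤ) * B i j - (w i - ⁺ 2 * 0ℤ) * B j j - (w j * B i j - w i * B j j)
      ≡⟨ cong (λ z → B i j + (w j - ⁺ 2 * 1ℤ) * B i j - (w i - ⁺ 2 * 0ℤ) * B j j - z)
         (trans (h i j) (trans (cong (λ z → pos (B i j) * pos z - pos (- B i j) * pos (- z)) (diag-zero q j)) (z₀ (pos (B i j)) (pos (- B i j))))) ⟩
     B i j + (w j - ⁺ 2 * 1ℤ) * B i j - (w i - ⁺ 2 * 0ℤ) * B j j - 0ℤ ≡⟨ ℤP.+-identityʳ _ ⟩
     B i j + (w j - ⁺ 2 * 1ℤ) * B i j - (w i - ⁺ 2 * 0ℤ) * B j j ∎
     where
     lem : ∀ b d wj wi → - b ≡ b + (wj - ⁺ 2 * 1ℤ) * b - (wi - ⁺ 2 * 0ℤ) * d - (wj * b - wi * d)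
     lem = solve-∀
     z₀ : ∀ a b → a * 0ℤ - b * 0ℤ ≡ 0ℤ
     z₀ = solve-∀
    ... | no _ | no _ = trans (assoc′ (B i j) (pos (B i k) * pos (B k j)) (pos (- B i k) * pos (- B k j)))
      (trans (cong (B i j +_) (sym (h i j))) (lem (B i j) (w j) (B i k) (w i) (B j k)))
     where
     assoc′ : ∀ a b c → a + b + - c ≡ a + (b - c)
     assoc′ = solve-∀
     lem : ∀ a wj bi wi bj → a + (wj * bi - wi * bj) ≡ a + (wj - ⁺ 2 * 0ℤ) * bi - (wi - ⁺ 2 * 0ℤ) * bj
     lem = solve-∀

    -- Both sides expand to `form B x y + d * X - Y * c`; on the reflected side e_k pairs to 0 with
    -- itself.
    isometry : (w : Lattice n) → (∀ i j → w j * B i k - w i * B j k ≡ pos (B i k) * pos (B k j) - pos (- B i k) * pos (- B k j)) →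
     ∀ x y → form (μ k B) x y ≡ form B (reflect w k x) (reflect w k y)
    isometry w h x y = trans lhs (sym rhs)
     where
     c = dot w x - ⁺ 2 * x k
     d = dot w y - ⁺ 2 * y k
     X = dot x (λ i → B i k)
     Y = dot y (λ i → B i k)
     coeff : Lattice n
     coeff j = w j - ⁺ 2 * unit k j
     coeff-dot : ∀ z → dot coeff z ≡ dot w z - ⁺ 2 * z k
     coeff-dot z = trans (dot-+ˡ w (λ j → - (⁺ 2 * unit k j)) z) (cong (λ t → dot w z + t)
      (trans (dot-negˡ (λ j → ⁺ 2 * unit k j) z) (cong -_ (trans (dot-*ˡ (⁺ 2) (unit k) z) (cong (⁺ 2 *_) (dot-unitˡ k z))))))
     row : ∀ i → dot (μ k B i) y ≡ dot (B i) y + B i k * d + (- Y) * coeff i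
     row i = begin
      dot (μ k B i) y ≡⟨ dot-cong {x = y} (λ j → trans (entry w h i j) (lem (B i j) (coeff j) (B i k) (coeff i) (B j k))) (λ _ → refl) ⟩
      dot (λ j → B i j + (B i k * coeff j + (- coeff i) * B j k)) y
       ≡⟨ trans (dot-+ˡ (B i) _ y) (cong (dot (B i) y +_) (trans (dot-+ˡ (λ j → B i k * coeff j) _ y) (cong₂ _+_ (dot-*ˡ (B i k) coeff y) (dot-*ˡ (- coeff i) (λ j → B j k) y)))) ⟩
      dot (B i) y + (B i k * dot coeff y + (- coeff i) * dot (λ j → B j k) y)
       ≡⟨ cong₂ (λ u v → dot (B i) y + (B i k * u + (- coeff i) * v)) (coeff-dot y) (dot-comm (λ j → B j k) y) ⟩
      dot (B i) y + (B i k * d + (- coeff i) * Y) ≡⟨ lem₂ (dot (B i) y) (B i k * d) (coeff i) Y ⟩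
      dot (B i) y + B i k * d + (- Y) * coeff i ∎
      where
      lem : ∀ a cj bi ci bj → a + cj * bi - ci * bj ≡ a + (bi * cj + (- ci) * bj)
      lem = solve-∀
      lem₂ : ∀ a b c y → a + (b + (- c) * y) ≡ a + b + (- y) * c
      lem₂ = solve-∀
     lhs : form (μ k B) x y ≡ form B x y + d * X - Y * c
     lhs = begin
      dot x (λ i → dot (μ k B i) y) ≡⟨ dot-cong {φ = x} (λ _ → refl) row ⟩
      dot x (λ i → dot (B i) y + B i k * d + (- Y) * coeff i)
       ≡⟨ trans (dot-+ʳ x (λ i → dot (B i) y + B i k * d) (λ i → (- Y) * coeff i)) (cong₂ _+_ (trans (dot-+ʳ x (λ i → dot (B i) y) (λ i → B i k * d))
          (cong (form B x y +_) (trans (dot-cong {φ = x} (λ _ → refl) (λ i → ℤP.*-comm (B i k) d)) (dot-*ʳ d x (λ i → B i k)))))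
          (trans (dot-*ʳ (- Y) x coeff) (cong (- Y *_) (trans (dot-comm x coeff) (coeff-dot x))))) ⟩
      form B x y + d * X + (- Y) * c ≡⟨ cong (form B x y + d * X +_) (sym (ℤP.neg-distribˡ-* Y c)) ⟩
      form B x y + d * X - Y * c ∎
     ek-y : form B (unit k) y ≡ - Y
     ek-y = trans (form-skew q (unit k) y) (cong -_ (form-unitʳ B y k))
     rhs : form B (reflect w k x) (reflect w k y) ≡ form B x y + d * X - Y * c
     rhs = begin
      form B (reflect w k x) (reflect w k y)
       ≡⟨ trans (form-+ˡ B x (λ i → c * unit k i) (reflect w k y)) (cong₂ _+_ (form-+ʳ B x y (λ i → d * unit k i))
          (trans (form-*ˡ B c (unit k) (reflect w k y)) (cong (c *_) (form-+ʳ B (unit k) y (λ i → d * unit k i))))) ⟩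
      (form B x y + form B x (λ i → d * unit k i)) + c * (form B (unit k) y + form B (unit k) (λ i → d * unit k i))
       ≡⟨ cong₂ (λ u v → (form B x y + u) + c * (form B (unit k) y + v)) (trans (form-*ʳ B d x (unit k)) (cong (d *_) (form-unitʳ B x k)))
          (trans (form-*ʳ B d (unit k) (unit k)) (trans (cong (d *_) (form-self q (unit k))) (ℤP.*-zeroʳ d))) ⟩
      (form B x y + d * X) + c * (form B (unit k) y + 0ℤ) ≡⟨ cong (λ u → (form B x y + d * X) + c * (u + 0ℤ)) ek-y ⟩
      (form B x y + d * X) + c * (- Y + 0ℤ) ≡⟨ lem (form B x y + d * X) c Y ⟩
      form B x y + d * X - Y * c ∎
      where
      lem : ∀ a c y → a + c * (- y + 0ℤ) ≡ a - y * c
      lem = solve-∀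

   isometryIn : ∀ x y → form (μ k B) x y ≡ form B (reflect weightIn k x) (reflect weightIn k y)
   isometryIn = isometry weightIn go
    where
    lem : ∀ a a′ b b′ → b * (a - a′) - a * (b - b′) ≡ a * b′ - a′ * b
    lem = solve-∀
    go : ∀ i j → weightIn j * B i k - weightIn i * B j k ≡ pos (B i k) * pos (B k j) - pos (- B i k) * pos (- B k j)
    go i j = trans (cong₂ (λ u v → pos (B j k) * u - pos (B i k) * v) (pos-neg (B i k)) (pos-neg (B j k)))
     (trans (lem (pos (B i k)) (pos (- B i k)) (pos (B j k)) (pos (- B j k)))
     (cong₂ (λ u v → pos (B i k) * pos u - pos (- B i k) * pos v) (sym (q k j)) (q j k)))

   isometryOut : ∀ x y → form (μ k B) x y ≡ form B (reflect weightOut k x) (reflect weightOut k y)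
   isometryOut = isometry weightOut go
    where
    lem : ∀ a a′ b b′ → b′ * (a - a′) - a′ * (b - b′) ≡ a * b′ - a′ * b
    lem = solve-∀
    go : ∀ i j → weightOut j * B i k - weightOut i * B j k ≡ pos (B i k) * pos (B k j) - pos (- B i k) * pos (- B k j)
    go i j = trans (cong (λ u → pos (B k j) * B i k - pos u * B j k) (q k i))
     (trans (cong₂ (λ u v → pos u * v - pos (- B i k) * B j k) (q k j) (pos-neg (B i k)))
     (trans (cong (λ v → pos (- B j k) * (pos (B i k) - pos (- B i k)) - pos (- B i k) * v) (pos-neg (B j k)))
     (trans (lem (pos (B i k)) (pos (- B i k)) (pos (B j k)) (pos (- B j k)))
     (cong₂ (λ u v → pos (B i k) * pos u - pos (- B i k) * pos v) (sym (q k j)) (q j k)))))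

   weightOut-weightIn : ∀ i → weightOut i - weightIn i ≡ B k i
   weightOut-weightIn i = sym (trans (pos-neg (B k i)) (cong (λ z → pos (B k i) - pos z) (sym (q i k))))

 -- Lines parallel to a coordinate axis, and reversal of segments on them.

 module Axes where
  open Scalars
  open Sums
  open Convolution
  open Lines
  open import Data.Vec using (sum)
  open import Data.Vec.Properties using (insertAt-lookup; removeAt-insertAt; insertAt-removeAt)
  open import Algebra.Bundles using (CommutativeRing)
  import Algebra.Solver.Ring.NaturalCoefficients.Default (CommutativeRing.commutativeSemiring commutativeRing) as FS

  open FS using (solve; _:=_; _:+_; _:*_)
  open ≡-Reasoning

  ∑₁-comm : ∀ n (G : ℕ → ℕ → F) → ∑₁ n G ≡ ∑₁ n (λ i j → G j i)
  ∑₁-comm zero    G = refl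
  ∑₁-comm (suc n) G = trans (+ˡ (∑₁-comm n (λ i j → G (suc i) j)))
   (trans (+-comm _ _) (sym (∑₁-last n (λ i j → G j i))))

  same : ℕ → ℕ → F
  same zero    zero    = 1F
  same (suc p) (suc d) = same p d
  same zero    (suc _) = 0F
  same (suc _) zero    = 0F

  same-≢ : ∀ {p d} → p ≢ d → same p d ≡ 0F
  same-≢ {zero}  {zero}  h = ⊥-elim (h refl)
  same-≢ {suc p} {suc d} h = same-≢ (λ e → h (cong suc e))
  same-≢ {zero}  {suc d} h = refl
  same-≢ {suc p} {zero}  h = refl

  same-+ : ∀ i p d → same (i ℕ.+ p) (i ℕ.+ d) ≡ same p d
  same-+ zero    p d = refl
  same-+ (suc i) p d = same-+ i p d

  ∑₁-same : ∀ j d t → d ℕ.≤ j → ∑₁ j (λ p _ → same p d * t) ≡ t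
  ∑₁-same zero    zero    t _ = *-identityˡ t
  ∑₁-same (suc j) zero    t _ = trans (+ˡ (trans (∑₁-cong j (λ _ _ _ → *-zeroˡ t)) (∑₁-0 j))) (trans (+-identityʳ _) (*-identityˡ t))
  ∑₁-same (suc j) (suc d) t p = trans (+ʳ (*-zeroˡ t)) (trans (+-identityˡ _) (∑₁-same j d t (ℕP.≤-pred p)))

  -- At most one p in the range satisfies i + p = A, and the hypothesis makes t zero when there is
  -- none. So a factor `same` can be inserted without changing a sum.
  ∑₁-match : ∀ i j A t → (¬ (i ℕ.≤ A × A ℕ.≤ i ℕ.+ j) → t ≡ 0F) → ∑₁ j (λ p _ → same (i ℕ.+ p) A * t) ≡ t
  ∑₁-match i j A t h with i ℕ.≤? A
  ... | no i≰A = trans (∑₁-cong j (λ _ _ _ → trans (*ˡ t0) (*-zeroʳ _))) (trans (∑₁-0 j) (sym t0))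
   where t0 = h (λ p → i≰A (proj₁ p))
  ... | yes i≤A with A ℕ.≤? i ℕ.+ j
  ...   | no A≰ = trans (∑₁-cong j (λ _ _ _ → trans (*ˡ t0) (*-zeroʳ _))) (trans (∑₁-0 j) (sym t0))
   where t0 = h (λ p → A≰ (proj₂ p))
  ...   | yes A≤ = trans (∑₁-cong j (λ p _ _ → *ʳ (trans (cong (same (i ℕ.+ p)) (sym d-eq)) (same-+ i p (A ℕ.∸ i)))))
    (∑₁-same j (A ℕ.∸ i) t (ℕP.+-cancelˡ-≤ i _ _ (subst (ℕ._≤ i ℕ.+ j) (sym d-eq) A≤)))
   where
   d-eq : i ℕ.+ (A ℕ.∸ i) ≡ A
   d-eq = ℕP.m+[n∸m]≡n i≤A

  insert-view : ∀ {m} (k : Fin (suc m)) (P : Vec ℕ (suc m) → Set) → (∀ J a → P (insertAt a k J)) → ∀ x → P x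
  insert-view k P h x = subst P (insertAt-removeAt x k) (h (lookup x k) (removeAt x k))

  insert-⊕ : ∀ {m} (k : Fin (suc m)) i j (a b : Vec ℕ m) → insertAt a k i ⊕ insertAt b k j ≡ insertAt (a ⊕ b) k (i ℕ.+ j)
  insert-⊕ zero    i j a       b       = refl
  insert-⊕ (suc k) i j (x ∷ a) (y ∷ b) = cong (x ℕ.+ y ∷_) (insert-⊕ k i j a b)

  insert-𝟘 : ∀ {m} (k : Fin (suc m)) → insertAt 𝟘 k 0 ≡ 𝟘
  insert-𝟘 {m}     zero    = refl
  insert-𝟘 {suc m} (suc k) = cong (0 ∷_) (insert-𝟘 k)

  sum-insert : ∀ {m} (k : Fin (suc m)) J (a : Vec ℕ m) → sum (insertAt a k J) ≡ J ℕ.+ sum a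
  sum-insert zero    J a       = refl
  sum-insert (suc k) J (x ∷ a) = trans (cong (x ℕ.+_) (sum-insert k J a))
   (trans (sym (ℕP.+-assoc x J _)) (trans (cong (ℕ._+ sum a) (ℕP.+-comm x J)) (ℕP.+-assoc J x _)))

  along : ∀ {m} → Fin (suc m) → Line → Series (suc m)
  along k f x = δ (removeAt x k) * f (lookup x k)

  along-insert : ∀ {m} (k : Fin (suc m)) f J a → along k f (insertAt a k J) ≡ δ a * f J
  along-insert k f J a = cong₂ (λ u v → δ u * f v) (removeAt-insertAt a k J) (insertAt-lookup a k J)

  line : ∀ {m} → Fin (suc m) → Vec ℕ m → Series (suc m) → Line
  line k a f J = f (insertAt a k J)

  dilog : ∀ {m} → Fin (suc m) → Series (suc m)
  dilog k = along k ε

  dilog-𝟘 : ∀ {m} (k : Fin (suc m)) → dilog k 𝟘 ≡ 1F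
  dilog-𝟘 {m} k = trans (cong (dilog k) (sym (insert-𝟘 k))) (trans (along-insert k ε 0 𝟘)
   (trans (cong₂ _*_ (δ-𝟘 m) ε-0) (*-identityˡ 1F)))

  dilog-off : ∀ {m} (k : Fin (suc m)) J (a : Vec ℕ m) → a ≢ 𝟘 → dilog k (insertAt a k J) ≡ 0F
  dilog-off k J a h = trans (along-insert k ε J a) (trans (*ʳ (δ-≢ a h)) (*-zeroˡ _))

  dilog-axis : ∀ {m} (k : Fin (suc m)) J → dilog k (insertAt 𝟘 k J) ≡ ε J
  dilog-axis {m} k J = trans (along-insert k ε J 𝟘) (trans (*ʳ (δ-𝟘 m)) (*-identityˡ _))

  module Axis {m : ℕ} (τ : Twist (suc m)) (k : Fin (suc m)) (s : Vec ℕ m → ℤ)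
   (χ-axisˡ : ∀ i j a → Twist.χ τ (insertAt 𝟘 k i) (insertAt a k j) ≡ pw (s a ℤ.* ⁺ i))
   (χ-axisʳ : ∀ i j a → Twist.χ τ (insertAt a k j) (insertAt 𝟘 k i) ≡ pw ((ℤ.- s a) ℤ.* ⁺ i)) where
   open Twist τ
   open Conv τ

   -- The pairing of e_k with an exponent does not change along a line in direction k, so E(y_k)
   -- acts on each such line as a one-variable series.
   dilog-⋆ : ∀ g a → line k a (dilog k ⋆ g) ≗ E (s a) ∗ line k a g
   dilog-⋆ g a J = trans (∑-insert k J a _) (∑₁-cong J (λ i j _ → begin
    ∑ a (λ b c → dilog k (insertAt b k i) * g (insertAt c k j) * χ (insertAt b k i) (insertAt c k j))
     ≡⟨ ∑-cong a (λ b c _ → trans (*ʳ (*ʳ (along-insert k ε i b))) (lem (δ b) (ε i) _ _)) ⟩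
    ∑ a (λ b c → δ b * (ε i * χ (insertAt b k i) (insertAt c k j) * g (insertAt c k j))) ≡⟨ ∑-δˡ a _ ⟩
    ε i * χ (insertAt 𝟘 k i) (insertAt a k j) * g (insertAt a k j) ≡⟨ *ʳ (*ˡ (χ-axisˡ i j a)) ⟩
    ε i * pw (s a ℤ.* ⁺ i) * g (insertAt a k j) ∎))
    where
    lem : ∀ a b c d → a * b * c * d ≡ a * (b * d * c)
    lem = solve 4 (λ a b c d → a :* b :* c :* d := a :* (b :* d :* c)) refl

   ⋆-dilog : ∀ g a → line k a (g ⋆ dilog k) ≗ E (ℤ.- s a) ∗ line k a g
   ⋆-dilog g a J = trans (∑-insert k J a _) (trans (∑₁-cong J (λ j i _ → begin
    ∑ a (λ b c → g (insertAt b k j) * dilog k (insertAt c k i) * χ (insertAt b k j) (insertAt c k i))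
     ≡⟨ ∑-cong a (λ b c _ → trans (*ʳ (*ˡ (along-insert k ε i c))) (lem _ (δ c) (ε i) _)) ⟩
    ∑ a (λ b c → δ c * (ε i * χ (insertAt b k j) (insertAt c k i) * g (insertAt b k j))) ≡⟨ ∑-δʳ a _ ⟩
    ε i * χ (insertAt a k j) (insertAt 𝟘 k i) * g (insertAt a k j) ≡⟨ *ʳ (*ˡ (χ-axisʳ i j a)) ⟩
    ε i * pw ((ℤ.- s a) ℤ.* ⁺ i) * g (insertAt a k j) ∎)) (∑₁-comm J _))
    where
    lem : ∀ g a b d → g * (a * b) * d ≡ a * (b * d * g)
    lem = solve 4 (λ g a b d → g :* (a :* b) :* d := a :* (b :* d :* g)) refl

  module Mirrored {m : ℕ} (k : Fin (suc m)) (β : Vec ℕ m → ℕ) (β-⊕ : ∀ a b → β (a ⊕ b) ≡ β a ℕ.+ β b) where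

   Bounded : Series (suc m) → Set
   Bounded f = ∀ a J → β a ℕ.< J → f (insertAt a k J) ≡ 0F

   -- Each segment a + J e_k with 0 ≤ J ≤ β a is turned end for end, and what lies beyond it is
   -- discarded. On exponents this is `reflect`, restricted to where the result is nonnegative.
   flip : Series (suc m) → Series (suc m)
   flip f x with lookup x k ℕ.≤? β (removeAt x k)
   ... | yes _ = f (insertAt (removeAt x k) k (β (removeAt x k) ℕ.∸ lookup x k))
   ... | no _  = 0F

   flip-in : ∀ f a i j → i ℕ.+ j ≡ β a → flip f (insertAt a k j) ≡ f (insertAt a k i)
   flip-in f a i j e with lookup (insertAt a k j) k ℕ.≤? β (removeAt (insertAt a k j) k)
   ... | yes _ = cong₂ (λ u v → f (insertAt u k v)) (removeAt-insertAt a k j)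
     (trans (cong₂ (λ u v → β u ℕ.∸ v) (removeAt-insertAt a k j) (insertAt-lookup a k j))
      (trans (cong (ℕ._∸ j) (sym e)) (ℕP.m+n∸n≡m i j)))
   ... | no h = ⊥-elim (h (subst₂ (λ u v → u ℕ.≤ β v) (sym (insertAt-lookup a k j)) (sym (removeAt-insertAt a k j))
     (subst (j ℕ.≤_) e (ℕP.m≤n+m j i))))

   flip-out : ∀ f → Bounded (flip f)
   flip-out f a j p with lookup (insertAt a k j) k ℕ.≤? β (removeAt (insertAt a k j) k)
   ... | yes h = ⊥-elim (ℕP.<⇒≱ p (subst₂ (λ u v → u ℕ.≤ β v) (insertAt-lookup a k j) (removeAt-insertAt a k j) h))
   ... | no _  = refl

   split-β : ∀ {a b c} → b ⊕ c ≡ a → β a ≡ β b ℕ.+ β c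
   split-β refl = β-⊕ _ _

   overflow : ∀ i₁ i₂ A C → A ℕ.+ C ℕ.< i₁ ℕ.+ i₂ → A ℕ.< i₁ ⊎ C ℕ.< i₂
   overflow i₁ i₂ A C p with i₁ ℕ.≤? A | i₂ ℕ.≤? C
   ... | no q  | _     = inj₁ (ℕP.≰⇒> q)
   ... | yes _ | no r  = inj₂ (ℕP.≰⇒> r)
   ... | yes q | yes r = ⊥-elim (ℕP.<⇒≱ p (ℕP.+-mono-≤ q r))

   module _ (τ : Twist (suc m)) where
    open Twist τ
    open Conv τ

    -- With j the complementary k-exponent, i + j = β a, the product is a sum over splits of (a, i, j);
    -- in this form it is symmetric in i and j.
    box : ∀ f g → Bounded f → Bounded g → ∀ a i j → i ℕ.+ j ≡ β a →
     (f ⋆ g) (insertAt a k i) ≡ ∑ a (λ b c → ∑₁ i (λ i₁ i₂ → ∑₁ j (λ j₁ j₂ → same (i₁ ℕ.+ j₁) (β b) *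
      (f (insertAt b k i₁) * g (insertAt c k i₂) * χ (insertAt b k i₁) (insertAt c k i₂)))))
    box f g bf bg a i j e = trans (∑-insert k i a _) (trans (∑₁-∑-swap i a _) (∑-cong a (λ b c e′ → ∑₁-cong i (λ i₁ i₂ e″ →
     sym (∑₁-match i₁ j (β b) _ (λ h → zero-term b c i₁ i₂ (out b c i₁ i₂ e′ e″ h)))))))
     where
     zero-term : ∀ b c i₁ i₂ → β b ℕ.< i₁ ⊎ β c ℕ.< i₂ →
      f (insertAt b k i₁) * g (insertAt c k i₂) * χ (insertAt b k i₁) (insertAt c k i₂) ≡ 0F
     zero-term b c i₁ i₂ (inj₁ p) = trans (*ʳ (trans (*ʳ (bf b i₁ p)) (*-zeroˡ _))) (*-zeroˡ _)
     zero-term b c i₁ i₂ (inj₂ p) = trans (*ʳ (trans (*ˡ (bg c i₂ p)) (*-zeroʳ _))) (*-zeroˡ _)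
     out : ∀ b c i₁ i₂ → b ⊕ c ≡ a → i₁ ℕ.+ i₂ ≡ i → ¬ (i₁ ℕ.≤ β b × β b ℕ.≤ i₁ ℕ.+ j) → β b ℕ.< i₁ ⊎ β c ℕ.< i₂
     out b c i₁ i₂ e′ e″ h with i₁ ℕ.≤? β b
     ... | no q  = inj₁ (ℕP.≰⇒> q)
     ... | yes q = inj₂ (ℕP.+-cancelˡ-< (β b) (β c) i₂ (subst (ℕ._< β b ℕ.+ i₂) eq (ℕP.+-monoˡ-< i₂ (ℕP.≰⇒> (λ r → h (q , r))))))
      where
      eq : (i₁ ℕ.+ j) ℕ.+ i₂ ≡ β b ℕ.+ β c
      eq = trans (trans (ℕP.+-assoc i₁ j i₂) (trans (cong (i₁ ℕ.+_) (ℕP.+-comm j i₂)) (sym (ℕP.+-assoc i₁ i₂ j))))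
       (trans (cong (ℕ._+ j) e″) (trans e (split-β e′)))

    ⋆-bounded : ∀ f g → Bounded f → Bounded g → Bounded (f ⋆ g)
    ⋆-bounded f g bf bg a J p = trans (∑-insert k J a _) (trans (∑₁-cong J (λ i j e → ∑-zero a (λ b c e′ →
     z i j b c (overflow i j (β b) (β c) (subst₂ ℕ._<_ (split-β e′) (sym e) p))))) (∑₁-0 J))
     where
     z : ∀ i j b c → β b ℕ.< i ⊎ β c ℕ.< j → f (insertAt b k i) * g (insertAt c k j) * χ (insertAt b k i) (insertAt c k j) ≡ 0F
     z i j b c (inj₁ q) = trans (*ʳ (trans (*ʳ (bf b i q)) (*-zeroˡ _))) (*-zeroˡ _)
     z i j b c (inj₂ q) = trans (*ʳ (trans (*ˡ (bg c j q)) (*-zeroʳ _))) (*-zeroˡ _)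

   -- `box` writes both products as sums in which the two complementary k-exponents occur
   -- symmetrically. Exchanging them, together with the isometry of the twists, turns one sum into
   -- the other.
   flip-⋆ : (τ τ′ : Twist (suc m)) →
    (∀ a b i₁ j₁ i₂ j₂ → i₁ ℕ.+ j₁ ≡ β a → i₂ ℕ.+ j₂ ≡ β b →
     Twist.χ τ′ (insertAt a k j₁) (insertAt b k j₂) ≡ Twist.χ τ (insertAt a k i₁) (insertAt b k i₂)) →
    ∀ f g → Bounded f → Bounded g → ∀ x → flip (Conv._⋆_ τ f g) x ≡ Conv._⋆_ τ′ (flip f) (flip g) x
   flip-⋆ τ τ′ iso f g bf bg = insert-view k _ go
    where
    open Conv τ using (_⋆_)
    open Conv τ′ using () renaming (_⋆_ to _⋆′_)
    term : ∀ b c i₁ i₂ → F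
    term b c i₁ i₂ = f (insertAt b k i₁) * g (insertAt c k i₂) * Twist.χ τ (insertAt b k i₁) (insertAt c k i₂)
    term′ : ∀ b c j₁ j₂ → F
    term′ b c j₁ j₂ = flip f (insertAt b k j₁) * flip g (insertAt c k j₂) * Twist.χ τ′ (insertAt b k j₁) (insertAt c k j₂)
    go : ∀ j a → flip (f ⋆ g) (insertAt a k j) ≡ (flip f ⋆′ flip g) (insertAt a k j)
    go j a with j ℕ.≤? β a
    ... | no q  = trans (flip-out (f ⋆ g) a j (ℕP.≰⇒> q)) (sym (⋆-bounded τ′ (flip f) (flip g) (flip-out f) (flip-out g) a j (ℕP.≰⇒> q)))
    ... | yes q = begin
     flip (f ⋆ g) (insertAt a k j) ≡⟨ flip-in (f ⋆ g) a i j e ⟩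
     (f ⋆ g) (insertAt a k i)      ≡⟨ box τ f g bf bg a i j e ⟩
     ∑ a (λ b c → ∑₁ i (λ i₁ i₂ → ∑₁ j (λ j₁ j₂ → same (i₁ ℕ.+ j₁) (β b) * term b c i₁ i₂)))
      ≡⟨ ∑-cong a (λ b c e′ → trans (∑₁-cong i (λ i₁ i₂ e₁ → ∑₁-cong j (λ j₁ j₂ e₂ → match b c i₁ i₂ j₁ j₂ e′ e₁ e₂))) (∑₁-swap i j _)) ⟩
     ∑ a (λ b c → ∑₁ j (λ j₁ j₂ → ∑₁ i (λ i₁ i₂ → same (j₁ ℕ.+ i₁) (β b) * term′ b c j₁ j₂)))
      ≡⟨ sym (box τ′ (flip f) (flip g) (flip-out f) (flip-out g) a j i (trans (ℕP.+-comm j i) e)) ⟩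
     (flip f ⋆′ flip g) (insertAt a k j) ∎
     where
     i = β a ℕ.∸ j
     e : i ℕ.+ j ≡ β a
     e = ℕP.m∸n+n≡m q
     match : ∀ b c i₁ i₂ j₁ j₂ → b ⊕ c ≡ a → i₁ ℕ.+ i₂ ≡ i → j₁ ℕ.+ j₂ ≡ j →
      same (i₁ ℕ.+ j₁) (β b) * term b c i₁ i₂ ≡ same (j₁ ℕ.+ i₁) (β b) * term′ b c j₁ j₂
     match b c i₁ i₂ j₁ j₂ e′ e₁ e₂ with (i₁ ℕ.+ j₁) ℕ.≟ β b
     ... | no h  = trans (trans (*ʳ (same-≢ h)) (*-zeroˡ _)) (sym (trans (*ʳ (same-≢ (λ r → h (trans (ℕP.+-comm i₁ j₁) r)))) (*-zeroˡ _)))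
     ... | yes r = cong₂ _*_ (cong (λ z → same z (β b)) (ℕP.+-comm i₁ j₁))
       (sym (cong₂ _*_ (cong₂ _*_ (flip-in f b i₁ j₁ r) (flip-in g c i₂ j₂ r₂)) (iso b c i₁ j₁ i₂ j₂ r r₂)))
      where
      inter : ∀ a b c d → (a ℕ.+ b) ℕ.+ (c ℕ.+ d) ≡ (a ℕ.+ c) ℕ.+ (b ℕ.+ d)
      inter a b c d = trans (ℕP.+-assoc a b _) (trans (cong (a ℕ.+_) (trans (sym (ℕP.+-assoc b c d))
       (trans (cong (ℕ._+ d) (ℕP.+-comm b c)) (ℕP.+-assoc c b d)))) (sym (ℕP.+-assoc a c _)))
      r₂ : i₂ ℕ.+ j₂ ≡ β c
      r₂ = ℕP.+-cancelˡ-≡ (β b) _ _ (trans (cong (ℕ._+ (i₂ ℕ.+ j₂)) (sym r)) (trans (inter i₁ j₁ i₂ j₂) (trans (cong₂ ℕ._+_ e₁ e₂) (trans e (split-β e′)))))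

 -- Lexicographic signs on the lattice and their transport.

 module Charts where
  open import Defs using (Q; IsQuiver)
  open Scalars using (F; 0F; 1F)
  open Sums using (_⊕_; 𝟘; 𝟘?; Series; ⊕-identityˡ; ⊕-identityʳ)
  open Convolution
  open Forms
  open import Data.Integer using (_+_; _*_; -_; _-_)
  open import Data.List using (map; cartesianProductWith; allFin)
  open import Data.List.Relation.Unary.All as All using (All; []; _∷_)
  import Data.List.Relation.Unary.All.Properties as AllP
  open import Data.List.Membership.Propositional using (_∈_)
  open import Data.List.Membership.Propositional.Properties using (∈-cartesianProductWith⁺; ∈-cartesianProductWith⁻; ∈-allFin)
  import Algebra.Properties.Semiring.Sum ℤP.+-*-semiring as Sum

  open ≡-Reasoning

  data Sgn : Set where
   neg nul pos⁺ : Sgn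

  opposite : Sgn → Sgn
  opposite neg  = pos⁺
  opposite nul  = nul
  opposite pos⁺ = neg

  refine : ℤ → Sgn → Sgn
  refine (⁺ zero)  s = s
  refine (⁺ suc _) s = pos⁺
  refine -[1+ _ ]  s = neg

  sgn : ∀ {n} → List (Lattice n) → Lattice n → Sgn
  sgn []      x = nul
  sgn (φ ∷ Φ) x = refine (dot φ x) (sgn Φ x)

  sgn-cong : ∀ {n} (Φ : List (Lattice n)) {x y : Lattice n} → x ≗ y → sgn Φ x ≡ sgn Φ y
  sgn-cong []      e = refl
  sgn-cong (φ ∷ Φ) e = cong₂ refine (dot-cong {φ = φ} (λ _ → refl) e) (sgn-cong Φ e)

  refine-nul : ∀ a s → refine a s ≡ nul → a ≡ 0ℤ × s ≡ nul
  refine-nul (⁺ zero) s e = refl , e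

  sgn-nul : ∀ {n} (Φ : List (Lattice n)) {x} → sgn Φ x ≡ nul → All (λ φ → dot φ x ≡ 0ℤ) Φ
  sgn-nul []      e = []
  sgn-nul (φ ∷ Φ) {x} e = proj₁ (refine-nul (dot φ x) (sgn Φ x) e) ∷ sgn-nul Φ (proj₂ (refine-nul (dot φ x) (sgn Φ x) e))

  nul-sgn : ∀ {n} (Φ : List (Lattice n)) {x} → All (λ φ → dot φ x ≡ 0ℤ) Φ → sgn Φ x ≡ nul
  nul-sgn []      []       = refl
  nul-sgn (φ ∷ Φ) {x} (e ∷ es) = trans (cong (λ z → refine z (sgn Φ x)) e) (nul-sgn Φ es)

  sgn-nul-+ : ∀ {n} (Φ : List (Lattice n)) {x y} → sgn Φ x ≡ nul → sgn Φ (λ i → x i + y i) ≡ sgn Φ y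
  sgn-nul-+ []      e = refl
  sgn-nul-+ (φ ∷ Φ) {x} {y} e = cong₂ refine
   (trans (dot-+ʳ φ x y) (trans (cong (_+ dot φ y) (proj₁ (refine-nul (dot φ x) (sgn Φ x) e))) (ℤP.+-identityˡ _)))
   (sgn-nul-+ Φ (proj₂ (refine-nul (dot φ x) (sgn Φ x) e)))

  refine-+ : ∀ {s} → s ≢ nul → ∀ a b {r t u} → refine a r ≡ s → refine b t ≡ s → (r ≡ s → t ≡ s → u ≡ s) → refine (a + b) u ≡ s
  refine-+ h (⁺ zero)  (⁺ zero)  p q f = f p q
  refine-+ h (⁺ zero)  (⁺ suc n) p q f = q
  refine-+ h (⁺ zero)  -[1+ n ]  p q f = q
  refine-+ h (⁺ suc m) (⁺ zero)  p q f = p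
  refine-+ h (⁺ suc m) (⁺ suc n) p q f = p
  refine-+ h (⁺ suc m) -[1+ n ]  p q f with trans p (sym q)
  ... | ()
  refine-+ h -[1+ m ]  (⁺ zero)  p q f = p
  refine-+ h -[1+ m ]  (⁺ suc n) p q f with trans p (sym q)
  ... | ()
  refine-+ h -[1+ m ]  -[1+ n ]  p q f = p

  sgn-+ : ∀ {n} {s} → s ≢ nul → (Φ : List (Lattice n)) {x y : Lattice n} → sgn Φ x ≡ s → sgn Φ y ≡ s → sgn Φ (λ i → x i + y i) ≡ s
  sgn-+ h []      p q = p
  sgn-+ {s = s} h (φ ∷ Φ) {x} {y} p q = trans (cong (λ z → refine z (sgn Φ (λ i → x i + y i))) (dot-+ʳ φ x y))
   (refine-+ h (dot φ x) (dot φ y) p q (sgn-+ h Φ))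

  refine-opp : ∀ a s → refine (- a) (opposite s) ≡ opposite (refine a s)
  refine-opp (⁺ zero)  s = refl
  refine-opp (⁺ suc _) s = refl
  refine-opp -[1+ _ ]  s = refl

  sgn-opp : ∀ {n} (Φ : List (Lattice n)) x → sgn Φ (λ i → - x i) ≡ opposite (sgn Φ x)
  sgn-opp []      x = refl
  sgn-opp (φ ∷ Φ) x = trans (cong₂ refine (trans (dot-comm φ _) (trans (dot-negˡ x φ) (cong -_ (dot-comm x φ)))) (sgn-opp Φ x)) (refine-opp (dot φ x) _)

  sgn-*-suc : ∀ {n} (Φ : List (Lattice n)) c x → sgn Φ (λ i → ⁺ suc c * x i) ≡ sgn Φ x
  sgn-*-suc Φ c x with sgn Φ x in eq
  ... | s = go c s eq
   where
   one : ∀ a → 1ℤ * a ≡ a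
   one = solve-∀
   more : ∀ c a → (1ℤ + c) * a ≡ a + c * a
   more = solve-∀
   go : ∀ c s → sgn Φ x ≡ s → sgn Φ (λ i → ⁺ suc c * x i) ≡ s
   go zero    s e = trans (sgn-cong Φ (λ i → one (x i))) e
   go (suc c) s e = trans (sgn-cong Φ (λ i → more (⁺ suc c) (x i))) (step s e (go c s e))
    where
    step : ∀ s → sgn Φ x ≡ s → sgn Φ (λ i → ⁺ suc c * x i) ≡ s → sgn Φ (λ i → x i + ⁺ suc c * x i) ≡ s
    step nul  p q = trans (sgn-nul-+ Φ p) q
    step neg  p q = sgn-+ (λ ()) Φ p q
    step pos⁺ p q = sgn-+ (λ ()) Φ p q

  isNeg : Sgn → Bool
  isNeg neg  = true
  isNeg nul  = false
  isNeg pos⁺ = false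

  Parallel : ∀ {n} → Lattice n → Lattice n → Set
  Parallel x y = ∀ i j → x i * y j ≡ x j * y i

  -- A chart at x is a lexicographic refinement of the linear form B(·,x) to an additive sign
  -- on the lattice that vanishes only on multiples of x.
  record Chart {n : ℕ} (B : Q n) (x : Vec ℕ n) : Set where
   no-eta-equality
   field
    Φ          : List (Lattice n)
    Φ-zero     : All (λ φ → dot φ ⟦ x ⟧ ≡ 0ℤ) Φ
    separating : ∀ y → form B y ⟦ x ⟧ ≡ 0ℤ → All (λ φ → dot φ y ≡ 0ℤ) Φ → Parallel y ⟦ x ⟧

   slope : Lattice n
   slope i = dot (B i) ⟦ x ⟧

   σ : Lattice n → Sgn
   σ = sgn (slope ∷ Φ)

   σᵛ : Vec ℕ n → Sgn
   σᵛ a = σ ⟦ a ⟧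

   negative : Vec ℕ n → Bool
   negative a = isNeg (σᵛ a)

  -- The linear forms given by the 2×2 minors of y against x: together they vanish exactly on the
  -- vectors parallel to x.
  minor : ∀ {n} → Vec ℕ n → Fin n → Fin n → Lattice n
  minor x i j l = unit i l * ⟦ x ⟧ j + unit j l * (- ⟦ x ⟧ i)

  dot-minor : ∀ {n} (x : Vec ℕ n) i j y → dot (minor x i j) y ≡ y i * ⟦ x ⟧ j - y j * ⟦ x ⟧ i
  dot-minor x i j y = trans (dot-+ˡ (λ l → unit i l * ⟦ x ⟧ j) (λ l → unit j l * (- ⟦ x ⟧ i)) y) (trans (cong₂ _+_ (side i (⟦ x ⟧ j)) (side j (- ⟦ x ⟧ i))) (lem (y i) (⟦ x ⟧ j) (y j) (⟦ x ⟧ i)))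
   where
   side : ∀ i c → dot (λ l → unit i l * c) y ≡ y i * c
   side i c = trans (dot-cong {y = y} (λ l → ℤP.*-comm (unit i l) c) (λ _ → refl)) (trans (dot-*ˡ c (unit i) y) (trans (cong (c *_) (dot-unitˡ i y)) (ℤP.*-comm c (y i))))
   lem : ∀ a b c d → a * b + c * (- d) ≡ a * b - c * d
   lem = solve-∀

  chart : ∀ {n} (B : Q n) x → Chart B x
  chart {n} B x = record
   { Φ = cartesianProductWith (minor x) (allFin n) (allFin n)
   ; Φ-zero = All.tabulate zero-on
   ; separating = λ y _ h i j → minus-zero (trans (sym (dot-minor x i j y)) (All.lookup h (∈-cartesianProductWith⁺ (minor x) (∈-allFin i) (∈-allFin j))))
   }
   where
   minus-zero : ∀ {a b} → a - b ≡ 0ℤ → a ≡ b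
   minus-zero {a} {b} = ℤP.i-j≡0⇒i≡j a b
   zero-on : ∀ {φ} → φ ∈ cartesianProductWith (minor x) (allFin n) (allFin n) → dot φ ⟦ x ⟧ ≡ 0ℤ
   zero-on φ∈ with ∈-cartesianProductWith⁻ (minor x) (allFin n) (allFin n) φ∈
   ... | i , j , _ , _ , refl = trans (dot-minor x i j ⟦ x ⟧) (lem (⟦ x ⟧ i) (⟦ x ⟧ j))
    where
    lem : ∀ a b → a * b - b * a ≡ 0ℤ
    lem = solve-∀

  module ChartProperties {n : ℕ} {B : Q n} (q : IsQuiver B) {x : Vec ℕ n} (c : Chart B x) where
   open Chart c

   dot-slope : ∀ y → dot slope y ≡ form B y ⟦ x ⟧
   dot-slope y = dot-comm slope y

   σ-self : σᵛ x ≡ nul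
   σ-self = nul-sgn (slope ∷ Φ) (trans (dot-slope ⟦ x ⟧) (form-self q ⟦ x ⟧) ∷ Φ-zero)

   σ-nul : ∀ y → σ y ≡ nul → Parallel y ⟦ x ⟧
   σ-nul y e with sgn-nul (slope ∷ Φ) {y} e
   ... | e₀ ∷ es = separating y (trans (sym (dot-slope y)) e₀) es

   σ-𝟘 : σᵛ 𝟘 ≡ nul
   σ-𝟘 = trans (sgn-cong (slope ∷ Φ) ⟦𝟘⟧) (nul-sgn (slope ∷ Φ) (All.tabulate (λ {φ} _ → dot-0ʳ φ)))

   negative-𝟘 : negative 𝟘 ≡ false
   negative-𝟘 = cong isNeg σ-𝟘

   σ-⊕-nulˡ : ∀ {a b} → σᵛ a ≡ nul → σᵛ (a ⊕ b) ≡ σᵛ b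
   σ-⊕-nulˡ {a} {b} e = trans (sgn-cong (slope ∷ Φ) (⟦⊕⟧ a b)) (sgn-nul-+ (slope ∷ Φ) e)

   σ-⊕-nulʳ : ∀ {a b} → σᵛ b ≡ nul → σᵛ (a ⊕ b) ≡ σᵛ a
   σ-⊕-nulʳ {a} {b} e = trans (sgn-cong (slope ∷ Φ) (λ i → trans (⟦⊕⟧ a b i) (ℤP.+-comm (⟦ a ⟧ i) (⟦ b ⟧ i)))) (sgn-nul-+ (slope ∷ Φ) {⟦ b ⟧} {⟦ a ⟧} e)

   σ-⊕ : ∀ {s} → s ≢ nul → ∀ {a b} → σᵛ a ≡ s → σᵛ b ≡ s → σᵛ (a ⊕ b) ≡ s
   σ-⊕ h {a} {b} p r = trans (sgn-cong (slope ∷ Φ) (⟦⊕⟧ a b)) (sgn-+ h (slope ∷ Φ) p r)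

   isNeg-true : ∀ {s} → isNeg s ≡ true → s ≡ neg
   isNeg-true {neg} _ = refl

   nonneg-⊕ : ∀ {a b} → negative a ≡ false → negative b ≡ false → negative (a ⊕ b) ≡ false
   nonneg-⊕ {a} {b} p r = go (σᵛ a) (σᵛ b) refl refl p r
    where
    go : ∀ s t → σᵛ a ≡ s → σᵛ b ≡ t → isNeg (σᵛ a) ≡ false → isNeg (σᵛ b) ≡ false → isNeg (σᵛ (a ⊕ b)) ≡ false
    go nul  t    e f p r = trans (cong isNeg (σ-⊕-nulˡ {a} {b} e)) r
    go pos⁺ nul  e f p r = trans (cong isNeg (σ-⊕-nulʳ {a} {b} f)) p
    go pos⁺ pos⁺ e f p r = cong isNeg (σ-⊕ {pos⁺} (λ ()) {a} {b} e f)
    go neg  t    e f p r with trans (sym (cong isNeg e)) p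
    ... | ()
    go pos⁺ neg  e f p r with trans (sym (cong isNeg f)) r
    ... | ()

   neg-⊕ : ∀ {a b} → negative a ≡ true → negative b ≡ true → negative (a ⊕ b) ≡ true
   neg-⊕ {a} {b} p r = cong isNeg (σ-⊕ {neg} (λ ()) {a} {b} (isNeg-true p) (isNeg-true r))

   -- On a decomposition of an exponent of sign 0, a positive part forces a negative one.
   pos-⊕-nul : ∀ {a b} → σᵛ (a ⊕ b) ≡ nul → σᵛ a ≡ pos⁺ → σᵛ b ≡ neg
   pos-⊕-nul {a} {b} z p = go (σᵛ b) refl
    where
    clash : ∀ {s t : Sgn} → s ≡ nul → s ≡ pos⁺ → ⊥
    clash refl ()
    go : ∀ s → σᵛ b ≡ s → σᵛ b ≡ neg
    go neg  e = e
    go nul  e = ⊥-elim (clash {t = nul} z (trans (σ-⊕-nulʳ {a} {b} e) p))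
    go pos⁺ e = ⊥-elim (clash {t = nul} z (σ-⊕ {pos⁺} (λ ()) {a} {b} p e))

  -- Proportionality without division: the values of two linear forms at parallel vectors have
  -- determinant 0. Applied to the rows of a reflection it shows that reflections preserve
  -- parallelism.
  parallel-dot : ∀ {n} {x y : Lattice n} → Parallel x y → ∀ φ ψ → dot φ x * dot ψ y ≡ dot ψ x * dot φ y
  parallel-dot {n} {x} {y} h φ ψ = begin
   dot φ x * dot ψ y
    ≡⟨ Sum.*-distribʳ-sum (dot ψ y) (λ i → φ i * x i) ⟩
   Sum.sum (λ i → φ i * x i * dot ψ y)
    ≡⟨ Sum.sum-cong-≗ (λ i → trans (Sum.*-distribˡ-sum (φ i * x i) (λ j → ψ j * y j)) (Sum.sum-cong-≗ (λ j →
       trans (l₁ (φ i) (x i) (ψ j) (y j)) (trans (cong (λ z → φ i * ψ j * z) (h i j)) (l₂ (φ i) (ψ j) (x j) (y i)))))) ⟩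
   Sum.sum (λ i → Sum.sum (λ j → ψ j * x j * (φ i * y i))) ≡⟨ Sum.∑-comm (λ i j → ψ j * x j * (φ i * y i)) ⟩
   Sum.sum (λ j → Sum.sum (λ i → ψ j * x j * (φ i * y i)))
    ≡⟨ Sum.sum-cong-≗ (λ j → sym (Sum.*-distribˡ-sum (ψ j * x j) (λ i → φ i * y i))) ⟩
   Sum.sum (λ j → ψ j * x j * dot φ y) ≡⟨ sym (Sum.*-distribʳ-sum (dot φ y) (λ j → ψ j * x j)) ⟩
   dot ψ x * dot φ y ∎
   where
   l₁ : ∀ a b c d → a * b * (c * d) ≡ a * c * (b * d)
   l₁ = solve-∀
   l₂ : ∀ a b c d → a * b * (c * d) ≡ b * c * (a * d)
   l₂ = solve-∀

  reflect-row : ∀ {n} → Lattice n → Fin n → Fin n → Lattice n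
  reflect-row w k i l = unit i l + (unit k i * (w l + (- ⁺ 2) * unit k l))

  reflect-dot : ∀ {n} (w : Lattice n) k x i → reflect w k x i ≡ dot (reflect-row w k i) x
  reflect-dot w k x i = sym (begin
   dot (reflect-row w k i) x ≡⟨ dot-+ˡ (unit i) (λ l → unit k i * (w l + (- ⁺ 2) * unit k l)) x ⟩
   dot (unit i) x + dot (λ l → unit k i * (w l + (- ⁺ 2) * unit k l)) x
    ≡⟨ cong₂ _+_ (dot-unitˡ i x) (trans (dot-*ˡ (unit k i) (λ l → w l + (- ⁺ 2) * unit k l) x) (cong (unit k i *_)
       (trans (dot-+ˡ w (λ l → (- ⁺ 2) * unit k l) x) (cong (dot w x +_) (trans (dot-*ˡ (- ⁺ 2) (unit k) x) (cong (- ⁺ 2 *_) (dot-unitˡ k x))))))) ⟩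
   x i + unit k i * (dot w x + (- ⁺ 2) * x k) ≡⟨ lem (x i) (unit k i) (dot w x) (x k) ⟩
   reflect w k x i ∎)
   where
   lem : ∀ a u d b → a + u * (d + (- ⁺ 2) * b) ≡ a + (d - ⁺ 2 * b) * u
   lem = solve-∀

  reflect-parallel : ∀ {n} (w : Lattice n) k {x y} → Parallel x y → Parallel (reflect w k x) (reflect w k y)
  reflect-parallel w k {x} {y} h i j = begin
   reflect w k x i * reflect w k y j ≡⟨ cong₂ _*_ (reflect-dot w k x i) (reflect-dot w k y j) ⟩
   _ ≡⟨ parallel-dot h (reflect-row w k i) (reflect-row w k j) ⟩
   _ ≡⟨ sym (cong₂ _*_ (reflect-dot w k x j) (reflect-dot w k y i)) ⟩
   reflect w k x j * reflect w k y i ∎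

  reflect-cong : ∀ {n} (w : Lattice n) k {x y : Lattice n} → x ≗ y → reflect w k x ≗ reflect w k y
  reflect-cong w k e i = cong₂ _+_ (e i) (cong (_* unit k i) (cong₂ (λ u v → u - ⁺ 2 * v) (dot-cong {φ = w} (λ _ → refl) e) (e k)))

  reflect-involutive : ∀ {n} (w : Lattice n) k → w k ≡ 0ℤ → ∀ x → reflect w k (reflect w k x) ≗ x
  reflect-involutive w k wk x i = begin
   reflect w k x i + (dot w (reflect w k x) - ⁺ 2 * reflect w k x k) * unit k i
    ≡⟨ cong (λ z → reflect w k x i + z * unit k i) (cong₂ (λ u v → u - ⁺ 2 * v) dot-eq (cong (λ z → x k + c * z) (unit-same k))) ⟩
   x i + c * unit k i + (dot w x - ⁺ 2 * (x k + c * 1ℤ)) * unit k i ≡⟨ lem (x i) (dot w x) (x k) (unit k i) ⟩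
   x i ∎
   where
   c = dot w x - ⁺ 2 * x k
   dot-eq : dot w (reflect w k x) ≡ dot w x
   dot-eq = trans (dot-+ʳ w x (λ i → c * unit k i)) (trans (cong (dot w x +_) (trans (dot-*ʳ c w (unit k)) (trans (cong (c *_) (trans (dot-unitʳ w k) wk)) (ℤP.*-zeroʳ c)))) (ℤP.+-identityʳ _))
   lem : ∀ a d b u → a + (d - ⁺ 2 * b) * u + (d - ⁺ 2 * (b + (d - ⁺ 2 * b) * 1ℤ)) * u ≡ a
   lem = solve-∀

  -- The transpose of `reflect w k`, acting on linear forms.
  pull : ∀ {n} → Lattice n → Fin n → Lattice n → Lattice n
  pull w k φ l = φ l + φ k * (w l + (- ⁺ 2) * unit k l)

  dot-pull : ∀ {n} (w : Lattice n) k φ x → dot (pull w k φ) x ≡ dot φ (reflect w k x)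
  dot-pull w k φ x = begin
   dot (pull w k φ) x ≡⟨ trans (dot-+ˡ φ (λ l → φ k * (w l + (- ⁺ 2) * unit k l)) x) (cong (dot φ x +_) (trans (dot-*ˡ (φ k) _ x) (cong (φ k *_)
     (trans (dot-+ˡ w (λ l → (- ⁺ 2) * unit k l) x) (cong (dot w x +_) (trans (dot-*ˡ (- ⁺ 2) (unit k) x) (cong (- ⁺ 2 *_) (dot-unitˡ k x)))))))) ⟩
   dot φ x + φ k * (dot w x + (- ⁺ 2) * x k) ≡⟨ lem (dot φ x) (φ k) (dot w x) (x k) ⟩
   dot φ x + c * φ k ≡⟨ sym (trans (dot-+ʳ φ x (λ i → c * unit k i)) (cong (dot φ x +_) (trans (dot-*ʳ c φ (unit k)) (cong (c *_) (dot-unitʳ φ k))))) ⟩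
   dot φ (reflect w k x) ∎
   where
   c = dot w x - ⁺ 2 * x k
   lem : ∀ a f d b → a + f * (d + (- ⁺ 2) * b) ≡ a + (d - ⁺ 2 * b) * f
   lem = solve-∀

  -- Charts transport along the lattice isometry attached to a mutation.
  module Transport {n : ℕ} {B B′ : Q n} (w : Lattice n) (k : Fin n) (wk : w k ≡ 0ℤ)
   (iso : ∀ x y → form B′ x y ≡ form B (reflect w k x) (reflect w k y))
   {x x′ : Vec ℕ n} (e : reflect w k ⟦ x′ ⟧ ≗ ⟦ x ⟧) (c : Chart B x) where

   open Chart c using (Φ; Φ-zero; separating)

   form-pull : ∀ y → form B′ y ⟦ x′ ⟧ ≡ form B (reflect w k y) ⟦ x ⟧
   form-pull y = trans (iso y ⟦ x′ ⟧) (form-cong B {x = reflect w k y} (λ _ → refl) e)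

   pulled : ∀ Ψ y → All (λ φ → dot φ y ≡ 0ℤ) (map (pull w k) Ψ) → All (λ φ → dot φ (reflect w k y) ≡ 0ℤ) Ψ
   pulled []      y []       = []
   pulled (φ ∷ Ψ) y (p ∷ ps) = trans (sym (dot-pull w k φ y)) p ∷ pulled Ψ y ps

   pushed : ∀ Ψ y → All (λ φ → dot φ (reflect w k y) ≡ 0ℤ) Ψ → All (λ φ → dot φ y ≡ 0ℤ) (map (pull w k) Ψ)
   pushed []      y []       = []
   pushed (φ ∷ Ψ) y (p ∷ ps) = trans (dot-pull w k φ y) p ∷ pushed Ψ y ps

   transported : Chart B′ x′
   transported = record
    { Φ = map (pull w k) Φ
    ; Φ-zero = pushed Φ ⟦ x′ ⟧ (All.map (λ {φ} h → trans (dot-cong {φ = φ} (λ _ → refl) e) h) Φ-zero)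
    ; separating = λ y h hs i j →
      let
        par = separating (reflect w k y) (trans (sym (form-pull y)) h) (pulled Φ y hs)
        back = reflect-parallel w k {reflect w k y} {⟦ x ⟧} par
        ex = λ i → trans (reflect-cong w k (λ l → sym (e l)) i) (reflect-involutive w k wk ⟦ x′ ⟧ i)
        ey = reflect-involutive w k wk y
      in trans (sym (cong₂ _*_ (ey i) (ex j))) (trans (back i j) (cong₂ _*_ (ey j) (ex i)))
    }

   sgn-pull : ∀ Ψ y → sgn (map (pull w k) Ψ) y ≡ sgn Ψ (reflect w k y)
   sgn-pull []      y = refl
   sgn-pull (φ ∷ Ψ) y = cong₂ refine (dot-pull w k φ y) (sgn-pull Ψ y)

   σ-transport : ∀ y → Chart.σ transported y ≡ Chart.σ c (reflect w k y)
   σ-transport y = cong₂ refine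
    (trans (dot-comm (λ i → dot (B′ i) ⟦ x′ ⟧) y) (trans (form-pull y) (dot-comm (reflect w k y) (λ i → dot (B i) ⟦ x ⟧))))
    (sgn-pull Φ y)

  abstract
   transport : ∀ {n} {B B′ : Q n} (w : Lattice n) (k : Fin n) → w k ≡ 0ℤ →
    (∀ x y → form B′ x y ≡ form B (reflect w k x) (reflect w k y)) →
    ∀ {x x′ : Vec ℕ n} → reflect w k ⟦ x′ ⟧ ≗ ⟦ x ⟧ → (c : Chart B x) →
    Σ (Chart B′ x′) (λ c′ → ∀ y → Chart.σ c′ y ≡ Chart.σ c (reflect w k y))
   transport {B = B} {B′} w k wk iso {x} {x′} e c = transported , σ-transport
    where open Transport {B = B} {B′} w k wk iso {x} {x′} e c

 -- Factorizations along a chart, and vanishing incoming terms.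

 module Cuts where
  open import Defs using (Q; IsQuiver; μ; pos)
  open Scalars using (F; 0F; 1F; pw; ε)
  open Sums
  open Convolution
  open Forms
  open Axes
  open Charts
  open import Data.Integer using (∣_∣)
  open import Data.Vec using (sum)
  open import Data.Vec.Properties using (insertAt-lookup; removeAt-insertAt; insertAt-removeAt; zipWith-comm)

  open ≡-Reasoning

  ⊕-comm : ∀ {n} (a b : Vec ℕ n) → a ⊕ b ≡ b ⊕ a
  ⊕-comm = zipWith-comm ℕP.+-comm

  ⊕-≢𝟘 : ∀ {n} (a : Vec ℕ n) {b} → b ≢ 𝟘 → a ⊕ b ≢ 𝟘
  ⊕-≢𝟘 {n} a {b} h e = h (sum≡0 b (ℕP.m+n≡0⇒n≡0 (sum a) (trans (sym (sum-⊕ a b)) (trans (cong sum e) (sum-𝟘 n)))))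
   where
   sum-𝟘 : ∀ n → sum (𝟘 {n}) ≡ 0
   sum-𝟘 zero    = refl
   sum-𝟘 (suc n) = sum-𝟘 n

  plus-0 : ∀ a j → a ≡ a ℤ.+ j ℤ.* 0ℤ
  plus-0 = solve-∀

  lattice-insert : ∀ {m} (k : Fin (suc m)) j (a : Vec ℕ m) → ⟦ insertAt a k j ⟧ ≗ λ i → ⟦ insertAt a k 0 ⟧ i ℤ.+ ⁺ j ℤ.* unit k i
  lattice-insert zero j a zero = sym (trans (ℤP.+-identityˡ _) (ℤP.*-identityʳ (⁺ j)))
  lattice-insert zero j a (suc i) = plus-0 (⁺ lookup a i) (⁺ j)
  lattice-insert (suc k) j (x ∷ a) zero = plus-0 (⁺ x) (⁺ j)
  lattice-insert (suc k) j (x ∷ a) (suc i) = trans (lattice-insert k j a i) (cong (λ z → ⟦ insertAt a k 0 ⟧ i ℤ.+ ⁺ j ℤ.* z) (sym (unit-suc k i)))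

  lattice-axis : ∀ {m} (k : Fin (suc m)) j → ⟦ insertAt 𝟘 k j ⟧ ≗ λ i → ⁺ j ℤ.* unit k i
  lattice-axis k j i = trans (lattice-insert k j 𝟘 i) (trans (cong (λ v → ⟦ v ⟧ i ℤ.+ ⁺ j ℤ.* unit k i) (insert-𝟘 k))
   (trans (cong (ℤ._+ ⁺ j ℤ.* unit k i) (⟦𝟘⟧ i)) (ℤP.+-identityˡ _)))

  AxisSeries : ∀ {m} → Fin (suc m) → Series (suc m) → Set
  AxisSeries k A = ∀ J a → a ≢ 𝟘 → A (insertAt a k J) ≡ 0F

  -- Strict divisibility of monomials.
  below : ∀ {n} → Vec ℕ n → Vec ℕ n → Set
  below x m = Σ _ λ c → m ⊕ c ≡ x × c ≢ 𝟘

  below-⊕ : ∀ {n} {x : Vec ℕ n} a b → below x (a ⊕ b) → below x a × below x b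
  below-⊕ a b (c , e , h) = (b ⊕ c , trans (sym (⊕-assoc a b c)) e , ⊕-≢𝟘 b h) ,
   (a ⊕ c , trans (sym (⊕-assoc b a c)) (trans (cong (_⊕ c) (⊕-comm b a)) e) , ⊕-≢𝟘 a h)

  module Cutting {m : ℕ} {B : Q (suc m)} (q : IsQuiver B) {x : Vec ℕ (suc m)} (c : Chart B x) where
   open Chart c
   open ChartProperties q c
   open Conv (twist B)

   NonNegSupp NegSupp : Series (suc m) → Set
   NonNegSupp u = ∀ a → negative a ≡ true → u a ≡ 0F
   NegSupp w    = ∀ a → a ≢ 𝟘 → negative a ≡ false → w a ≡ 0F

   private
    clash : ∀ {b} → b ≡ true → b ≡ false → ⊥
    clash refl ()

    decide : ∀ b → b ≡ true ⊎ b ≡ false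
    decide true  = inj₁ refl
    decide false = inj₂ refl

   nonneg-⋆ : ∀ {u u′} → NonNegSupp u → NonNegSupp u′ → NonNegSupp (u ⋆ u′)
   nonneg-⋆ {u} {u′} hu hu′ y ny = ⋆-zero u u′ y (λ a b e → go a b e (decide (negative a)) (decide (negative b)))
    where
    go : ∀ a b → a ⊕ b ≡ y → negative a ≡ true ⊎ negative a ≡ false → negative b ≡ true ⊎ negative b ≡ false → u a ≡ 0F ⊎ u′ b ≡ 0F
    go a b e (inj₁ na) _         = inj₁ (hu a na)
    go a b e (inj₂ _)  (inj₁ nb) = inj₂ (hu′ b nb)
    go a b e (inj₂ pa) (inj₂ pb) = ⊥-elim (clash (trans (cong negative e) ny) (nonneg-⊕ {a} {b} pa pb))

   neg-⋆ : ∀ {w w′} → NegSupp w → NegSupp w′ → NegSupp (w ⋆ w′)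
   neg-⋆ {w} {w′} hw hw′ y y≢ py = ⋆-zero w w′ y (λ a b e → go a b e (𝟘? a) (𝟘? b) (decide (negative a)) (decide (negative b)))
    where
    go : ∀ a b → a ⊕ b ≡ y → a ≡ 𝟘 ⊎ a ≢ 𝟘 → b ≡ 𝟘 ⊎ b ≢ 𝟘 → negative a ≡ true ⊎ negative a ≡ false → negative b ≡ true ⊎ negative b ≡ false →
     w a ≡ 0F ⊎ w′ b ≡ 0F
    go a b e (inj₁ refl) _ _ _ with trans (sym (⊕-identityˡ b)) e
    ... | refl = inj₂ (hw′ b y≢ py)
    go a b e (inj₂ a≢) (inj₁ refl) _ _ with trans (sym (⊕-identityʳ a)) e
    ... | refl = inj₁ (hw a y≢ py)
    go a b e (inj₂ a≢) (inj₂ b≢) (inj₂ pa) _ = inj₁ (hw a a≢ pa)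
    go a b e (inj₂ a≢) (inj₂ b≢) (inj₁ na) (inj₂ pb) = inj₂ (hw′ b b≢ pb)
    go a b e (inj₂ a≢) (inj₂ b≢) (inj₁ na) (inj₁ nb) = ⊥-elim (clash (neg-⊕ {a} {b} na nb) (trans (cong negative e) py))

   σ-axis : ∀ k i → σᵛ (insertAt 𝟘 k (suc i)) ≡ σ (unit k)
   σ-axis k i = trans (sgn-cong (slope ∷ Φ) (lattice-axis k (suc i))) (sgn-*-suc (slope ∷ Φ) i (unit k))
    where open import Data.List using (_∷_)

   axis-nonneg : ∀ k {A} → σ (unit k) ≡ pos⁺ → AxisSeries k A → NonNegSupp A
   axis-nonneg k {A} s h = insert-view k _ (λ J a n → go J a n (𝟘? a))
    where
    go : ∀ J a → negative (insertAt a k J) ≡ true → a ≡ 𝟘 ⊎ a ≢ 𝟘 → A (insertAt a k J) ≡ 0F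
    go J       a n (inj₂ a≢)   = h J a a≢
    go zero    a n (inj₁ refl) = ⊥-elim (clash n (trans (cong negative (insert-𝟘 k)) negative-𝟘))
    go (suc J) a n (inj₁ refl) = ⊥-elim (clash n (cong isNeg (trans (σ-axis k J) s)))

   axis-neg : ∀ k {A} → σ (unit k) ≡ neg → AxisSeries k A → NegSupp A
   axis-neg k {A} s h = insert-view k _ (λ J a a≢ n → go J a a≢ n (𝟘? a))
    where
    go : ∀ J a → insertAt a k J ≢ 𝟘 → negative (insertAt a k J) ≡ false → a ≡ 𝟘 ⊎ a ≢ 𝟘 → A (insertAt a k J) ≡ 0F
    go J       a x≢ n (inj₂ a≢)   = h J a a≢
    go zero    a x≢ n (inj₁ refl) = ⊥-elim (x≢ (insert-𝟘 k))
    go (suc J) a x≢ n (inj₁ refl) = ⊥-elim (clash (cong isNeg (trans (σ-axis k J) s)) n)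

   -- A split of x with a positive multiple of e_k in its first part leaves a negative second part,
   -- since x itself has sign 0; there `u` vanishes.
   axis-vanish : ∀ k {A u} → σ (unit k) ≡ pos⁺ → AxisSeries k A → NonNegSupp u → u x ≡ 0F → (A ⋆ u) x ≡ 0F
   axis-vanish k {A} {u} s h hu ux = ⋆-zero A u x (λ a b → insert-view k (λ a → a ⊕ b ≡ x → A a ≡ 0F ⊎ u b ≡ 0F) (λ J a e → go J a b e (𝟘? a)) a)
    where
    go : ∀ J a b → insertAt a k J ⊕ b ≡ x → a ≡ 𝟘 ⊎ a ≢ 𝟘 → A (insertAt a k J) ≡ 0F ⊎ u b ≡ 0F
    go J       a b e (inj₂ a≢)   = inj₁ (h J a a≢)
    go zero    a b e (inj₁ refl) = inj₂ (trans (cong u (trans (sym (⊕-identityˡ b)) (trans (cong (_⊕ b) (sym (insert-𝟘 k))) e))) ux)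
    go (suc J) a b e (inj₁ refl) = inj₂ (hu b (cong isNeg (pos-⊕-nul {insertAt 𝟘 k (suc J)} {b} (trans (cong σᵛ e) σ-self) (trans (σ-axis k J) s))))

   record Cut (S : Series (suc m)) : Set where
    no-eta-equality; pattern
    constructor _⊣_
    field
     factorization : Factor negative S
     vanishing     : Factor.u factorization x ≡ 0F

   -- A series on an axis of positive sign is absorbed from the left by the nonnegative factor, and
   -- `axis-vanish` keeps the coefficient at x zero. On an axis of negative sign the other factor
   -- absorbs it from the right.
   cut-left : ∀ k {A S S′} → σ (unit k) ≡ pos⁺ → AxisSeries k A → A 𝟘 ≡ 1F → S′ ≗ A ⋆ S → Cut S → Cut S′
   cut-left k {A} {S} {S′} s h A0 e (f ⊣ ux) = record
    { u = A ⋆ u ; w = w ; u-𝟘 = ⋆-𝟘 A u A0 u-𝟘 ; w-𝟘 = w-𝟘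
    ; u-neg = nonneg-⋆ {A} {u} (axis-nonneg k s h) u-neg ; w-pos = w-pos
    ; prod = λ y → trans (e y) (trans (⋆-cong {f = A} (λ _ → refl) prod y) (sym (⋆-assoc A u w y))) } ⊣
    axis-vanish k {A} {u} s h u-neg ux
    where open Factor f

   cut-right : ∀ k {A S S′} → σ (unit k) ≡ neg → AxisSeries k A → A 𝟘 ≡ 1F → S′ ≗ S ⋆ A → Cut S → Cut S′
   cut-right k {A} {S} {S′} s h A0 e (f ⊣ ux) = record
    { u = u ; w = w ⋆ A ; u-𝟘 = u-𝟘 ; w-𝟘 = ⋆-𝟘 w A w-𝟘 A0
    ; u-neg = u-neg ; w-pos = neg-⋆ {w} {A} w-pos (axis-neg k s h)
    ; prod = λ y → trans (e y) (trans (⋆-cong {g = A} prod (λ _ → refl) y) (⋆-assoc u w A y)) } ⊣ ux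
    where open Factor f

   module _ (K : Vec ℕ (suc m) → Set) (K? : ∀ y → K y ⊎ ¬ K y) (K-𝟘 : K 𝟘) (K-⊕ : ∀ {a b} → K a → K b → K (a ⊕ b)) where

    private
     disjoint : ∀ {S} (f : Factor negative S) → ∀ y → y ≢ 𝟘 → Factor.u f y ≡ 0F ⊎ Factor.w f y ≡ 0F
     disjoint f y y≢ with decide (negative y)
     ... | inj₁ n = inj₁ (Factor.u-neg f y n)
     ... | inj₂ n = inj₂ (Factor.w-pos f y y≢ n)

     module Sup {S} (f : Factor negative S) = Support K K? K-𝟘 K-⊕ {S} {Factor.u f} {Factor.w f} (Factor.u-𝟘 f) (Factor.w-𝟘 f) (Factor.prod f) (disjoint f)

    factor-off : ∀ {S} (f : Factor negative S) → (∀ y → ¬ K y → S y ≡ 0F) → ∀ y → ¬ K y → Factor.u f y ≡ 0F × Factor.w f y ≡ 0F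
    factor-off f = Sup.off-K-everywhere f

    -- Both factors of `S` inherit its support, so at an exponent outside `K` the required
    -- coefficient is zero for free.
    cut-off : ∀ {S} → S 𝟘 ≡ 1F → (∀ y → ¬ K y → S y ≡ 0F) → ¬ K x → Cut S
    cut-off {S} S0 h ¬Kx = f ⊣ proj₁ (factor-off f h x ¬Kx)
     where f = factor negative S negative-𝟘 S0

    -- Outside `K` only the trivial splits contribute: `w x` vanishes because x has sign 0, `u x`
    -- because of the cut. This is how the absence of incoming terms becomes a bound on the support.
    cut-vanish : ∀ {S} → Cut S → ¬ K x → (∀ y → below x y → ¬ K y → S y ≡ 0F) → S x ≡ 0F
    cut-vanish {S} (f ⊣ ux) ¬Kx h = trans (Sup.sum-off-K f x ¬Kx (λ a b e a≢ b≢ →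
      (λ ¬Ka → proj₁ (Sup.off-K f (below x) below-⊕ h a (b , e , b≢) ¬Ka)) ,
      (λ ¬Kb → proj₂ (Sup.off-K f (below x) below-⊕ h b (a , trans (⊕-comm b a) e , a≢) ¬Kb))))
     (trans (cong₂ Scalars._+_ (Factor.w-pos f x (λ e → ¬Kx (subst K (sym e) K-𝟘)) (cong isNeg σ-self)) ux) (+-identityʳ _))

   -- Only vectors parallel to x have sign 0; so if x lies off the k-axis, the sign of e_k is
   -- definite.
   σ-unit-nul : ∀ k → σ (unit k) ≡ nul → removeAt x k ≡ 𝟘
   σ-unit-nul k e = ⟦⟧-injective _ _ (λ i → trans (entry i) (sym (⟦𝟘⟧ i)))
    where
    open import Data.Fin using (punchIn)
    open import Data.Fin.Properties using (punchInᵢ≢i)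
    entry : ∀ i → ⟦ removeAt x k ⟧ i ≡ 0ℤ
    entry i = trans (cong ⁺_ (lookup-removeAt x k i)) (trans (sym (ℤP.*-identityˡ (⟦ x ⟧ (punchIn k i)))) (trans (cong (ℤ._* ⟦ x ⟧ (punchIn k i)) (sym (unit-same k)))
     (trans (σ-nul (unit k) e k (punchIn k i)) (trans (cong (ℤ._* ⟦ x ⟧ k) (unit-≢ (punchInᵢ≢i k i))) (ℤP.*-zeroˡ (⟦ x ⟧ k))))))
     where
     lookup-removeAt : ∀ {n} (v : Vec ℕ (suc n)) k i → lookup (removeAt v k) i ≡ lookup v (punchIn k i)
     lookup-removeAt (_ ∷ v)         zero    i       = refl
     lookup-removeAt (_ ∷ v@(_ ∷ _)) (suc k) zero    = refl
     lookup-removeAt (_ ∷ v@(_ ∷ _)) (suc k) (suc i) = lookup-removeAt v k i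

  ndot : ∀ {n} → (Fin n → ℕ) → Vec ℕ n → ℕ
  ndot ω []      = 0
  ndot ω (x ∷ a) = ω zero ℕ.* x ℕ.+ ndot (λ i → ω (suc i)) a

  dot-ndot : ∀ {n} {w : Lattice n} (ω : Fin n → ℕ) → (∀ i → w i ≡ ⁺ ω i) → ∀ a → dot w ⟦ a ⟧ ≡ ⁺ ndot ω a
  dot-ndot ω h []      = refl
  dot-ndot ω h (x ∷ a) = trans (cong₂ ℤ._+_ (trans (cong (ℤ._* ⁺ x) (h zero)) (sym (ℤP.pos-* (ω zero) x))) (dot-ndot (λ i → ω (suc i)) (λ i → h (suc i)) a))
   (sym (ℤP.pos-+ (ω zero ℕ.* x) _))

  pos-abs : ∀ z → pos z ≡ ⁺ ∣ pos z ∣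
  pos-abs (⁺ zero)  = refl
  pos-abs (⁺ suc n) = refl
  pos-abs -[1+ n ]  = refl

  -- The lattice of B′ = μ_k B is expressed in that of B by a reflection in two ways, with w = incoming or outgoing weights at k.
  module Side {m : ℕ} {B B′ : Q (suc m)} (q : IsQuiver B) (k : Fin (suc m)) (w : Lattice (suc m)) (ω : Fin (suc m) → ℕ)
   (wω : ∀ i → w i ≡ ⁺ ω i) (wk : w k ≡ 0ℤ)
   (iso : ∀ x y → form B′ x y ≡ form B (reflect w k x) (reflect w k y)) where

   β : Vec ℕ m → ℕ
   β a = ndot ω (insertAt a k 0)

   β-eq : ∀ a → ⁺ β a ≡ dot w ⟦ insertAt a k 0 ⟧
   β-eq a = sym (dot-ndot ω wω (insertAt a k 0))

   β-⊕ : ∀ a b → β (a ⊕ b) ≡ β a ℕ.+ β b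
   β-⊕ a b = ℤP.+-injective (trans (β-eq (a ⊕ b)) (trans (cong (λ v → dot w ⟦ v ⟧) (sym (insert-⊕ k 0 0 a b)))
    (trans (dot-cong {φ = w} (λ _ → refl) (⟦⊕⟧ (insertAt a k 0) (insertAt b k 0))) (trans (dot-+ʳ w ⟦ insertAt a k 0 ⟧ ⟦ insertAt b k 0 ⟧)
    (trans (cong₂ ℤ._+_ (sym (β-eq a)) (sym (β-eq b))) (sym (ℤP.pos-+ (β a) (β b))))))))

   β-𝟘 : β 𝟘 ≡ 0
   β-𝟘 = ℤP.+-injective (trans (β-eq 𝟘) (trans (cong (λ v → dot w ⟦ v ⟧) (insert-𝟘 k)) (trans (dot-cong {φ = w} (λ _ → refl) ⟦𝟘⟧) (dot-0ʳ w))))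

   open Mirrored k β β-⊕ public

   -- The exponents whose reflection again has nonnegative entries. They form a submonoid, so
   -- supports of factors can be confined to it.
   K : Vec ℕ (suc m) → Set
   K y = lookup y k ℕ.≤ β (removeAt y k)

   K-insert : ∀ J a → K (insertAt a k J) → J ℕ.≤ β a
   K-insert J a = subst₂ (λ u v → u ℕ.≤ β v) (insertAt-lookup a k J) (removeAt-insertAt a k J)

   insert-K : ∀ J a → J ℕ.≤ β a → K (insertAt a k J)
   insert-K J a = subst₂ (λ u v → u ℕ.≤ β v) (sym (insertAt-lookup a k J)) (sym (removeAt-insertAt a k J))

   K? : ∀ y → K y ⊎ ¬ K y
   K? y with lookup y k ℕ.≤? β (removeAt y k)
   ... | yes h = inj₁ h
   ... | no h  = inj₂ h

   K-𝟘 : K 𝟘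
   K-𝟘 = subst K (insert-𝟘 k) (insert-K 0 𝟘 ℕ.z≤n)

   K-⊕ : ∀ {a b} → K a → K b → K (a ⊕ b)
   K-⊕ {a} {b} = insert-view k (λ a → K a → K b → K (a ⊕ b)) (λ i a → insert-view k (λ b → K (insertAt a k i) → K b → K (insertAt a k i ⊕ b)) (λ j b p r →
    subst K (sym (insert-⊕ k i j a b)) (insert-K (i ℕ.+ j) (a ⊕ b) (subst (i ℕ.+ j ℕ.≤_) (sym (β-⊕ a b)) (ℕP.+-mono-≤ (K-insert i a p) (K-insert j b r))))) b) a

   Bounded⇒off-K : ∀ {S} → Bounded S → ∀ y → ¬ K y → S y ≡ 0F
   Bounded⇒off-K {S} h = insert-view k (λ y → ¬ K y → S y ≡ 0F) (λ J a ¬K → h a J (ℕP.≰⇒> (λ p → ¬K (insert-K J a p))))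

   off-K⇒Bounded : ∀ {S} → (∀ y → ¬ K y → S y ≡ 0F) → Bounded S
   off-K⇒Bounded h a J p = h (insertAt a k J) (λ r → ℕP.<⇒≱ p (K-insert J a r))

   reflect-insert : ∀ a i j → i ℕ.+ j ≡ β a → reflect w k ⟦ insertAt a k j ⟧ ≗ ⟦ insertAt a k i ⟧
   reflect-insert a i j e l = begin
    reflect w k ⟦ insertAt a k j ⟧ l
     ≡⟨ reflect-cong w k (lattice-insert k j a) l ⟩
    (z l ℤ.+ ⁺ j ℤ.* unit k l) ℤ.+ (dot w (λ i → z i ℤ.+ ⁺ j ℤ.* unit k i) ℤ.- ⁺ 2 ℤ.* (z k ℤ.+ ⁺ j ℤ.* unit k k)) ℤ.* unit k l
     ≡⟨ cong₂ (λ s t → (z l ℤ.+ ⁺ j ℤ.* unit k l) ℤ.+ (s ℤ.- ⁺ 2 ℤ.* t) ℤ.* unit k l) d (cong₂ (λ s t → s ℤ.+ ⁺ j ℤ.* t) zk (unit-same k)) ⟩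
    (z l ℤ.+ ⁺ j ℤ.* unit k l) ℤ.+ ((⁺ i ℤ.+ ⁺ j) ℤ.- ⁺ 2 ℤ.* (0ℤ ℤ.+ ⁺ j ℤ.* 1ℤ)) ℤ.* unit k l ≡⟨ lem (z l) (⁺ i) (⁺ j) (unit k l) ⟩
    z l ℤ.+ ⁺ i ℤ.* unit k l ≡⟨ sym (lattice-insert k i a l) ⟩
    ⟦ insertAt a k i ⟧ l ∎
    where
    z = ⟦ insertAt a k 0 ⟧
    zk : z k ≡ 0ℤ
    zk = cong ⁺_ (insertAt-lookup a k 0)
    d : dot w (λ i → z i ℤ.+ ⁺ j ℤ.* unit k i) ≡ ⁺ i ℤ.+ ⁺ j
    d = trans (dot-+ʳ w z (λ i → ⁺ j ℤ.* unit k i)) (trans (cong₂ ℤ._+_ (trans (sym (β-eq a)) (trans (cong ⁺_ (sym e)) (ℤP.pos-+ i j)))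
     (trans (dot-*ʳ (⁺ j) w (unit k)) (trans (cong (⁺ j ℤ.*_) (trans (dot-unitʳ w k) wk)) (ℤP.*-zeroʳ (⁺ j))))) (ℤP.+-identityʳ _))
    lem : ∀ z i j u → (z ℤ.+ j ℤ.* u) ℤ.+ ((i ℤ.+ j) ℤ.- ⁺ 2 ℤ.* (0ℤ ℤ.+ j ℤ.* 1ℤ)) ℤ.* u ≡ z ℤ.+ i ℤ.* u
    lem = solve-∀

   twist-iso : ∀ a b i₁ j₁ i₂ j₂ → i₁ ℕ.+ j₁ ≡ β a → i₂ ℕ.+ j₂ ≡ β b →
    Twist.χ (twist B′) (insertAt a k j₁) (insertAt b k j₂) ≡ Twist.χ (twist B) (insertAt a k i₁) (insertAt b k i₂)
   twist-iso a b i₁ j₁ i₂ j₂ e₁ e₂ = cong pw (trans (iso ⟦ insertAt a k j₁ ⟧ ⟦ insertAt b k j₂ ⟧) (form-cong B (reflect-insert a i₁ j₁ e₁) (reflect-insert b i₂ j₂ e₂)))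

   flip-product : ∀ f g → Bounded f → Bounded g → flip (Conv._⋆_ (twist B) f g) ≗ Conv._⋆_ (twist B′) (flip f) (flip g)
   flip-product = flip-⋆ (twist B) (twist B′) twist-iso

   flip-cong : ∀ {f g : Series (suc m)} → f ≗ g → flip f ≗ flip g
   flip-cong e y with lookup y k ℕ.≤? β (removeAt y k)
   ... | yes _ = e _
   ... | no _  = refl

   flip-𝟘 : ∀ f → flip f 𝟘 ≡ f 𝟘
   flip-𝟘 f = subst (λ z → flip f z ≡ f z) (insert-𝟘 k) (flip-in f 𝟘 0 0 (sym β-𝟘))

   -- By the hypothesis on `c′`, mirror exponents have equal signs, so the two reflected factors are
   -- again separated by sign.
   flip-cut : ∀ (q′ : IsQuiver B′) a i j (e : i ℕ.+ j ≡ β a) (c : Chart B (insertAt a k i)) (c′ : Chart B′ (insertAt a k j)) →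
    (∀ y → Chart.σ c′ y ≡ Chart.σ c (reflect w k y)) → ∀ {S} → Bounded S → Cutting.Cut {B = B} q c S → Cutting.Cut {B = B′} q′ c′ (flip S)
   flip-cut q′ a i j e c c′ hσ {S} bS (f Cutting.⊣ ux) = record
    { u = flip u ; w = flip v
    ; u-𝟘 = trans (flip-𝟘 u) u-𝟘 ; w-𝟘 = trans (flip-𝟘 v) w-𝟘
    ; u-neg = insert-view k _ (λ J b n → go-u J b n (J ℕ.≤? β b))
    ; w-pos = insert-view k _ (λ J b y≢ n → go-w J b y≢ n (J ℕ.≤? β b))
    ; prod = λ y → trans (flip-cong prod y) (flip-product u v bu bv y) } Cutting.⊣
    trans (flip-in u a i j e) ux
    where
    open Conv.Factor f renaming (w to v)
    off = Cutting.factor-off {B = B} q c K K? K-𝟘 (λ {a} {b} → K-⊕ {a} {b}) f (Bounded⇒off-K bS)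
    bu : Bounded u
    bu = off-K⇒Bounded (λ y h → proj₁ (off y h))
    bv : Bounded v
    bv = off-K⇒Bounded (λ y h → proj₂ (off y h))
    σ-eq : ∀ b i j → i ℕ.+ j ≡ β b → Chart.σᵛ c′ (insertAt b k j) ≡ Chart.σᵛ c (insertAt b k i)
    σ-eq b i₁ j₁ e₁ = trans (hσ ⟦ insertAt b k j₁ ⟧) (sgn-cong (Chart.slope c List.∷ Chart.Φ c) (reflect-insert b i₁ j₁ e₁))
    go-u : ∀ J b → Chart.negative c′ (insertAt b k J) ≡ true → Relation.Nullary.Dec (J ℕ.≤ β b) → flip u (insertAt b k J) ≡ 0F
    go-u J b n (no p)  = flip-out u b J (ℕP.≰⇒> p)
    go-u J b n (yes p) = trans (flip-in u b (β b ℕ.∸ J) J eq) (u-neg _ (trans (cong isNeg (sym (σ-eq b (β b ℕ.∸ J) J eq))) n))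
     where eq = ℕP.m∸n+n≡m p
    go-w : ∀ J b → insertAt b k J ≢ 𝟘 → Chart.negative c′ (insertAt b k J) ≡ false → Relation.Nullary.Dec (J ℕ.≤ β b) → flip v (insertAt b k J) ≡ 0F
    go-w J b y≢ n (no p)  = flip-out v b J (ℕP.≰⇒> p)
    go-w J b y≢ n (yes p) = trans (flip-in v b (β b ℕ.∸ J) J eq) (w-pos _ nz (trans (cong isNeg (sym (σ-eq b (β b ℕ.∸ J) J eq))) n))
     where
     eq = ℕP.m∸n+n≡m p
     nz : insertAt b k (β b ℕ.∸ J) ≢ 𝟘
     nz z = y≢ (trans (cong₂ (λ s t → insertAt s k t) b0 J0) (insert-𝟘 k))
      where
      b0 : b ≡ 𝟘
      b0 = trans (sym (removeAt-insertAt b k _)) (trans (cong (λ v → removeAt v k) (trans z (sym (insert-𝟘 k)))) (removeAt-insertAt 𝟘 k 0))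
      J0 : J ≡ 0
      J0 = ℕP.n≤0⇒n≡0 (subst (J ℕ.≤_) (trans (cong β b0) β-𝟘) p)

   reflect-unit : reflect w k (unit k) ≗ λ i → ℤ.- unit k i
   reflect-unit i = trans (cong₂ (λ u v → unit k i ℤ.+ (u ℤ.- ⁺ 2 ℤ.* v) ℤ.* unit k i) (trans (dot-unitʳ w k) wk) (unit-same k)) (lem (unit k i))
    where
    lem : ∀ u → u ℤ.+ (0ℤ ℤ.- ⁺ 2 ℤ.* 1ℤ) ℤ.* u ≡ ℤ.- u
    lem = solve-∀

   -- Reflection reverses the sign of e_k. Therefore E(y_k), split off on one side before the
   -- reflection, has to be put back on the other side after it.
   flip-chart-cut : ∀ (q′ : IsQuiver B′) a i j (e : i ℕ.+ j ≡ β a) (c : Chart B (insertAt a k i)) {S} → Bounded S → Cutting.Cut {B = B} q c S →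
    Σ (Chart B′ (insertAt a k j)) (λ c′ → Chart.σ c′ (unit k) ≡ opposite (Chart.σ c (unit k)) × Cutting.Cut {B = B′} q′ c′ (flip S))
   flip-chart-cut q′ a i j e c {S} bS cut = go (transport {B = B} {B′} w k wk iso {insertAt a k i} {insertAt a k j} (reflect-insert a i j e) c)
    where
    go : Σ (Chart B′ (insertAt a k j)) (λ c′ → ∀ y → Chart.σ c′ y ≡ Chart.σ c (reflect w k y)) →
     Σ (Chart B′ (insertAt a k j)) (λ c′ → Chart.σ c′ (unit k) ≡ opposite (Chart.σ c (unit k)) × Cutting.Cut {B = B′} q′ c′ (flip S))
    go (c′ , hσ) = c′ ,
     trans (hσ (unit k)) (trans (sgn-cong (Chart.slope c List.∷ Chart.Φ c) reflect-unit) (sgn-opp (Chart.slope c List.∷ Chart.Φ c) (unit k))) ,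
     flip-cut q′ a i j e c c′ hσ bS cut

  module SideOff {m : ℕ} {B B′ : Q (suc m)} (q : IsQuiver B) (k : Fin (suc m)) (w : Lattice (suc m)) (ω : Fin (suc m) → ℕ)
   (wω : ∀ i → w i ≡ ⁺ ω i) (wk : w k ≡ 0ℤ)
   (iso : ∀ x y → form B′ x y ≡ form B (reflect w k x) (reflect w k y)) where
   open Side {B = B} {B′} q k w ω wω wk iso

   off-cut : ∀ (q′ : IsQuiver B′) x → ¬ K x → (c : Chart B′ x) → ∀ S → S 𝟘 ≡ 1F → Bounded S → Cutting.Cut {B = B′} q′ c S
   off-cut q′ x h c S S0 bS = Cutting.cut-off {B = B′} q′ {x} c K K? K-𝟘 (λ {a} {b} → K-⊕ {a} {b}) {S} S0 (Bounded⇒off-K {S} bS) h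

   ¬insert-K : ∀ a j → β a ℕ.< j → ¬ K (insertAt a k j)
   ¬insert-K a j p h = ℕP.<⇒≱ p (K-insert j a h)

 -- Mutation of the series attached to a quiver.

 module Mutations where
  open import Defs using (Q; IsQuiver; μ; pos)
  open Scalars using (F; 0F; 1F; pw; ε; ε-0; pw-0)
  open Sums
  open Convolution
  open Lines
  open Forms
  open Axes
  open Charts
  open Cuts
  open import Data.Integer using (∣_∣)
  open import Data.Vec using (sum)
  open import Data.Vec.Properties using (insertAt-lookup; removeAt-insertAt; insertAt-removeAt)

  open ≡-Reasoning

  μ-quiver : ∀ {n} {B : Q n} → IsQuiver B → ∀ k → IsQuiver (μ k B)
  μ-quiver {B = B} q k i j with i ≟ᶠ k | j ≟ᶠ k
  ... | yes _ | yes _ = cong ℤ.-_ (q i j)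
  ... | yes _ | no _  = cong ℤ.-_ (q i j)
  ... | no _  | yes _ = cong ℤ.-_ (q i j)
  ... | no _  | no _  = trans (cong₂ (λ a b → B i j ℤ.+ a ℤ.+ ℤ.- b) (ℤP.*-comm (pos (B i k)) (pos (B k j))) (ℤP.*-comm (pos (ℤ.- B i k)) (pos (ℤ.- B k j))))
   (trans (cong (λ a → a ℤ.+ pos (B k j) ℤ.* pos (B i k) ℤ.+ ℤ.- (pos (ℤ.- B k j) ℤ.* pos (ℤ.- B i k))) (q i j))
   (trans (lem (B j i) (pos (B k j) ℤ.* pos (B i k)) (pos (ℤ.- B k j) ℤ.* pos (ℤ.- B i k)))
   (cong ℤ.-_ (cong₂ (λ a b → B j i ℤ.+ a ℤ.+ ℤ.- b) (cong₂ (λ a b → pos a ℤ.* pos b) (sym (q j k)) (sym (q k i)))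
    (cong₂ (λ a b → pos a ℤ.* pos b) (q k j) (q i k))))))
   where
   lem : ∀ b x y → ℤ.- b ℤ.+ x ℤ.+ ℤ.- y ≡ ℤ.- (b ℤ.+ y ℤ.+ ℤ.- x)
   lem = solve-∀

  Off-axes : ∀ {m} → Vec ℕ (suc m) → Set
  Off-axes x = ∀ k → removeAt x k ≢ 𝟘

  off-axes? : ∀ {m} (x : Vec ℕ (suc m)) → Off-axes x ⊎ ∃ λ k → removeAt x k ≡ 𝟘
  off-axes? {m} x = go (suc m) (λ k → k)
   where
   go : ∀ l (f : Fin l → Fin (suc m)) → (∀ k → removeAt x (f k) ≢ 𝟘) ⊎ ∃ λ k → removeAt x k ≡ 𝟘
   go zero    f = inj₁ (λ ())
   go (suc l) f with 𝟘? (removeAt x (f zero)) | go l (λ k → f (suc k))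
   ... | inj₁ e | _      = inj₂ (f zero , e)
   ... | inj₂ _ | inj₂ r = inj₂ r
   ... | inj₂ h | inj₁ r = inj₁ (λ { zero → h ; (suc k) → r k })

  axis-form : ∀ {m} (x : Vec ℕ (suc m)) l → removeAt x l ≡ 𝟘 → x ≡ insertAt 𝟘 l (lookup x l)
  axis-form x l e = trans (sym (insertAt-removeAt x l)) (cong (λ v → insertAt v l (lookup x l)) e)

  -- The series attached to a quiver: on the coordinate axes it is the quantum dilogarithm, and off the axes it has
  -- no incoming term, i.e. the coefficient at x of the nonnegative factor for a chart at x vanishes.
  record Good {m : ℕ} {B : Q (suc m)} (q : IsQuiver B) (p : Series (suc m)) : Set where
   field
    axis     : ∀ k J → p (insertAt 𝟘 k J) ≡ ε J
    incoming : ∀ x → Off-axes x → Σ (Chart B x) (λ c → Cutting.Cut {B = B} q c p)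

   unit-term : p 𝟘 ≡ 1F
   unit-term = trans (cong p (sym (insert-𝟘 zero))) (trans (axis zero 0) ε-0)

  E-head : ∀ t f → (E t ∗ f) 0 ≡ f 0
  E-head t f = trans (*ʳ (trans (cong₂ Scalars._*_ ε-0 (trans (cong pw (ℤP.*-zeroʳ t)) pw-0)) (*-identityˡ 1F))) (*-identityˡ _)

  ndot-axis : ∀ {m} (ω : Fin (suc m) → ℕ) l J → ndot ω (insertAt 𝟘 l J) ≡ ω l ℕ.* J
  ndot-axis {m} ω l J = ℤP.+-injective (trans (sym (dot-ndot ω (λ _ → refl) (insertAt 𝟘 l J)))
   (trans (dot-cong {φ = λ i → ⁺ ω i} (λ _ → refl) (lattice-axis l J)) (trans (dot-*ʳ (⁺ J) (λ i → ⁺ ω i) (unit l))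
   (trans (cong (⁺ J ℤ.*_) (dot-unitʳ (λ i → ⁺ ω i) l)) (trans (ℤP.*-comm (⁺ J) (⁺ ω l)) (sym (ℤP.pos-* (ω l) J)))))))

  insert-injective : ∀ {m} (k : Fin (suc m)) {i j} {a b : Vec ℕ m} → insertAt a k i ≡ insertAt b k j → i ≡ j × a ≡ b
  insert-injective k {i} {j} {a} {b} e =
   trans (sym (insertAt-lookup a k i)) (trans (cong (λ v → lookup v k) e) (insertAt-lookup b k j)) ,
   trans (sym (removeAt-insertAt a k i)) (trans (cong (λ v → removeAt v k) e) (removeAt-insertAt b k j))

  insert-off-axes : ∀ {m} (k : Fin (suc m)) {J} {a : Vec ℕ m} → a ≢ 𝟘 → 0 ℕ.< J → Off-axes (insertAt a k J)
  insert-off-axes k {J} {a} a≢ J>0 l e with l ≟ᶠ k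
  ... | yes refl = a≢ (trans (sym (removeAt-insertAt a k J)) e)
  ... | no l≢k   = ℕP.<⇒≢ J>0 (sym (ℤP.+-injective (trans (cong ⁺_ (sym (insertAt-lookup a k J)))
    (trans (cong (λ v → ⟦ v ⟧ k) (axis-form (insertAt a k J) l e)) (trans (lattice-axis l (lookup (insertAt a k J) l) k) (trans (cong (⁺ lookup (insertAt a k J) l ℤ.*_) (unit-≢ (λ h → l≢k (sym h))))
     (ℤP.*-zeroʳ (⁺ lookup (insertAt a k J) l))))))))

  module Pairing {m : ℕ} {B : Q (suc m)} (q : IsQuiver B) (k : Fin (suc m)) where
   s : Vec ℕ m → ℤ
   s a = form B (unit k) ⟦ insertAt a k 0 ⟧

   form-k : ∀ j a → form B (unit k) ⟦ insertAt a k j ⟧ ≡ s a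
   form-k j a = trans (form-cong B {x = unit k} (λ _ → refl) (lattice-insert k j a)) (trans (form-+ʳ B (unit k) ⟦ insertAt a k 0 ⟧ (λ i → ⁺ j ℤ.* unit k i))
    (trans (cong (λ z → s a ℤ.+ z) (trans (form-*ʳ B (⁺ j) (unit k) (unit k)) (trans (cong (⁺ j ℤ.*_) (form-self q (unit k))) (ℤP.*-zeroʳ (⁺ j))))) (ℤP.+-identityʳ (s a))))

   private
    formˡ : ∀ i j a → form B ⟦ insertAt 𝟘 k i ⟧ ⟦ insertAt a k j ⟧ ≡ s a ℤ.* ⁺ i
    formˡ i j a = trans (form-cong B {y = ⟦ insertAt a k j ⟧} (lattice-axis k i) (λ _ → refl)) (trans (form-*ˡ B (⁺ i) (unit k) ⟦ insertAt a k j ⟧)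
     (trans (cong (⁺ i ℤ.*_) (form-k j a)) (ℤP.*-comm (⁺ i) (s a))))

   open Axis (twist B) k s (λ i j a → cong pw (formˡ i j a))
    (λ i j a → cong pw (trans (form-skew q ⟦ insertAt a k j ⟧ ⟦ insertAt 𝟘 k i ⟧) (trans (cong ℤ.-_ (formˡ i j a)) (ℤP.neg-distribˡ-* (s a) (⁺ i))))) public

   slope-k : ∀ J a (c : Chart B (insertAt a k J)) → dot (Chart.slope c) (unit k) ≡ s a
   slope-k J a c = trans (dot-comm (Chart.slope c) (unit k)) (form-k J a)

   σ-pos : ∀ {J a t} (c : Chart B (insertAt a k J)) → s a ≡ ⁺ suc t → Chart.σ c (unit k) ≡ pos⁺
   σ-pos {J} {a} c e = cong (λ z → refine z (sgn (Chart.Φ c) (unit k))) (trans (slope-k J a c) e)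

   σ-neg : ∀ {J a t} (c : Chart B (insertAt a k J)) → s a ≡ -[1+ t ] → Chart.σ c (unit k) ≡ neg
   σ-neg {J} {a} c e = cong (λ z → refine z (sgn (Chart.Φ c) (unit k))) (trans (slope-k J a c) e)

   σ-cases : ∀ {J a} → a ≢ 𝟘 → (c : Chart B (insertAt a k J)) → Chart.σ c (unit k) ≡ pos⁺ ⊎ Chart.σ c (unit k) ≡ neg
   σ-cases {J} {a} a≢ c = go (Chart.σ c (unit k)) refl
    where
    go : ∀ r → Chart.σ c (unit k) ≡ r → Chart.σ c (unit k) ≡ pos⁺ ⊎ Chart.σ c (unit k) ≡ neg
    go pos⁺ e = inj₁ e
    go neg  e = inj₂ e
    go nul  e = ⊥-elim (a≢ (trans (sym (removeAt-insertAt a k J)) (ChartProperties-σ e)))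
     where ChartProperties-σ = Cutting.σ-unit-nul {B = B} q c k

  -- Provides the order of the induction on supports: first the degree of the part away from k, then
  -- the exponent at k.
  below-insert : ∀ {m} (k : Fin (suc m)) {J J′} {a b : Vec ℕ m} → below (insertAt a k J) (insertAt b k J′) → sum b ℕ.< sum a ⊎ (b ≡ a × J′ ℕ.< J)
  below-insert k {J} {J′} {a} {b} (c , e , c≢) = insert-view k (λ c → insertAt b k J′ ⊕ c ≡ insertAt a k J → c ≢ 𝟘 → sum b ℕ.< sum a ⊎ (b ≡ a × J′ ℕ.< J)) go c e c≢
   where
   go : ∀ i c → insertAt b k J′ ⊕ insertAt c k i ≡ insertAt a k J → insertAt c k i ≢ 𝟘 → sum b ℕ.< sum a ⊎ (b ≡ a × J′ ℕ.< J)
   go i c e h with insert-injective k (trans (sym (insert-⊕ k J′ i b c)) e) | 𝟘? c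
   ... | eJ , ea | inj₂ c≢  = inj₁ (left-smaller ea c≢)
   go zero    c e h | eJ , ea | inj₁ refl = ⊥-elim (h (insert-𝟘 k))
   go (suc i) c e h | eJ , ea | inj₁ refl = inj₂ (trans (sym (⊕-identityʳ b)) ea , subst (J′ ℕ.<_) eJ (ℕP.m<m+n J′ (ℕ.s≤s ℕ.z≤n)))

  module Mutation {m : ℕ} {B B′ : Q (suc m)} (q : IsQuiver B) (q′ : IsQuiver B′) (k : Fin (suc m))
   (isoIn : ∀ x y → form B′ x y ≡ form B (reflect (weightIn {B = B} q k) k x) (reflect (weightIn {B = B} q k) k y))
   (isoOut : ∀ x y → form B′ x y ≡ form B (reflect (weightOut {B = B} q k) k x) (reflect (weightOut {B = B} q k) k y))
   (μ-row : ∀ j → B′ k j ≡ ℤ.- B k j)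
   {p : Series (suc m)} (good : Good {B = B} q p) where
   open Good good
   open Conv (twist B)
   open Pairing {B = B} q k

   D : Series (suc m)
   D = dilog k

   private
    module I = Inverse (invertible D (dilog-𝟘 k))

   D⁻¹ : Series (suc m)
   D⁻¹ = I.inv

   D⁻¹⋆D : D⁻¹ ⋆ D ≗ δ
   D⁻¹⋆D = I.inverseˡ

   D⋆D⁻¹ : D ⋆ D⁻¹ ≗ δ
   D⋆D⁻¹ = I.inverseʳ

   private
    δ-off : ∀ J a → a ≢ 𝟘 → δ (insertAt a k J) ≡ 0F
    δ-off J a a≢ = δ-≢ _ (λ e → a≢ (proj₂ (insert-injective k (trans e (sym (insert-𝟘 k))))))

    ∗-zero : ∀ t (f : Line) → (∀ i → f i ≡ 0F) → ∀ J → (E t ∗ f) J ≡ 0F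
    ∗-zero t f h J = trans (∑₁-cong J (λ i j _ → trans (*ˡ (h j)) (*-zeroʳ _))) (∑₁-0 J)

   D⁻¹-axis : AxisSeries k D⁻¹
   D⁻¹-axis J a a≢ = ∗-cancel (s a) {line k a D⁻¹} {λ _ → 0F} (λ J → trans (sym (dilog-⋆ D⁻¹ a J)) (trans (I.inverseʳ (insertAt a k J))
     (trans (δ-off J a a≢) (sym (∗-zero (s a) (λ _ → 0F) (λ _ → refl) J))))) J

   D⁻¹-𝟘 : D⁻¹ 𝟘 ≡ 1F
   D⁻¹-𝟘 = subst (λ z → D⁻¹ z ≡ 1F) (insert-𝟘 k) (trans (sym (E-head (s 𝟘) (line k 𝟘 D⁻¹)))
     (trans (sym (dilog-⋆ D⁻¹ 𝟘 0)) (trans (I.inverseʳ (insertAt 𝟘 k 0)) (trans (cong δ (insert-𝟘 k)) (δ-𝟘 (suc m))))))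

   -- What remains of p when E(y_k) is split off on the left and on the right. The aim is support of
   -- `R` in `In.K` and of `X` in `Out.K`, where they can be reflected.
   R X : Series (suc m)
   R = D⁻¹ ⋆ p
   X = p ⋆ D⁻¹

   D⋆R : D ⋆ R ≗ p
   D⋆R x = trans (sym (⋆-assoc D D⁻¹ p x)) (trans (⋆-cong {g = p} I.inverseʳ (λ _ → refl) x) (⋆-identityˡ p x))

   X⋆D : X ⋆ D ≗ p
   X⋆D x = trans (⋆-assoc p D⁻¹ D x) (trans (⋆-cong {f = p} (λ _ → refl) I.inverseˡ x) (⋆-identityʳ p x))

   R-𝟘 : R 𝟘 ≡ 1F
   R-𝟘 = ⋆-𝟘 D⁻¹ p D⁻¹-𝟘 unit-term

   X-𝟘 : X 𝟘 ≡ 1F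
   X-𝟘 = ⋆-𝟘 p D⁻¹ unit-term D⁻¹-𝟘

   lineR : ∀ a → E (s a) ∗ line k a R ≗ line k a p
   lineR a J = trans (sym (dilog-⋆ R a J)) (D⋆R _)

   lineX : ∀ a → E (ℤ.- s a) ∗ line k a X ≗ line k a p
   lineX a J = trans (sym (⋆-dilog X a J)) (X⋆D _)

   -- The link between the two remainders: with `line-chain` it makes one of them a polynomial
   -- multiple of the other on every line.
   lines : ∀ a → E (s a) ∗ line k a R ≗ E (ℤ.- s a) ∗ line k a X
   lines a J = trans (lineR a J) (sym (lineX a J))

   axis-free : ∀ t f → E t ∗ line k 𝟘 f ≗ line k 𝟘 p → E t ∗ line k 𝟘 δ ≗ line k 𝟘 D → ∀ J → 0 ℕ.< J → f (insertAt 𝟘 k J) ≡ 0F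
   axis-free t f h h′ J J>0 = trans (∗-cancel t {line k 𝟘 f} {line k 𝟘 δ} (λ i → trans (h i) (trans (axis k i) (sym (trans (h′ i) (dilog-axis k i))))) J)
    (δ-≢ _ (λ e → ℕP.<⇒≢ J>0 (sym (proj₁ (insert-injective k (trans e (sym (insert-𝟘 k))))))))

   module In  = Side {B = B} {B′} q k (weightIn {B = B} q k)  (λ i → ∣ pos (B i k) ∣) (λ i → pos-abs (B i k)) (cong pos (diag-zero q k)) isoIn
   module Out = Side {B = B} {B′} q k (weightOut q k) (λ i → ∣ pos (B k i) ∣) (λ i → pos-abs (B k i)) (cong pos (diag-zero q k)) isoOut
   module InOff = SideOff {B = B} {B′} q k (weightIn {B = B} q k)  (λ i → ∣ pos (B i k) ∣) (λ i → pos-abs (B i k)) (cong pos (diag-zero q k)) isoIn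
   module OutOff = SideOff {B = B} {B′} q k (weightOut q k) (λ i → ∣ pos (B k i) ∣) (λ i → pos-abs (B k i)) (cong pos (diag-zero q k)) isoOut

   s-eq : ∀ a → s a ≡ ⁺ Out.β a ℤ.- ⁺ In.β a
   s-eq a = trans (form-unitˡ B k z) (trans (dot-cong {x = z} (λ i → sym (weightOut-weightIn q k i)) (λ _ → refl))
    (trans (dot-+ˡ (weightOut q k) (λ i → ℤ.- weightIn q k i) z) (cong₂ ℤ._+_ (sym (Out.β-eq a)) (trans (dot-negˡ (weightIn q k) z) (cong ℤ.-_ (sym (In.β-eq a)))))))
    where z = ⟦ insertAt a k 0 ⟧

   data Balance (a : Vec ℕ m) : Set where
    out-heavy : ∀ t → Out.β a ≡ In.β a ℕ.+ suc t → s a ≡ ⁺ suc t → Balance a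
    in-heavy  : ∀ t → In.β a ≡ Out.β a ℕ.+ suc t → s a ≡ -[1+ t ] → Balance a
    level     : Out.β a ≡ In.β a → s a ≡ 0ℤ → Balance a

   balance : ∀ a → Balance a
   balance a = go (In.β a) (Out.β a) refl refl (ℕ.compare (In.β a) (Out.β a))
    where
    lem₁ : ∀ i t → (i ℤ.+ t) ℤ.- i ≡ t
    lem₁ = solve-∀
    lem₂ : ∀ o t → o ℤ.- (o ℤ.+ t) ≡ ℤ.- t
    lem₂ = solve-∀
    go : ∀ i o → In.β a ≡ i → Out.β a ≡ o → ℕ.Ordering i o → Balance a
    go i _ eᵢ eₒ (ℕ.less .i t) = out-heavy t (trans eₒ (trans (sym (ℕP.+-suc i t)) (cong (ℕ._+ suc t) (sym eᵢ))))
     (trans (s-eq a) (trans (cong₂ (λ u v → ⁺ u ℤ.- ⁺ v) (trans eₒ (sym (ℕP.+-suc i t))) eᵢ) (trans (cong (λ z → z ℤ.- ⁺ i) (ℤP.pos-+ i (suc t))) (lem₁ (⁺ i) (⁺ suc t)))))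
    go i .i eᵢ eₒ (ℕ.equal .i) = level (trans eₒ (sym eᵢ)) (trans (s-eq a) (trans (cong₂ (λ u v → ⁺ u ℤ.- ⁺ v) eₒ eᵢ) (ℤP.+-inverseʳ (⁺ i))))
    go _ o eᵢ eₒ (ℕ.greater .o t) = in-heavy t (trans eᵢ (trans (sym (ℕP.+-suc o t)) (cong (ℕ._+ suc t) (sym eₒ))))
     (trans (s-eq a) (trans (cong₂ (λ u v → ⁺ u ℤ.- ⁺ v) eₒ (trans eᵢ (sym (ℕP.+-suc o t)))) (trans (cong (λ z → ⁺ o ℤ.- z) (ℤP.pos-+ o (suc t))) (lem₂ (⁺ o) (⁺ suc t)))))

   private
    cutR : ∀ {x} (c : Chart B x) → Chart.σ c (unit k) ≡ pos⁺ → Cutting.Cut {B = B} q c p → Cutting.Cut {B = B} q c R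
    cutR c e = Cutting.cut-left {B = B} q c k {D⁻¹} {p} {R} e D⁻¹-axis D⁻¹-𝟘 (λ _ → refl)

    cutX : ∀ {x} (c : Chart B x) → Chart.σ c (unit k) ≡ neg → Cutting.Cut {B = B} q c p → Cutting.Cut {B = B} q c X
    cutX c e = Cutting.cut-right {B = B} q c k {D⁻¹} {p} {X} e D⁻¹-axis D⁻¹-𝟘 (λ _ → refl)

    Both : Vec ℕ m → Set
    Both a = (∀ J → In.β a ℕ.< J → R (insertAt a k J) ≡ 0F) × (∀ J → Out.β a ℕ.< J → X (insertAt a k J) ≡ 0F)

    -- With e_k positive in the chart, the cut of p passes to `R`, and `cut-vanish` propagates the
    -- bound from smaller exponents.
    vanishR : ∀ a J → (∀ b → sum b ℕ.< sum a → Both b) → In.β a ℕ.< J → (∀ J′ → J′ ℕ.< J → In.β a ℕ.< J′ → R (insertAt a k J′) ≡ 0F) →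
     (c : Chart B (insertAt a k J)) → Chart.σ c (unit k) ≡ pos⁺ → Cutting.Cut {B = B} q c p → R (insertAt a k J) ≡ 0F
    vanishR a J ih J> ihJ c e cut = Cutting.cut-vanish {B = B} q c In.K In.K? In.K-𝟘 (λ {a} {b} → In.K-⊕ {a} {b}) (cutR c e cut)
     (λ h → ℕP.<⇒≱ J> (In.K-insert J a h))
     (insert-view k (λ y → below (insertAt a k J) y → ¬ In.K y → R y ≡ 0F) (λ J′ b lt ¬K → go J′ b (below-insert k lt) (ℕP.≰⇒> (λ p → ¬K (In.insert-K J′ b p)))))
     where
     go : ∀ J′ b → sum b ℕ.< sum a ⊎ (b ≡ a × J′ ℕ.< J) → In.β b ℕ.< J′ → R (insertAt b k J′) ≡ 0F
     go J′ b (inj₁ p)          h = proj₁ (ih b p) J′ h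
     go J′ b (inj₂ (refl , p)) h = ihJ J′ p h

    vanishX : ∀ a J → (∀ b → sum b ℕ.< sum a → Both b) → Out.β a ℕ.< J → (∀ J′ → J′ ℕ.< J → Out.β a ℕ.< J′ → X (insertAt a k J′) ≡ 0F) →
     (c : Chart B (insertAt a k J)) → Chart.σ c (unit k) ≡ neg → Cutting.Cut {B = B} q c p → X (insertAt a k J) ≡ 0F
    vanishX a J ih J> ihJ c e cut = Cutting.cut-vanish {B = B} q c Out.K Out.K? Out.K-𝟘 (λ {a} {b} → Out.K-⊕ {a} {b}) (cutX c e cut)
     (λ h → ℕP.<⇒≱ J> (Out.K-insert J a h))
     (insert-view k (λ y → below (insertAt a k J) y → ¬ Out.K y → X y ≡ 0F) (λ J′ b lt ¬K → go J′ b (below-insert k lt) (ℕP.≰⇒> (λ p → ¬K (Out.insert-K J′ b p)))))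
     where
     go : ∀ J′ b → sum b ℕ.< sum a ⊎ (b ≡ a × J′ ℕ.< J) → Out.β b ℕ.< J′ → X (insertAt b k J′) ≡ 0F
     go J′ b (inj₁ p)          h = proj₂ (ih b p) J′ h
     go J′ b (inj₂ (refl , p)) h = ihJ J′ p h

    chart-at : ∀ {a J} → a ≢ 𝟘 → 0 ℕ.< J → Σ (Chart B (insertAt a k J)) (λ c → Cutting.Cut {B = B} q c p)
    chart-at a≢ J>0 = incoming _ (insert-off-axes k a≢ J>0)

    strong : (P : ℕ → Set) → (∀ J → (∀ J′ → J′ ℕ.< J → P J′) → P J) → ∀ J → P J
    strong P h J = go (suc J) J ℕP.≤-refl
     where
     go : ∀ d J → J ℕ.< d → P J
     go (suc d) J J<d = h J (λ J′ p → go d J′ (ℕP.<-≤-trans p (ℕP.≤-pred J<d)))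

    -- If `s a` > 0, every chart on the line makes e_k positive, which bounds `R`; the bound on `X`
    -- follows since `X` is `R` times a polynomial of degree `s a`. If `s a` < 0 the roles are
    -- exchanged. For a = `𝟘` the restriction of p to the axis is E(y_k) itself.
    step : ∀ a → (∀ b → sum b ℕ.< sum a → Both b) → Both a
    step a ih with 𝟘? a
    ... | inj₁ refl = (λ J p → axis-free (s 𝟘) R (lineR 𝟘) (λ J → trans (sym (dilog-⋆ δ 𝟘 J)) (⋆-identityʳ D (insertAt 𝟘 k J))) J (ℕP.≤-<-trans ℕ.z≤n p)) ,
     (λ J p → axis-free (ℤ.- s 𝟘) X (lineX 𝟘) (λ J → trans (sym (⋆-dilog δ 𝟘 J)) (⋆-identityˡ D (insertAt 𝟘 k J))) J (ℕP.≤-<-trans ℕ.z≤n p))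
    ... | inj₂ a≢ = cases (balance a)
     where
     cases : Balance a → Both a
     cases (out-heavy t e es) = bR , λ J p → line-degree (suc t) (In.β a) {line k a R} {line k a X}
       (λ i → subst (λ z → (E z ∗ line k a R) i ≡ (E (ℤ.- z) ∗ line k a X) i) es (lines a i)) bR J (subst (ℕ._< J) e p)
      where
      bR : ∀ J → In.β a ℕ.< J → R (insertAt a k J) ≡ 0F
      bR = strong _ (λ J ihJ p → let (c , cut) = chart-at a≢ (ℕP.≤-<-trans ℕ.z≤n p) in vanishR a J ih p ihJ c (σ-pos c es) cut)
     cases (in-heavy t e es) = (λ J p → line-degree (suc t) (Out.β a) {line k a X} {line k a R}
       (λ i → sym (subst (λ z → (E z ∗ line k a R) i ≡ (E (ℤ.- z) ∗ line k a X) i) es (lines a i))) bX J (subst (ℕ._< J) e p)) , bX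
      where
      bX : ∀ J → Out.β a ℕ.< J → X (insertAt a k J) ≡ 0F
      bX = strong _ (λ J ihJ p → let (c , cut) = chart-at a≢ (ℕP.≤-<-trans ℕ.z≤n p) in vanishX a J ih p ihJ c (σ-neg c es) cut)
     -- When `s a` is 0 the sign of e_k depends on the refinement in the chart; since `R` and `X`
     -- agree on the line, either outcome bounds both.
     cases (level e es) = bR , λ J p → trans (sym (R≡X J)) (bR J (subst (ℕ._< J) e p))
      where
      R≡X : ∀ J → R (insertAt a k J) ≡ X (insertAt a k J)
      R≡X = ∗-cancel 0ℤ (λ i → subst (λ z → (E z ∗ line k a R) i ≡ (E (ℤ.- z) ∗ line k a X) i) es (lines a i))
      bR : ∀ J → In.β a ℕ.< J → R (insertAt a k J) ≡ 0F
      bR = strong _ (λ J ihJ p → let (c , cut) = chart-at a≢ (ℕP.≤-<-trans ℕ.z≤n p) in go J ihJ p c cut (σ-cases a≢ c))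
       where
       go : ∀ J → (∀ J′ → J′ ℕ.< J → In.β a ℕ.< J′ → R (insertAt a k J′) ≡ 0F) → In.β a ℕ.< J → (c : Chart B (insertAt a k J)) → Cutting.Cut {B = B} q c p →
        Chart.σ c (unit k) ≡ pos⁺ ⊎ Chart.σ c (unit k) ≡ neg → R (insertAt a k J) ≡ 0F
       go J ihJ p c cut (inj₁ h) = vanishR a J ih p ihJ c h cut
       go J ihJ p c cut (inj₂ h) = trans (R≡X J) (vanishX a J ih (subst (ℕ._< J) (sym e) p)
        (λ J′ p′ r → trans (sym (R≡X J′)) (ihJ J′ p′ (subst (ℕ._< J′) e r))) c h cut)

    both : ∀ a → Both a
    both a = go (suc (sum a)) a ℕP.≤-refl
     where
     go : ∀ d a → sum a ℕ.< d → Both a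
     go (suc d) a p = step a (λ b r → go d b (ℕP.<-≤-trans r (ℕP.≤-pred p)))

   R-bounded : In.Bounded R
   R-bounded a = proj₁ (both a)

   X-bounded : Out.Bounded X
   X-bounded a = proj₂ (both a)

   open Conv (twist B′) using () renaming (_⋆_ to _⋆′_)
   private
    module C′ = Conv (twist B′)
    module P′ = Pairing {B = B′} q′ k

   s′-eq : ∀ a → P′.s a ≡ ℤ.- s a
   s′-eq a = trans (form-unitˡ B′ k z) (trans (dot-cong {x = z} μ-row (λ _ → refl)) (trans (dot-negˡ (B k) z) (cong ℤ.-_ (sym (form-unitˡ B k z)))))
    where z = ⟦ insertAt a k 0 ⟧

   R′ X′ : Series (suc m)
   R′ = In.flip R
   X′ = Out.flip X

   abstract
    -- E(y_k) stood to the left of `R` and is put back to the right of the reflected `R`. By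
    -- `p′-left` the other remainder leads to the same series.
    p′ : Series (suc m)
    p′ = R′ ⋆′ D

    p′-right : p′ ≗ R′ ⋆′ D
    p′-right _ = refl

   private
    mirrorIn : ∀ a → Mirror (In.β a) (line k a R) (line k a R′)
    mirrorIn a = mirror (λ i j e → sym (In.flip-in R a i j e)) (R-bounded a) (In.flip-out R a)

    mirrorOut : ∀ a → Mirror (Out.β a) (line k a X) (line k a X′)
    mirrorOut a = mirror (λ i j e → sym (Out.flip-in X a i j e)) (X-bounded a) (Out.flip-out X a)

    -- The relation `lines` survives reversal because the polynomial between the two remainders is
    -- palindromic; the sign of `s a` decides which remainder is the multiple.
    lines′ : ∀ a → E (s a) ∗ line k a R′ ≗ E (ℤ.- s a) ∗ line k a X′
    lines′ a = cases (balance a)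
     where
     cases : Balance a → E (s a) ∗ line k a R′ ≗ E (ℤ.- s a) ∗ line k a X′
     cases (out-heavy t e es) J = subst (λ z → (E z ∗ line k a R′) J ≡ (E (ℤ.- z) ∗ line k a X′) J) (sym es) (sym
      (line-mirror (suc t) (In.β a) {line k a R} {line k a R′} {line k a X} {line k a X′}
       (λ i → subst (λ z → (E z ∗ line k a R) i ≡ (E (ℤ.- z) ∗ line k a X) i) es (lines a i)) (mirrorIn a)
       (subst (λ z → Mirror z (line k a X) (line k a X′)) (trans e (ℕP.+-comm (In.β a) (suc t))) (mirrorOut a)) J))
     cases (in-heavy t e es) J = subst (λ z → (E z ∗ line k a R′) J ≡ (E (ℤ.- z) ∗ line k a X′) J) (sym es)
      (line-mirror (suc t) (Out.β a) {line k a X} {line k a X′} {line k a R} {line k a R′}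
       (λ i → sym (subst (λ z → (E z ∗ line k a R) i ≡ (E (ℤ.- z) ∗ line k a X) i) es (lines a i))) (mirrorOut a)
       (subst (λ z → Mirror z (line k a R) (line k a R′)) (trans e (ℕP.+-comm (Out.β a) (suc t))) (mirrorIn a)) J)
     cases (level e es) J = subst (λ z → (E z ∗ line k a R′) J ≡ (E (ℤ.- z) ∗ line k a X′) J) (sym es) (sym
      (line-mirror 0 (In.β a) {line k a R} {line k a R′} {line k a X} {line k a X′}
       (λ i → subst (λ z → (E z ∗ line k a R) i ≡ (E (ℤ.- z) ∗ line k a X) i) es (lines a i)) (mirrorIn a)
       (subst (λ z → Mirror z (line k a X) (line k a X′)) e (mirrorOut a)) J))

   p′-left : p′ ≗ D ⋆′ X′
   p′-left = insert-view k _ (λ J a → trans (p′-right (insertAt a k J)) (trans (P′.⋆-dilog R′ a J) (trans (cong (λ z → (E z ∗ line k a R′) J) (trans (cong ℤ.-_ (s′-eq a)) (ℤP.neg-involutive (s a))))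
    (trans (lines′ a J) (trans (cong (λ z → (E z ∗ line k a X′) J) (sym (s′-eq a))) (sym (P′.dilog-⋆ X′ a J)))))))

   private
    R′-𝟘 : R′ 𝟘 ≡ 1F
    R′-𝟘 = trans (In.flip-𝟘 R) R-𝟘

    X′-𝟘 : X′ 𝟘 ≡ 1F
    X′-𝟘 = trans (Out.flip-𝟘 X) X-𝟘

    D-axis : AxisSeries k D
    D-axis = dilog-off k

    axis-k : ∀ J → p′ (insertAt 𝟘 k J) ≡ ε J
    axis-k J = begin
     p′ (insertAt 𝟘 k J) ≡⟨ trans (p′-right (insertAt 𝟘 k J)) (P′.⋆-dilog R′ 𝟘 J) ⟩
     (E (ℤ.- P′.s 𝟘) ∗ line k 𝟘 R′) J ≡⟨ ∗-cong {f = E (ℤ.- P′.s 𝟘)} (λ _ → refl) R′-line J ⟩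
     (E (ℤ.- P′.s 𝟘) ∗ line k 𝟘 δ) J ≡⟨ sym (P′.⋆-dilog δ 𝟘 J) ⟩
     (δ ⋆′ D) (insertAt 𝟘 k J) ≡⟨ C′.⋆-identityˡ D (insertAt 𝟘 k J) ⟩
     D (insertAt 𝟘 k J) ≡⟨ dilog-axis k J ⟩
     ε J ∎
     where
     R′-line : line k 𝟘 R′ ≗ line k 𝟘 δ
     R′-line zero    = trans (cong R′ (insert-𝟘 k)) (trans R′-𝟘 (sym (trans (cong δ (insert-𝟘 k)) (δ-𝟘 (suc m)))))
     R′-line (suc J) = trans (In.flip-out R 𝟘 (suc J) (subst (ℕ._< suc J) (sym In.β-𝟘) (ℕ.s≤s ℕ.z≤n)))
      (sym (δ-≢ _ (λ e → ℕP.1+n≢0 (proj₁ (insert-injective k (trans e (sym (insert-𝟘 k))))))))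

    one-sided : ∀ l → ∣ pos (B l k) ∣ ≡ 0 ⊎ ∣ pos (B k l) ∣ ≡ 0
    one-sided l = subst (λ z → ∣ pos (B l k) ∣ ≡ 0 ⊎ ∣ pos z ∣ ≡ 0) (sym (q k l)) (go (B l k))
     where
     go : ∀ z → ∣ pos z ∣ ≡ 0 ⊎ ∣ pos (ℤ.- z) ∣ ≡ 0
     go (⁺ zero)  = inj₁ refl
     go (⁺ suc n) = inj₂ refl
     go -[1+ n ]  = inj₁ refl

    β-axis : ∀ (ω : Fin (suc m) → ℕ) l J {a} → insertAt 𝟘 l J ≡ insertAt a k 0 → ndot ω (insertAt a k 0) ≡ ω l ℕ.* J
    β-axis ω l J e = trans (cong (ndot ω) (sym e)) (ndot-axis ω l J)

    -- There are no arrows l → k or no arrows k → l. The corresponding weight is 0 on the l-axis, so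
    -- the reflection with that weight fixes its points.
    axis-other : ∀ l J a → insertAt 𝟘 l J ≡ insertAt a k 0 → p′ (insertAt 𝟘 l J) ≡ ε J
    axis-other l J a e with one-sided l
    ... | inj₁ z = begin
     p′ (insertAt 𝟘 l J)   ≡⟨ cong p′ e ⟩
     p′ (insertAt a k 0)   ≡⟨ trans (trans (p′-right (insertAt a k 0)) (P′.⋆-dilog R′ a 0)) (E-head (ℤ.- P′.s a) (line k a R′)) ⟩
     R′ (insertAt a k 0)   ≡⟨ In.flip-in R a 0 0 (sym (trans (β-axis _ l J e) (cong (ℕ._* J) z))) ⟩
     R (insertAt a k 0)    ≡⟨ trans (sym (E-head (s a) (line k a R))) (lineR a 0) ⟩
     p (insertAt a k 0)    ≡⟨ trans (cong p (sym e)) (axis l J) ⟩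
     ε J ∎
    ... | inj₂ z = begin
     p′ (insertAt 𝟘 l J)   ≡⟨ cong p′ e ⟩
     p′ (insertAt a k 0)   ≡⟨ p′-left (insertAt a k 0) ⟩
     (D ⋆′ X′) (insertAt a k 0) ≡⟨ trans (P′.dilog-⋆ X′ a 0) (E-head (P′.s a) (line k a X′)) ⟩
     X′ (insertAt a k 0)   ≡⟨ Out.flip-in X a 0 0 (sym (trans (β-axis _ l J e) (cong (ℕ._* J) z))) ⟩
     X (insertAt a k 0)    ≡⟨ trans (sym (E-head (ℤ.- s a) (line k a X))) (lineX a 0) ⟩
     p (insertAt a k 0)    ≡⟨ trans (cong p (sym e)) (axis l J) ⟩
     ε J ∎

    axis′ : ∀ l J → p′ (insertAt 𝟘 l J) ≡ ε J
    axis′ l J with l ≟ᶠ k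
    ... | yes refl = axis-k J
    ... | no l≢k   = axis-other l J (removeAt (insertAt 𝟘 l J) k) (trans (sym (insertAt-removeAt (insertAt 𝟘 l J) k)) (cong (insertAt _ k) k-entry))
     where
     k-entry : lookup (insertAt 𝟘 l J) k ≡ 0
     k-entry = ℤP.+-injective (trans (lattice-axis l J k) (trans (cong (λ z → ⁺ J ℤ.* z) (unit-≢ (λ h → l≢k (sym h)))) (ℤP.*-zeroʳ (⁺ J))))

    Goal : Vec ℕ (suc m) → Set
    Goal x = Σ (Chart B′ x) (λ c → Cutting.Cut {B = B′} q′ c p′)

    finish-right : ∀ {x} (c : Chart B′ x) → Chart.σ c (unit k) ≡ neg → Cutting.Cut {B = B′} q′ c R′ → Goal x
    finish-right c h cut = c , Cutting.cut-right {B = B′} q′ c k h D-axis (dilog-𝟘 k) p′-right cut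

    finish-left : ∀ {x} (c : Chart B′ x) → Chart.σ c (unit k) ≡ pos⁺ → Cutting.Cut {B = B′} q′ c X′ → Goal x
    finish-left c h cut = c , Cutting.cut-left {B = B′} q′ c k h D-axis (dilog-𝟘 k) p′-left cut

    viaIn : ∀ a i j → i ℕ.+ j ≡ In.β a → (c : Chart B (insertAt a k i)) → Chart.σ c (unit k) ≡ pos⁺ → Cutting.Cut {B = B} q c p → Goal (insertAt a k j)
    viaIn a i j e c h cut = go (In.flip-chart-cut q′ a i j e c R-bounded (cutR c h cut))
     where
     go : Σ (Chart B′ (insertAt a k j)) (λ c′ → Chart.σ c′ (unit k) ≡ opposite (Chart.σ c (unit k)) × Cutting.Cut {B = B′} q′ c′ R′) → Goal (insertAt a k j)
     go (c′ , h′ , cut′) = finish-right c′ (trans h′ (cong opposite h)) cut′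

    viaOut : ∀ a i j → i ℕ.+ j ≡ Out.β a → (c : Chart B (insertAt a k i)) → Chart.σ c (unit k) ≡ neg → Cutting.Cut {B = B} q c p → Goal (insertAt a k j)
    viaOut a i j e c h cut = go (Out.flip-chart-cut q′ a i j e c X-bounded (cutX c h cut))
     where
     go : Σ (Chart B′ (insertAt a k j)) (λ c′ → Chart.σ c′ (unit k) ≡ opposite (Chart.σ c (unit k)) × Cutting.Cut {B = B′} q′ c′ X′) → Goal (insertAt a k j)
     go (c′ , h′ , cut′) = finish-left c′ (trans h′ (cong opposite h)) cut′

    offIn : ∀ a j → In.β a ℕ.< j → (c : Chart B′ (insertAt a k j)) → Chart.σ c (unit k) ≡ neg → Goal (insertAt a k j)
    offIn a j p> c h = finish-right c h (InOff.off-cut  q′ (insertAt a k j) (InOff.¬insert-K a j p>) c R′ R′-𝟘 (In.flip-out R))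

    offOut : ∀ a j → Out.β a ℕ.< j → (c : Chart B′ (insertAt a k j)) → Chart.σ c (unit k) ≡ pos⁺ → Goal (insertAt a k j)
    offOut a j p> c h = finish-left c h (OutOff.off-cut  q′ (insertAt a k j) (OutOff.¬insert-K a j p>) c X′ X′-𝟘 (Out.flip-out X))

    incoming′ : ∀ j a → Off-axes (insertAt a k j) → Goal (insertAt a k j)
    incoming′ j a off = cases (balance a)
     where
     a≢ : a ≢ 𝟘
     a≢ e = off k (trans (removeAt-insertAt a k j) e)
     no-axis : ∀ l {i} → i ≢ 0 → removeAt (insertAt a k i) l ≢ 𝟘
     no-axis l i≢ = insert-off-axes k a≢ (ℕP.n≢0⇒n>0 i≢) l
     axis-eq : ∀ l → removeAt (insertAt a k 0) l ≡ 𝟘 → ∃ λ J → insertAt 𝟘 l J ≡ insertAt a k 0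
     axis-eq l e = _ , sym (axis-form (insertAt a k 0) l e)
     -- `incoming` applies only off the axes. If the mirror exponent lay on an axis l, one of the
     -- weights would be 0 there, and then, through `le` if it is the outgoing one, the segment
     -- would have length 0; the given exponent would equal its mirror and lie on that axis too.
     offIn-n : In.β a ℕ.≤ Out.β a → ∀ i → i ℕ.+ j ≡ In.β a → Off-axes (insertAt a k i)
     offIn-n le (suc i) e l h = no-axis l ℕP.1+n≢0 h
     offIn-n le zero    e l h with axis-eq l h | one-sided l
     ... | J , eJ | inj₁ z = off l (trans (cong (λ v → removeAt (insertAt a k v) l) (trans e (trans (β-axis _ l J eJ) (cong (ℕ._* J) z)))) h)
     ... | J , eJ | inj₂ z = off l (trans (cong (λ v → removeAt (insertAt a k v) l) (ℕP.n≤0⇒n≡0 (subst₂ ℕ._≤_ (sym e) (trans (β-axis _ l J eJ) (cong (ℕ._* J) z)) le))) h)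
     offOut-n : Out.β a ℕ.≤ In.β a → ∀ i → i ℕ.+ j ≡ Out.β a → Off-axes (insertAt a k i)
     offOut-n le (suc i) e l h = no-axis l ℕP.1+n≢0 h
     offOut-n le zero    e l h with axis-eq l h | one-sided l
     ... | J , eJ | inj₂ z = off l (trans (cong (λ v → removeAt (insertAt a k v) l) (trans e (trans (β-axis _ l J eJ) (cong (ℕ._* J) z)))) h)
     ... | J , eJ | inj₁ z = off l (trans (cong (λ v → removeAt (insertAt a k v) l) (ℕP.n≤0⇒n≡0 (subst₂ ℕ._≤_ (sym e) (trans (β-axis _ l J eJ) (cong (ℕ._* J) z)) le))) h)
     cases : Balance a → Goal (insertAt a k j)
     cases (out-heavy t e es) with j ℕ.≤? In.β a
     -- Beyond the segment the reflected `R` vanishes, so any chart that makes e_k negative will do.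
     ... | no h  = offIn a j (ℕP.≰⇒> h) (chart B′ (insertAt a k j)) (P′.σ-neg (chart B′ (insertAt a k j)) (trans (s′-eq a) (cong ℤ.-_ es)))
     ... | yes h = let
              eq = ℕP.m∸n+n≡m h
              (c , cut) = incoming _ (offIn-n (subst (In.β a ℕ.≤_) (sym e) (ℕP.m≤m+n _ _)) (In.β a ℕ.∸ j) eq)
            in viaIn a (In.β a ℕ.∸ j) j eq c (σ-pos c es) cut
     cases (in-heavy t e es) with j ℕ.≤? Out.β a
     ... | no h  = offOut a j (ℕP.≰⇒> h) (chart B′ (insertAt a k j)) (P′.σ-pos (chart B′ (insertAt a k j)) (trans (s′-eq a) (cong ℤ.-_ es)))
     ... | yes h = let
              eq = ℕP.m∸n+n≡m h
              (c , cut) = incoming _ (offOut-n (subst (Out.β a ℕ.≤_) (sym e) (ℕP.m≤m+n _ _)) (Out.β a ℕ.∸ j) eq)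
            in viaOut a (Out.β a ℕ.∸ j) j eq c (σ-neg c es) cut
     cases (level e es) with j ℕ.≤? In.β a
     ... | no h  = go (P′.σ-cases {j} {a} a≢ (chart B′ (insertAt a k j)))
      where
      go : Chart.σ (chart B′ (insertAt a k j)) (unit k) ≡ pos⁺ ⊎ Chart.σ (chart B′ (insertAt a k j)) (unit k) ≡ neg → Goal (insertAt a k j)
      go (inj₁ r) = offOut a j (subst (ℕ._< j) (sym e) (ℕP.≰⇒> h)) (chart B′ (insertAt a k j)) r
      go (inj₂ r) = offIn a j (ℕP.≰⇒> h) (chart B′ (insertAt a k j)) r
     ... | yes h = go (incoming _ (offIn-n (ℕP.≤-reflexive (sym e)) i eq))
      where
      i = In.β a ℕ.∸ j
      eq : i ℕ.+ j ≡ In.β a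
      eq = ℕP.m∸n+n≡m h
      go : Σ (Chart B (insertAt a k i)) (λ c → Cutting.Cut {B = B} q c p) → Goal (insertAt a k j)
      go (c , cut) with σ-cases {i} {a} a≢ c
      ... | inj₁ r = viaIn a i j eq c r cut
      ... | inj₂ r = viaOut a i j (trans eq (sym e)) c r cut

   good′ : Good {B = B′} q′ p′
   good′ = record { axis = axis′ ; incoming = insert-view k (λ x → Off-axes x → Goal x) incoming′ }

 -- Existence of the series, and products of dilogarithms.

 module Rays where
  open import Defs using (Q; IsQuiver)
  open Scalars
  open Sums
  open Convolution
  open Forms using (twist; ⟦_⟧; form)
  open Axes
  open Charts
  open Cuts
  open Mutations
  open import Data.Vec using (sum; map; length)
  open import Data.Vec.Properties using (≡-dec; removeAt-insertAt; insertAt-lookup)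
  open import Data.List using (_++_)
  open import Data.List.Membership.Propositional using (_∈_)
  open import Data.List.Relation.Unary.Any using (here; there)

  open ≡-Reasoning

  module Existence {m : ℕ} {B : Q (suc m)} (q : IsQuiver B) where
   open Conv (twist B)

   private
    -- On an axis the total degree is the exponent itself. Off the axes the coefficient is set to
    -- the proper products of its own factorization, which `factor-u` turns into the absence of an
    -- incoming term.
    step : Series (suc m) → Series (suc m)
    step p x with off-axes? x
    ... | inj₁ _ = factor-proper (Chart.negative (chart B x)) p x
    ... | inj₂ _ = ε (sum x)

    step-local : Local step
    step-local p p′ x e with off-axes? x
    ... | inj₁ _ = factor-proper-agree (Chart.negative (chart B x)) x e
    ... | inj₂ _ = refl

    step-on : ∀ p x k → removeAt x k ≡ 𝟘 → step p x ≡ ε (sum x)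
    step-on p x k e with off-axes? x
    ... | inj₁ h = ⊥-elim (h k e)
    ... | inj₂ _ = refl

    step-off : ∀ p x → Off-axes x → step p x ≡ factor-proper (Chart.negative (chart B x)) p x
    step-off p x h with off-axes? x
    ... | inj₁ _       = refl
    ... | inj₂ (k , e) = ⊥-elim (h k e)

   abstract
    canonical : Series (suc m)
    canonical = fix step

    private
     canonical-eq : ∀ x → canonical x ≡ step canonical x
     canonical-eq = fix-eq step step-local

     on-axis : ∀ k J → canonical (insertAt 𝟘 k J) ≡ ε J
     on-axis k J = trans (canonical-eq (insertAt 𝟘 k J)) (trans (step-on canonical (insertAt 𝟘 k J) k (removeAt-insertAt 𝟘 k J))
      (cong ε (trans (sum-insert k J 𝟘) (trans (cong (J ℕ.+_) (sum-𝟘 m)) (ℕP.+-identityʳ J)))))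
      where
      sum-𝟘 : ∀ n → sum (𝟘 {n}) ≡ 0
      sum-𝟘 zero    = refl
      sum-𝟘 (suc n) = sum-𝟘 n

     at-𝟘 : canonical 𝟘 ≡ 1F
     at-𝟘 = trans (on-axis zero 0) ε-0

    canonical-good : Good {B = B} q canonical
    canonical-good = record { axis = on-axis ; incoming = λ x off → chart B x , cut x off }
     where
     cut : ∀ x → Off-axes x → Cutting.Cut {B = B} q (chart B x) canonical
     cut x off = factor negative canonical negative-𝟘 at-𝟘 Cutting.⊣
       factor-u negative canonical negative-𝟘 at-𝟘 x (λ { refl → off zero refl }) (cong isNeg σ-self)
        (trans (canonical-eq x) (step-off canonical x off))
      where
      open Chart (chart B x) using (negative)
      open ChartProperties {B = B} q (chart B x) using (negative-𝟘; σ-self)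

  infixr 7 _·_
  _·_ : ∀ {n} → ℕ → Vec ℕ n → Vec ℕ n
  j · x = map (j ℕ.*_) x

  ·-suc : ∀ {n} j (x : Vec ℕ n) → suc j · x ≡ x ⊕ j · x
  ·-suc j []      = refl
  ·-suc j (y ∷ x) = cong (_ ∷_) (·-suc j x)

  ·-zero : ∀ {n} (x : Vec ℕ n) → 0 · x ≡ 𝟘
  ·-zero []      = refl
  ·-zero (y ∷ x) = cong (0 ∷_) (·-zero x)

  sum-· : ∀ {n} j (x : Vec ℕ n) → sum (j · x) ≡ j ℕ.* sum x
  sum-· zero    x = trans (cong sum (·-zero x)) (z (length x))
   where
   z : ∀ n → sum (𝟘 {n}) ≡ 0
   z zero    = refl
   z (suc n) = z n
  sum-· (suc j) x = trans (cong sum (·-suc j x)) (trans (sum-⊕ x (j · x)) (cong (sum x ℕ.+_) (sum-· j x)))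

  ·-injective : ∀ {n} {x : Vec ℕ n} → x ≢ 𝟘 → ∀ {i j} → i · x ≡ j · x → i ≡ j
  ·-injective {x = x} h {i} {j} e = ℕP.*-cancelʳ-≡ i j (sum x) {{ℕP.m*n≢0⇒m≢0 (sum x) {1} {{ℕ.≢-nonZero (λ z → h (sum≡0 x (trans (sym (ℕP.*-identityʳ _)) z)))}}}}
   (trans (sym (sum-· i x)) (trans (cong sum e) (sum-· j x)))

  ·-insert : ∀ {m} (k : Fin (suc m)) j i (a : Vec ℕ m) → j · insertAt a k i ≡ insertAt (j · a) k (j ℕ.* i)
  ·-insert zero    j i a       = refl
  ·-insert (suc k) j i (y ∷ a) = cong (_ ∷_) (·-insert k j i a)

  multiple? : ∀ {n} (x a : Vec ℕ n) → x ≢ 𝟘 → (∃ λ j → a ≡ j · x) ⊎ (∀ j → a ≢ j · x)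
  multiple? x a h = go (suc (sum a)) (λ j e p → ℕP.<⇒≱ p (bound j e))
   where
   bound : ∀ j → a ≡ j · x → j ℕ.≤ sum a
   bound j e = subst (j ℕ.≤_) (sym (trans (cong sum e) (sum-· j x))) (ℕP.m≤m*n j (sum x) {{ℕ.≢-nonZero (λ z → h (sum≡0 x z))}})
   go : ∀ d → (∀ j → a ≡ j · x → ¬ d ℕ.≤ j) → (∃ λ j → a ≡ j · x) ⊎ (∀ j → a ≢ j · x)
   go zero    h = inj₂ (λ j e → h j e ℕ.z≤n)
   go (suc d) h with ≡-dec ℕ._≟_ a (d · x)
   ... | yes e = inj₁ (d , e)
   ... | no ¬e = go d (λ j e p → h j e (ℕP.≤∧≢⇒< p (λ { refl → ¬e e })))

  -- The quantum dilogarithm E(y^x).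
  abstract
   ray : ∀ {n} (x : Vec ℕ n) → x ≢ 𝟘 → Series n
   ray x h a with multiple? x a h
   ... | inj₁ (j , _) = ε j
   ... | inj₂ _       = 0F

   ray-on : ∀ {n} (x : Vec ℕ n) h j → ray x h (j · x) ≡ ε j
   ray-on x h j with multiple? x (j · x) h
   ... | inj₁ (i , e) = cong ε (·-injective h (sym e))
   ... | inj₂ f       = ⊥-elim (f j refl)

   ray-off : ∀ {n} (x : Vec ℕ n) h a → (∀ j → a ≢ j · x) → ray x h a ≡ 0F
   ray-off x h a f with multiple? x a h
   ... | inj₁ (i , e) = ⊥-elim (f i e)
   ... | inj₂ _       = refl

   ray-nonneg : ∀ {n} (x : Vec ℕ n) h a → NonNeg (ray x h a)
   ray-nonneg x h a with multiple? x a h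
   ... | inj₁ (j , _) = Pos⇒NonNeg (Pos-ε j)
   ... | inj₂ _       = NonNeg-0

  ray-𝟘 : ∀ {n} (x : Vec ℕ n) h → ray x h 𝟘 ≡ 1F
  ray-𝟘 x h = trans (cong (ray x h) (sym (·-zero x))) (trans (ray-on x h 0) ε-0)

  ray-at : ∀ {n} (x : Vec ℕ n) h → ray x h x ≡ ε 1
  ray-at x h = trans (cong (ray x h) (sym (one x))) (ray-on x h 1)
   where
   one : ∀ {n} (x : Vec ℕ n) → 1 · x ≡ x
   one []      = refl
   one (y ∷ x) = cong₂ _∷_ (ℕP.+-identityʳ y) (one x)

  Exponent : ℕ → Set
  Exponent n = Σ (Vec ℕ n) (_≢ 𝟘)

  e : ∀ {m} → Fin (suc m) → Vec ℕ (suc m)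
  e k = insertAt 𝟘 k 1

  e≢𝟘 : ∀ {m} (k : Fin (suc m)) → e k ≢ 𝟘
  e≢𝟘 k h = ℕP.1+n≢0 (proj₁ (insert-injective k (trans h (sym (insert-𝟘 k)))))

  ê : ∀ {m} → Fin (suc m) → Exponent (suc m)
  ê k = e k , e≢𝟘 k

  e-multiple : ∀ {m} (k : Fin (suc m)) j → j · e k ≡ insertAt 𝟘 k j
  e-multiple {m} k j = trans (·-insert k j 1 𝟘) (cong₂ (λ a i → insertAt a k i) (z m) (ℕP.*-identityʳ j))
   where
   z : ∀ n → j · 𝟘 {n} ≡ 𝟘
   z zero    = refl
   z (suc n) = cong₂ _∷_ (ℕP.*-zeroʳ j) (z n)

  dilog≗ray : ∀ {m} (k : Fin (suc m)) → dilog k ≗ ray (e k) (e≢𝟘 k)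
  dilog≗ray k = insert-view k _ (λ J a → go J a (𝟘? a))
   where
   go : ∀ J a → a ≡ 𝟘 ⊎ a ≢ 𝟘 → dilog k (insertAt a k J) ≡ ray (e k) (e≢𝟘 k) (insertAt a k J)
   go J a (inj₁ refl) = trans (dilog-axis k J) (sym (trans (cong (ray (e k) (e≢𝟘 k)) (sym (e-multiple k J))) (ray-on (e k) (e≢𝟘 k) J)))
   go J a (inj₂ h)    = trans (dilog-off k J a h) (sym (ray-off (e k) (e≢𝟘 k) _ (λ j eq → h (proj₂ (insert-injective k (trans eq (e-multiple k j)))))))

  ∑-nonneg : ∀ {n} (x : Vec ℕ n) (G : Vec ℕ n → Vec ℕ n → F) → (∀ a b → NonNeg (G a b)) → NonNeg (∑ x G)
  ∑-nonneg []      G h = h [] []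
  ∑-nonneg (x ∷ v) G h = go x _ (λ i j → ∑-nonneg v _ (λ a b → h (i ∷ a) (j ∷ b)))
   where
   go : ∀ x (G : ℕ → ℕ → F) → (∀ i j → NonNeg (G i j)) → NonNeg (∑₁ x G)
   go zero    G h = h 0 0
   go (suc x) G h = NonNeg-+ (h 0 (suc x)) (go x _ (λ i j → h (suc i) j))

  module Products {m : ℕ} (B : Q (suc m)) where
   open Conv (twist B)

   product : List (Exponent (suc m)) → Series (suc m)
   product []             = δ
   product ((x , h) ∷ xs) = ray x h ⋆ product xs

   product-𝟘 : ∀ xs → product xs 𝟘 ≡ 1F
   product-𝟘 []             = δ-𝟘 (suc m)
   product-𝟘 ((x , h) ∷ xs) = ⋆-𝟘 (ray x h) (product xs) (ray-𝟘 x h) (product-𝟘 xs)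

   product-++ : ∀ xs ys → product (xs ++ ys) ≗ product xs ⋆ product ys
   product-++ []             ys y = sym (⋆-identityˡ (product ys) y)
   product-++ ((x , h) ∷ xs) ys y = trans (⋆-cong {f = ray x h} (λ _ → refl) (product-++ xs ys) y) (sym (⋆-assoc (ray x h) (product xs) (product ys) y))

   product-single : ∀ k → product (ê k ∷ []) ≗ dilog k
   product-single k y = trans (⋆-identityʳ (ray (e k) (e≢𝟘 k)) y) (sym (dilog≗ray k y))

   product-cons : ∀ k xs → product (ê k ∷ xs) ≗ dilog k ⋆ product xs
   product-cons k xs = ⋆-cong {g = product xs} (λ y → sym (dilog≗ray k y)) (λ _ → refl)

   product-snoc : ∀ xs k → product (xs ++ ê k ∷ []) ≗ product xs ⋆ dilog k
   product-snoc xs k y = trans (product-++ xs (ê k ∷ []) y) (⋆-cong {f = product xs} (λ _ → refl) (product-single k) y)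

   ⋆-nonneg : ∀ f g → (∀ a → NonNeg (f a)) → (∀ a → NonNeg (g a)) → ∀ a → NonNeg ((f ⋆ g) a)
   ⋆-nonneg f g hf hg x = ∑-nonneg x _ (λ a b → NonNeg-* (NonNeg-* (hf a) (hg b)) (Pos⇒NonNeg (Pos-pw (form B ⟦ a ⟧ ⟦ b ⟧))))

   δ-nonneg : ∀ {n} (a : Vec ℕ n) → NonNeg (δ a)
   δ-nonneg []          = Pos⇒NonNeg Pos-1
   δ-nonneg (zero ∷ a)  = δ-nonneg a
   δ-nonneg (suc _ ∷ a) = NonNeg-0

   reduced-nonneg : ∀ {f : Series (suc m)} → (∀ a → NonNeg (f a)) → ∀ a → NonNeg (reduced f a)
   reduced-nonneg h a with 𝟘? a
   ... | inj₁ _ = NonNeg-0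
   ... | inj₂ _ = h a

   product-nonneg : ∀ xs a → NonNeg (product xs a)
   product-nonneg []             = δ-nonneg
   product-nonneg ((x , h) ∷ xs) = ⋆-nonneg (ray x h) (product xs) (ray-nonneg x h) (product-nonneg xs)

   -- All coefficients are nonnegative, so no factor of a product can be cancelled.
   product-pos : ∀ xs {x} → x ∈ xs → Pos (product xs (proj₁ x))
   product-pos ((x , h) ∷ xs) (here refl) = subst Pos (sym (⋆-splitʳ (ray x h) (product xs) (product-𝟘 xs) x))
    (Pos-+ˡ (subst Pos (sym (ray-at x h)) (Pos-ε 1)) (⋆-nonneg (ray x h) _ (ray-nonneg x h) (reduced-nonneg (product-nonneg xs)) x))
   product-pos ((y , h) ∷ xs) {x , _} (there i) = subst Pos (sym (⋆-splitˡ (ray y h) (product xs) (ray-𝟘 y h) x))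
    (Pos-+ˡ (product-pos xs i) (⋆-nonneg _ (product xs) (reduced-nonneg (ray-nonneg y h)) (product-nonneg xs) x))

 -- Reflecting products, and rotating a factorization.

 module Reflections where
  open import Defs using (Q; IsQuiver)
  open Scalars using (F; 0F; 1F; pw; ε; Pos⇒≢0)
  open Sums
  open Convolution
  open Forms
  open Axes
  open Cuts
  open Mutations
  open Rays
  open import Data.Integer using (∣_∣)
  open import Data.Vec.Properties using (removeAt-insertAt; insertAt-lookup; insertAt-removeAt)
  open import Data.List using (_++_)
  open import Data.List.Relation.Binary.Pointwise as Pointwise using (Pointwise; []; _∷_)
  open import Data.List.Membership.Propositional using (_∈_)
  open import Data.List.Relation.Unary.Any using (here; there)

  open ≡-Reasoning

  module Flips {m : ℕ} {B B′ : Q (suc m)} (q : IsQuiver B) (k : Fin (suc m)) (w : Lattice (suc m)) (ω : Fin (suc m) → ℕ)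
   (wω : ∀ i → w i ≡ ⁺ ω i) (wk : w k ≡ 0ℤ)
   (iso : ∀ x y → form B′ x y ≡ form B (reflect w k x) (reflect w k y)) where

   open Side {B = B} {B′} q k w ω wω wk iso
   private
    module P  = Products B
    module P′ = Products B′
    module C  = Conv (twist B)
    module C′ = Conv (twist B′)

   -- Kept as a relation with the two complementary positions as data, so that lists of exponents
   -- can be compared entry by entry.
   Mirrors : Vec ℕ (suc m) → Vec ℕ (suc m) → Set
   Mirrors x x′ = Σ (Vec ℕ m) λ a → Σ ℕ λ i → Σ ℕ λ j → i ℕ.+ j ≡ β a × x ≡ insertAt a k i × x′ ≡ insertAt a k j

   Mirrors-reflect : ∀ {x x′} → Mirrors x x′ → reflect w k ⟦ x′ ⟧ ≗ ⟦ x ⟧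
   Mirrors-reflect (a , i , j , e , refl , refl) = reflect-insert a i j e

   Mirrors-K : ∀ {x x′} → Mirrors x x′ → K x × K x′
   Mirrors-K (a , i , j , e , refl , refl) =
    insert-K i a (subst (i ℕ.≤_) e (ℕP.m≤m+n i j)) , insert-K j a (subst (j ℕ.≤_) e (ℕP.m≤n+m j i))

   mirrors : ∀ x → K x → ∃ λ x′ → Mirrors x x′
   mirrors x h = insertAt (removeAt x k) k (β (removeAt x k) ℕ.∸ lookup x k) ,
    removeAt x k , lookup x k , _ , ℕP.m+[n∸m]≡n h , sym (insertAt-removeAt x k) , refl

   Mirrors-≢𝟘 : ∀ {x x′} → Mirrors x x′ → x ≢ 𝟘 → x′ ≢ 𝟘
   Mirrors-≢𝟘 (a , i , j , e , refl , refl) h z = h (trans (cong₂ (λ u v → insertAt u k v) a0 i0) (insert-𝟘 k))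
    where
    a0 : a ≡ 𝟘
    a0 = proj₂ (insert-injective k (trans z (sym (insert-𝟘 k))))
    i0 : i ≡ 0
    i0 = ℕP.m+n≡0⇒m≡0 i (trans e (trans (cong β a0) β-𝟘))

   K-multiple : ∀ {x} → K x → ∀ j → K (j · x)
   K-multiple {x} h zero    = subst K (sym (·-zero x)) K-𝟘
   K-multiple {x} h (suc j) = subst K (sym (·-suc j x)) (K-⊕ {x} {j · x} h (K-multiple {x} h j))

   β-multiple : ∀ t a → β (t · a) ≡ t ℕ.* β a
   β-multiple zero    a = trans (cong β (·-zero a)) β-𝟘
   β-multiple (suc t) a = trans (cong β (·-suc t a)) (trans (β-⊕ a (t · a)) (cong (β a ℕ.+_) (β-multiple t a)))

   ray-bounded : ∀ x h → K x → Bounded (ray x h)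
   ray-bounded x h Kx = off-K⇒Bounded {ray x h} (λ y ¬Ky → ray-off x h y (λ j e → ¬Ky (subst K (sym e) (K-multiple {x} Kx j))))

   mirror-multiple : ∀ {a b i j I J} t → i ℕ.+ j ≡ β a → I ℕ.+ J ≡ β b → insertAt b k I ≡ t · insertAt a k i → insertAt b k J ≡ t · insertAt a k j
   mirror-multiple {a} {b} {i} {j} {I} {J} t e E h = trans (cong₂ (λ u v → insertAt u k v) (proj₂ s) eJ) (sym (·-insert k t j a))
    where
    s : I ≡ t ℕ.* i × b ≡ t · a
    s = insert-injective k (trans h (·-insert k t i a))
    eJ : J ≡ t ℕ.* j
    eJ = ℕP.+-cancelˡ-≡ I J (t ℕ.* j) (trans E (trans (cong β (proj₂ s)) (trans (β-multiple t a) (trans (cong (t ℕ.*_) (sym e))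
     (trans (ℕP.*-distribˡ-+ t i j) (cong (ℕ._+ t ℕ.* j) (sym (proj₁ s))))))))

   -- By `mirror-multiple` the reflection respects multiples, so E(y^x) goes to E(y^x′).
   flip-ray : ∀ {x x′} → Mirrors x x′ → ∀ h h′ → flip (ray x h) ≗ ray x′ h′
   flip-ray M@(a , i , j , e , refl , refl) h h′ = insert-view k _ (λ J b → go J b (J ℕ.≤? β b))
    where
    x = insertAt a k i
    x′ = insertAt a k j
    go : ∀ J b → Dec (J ℕ.≤ β b) → flip (ray x h) (insertAt b k J) ≡ ray x′ h′ (insertAt b k J)
    go J b (no p)  = trans (flip-out (ray x h) b J (ℕP.≰⇒> p)) (sym (ray-off x′ h′ _ (λ t e → p (K-insert J b (subst K (sym e) (K-multiple {x′} (proj₂ (Mirrors-K M)) t))))))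
    go J b (yes p) = trans (flip-in (ray x h) b I J E) (cases (multiple? x (insertAt b k I) h))
     where
     I = β b ℕ.∸ J
     E : I ℕ.+ J ≡ β b
     E = ℕP.m∸n+n≡m p
     cases : (∃ λ t → insertAt b k I ≡ t · x) ⊎ (∀ t → insertAt b k I ≢ t · x) → ray x h (insertAt b k I) ≡ ray x′ h′ (insertAt b k J)
     cases (inj₁ (t , eq)) = trans (cong (ray x h) eq) (trans (ray-on x h t) (sym (trans (cong (ray x′ h′) (mirror-multiple t e E eq)) (ray-on x′ h′ t))))
     cases (inj₂ f) = trans (ray-off x h _ f) (sym (ray-off x′ h′ _ (λ t eq → f t (mirror-multiple t (trans (ℕP.+-comm j i) e) (trans (ℕP.+-comm J I) E) eq))))

   δ-bounded : Bounded δ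
   δ-bounded a J p = δ-≢ (insertAt a k J) (λ z → ℕP.<⇒≢ (ℕP.≤-<-trans ℕ.z≤n p) (sym (proj₁ (insert-injective k (trans z (sym (insert-𝟘 k)))))))

   flip-δ : flip δ ≗ δ
   flip-δ = insert-view k _ (λ J b → go J b (J ℕ.≤? β b) (𝟘? b))
    where
    go : ∀ J b → Dec (J ℕ.≤ β b) → b ≡ 𝟘 ⊎ b ≢ 𝟘 → flip δ (insertAt b k J) ≡ δ (insertAt b k J)
    go J b (no p) _ = trans (flip-out δ b J (ℕP.≰⇒> p)) (sym (δ-bounded b J (ℕP.≰⇒> p)))
    go J b (yes p) (inj₂ h) = trans (flip-in δ b (β b ℕ.∸ J) J (ℕP.m∸n+n≡m p)) (trans (δ-≢ _ (nz (β b ℕ.∸ J))) (sym (δ-≢ _ (nz J))))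
     where
     nz : ∀ I → insertAt b k I ≢ 𝟘
     nz I z = h (proj₂ (insert-injective k (trans z (sym (insert-𝟘 k)))))
    go J .𝟘 (yes p) (inj₁ refl) = subst (λ z → flip δ z ≡ δ z) (sym (trans (cong (insertAt 𝟘 k) (ℕP.n≤0⇒n≡0 (subst (J ℕ.≤_) β-𝟘 p))) (insert-𝟘 k))) (flip-𝟘 δ)

   MirrorList : List (Exponent (suc m)) → List (Exponent (suc m)) → Set
   MirrorList = Pointwise (λ x x′ → Mirrors (proj₁ x) (proj₁ x′))

   mirror-list : ∀ xs → (∀ {x} → x ∈ xs → K (proj₁ x)) → ∃ λ xs′ → MirrorList xs xs′
   mirror-list [] h = [] , []
   mirror-list ((x , x≢) ∷ xs) h with mirrors x (h (here refl)) | mirror-list xs (λ i → h (there i))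
   ... | x′ , M | xs′ , Ms = (x′ , Mirrors-≢𝟘 M x≢) ∷ xs′ , M ∷ Ms

   product-bounded : ∀ {xs xs′} → MirrorList xs xs′ → Bounded (P.product xs)
   product-bounded [] = δ-bounded
   product-bounded {(x , h) ∷ xs} (M ∷ Ms) = ⋆-bounded (twist B) (ray x h) (P.product xs) (ray-bounded x h (proj₁ (Mirrors-K M))) (product-bounded Ms)

   flip-products : ∀ {xs xs′} → MirrorList xs xs′ → flip (P.product xs) ≗ P′.product xs′
   flip-products [] = flip-δ
   flip-products {(x , h) ∷ xs} {(x′ , h′) ∷ xs′} (M ∷ Ms) y =
    trans (flip-product (ray x h) (P.product xs) (ray-bounded x h (proj₁ (Mirrors-K M))) (product-bounded Ms) y)
     (C′.⋆-cong (flip-ray M h h′) (flip-products Ms) y)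

   -- An exponent outside `K` among the factors would leave a positive coefficient there, which
   -- nothing cancels.
   product-K : ∀ xs → Bounded (P.product xs) → ∀ {x} → x ∈ xs → K (proj₁ x)
   product-K xs bd {x} i with K? (proj₁ x)
   ... | inj₁ h = h
   ... | inj₂ h = ⊥-elim (Pos⇒≢0 (P.product-pos xs i) (Bounded⇒off-K {P.product xs} bd (proj₁ x) h))

  record Factored {m : ℕ} {B : Q (suc m)} (q : IsQuiver B) (xs : List (Exponent (suc m))) : Set where
   field
    series  : Series (suc m)
    good    : Good {B = B} q series
    factors : series ≗ Products.product B xs

  module Rotation {m : ℕ} {B B′ : Q (suc m)} (q : IsQuiver B) (q′ : IsQuiver B′) (k : Fin (suc m))
   (isoIn : ∀ x y → form B′ x y ≡ form B (reflect (weightIn {B = B} q k) k x) (reflect (weightIn {B = B} q k) k y))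
   (isoOut : ∀ x y → form B′ x y ≡ form B (reflect (weightOut {B = B} q k) k x) (reflect (weightOut {B = B} q k) k y))
   (μ-row : ∀ j → B′ k j ≡ ℤ.- B k j) where
   private
    module P  = Products B
    module P′ = Products B′
    module C  = Conv (twist B)
    module C′ = Conv (twist B′)
    module FIn  = Flips {B = B} {B′} q k (weightIn {B = B} q k)  (λ i → ∣ Defs.pos (B i k) ∣) (λ i → pos-abs (B i k)) (cong Defs.pos (diag-zero q k)) isoIn
    module FOut = Flips {B = B} {B′} q k (weightOut {B = B} q k) (λ i → ∣ Defs.pos (B k i) ∣) (λ i → pos-abs (B k i)) (cong Defs.pos (diag-zero q k)) isoOut

   -- Without its first factor E(y_k) the series is the product of the others, so by `product-K`
   -- each of them can be reflected; then E(y_k) reappears at the end. Mutation thus rotates the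
   -- factorization.
   rotate-first : ∀ {ys} → Factored {B = B} q (ê k ∷ ys) → ∃ λ ys′ → Factored {B = B′} q′ ys′
   rotate-first {ys} f = proj₁ l ++ ê k ∷ [] , record { series = M.p′ ; good = M.good′ ; factors = λ y →
     trans (M.p′-right y) (trans (C′.⋆-cong {g = M.D} (λ z → trans (M.In.flip-cong R≗ z) (FIn.flip-products (proj₂ l) z)) (λ _ → refl) y)
      (sym (P′.product-snoc (proj₁ l) k y))) }
    where
    open Factored f
    module M = Mutation {B = B} {B′} q q′ k isoIn isoOut μ-row {series} good
    R≗ : M.R ≗ P.product ys
    R≗ y = trans (sym (C.⋆-identityˡ M.R y)) (trans (sym (C.⋆-cong {g = M.R} M.D⁻¹⋆D (λ _ → refl) y)) (trans (C.⋆-assoc M.D⁻¹ M.D M.R y)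
     (trans (C.⋆-cong {f = M.D⁻¹} (λ _ → refl) (λ z → trans (M.D⋆R z) (trans (factors z) (P.product-cons k ys z))) y)
     (trans (sym (C.⋆-assoc M.D⁻¹ M.D (P.product ys) y)) (trans (C.⋆-cong {g = P.product ys} M.D⁻¹⋆D (λ _ → refl) y) (C.⋆-identityˡ (P.product ys) y))))))
    l : ∃ λ ys′ → FIn.MirrorList ys ys′
    l = FIn.mirror-list ys (FIn.product-K ys (λ a J h → trans (sym (R≗ (insertAt a k J))) (M.R-bounded a J h)))

   rotate-last : ∀ {ys} → Factored {B = B} q (ys ++ ê k ∷ []) → ∃ λ ys′ → Factored {B = B′} q′ ys′
   rotate-last {ys} f = ê k ∷ proj₁ l , record { series = M.p′ ; good = M.good′ ; factors = λ y →
     trans (M.p′-left y) (trans (C′.⋆-cong {f = M.D} (λ _ → refl) (λ z → trans (M.Out.flip-cong X≗ z) (FOut.flip-products (proj₂ l) z)) y)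
      (sym (P′.product-cons k (proj₁ l) y))) }
    where
    open Factored f
    module M = Mutation {B = B} {B′} q q′ k isoIn isoOut μ-row {series} good
    X≗ : M.X ≗ P.product ys
    X≗ y = trans (sym (C.⋆-identityʳ M.X y)) (trans (sym (C.⋆-cong {f = M.X} (λ _ → refl) M.D⋆D⁻¹ y)) (trans (sym (C.⋆-assoc M.X M.D M.D⁻¹ y))
     (trans (C.⋆-cong {g = M.D⁻¹} (λ z → trans (M.X⋆D z) (trans (factors z) (P.product-snoc ys k z))) (λ _ → refl) y)
     (trans (C.⋆-assoc (P.product ys) M.D M.D⁻¹ y) (trans (C.⋆-cong {f = P.product ys} (λ _ → refl) M.D⋆D⁻¹ y) (C.⋆-identityʳ (P.product ys) y))))))
    l : ∃ λ ys′ → FOut.MirrorList ys ys′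
    l = FOut.mirror-list ys (FOut.product-K ys (λ a J h → trans (sym (X≗ (insertAt a k J))) (M.X-bounded a J h)))

 -- The state of a green sequence: crossed and uncrossed factors.

 module GreenSteps where
  open import Defs using (Q; IsQuiver; μ; pos)
  open Scalars using (F; 0F; 1F; pw; ε; Pos⇒≢0)
  open Sums
  open Convolution
  open Forms
  open Axes
  open Cuts
  open Mutations
  open Rays
  open Reflections
  open import Data.Integer using (∣_∣; _+_; _*_; -_; _-_; _≤_)
  open import Data.Fin.Properties using (all?)
  open import Data.Vec.Properties using (removeAt-insertAt; insertAt-lookup; insertAt-removeAt)
  open import Data.List using (_++_)
  open import Data.List.Properties using (++-assoc)
  open import Data.List.Relation.Binary.Pointwise as Pointwise using (Pointwise; []; _∷_)
  open import Data.List.Membership.Propositional using (_∈_)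
  open import Data.List.Membership.Propositional.Properties using (∈-++⁻; ∈-++⁺ˡ; ∈-++⁺ʳ)
  open import Data.List.Relation.Unary.Any using (here; there)

  open ≡-Reasoning

  Rows : ℕ → Set
  Rows n = Fin n → Lattice n

  -- With the c-vectors as rows of `C`, this writes an exponent of the current lattice in the
  -- coordinates of the initial one.
  image : ∀ {n} → Rows n → Lattice n → Lattice n
  image C y j = dot y (λ i → C i j)

  image-cong : ∀ {n} (C : Rows n) {x y} → x ≗ y → image C x ≗ image C y
  image-cong C e j = dot-cong {x = λ i → C i j} e (λ _ → refl)

  image-unit : ∀ {n} (C : Rows n) i → image C (unit i) ≗ C i
  image-unit C i j = dot-unitˡ i (λ l → C l j)

  image-insert : ∀ {m} (C : Rows (suc m)) k J a j → image C ⟦ insertAt a k J ⟧ j ≡ ⁺ J * C k j + image C ⟦ insertAt a k 0 ⟧ j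
  image-insert C k J a j = trans (image-cong C (lattice-insert k J a) j) (trans (dot-+ˡ ⟦ insertAt a k 0 ⟧ (λ i → ⁺ J * unit k i) (λ i → C i j))
   (trans (cong (image C ⟦ insertAt a k 0 ⟧ j +_) (trans (dot-*ˡ (⁺ J) (unit k) (λ i → C i j)) (cong (⁺ J *_) (image-unit C k j)))) (ℤP.+-comm _ (⁺ J * C k j))))

  image-⊕ : ∀ {n} (C : Rows n) a b j → image C ⟦ a ⊕ b ⟧ j ≡ image C ⟦ a ⟧ j + image C ⟦ b ⟧ j
  image-⊕ C a b j = trans (image-cong C (⟦⊕⟧ a b) j) (dot-+ˡ ⟦ a ⟧ ⟦ b ⟧ (λ i → C i j))

  image-𝟘 : ∀ {n} (C : Rows n) j → image C ⟦ 𝟘 ⟧ j ≡ 0ℤ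
  image-𝟘 C j = trans (image-cong C ⟦𝟘⟧ j) (trans (dot-comm (λ _ → 0ℤ) (λ i → C i j)) (dot-0ʳ (λ i → C i j)))

  scale-nonneg : ∀ J {u} → 0ℤ ≤ u → 0ℤ ≤ ⁺ J * u
  scale-nonneg J {u} h = subst (λ t → t ≤ ⁺ J * u) (ℤP.*-zeroʳ (⁺ J)) (ℤP.*-monoˡ-≤-nonNeg (⁺ J) h)

  image-nonpos : ∀ {n} (C : Rows n) j → (∀ i → C i j ≤ 0ℤ) → ∀ (a : Vec ℕ n) → image C ⟦ a ⟧ j ≤ 0ℤ
  image-nonpos C j h a = go (λ i → C i j) h a
   where
   go : ∀ {n} (φ : Lattice n) → (∀ i → φ i ≤ 0ℤ) → ∀ (a : Vec ℕ n) → dot ⟦ a ⟧ φ ≤ 0ℤ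
   go φ h []      = ℤP.≤-refl
   go φ h (x ∷ a) = ℤP.+-mono-≤ (subst (λ t → ⁺ x * φ zero ≤ t) (ℤP.*-zeroʳ (⁺ x)) (ℤP.*-monoˡ-≤-nonNeg (⁺ x) (h zero))) (go (λ i → φ (suc i)) (λ i → h (suc i)) a)

  nonneg+≤ : ∀ {u v} → 0ℤ ≤ v → u ≤ u + v
  nonneg+≤ {u} {v} h = subst (λ t → t ≤ u + v) (ℤP.+-identityʳ u) (ℤP.+-monoʳ-≤ u h)

  -- A standard basis vector is indecomposable among the nonnegative integer vectors.
  unit-part : ∀ {n} l J (u v : Lattice n) → (∀ j → 0ℤ ≤ u j) → (∀ j → 0ℤ ≤ v j) →
   (∀ j → ⁺ suc J * u j + v j ≡ unit l j) → ¬ (∀ j → u j ≡ 0ℤ) → u ≗ unit l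
  unit-part l J u v u≥0 v≥0 e u≢0 = fin (u l ℤ.≟ 0ℤ)
   where
   bound : ∀ j → u j ≤ unit l j
   bound j = subst (u j ≤_) (e j) (ℤP.≤-trans (subst (u j ≤_) (lem (⁺ J) (u j)) (nonneg+≤ (scale-nonneg J (u≥0 j)))) (nonneg+≤ (v≥0 j)))
    where
    lem : ∀ J u → u + J * u ≡ (1ℤ + J) * u
    lem = solve-∀
   off : ∀ j → j ≢ l → u j ≡ 0ℤ
   off j h = ℤP.≤-antisym (subst (u j ≤_) (unit-≢ h) (bound j)) (u≥0 j)
   one : ∀ z → 0ℤ ≤ z → z ≤ 1ℤ → z ≢ 0ℤ → z ≡ 1ℤ
   one (⁺ 0) _ _ h = ⊥-elim (h refl)
   one (⁺ 1) _ _ _ = refl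
   one (⁺ suc (suc n)) _ (ℤ.+≤+ (ℕ.s≤s ())) _
   fin : Dec (u l ≡ 0ℤ) → u ≗ unit l
   fin (yes z) = ⊥-elim (u≢0 (λ j → case j (j ≟ᶠ l)))
    where
    case : ∀ j → Dec (j ≡ l) → u j ≡ 0ℤ
    case j (yes refl) = z
    case j (no h)     = off j h
   fin (no h) j = case j (j ≟ᶠ l)
    where
    case : ∀ j → Dec (j ≡ l) → u j ≡ unit l j
    case j (yes refl) = trans (one (u l) (u≥0 l) (subst (u l ≤_) (unit-same l) (bound l)) h) (sym (unit-same l))
    case j (no h)     = trans (off j h) (sym (unit-≢ h))

  NonNegative : ∀ {n} → Lattice n → Set
  NonNegative u = ∀ j → 0ℤ ≤ u j

  nonnegative? : ∀ {n} (u : Lattice n) → NonNegative u ⊎ ¬ NonNegative u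
  nonnegative? u with all? (λ j → 0ℤ ℤ.≤? u j)
  ... | yes h = inj₁ h
  ... | no h  = inj₂ h

  support-⋆ : ∀ {n} (τ : Twist n) (P : Vec ℕ n → Set) → (∀ x → P x ⊎ ¬ P x) → (∀ a b → P a → P b → P (a ⊕ b)) →
   ∀ f g → (∀ x → f x ≡ 0F ⊎ P x) → (∀ x → g x ≡ 0F ⊎ P x) → ∀ x → Conv._⋆_ τ f g x ≡ 0F ⊎ P x
  support-⋆ τ P P? P-⊕ f g hf hg x with P? x
  ... | inj₁ h = inj₂ h
  ... | inj₂ h = inj₁ (Conv.⋆-zero τ f g x (λ a b e → go a b e (hf a) (hg b)))
   where
   go : ∀ a b → a ⊕ b ≡ x → f a ≡ 0F ⊎ P a → g b ≡ 0F ⊎ P b → f a ≡ 0F ⊎ g b ≡ 0F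
   go a b e (inj₁ z) _        = inj₁ z
   go a b e (inj₂ _) (inj₁ z) = inj₂ z
   go a b e (inj₂ p) (inj₂ r) = ⊥-elim (h (subst P e (P-⊕ a b p r)))

  neg-nonneg : ∀ {u} → u ≤ 0ℤ → 0ℤ ≤ - u
  neg-nonneg = ℤP.neg-mono-≤

  product-support : ∀ {m} (B : Q (suc m)) (C : Rows (suc m)) xs → (∀ {x} → x ∈ xs → ∀ j → image C ⟦ proj₁ x ⟧ j ≤ 0ℤ) →
   ∀ y → Products.product B xs y ≡ 0F ⊎ (∀ j → image C ⟦ y ⟧ j ≤ 0ℤ)
  product-support {m} B C xs h = go xs h
   where
   P : Vec ℕ (suc m) → Set
   P y = ∀ j → image C ⟦ y ⟧ j ≤ 0ℤ
   P? : ∀ y → P y ⊎ ¬ P y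
   P? y with all? (λ j → image C ⟦ y ⟧ j ℤ.≤? 0ℤ)
   ... | yes h = inj₁ h
   ... | no h  = inj₂ h
   P-⊕ : ∀ a b → P a → P b → P (a ⊕ b)
   P-⊕ a b p r j = subst (_≤ 0ℤ) (sym (image-⊕ C a b j)) (ℤP.+-mono-≤ (p j) (r j))
   P-𝟘 : P 𝟘
   P-𝟘 j = ℤP.≤-reflexive (image-𝟘 C j)
   P-multiple : ∀ x → P x → ∀ t → P (t · x)
   P-multiple x p zero    = subst P (sym (·-zero x)) P-𝟘
   P-multiple x p (suc t) = subst P (sym (·-suc t x)) (P-⊕ x (t · x) p (P-multiple x p t))
   ray-P : ∀ x x≢ → P x → ∀ y → ray x x≢ y ≡ 0F ⊎ P y
   ray-P x x≢ p y with multiple? x y x≢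
   ... | inj₁ (t , e) = inj₂ (subst P (sym e) (P-multiple x p t))
   ... | inj₂ f       = inj₁ (ray-off x x≢ y f)
   go : ∀ xs → (∀ {x} → x ∈ xs → P (proj₁ x)) → ∀ y → Products.product B xs y ≡ 0F ⊎ P y
   go [] h y with 𝟘? y
   ... | inj₁ refl = inj₂ P-𝟘
   ... | inj₂ y≢   = inj₁ (δ-≢ y y≢)
   go ((x , x≢) ∷ xs) h = support-⋆ (twist B) P P? P-⊕ (ray x x≢) (Products.product B xs) (ray-P x x≢ (h (here refl))) (go xs (λ i → h (there i)))

  -- The situation after some green mutations: `xs` lists the factors already crossed, `z` is the
  -- part of the series still ahead, `C` holds the c-vectors. Signs are recorded for the images of
  -- the supports of `z` and `xs`, in place of sign-coherence of the rows. `seen` follows each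
  -- initial generator from `z` into `xs`; `first` and `last` remember that the outermost factors
  -- are simple, in the initial and in the current lattice.
  record State {m : ℕ} (B₀ : Q (suc m)) {B : Q (suc m)} (q : IsQuiver B) (C : Rows (suc m)) : Set where
   field
    p z        : Series (suc m)
    xs         : List (Exponent (suc m))
    good       : Good {B = B} q p
    factors    : p ≗ Conv._⋆_ (twist B) z (Products.product B xs)
    z-𝟘        : z 𝟘 ≡ 1F
    isometric  : ∀ x y → form B x y ≡ form B₀ (image C x) (image C y)
    faithful   : ∀ x → (∀ j → image C x j ≡ 0ℤ) → ∀ i → x i ≡ 0ℤ
    z-support  : ∀ a → z a ≡ 0F ⊎ NonNegative (image C ⟦ a ⟧)
    xs-support : ∀ {x} → x ∈ xs → ∀ j → image C ⟦ proj₁ x ⟧ j ≤ 0ℤ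
    seen       : ∀ l → (∃ λ α → image C ⟦ α ⟧ ≗ unit l × z α ≢ 0F) ⊎ (∃ λ x → x ∈ xs × (∀ j → image C ⟦ proj₁ x ⟧ j ≡ - unit l j))
    first      : (xs ≡ [] × (∀ i → C i ≗ unit i)) ⊎ (∃ λ x → ∃ λ ys → ∃ λ l → xs ≡ x ∷ ys × (∀ j → image C ⟦ proj₁ x ⟧ j ≡ - unit l j))
    last       : xs ≡ [] ⊎ (∃ λ ys → ∃ λ k → xs ≡ ys ++ ê k ∷ [])

   row≢0 : ∀ i → ¬ (∀ j → C i j ≡ 0ℤ)
   row≢0 i h with trans (sym (unit-same i)) (faithful (unit i) (λ j → trans (image-unit C i j) (h j)) i)
   ... | ()

   faithful-≡ : ∀ x y → (∀ j → image C ⟦ x ⟧ j ≡ image C ⟦ y ⟧ j) → x ≡ y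
   faithful-≡ x y h = ⟦⟧-injective x y (λ i → ℤP.i-j≡0⇒i≡j _ _ (faithful (λ i → ⟦ x ⟧ i - ⟦ y ⟧ i)
    (λ j → trans (dot-+ˡ ⟦ x ⟧ (λ i → - ⟦ y ⟧ i) (λ i → C i j)) (trans (cong (image C ⟦ x ⟧ j +_) (dot-negˡ ⟦ y ⟧ (λ i → C i j))) (ℤP.i≡j⇒i-j≡0 (h j)))) i))

  initial : ∀ {m} {B : Q (suc m)} (q : IsQuiver B) (C : Rows (suc m)) → (∀ i → C i ≗ unit i) → State B q C
  initial {m} {B} q C hC = record
   { p = canonical ; z = canonical ; xs = [] ; good = canonical-good
   ; factors = λ y → sym (Conv.⋆-identityʳ (twist B) canonical y)
   ; z-𝟘 = Good.unit-term canonical-good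
   ; isometric = λ x y → sym (form-cong B (im x) (im y))
   ; faithful = λ x h i → trans (sym (im x i)) (h i)
   ; z-support = λ a → inj₂ (λ j → subst (0ℤ ≤_) (sym (im ⟦ a ⟧ j)) (ℤ.+≤+ ℕ.z≤n))
   ; xs-support = λ ()
   ; seen = λ l → inj₁ (e l , (λ j → trans (im ⟦ e l ⟧ j) (trans (lattice-axis l 1 j) (ℤP.*-identityˡ _))) ,
     λ h → Pos⇒≢0 (Scalars.Pos-ε 1) (trans (sym (Good.axis canonical-good l 1)) h))
   ; first = inj₁ (refl , hC)
   ; last = inj₁ refl }
   where
   open Existence {B = B} q
   im : ∀ x → image C x ≗ x
   im x j = trans (dot-cong {φ = x} (λ _ → refl) (λ i → trans (hC i j) (unit-sym i j))) (dot-unitʳ x j)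
    where
    unit-sym : ∀ {n} (i j : Fin n) → unit i j ≡ unit j i
    unit-sym i j with j ≟ᶠ i | i ≟ᶠ j
    ... | yes _ | yes _ = refl
    ... | no _  | no _  = refl
    ... | yes h | no g  = ⊥-elim (g (sym h))
    ... | no g  | yes h = ⊥-elim (g (sym h))

  module Step {m : ℕ} (B₀ : Q (suc m)) {B B′ : Q (suc m)} (q : IsQuiver B) (q′ : IsQuiver B′) (k : Fin (suc m))
   (isoIn : ∀ x y → form B′ x y ≡ form B (reflect (weightIn {B = B} q k) k x) (reflect (weightIn {B = B} q k) k y))
   (isoOut : ∀ x y → form B′ x y ≡ form B (reflect (weightOut {B = B} q k) k x) (reflect (weightOut {B = B} q k) k y))
   (μ-row : ∀ j → B′ k j ≡ - B k j)
   (C C′ : Rows (suc m)) (green : NonNegative (C k))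
   (C′-eq : ∀ i j → C′ i j ≡ C i j + (weightIn {B = B} q k i - ⁺ 2 * unit k i) * C k j)
   (S : State B₀ q C) where

   open State S
   private
    w = weightIn {B = B} q k
    wk : w k ≡ 0ℤ
    wk = cong pos (diag-zero q k)
    module M = Mutation {B = B} {B′} q q′ k isoIn isoOut μ-row {p} good
    module Fl = Flips {B = B} {B′} q k w (λ i → ∣ pos (B i k) ∣) (λ i → pos-abs (B i k)) wk isoIn
    module V = Conv (twist B)
    module V′ = Conv (twist B′)
    module P = Products B
    module P′ = Products B′

    -- At a green vertex the mutation rule for c-vectors is the transpose of the reflection with
    -- incoming weights, so mirror exponents keep their image.
    image-reflect : ∀ y → image C′ y ≗ image C (reflect w k y)
    image-reflect y j = begin
     dot y (λ i → C′ i j)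
      ≡⟨ dot-cong {φ = y} (λ _ → refl) (λ i → trans (C′-eq i j) (cong (C i j +_) (ℤP.*-comm (coeff i) (C k j)))) ⟩
     dot y (λ i → C i j + C k j * coeff i)
      ≡⟨ trans (dot-+ʳ y (λ i → C i j) (λ i → C k j * coeff i)) (cong (dot y (λ i → C i j) +_) (trans (dot-*ʳ (C k j) y coeff) (cong (C k j *_) coeff-dot))) ⟩
     dot y (λ i → C i j) + C k j * c
      ≡⟨ cong (dot y (λ i → C i j) +_) (trans (ℤP.*-comm (C k j) c) (sym (trans (dot-*ˡ c (unit k) (λ i → C i j)) (cong (c *_) (dot-unitˡ k (λ i → C i j)))))) ⟩
     dot y (λ i → C i j) + dot (λ i → c * unit k i) (λ i → C i j)
      ≡⟨ sym (dot-+ˡ y (λ i → c * unit k i) (λ i → C i j)) ⟩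
     dot (reflect w k y) (λ i → C i j) ∎
     where
     coeff : Lattice (suc m)
     coeff i = w i - ⁺ 2 * unit k i
     c = dot w y - ⁺ 2 * y k
     coeff-dot : dot y coeff ≡ c
     coeff-dot = trans (dot-comm y coeff) (trans (dot-+ˡ w (λ j → - (⁺ 2 * unit k j)) y) (cong (dot w y +_)
      (trans (dot-negˡ (λ j → ⁺ 2 * unit k j) y) (cong -_ (trans (dot-*ˡ (⁺ 2) (unit k) y) (cong (⁺ 2 *_) (dot-unitˡ k y)))))))

    reflect-involutive : ∀ y → reflect w k (reflect w k y) ≗ y
    reflect-involutive y i = trans (cong₂ (λ u v → (y i + c * unit k i) + (u - ⁺ 2 * (y k + c * v)) * unit k i)
      (trans (dot-+ʳ w y (λ i → c * unit k i)) (cong (dot w y +_) (trans (dot-*ʳ c w (unit k)) (cong (c *_) (trans (dot-unitʳ w k) wk))))) (unit-same k))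
      (lem (y i) (dot w y) (y k) (unit k i))
     where
     c = dot w y - ⁺ 2 * y k
     lem : ∀ y d t u → (y + (d - ⁺ 2 * t) * u) + ((d + (d - ⁺ 2 * t) * 0ℤ) - ⁺ 2 * (t + (d - ⁺ 2 * t) * 1ℤ)) * u ≡ y
     lem = solve-∀

    Nonneg : Vec ℕ (suc m) → Set
    Nonneg a = NonNegative (image C ⟦ a ⟧)
    Nonneg-⊕ : ∀ a b → Nonneg a → Nonneg b → Nonneg (a ⊕ b)
    Nonneg-⊕ a b p r j = subst (0ℤ ≤_) (sym (image-⊕ C a b j)) (ℤP.+-mono-≤ (p j) (r j))

    image-axis : ∀ J j → image C ⟦ insertAt 𝟘 k J ⟧ j ≡ ⁺ J * C k j
    image-axis J j = trans (image-insert C k J 𝟘 j) (trans (cong (⁺ J * C k j +_) (trans (cong (λ v → image C ⟦ v ⟧ j) (insert-𝟘 k)) (image-𝟘 C j))) (ℤP.+-identityʳ _))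

    axis-Nonneg : ∀ {f : Series (suc m)} → (∀ J a → a ≢ 𝟘 → f (insertAt a k J) ≡ 0F) → ∀ x → f x ≡ 0F ⊎ Nonneg x
    axis-Nonneg {f} h = insert-view k _ (λ J a → go J a (𝟘? a))
     where
     go : ∀ J a → a ≡ 𝟘 ⊎ a ≢ 𝟘 → f (insertAt a k J) ≡ 0F ⊎ Nonneg (insertAt a k J)
     go J a (inj₂ a≢)   = inj₁ (h J a a≢)
     go J .𝟘 (inj₁ refl) = inj₂ (λ j → subst (0ℤ ≤_) (sym (image-axis J j)) (scale-nonneg J (green j)))

    W z″ : Series (suc m)
    W  = P.product xs
    z″ = M.D⁻¹ V.⋆ z

    z″-𝟘 : z″ 𝟘 ≡ 1F
    z″-𝟘 = V.⋆-𝟘 M.D⁻¹ z M.D⁻¹-𝟘 z-𝟘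

    z″-support : ∀ a → z″ a ≡ 0F ⊎ Nonneg a
    z″-support = support-⋆ (twist B) Nonneg (λ x → nonnegative? (image C ⟦ x ⟧)) Nonneg-⊕ M.D⁻¹ z (axis-Nonneg {M.D⁻¹} M.D⁻¹-axis) z-support

    D⋆z″ : M.D V.⋆ z″ ≗ z
    D⋆z″ y = trans (sym (V.⋆-assoc M.D M.D⁻¹ z y)) (trans (V.⋆-cong {g = z} M.D⋆D⁻¹ (λ _ → refl) y) (V.⋆-identityˡ z y))

    R≗ : M.R ≗ z″ V.⋆ W
    R≗ y = trans (sym (V.⋆-identityˡ M.R y)) (trans (sym (V.⋆-cong {g = M.R} M.D⁻¹⋆D (λ _ → refl) y)) (trans (V.⋆-assoc M.D⁻¹ M.D M.R y)
     (trans (V.⋆-cong {f = M.D⁻¹} (λ _ → refl) (λ t → trans (M.D⋆R t) (factors t)) y) (sym (V.⋆-assoc M.D⁻¹ z W y)))))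

    -- The image of a common exponent would be both nonnegative and nonpositive, hence 0, against
    -- faithfulness.
    disjoint : ∀ x → x ≢ 𝟘 → z″ x ≡ 0F ⊎ W x ≡ 0F
    disjoint x x≢ = go (z″-support x) (product-support B C xs xs-support x)
     where
     go : z″ x ≡ 0F ⊎ Nonneg x → W x ≡ 0F ⊎ (∀ j → image C ⟦ x ⟧ j ≤ 0ℤ) → z″ x ≡ 0F ⊎ W x ≡ 0F
     go (inj₁ h) _        = inj₁ h
     go (inj₂ _) (inj₁ h) = inj₂ h
     go (inj₂ p) (inj₂ r) = ⊥-elim (x≢ (faithful-≡ x 𝟘 (λ j → trans (ℤP.≤-antisym (r j) (p j)) (sym (image-𝟘 C j)))))

    -- The bound on the support of `M.R` is inherited by both of its factors, since by `disjoint`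
    -- their coefficients cannot cancel.
    off : ∀ x → ¬ M.In.K x → z″ x ≡ 0F × W x ≡ 0F
    off = V.Support.off-K-everywhere M.In.K M.In.K? M.In.K-𝟘 (λ {a} {b} → M.In.K-⊕ {a} {b}) {M.R} {z″} {W} z″-𝟘 (P.product-𝟘 xs) R≗ disjoint
     (M.In.Bounded⇒off-K {M.R} M.R-bounded)

    z″-bounded : M.In.Bounded z″
    z″-bounded = M.In.off-K⇒Bounded {z″} (λ x h → proj₁ (off x h))

    W-bounded : M.In.Bounded W
    W-bounded = M.In.off-K⇒Bounded {W} (λ x h → proj₂ (off x h))

    l : ∃ λ ys → Fl.MirrorList xs ys
    l = Fl.mirror-list xs (Fl.product-K xs W-bounded)

    ys : List (Exponent (suc m))
    ys = proj₁ l

    image-mirror : ∀ {x x′} → Fl.Mirrors x x′ → ∀ j → image C′ ⟦ x′ ⟧ j ≡ image C ⟦ x ⟧ j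
    image-mirror {x} {x′} h j = trans (image-reflect ⟦ x′ ⟧ j) (image-cong C (Fl.Mirrors-reflect h) j)

    image-insert-mirror : ∀ a i j → i ℕ.+ j ≡ M.In.β a → ∀ t → image C′ ⟦ insertAt a k j ⟧ t ≡ image C ⟦ insertAt a k i ⟧ t
    image-insert-mirror a i j e t = image-mirror (a , i , j , e , refl , refl) t

    image-e : ∀ j → image C′ ⟦ e k ⟧ j ≡ - C k j
    image-e j = trans (image-cong C′ (λ i → trans (lattice-axis k 1 i) (ℤP.*-identityˡ _)) j) (trans (image-unit C′ k j) (trans (C′-eq k j)
     (trans (cong₂ (λ u v → C k j + (u - ⁺ 2 * v) * C k j) wk (unit-same k)) (lem (C k j)))))
     where
     lem : ∀ c → c + (0ℤ - ⁺ 2 * 1ℤ) * c ≡ - c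
     lem = solve-∀

    mirror-∈ : ∀ {xs ys x} → Fl.MirrorList xs ys → x ∈ xs → ∃ λ y → y ∈ ys × Fl.Mirrors (proj₁ x) (proj₁ y)
    mirror-∈ (h ∷ hs) (here refl) = _ , here refl , h
    mirror-∈ (h ∷ hs) (there i) with mirror-∈ hs i
    ... | y , j , g = y , there j , g

    mirror-∋ : ∀ {xs ys y} → Fl.MirrorList xs ys → y ∈ ys → ∃ λ x → x ∈ xs × Fl.Mirrors (proj₁ x) (proj₁ y)
    mirror-∋ (h ∷ hs) (here refl) = _ , here refl , h
    mirror-∋ (h ∷ hs) (there i) with mirror-∋ hs i
    ... | y , j , g = y , there j , g

    xs′ : List (Exponent (suc m))
    xs′ = ys ++ ê k ∷ []

    z′ : Series (suc m)
    z′ = M.In.flip z″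

    z′-support : ∀ a → z′ a ≡ 0F ⊎ NonNegative (image C′ ⟦ a ⟧)
    z′-support = insert-view k _ (λ J a → go J a (J ℕ.≤? M.In.β a))
     where
     go : ∀ J a → Dec (J ℕ.≤ M.In.β a) → z′ (insertAt a k J) ≡ 0F ⊎ NonNegative (image C′ ⟦ insertAt a k J ⟧)
     go J a (no h)  = inj₁ (M.In.flip-out z″ a J (ℕP.≰⇒> h))
     go J a (yes h) = cases (z″-support (insertAt a k (M.In.β a ℕ.∸ J)))
      where
      eq = ℕP.m∸n+n≡m h
      cases : _ → z′ (insertAt a k J) ≡ 0F ⊎ NonNegative (image C′ ⟦ insertAt a k J ⟧)
      cases (inj₁ v) = inj₁ (trans (M.In.flip-in z″ a _ J eq) v)
      cases (inj₂ v) = inj₂ (λ t → subst (0ℤ ≤_) (sym (image-insert-mirror a _ J eq t)) (v t))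

    xs′-support : ∀ {x} → x ∈ xs′ → ∀ j → image C′ ⟦ proj₁ x ⟧ j ≤ 0ℤ
    xs′-support {y} i j = go (∈-++⁻ ys i)
     where
     go : y ∈ ys ⊎ y ∈ ê k ∷ [] → image C′ ⟦ proj₁ y ⟧ j ≤ 0ℤ
     go (inj₁ i′) = let (x , ix , h) = mirror-∋ (proj₂ l) i′ in subst (_≤ 0ℤ) (sym (image-mirror h j)) (xs-support ix j)
     go (inj₂ (here refl)) = subst (_≤ 0ℤ) (sym (image-e j)) (ℤP.neg-mono-≤ (green j))

    seen′ : ∀ t → (∃ λ α → image C′ ⟦ α ⟧ ≗ unit t × z′ α ≢ 0F) ⊎ (∃ λ x → x ∈ xs′ × (∀ j → image C′ ⟦ proj₁ x ⟧ j ≡ - unit t j))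
    seen′ t = go (seen t) (all? (λ j → C k j ℤ.≟ unit t j))
     where
     go : _ → Dec (∀ j → C k j ≡ unit t j) → (∃ λ α → image C′ ⟦ α ⟧ ≗ unit t × z′ α ≢ 0F) ⊎ (∃ λ x → x ∈ xs′ × (∀ j → image C′ ⟦ proj₁ x ⟧ j ≡ - unit t j))
     -- The mutation at k crosses the initial generator t at this very moment.
     go _ (yes h) = inj₂ (ê k , ∈-++⁺ʳ ys (here refl) , λ j → trans (image-e j) (cong -_ (h j)))
     go (inj₂ (x , i , h)) (no _) = let (y , iy , g) = mirror-∈ (proj₂ l) i in inj₂ (y , ∈-++⁺ˡ iy , λ j → trans (image-mirror g j) (h j))
     go (inj₁ (α , hα , zα)) (no ¬h) = inj₁ (transfer α hα z″α)
      where
      z″α : z″ α ≢ 0F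
      z″α v = zα (trans (sym (D⋆z″ α)) (V.⋆-zero M.D z″ α (λ a b e → insert-view k (λ a → a ⊕ b ≡ α → M.D a ≡ 0F ⊎ z″ b ≡ 0F)
       (λ J a e → split J a b e (𝟘? a) (z″-support b)) a e)))
       where
       split : ∀ J a b → insertAt a k J ⊕ b ≡ α → a ≡ 𝟘 ⊎ a ≢ 𝟘 → z″ b ≡ 0F ⊎ Nonneg b → M.D (insertAt a k J) ≡ 0F ⊎ z″ b ≡ 0F
       split J a b e (inj₂ a≢) _ = inj₁ (dilog-off k J a a≢)
       split J a b e (inj₁ _) (inj₁ v) = inj₂ v
       split zero .𝟘 b e (inj₁ refl) (inj₂ _) = inj₂ (trans (cong z″ (trans (sym (⊕-identityˡ b)) (trans (cong (_⊕ b) (sym (insert-𝟘 k))) e))) v)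
       -- A positive multiple of the c-vector of k plus a nonnegative image is a unit vector only if
       -- the c-vector is that unit vector, which is excluded in this case.
       split (suc J) .𝟘 b e (inj₁ refl) (inj₂ nb) = ⊥-elim (¬h (unit-part t J (C k) (image C ⟦ b ⟧) green nb
        (λ j → trans (cong (_+ image C ⟦ b ⟧ j) (sym (image-axis (suc J) j))) (trans (sym (image-⊕ C (insertAt 𝟘 k (suc J)) b j)) (trans (cong (λ v → image C ⟦ v ⟧ j) e) (hα j)))) (row≢0 k)))
      transfer : ∀ α → image C ⟦ α ⟧ ≗ unit t → z″ α ≢ 0F → ∃ λ α → image C′ ⟦ α ⟧ ≗ unit t × z′ α ≢ 0F
      transfer = insert-view k _ (λ I a → tr I a (I ℕ.≤? M.In.β a))
       where
       tr : ∀ I a → Dec (I ℕ.≤ M.In.β a) → image C ⟦ insertAt a k I ⟧ ≗ unit t → z″ (insertAt a k I) ≢ 0F → ∃ λ α → image C′ ⟦ α ⟧ ≗ unit t × z′ α ≢ 0F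
       tr I a (no h) _ v = ⊥-elim (v (z″-bounded a I (ℕP.≰⇒> h)))
       tr I a (yes h) im v = insertAt a k J , (λ j → trans (image-insert-mirror a I J eq j) (im j)) , (λ g → v (trans (sym (M.In.flip-in z″ a I J eq)) g))
        where
        J = M.In.β a ℕ.∸ I
        eq : I ℕ.+ J ≡ M.In.β a
        eq = ℕP.m+[n∸m]≡n h

    -- New factors are appended at the end, so the first one stays the reflection of the very first
    -- crossing, made when the c-vectors were unit vectors.
    first′ : (xs′ ≡ [] × (∀ i → C′ i ≗ unit i)) ⊎ (∃ λ x → ∃ λ zs → ∃ λ t → xs′ ≡ x ∷ zs × (∀ j → image C′ ⟦ proj₁ x ⟧ j ≡ - unit t j))
    first′ = inj₂ (go first (proj₂ l))
     where
     go : _ → ∀ {ys} → Fl.MirrorList xs ys → ∃ λ x → ∃ λ zs → ∃ λ t → ys ++ ê k ∷ [] ≡ x ∷ zs × (∀ j → image C′ ⟦ proj₁ x ⟧ j ≡ - unit t j)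
     go (inj₁ (e , h)) L = go-[] (subst (λ xs → Fl.MirrorList xs _) e L)
      where
      go-[] : ∀ {ys} → Fl.MirrorList [] ys → ∃ λ x → ∃ λ zs → ∃ λ t → ys ++ ê k ∷ [] ≡ x ∷ zs × (∀ j → image C′ ⟦ proj₁ x ⟧ j ≡ - unit t j)
      go-[] [] = ê k , [] , k , refl , λ j → trans (image-e j) (cong -_ (h k j))
     go (inj₂ (x , zs , t , e , h)) L = go-∷ (subst (λ xs → Fl.MirrorList xs _) e L)
      where
      go-∷ : ∀ {ys} → Fl.MirrorList (x ∷ zs) ys → ∃ λ x → ∃ λ zs → ∃ λ t → ys ++ ê k ∷ [] ≡ x ∷ zs × (∀ j → image C′ ⟦ proj₁ x ⟧ j ≡ - unit t j)
      go-∷ (g ∷ gs) = _ , _ , t , refl , λ j → trans (image-mirror g j) (h j)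

   next : State B₀ q′ C′
   next = record
    { p = M.p′ ; z = z′ ; xs = xs′ ; good = M.good′
    ; factors = λ y → trans (M.p′-right y) (trans (V′.⋆-cong {g = M.D} (λ t → trans (M.In.flip-cong R≗ t) (trans (M.In.flip-product z″ W z″-bounded W-bounded t)
       (V′.⋆-cong {f = z′} (λ _ → refl) (Fl.flip-products (proj₂ l)) t))) (λ _ → refl) y)
      (trans (V′.⋆-assoc z′ (P′.product ys) M.D y) (V′.⋆-cong {f = z′} (λ _ → refl) (λ t → sym (P′.product-snoc ys k t)) y)))
    ; z-𝟘 = trans (M.In.flip-𝟘 z″) z″-𝟘
    ; isometric = λ x y → trans (isoIn x y) (trans (isometric (reflect w k x) (reflect w k y)) (sym (form-cong B₀ (image-reflect x) (image-reflect y))))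
    ; faithful = λ x h i → trans (sym (reflect-involutive x i)) (reflect-0 (faithful (reflect w k x) (λ j → trans (sym (image-reflect x j)) (h j))) i)
    ; z-support = z′-support
    ; xs-support = xs′-support
    ; seen = seen′
    ; first = first′
    ; last = inj₂ (ys , k , refl) }
    where
    reflect-0 : ∀ {y} → (∀ i → y i ≡ 0ℤ) → ∀ i → reflect w k y i ≡ 0ℤ
    reflect-0 {y} h i = trans (cong₂ (λ u v → u + v * unit k i) (h i) (cong₂ (λ u v → u - ⁺ 2 * v)
     (trans (dot-cong {φ = w} (λ _ → refl) h) (dot-0ʳ w)) (h k))) (lem (unit k i))
     where
     lem : ∀ u → 0ℤ + (0ℤ - ⁺ 2 * 0ℤ) * u ≡ 0ℤ
     lem = solve-∀

 -- From maximal green sequences of the framed quiver to factorizations.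

 module Framings where
  open import Defs
  open Scalars using (F; 0F; 1F; pw; ε; Pos⇒≢0)
  open Sums hiding (δ)
  open Convolution
  open Forms hiding (pos-neg)
  open Axes
  open Cuts
  open Mutations
  open Rays
  open Reflections
  open GreenSteps
  open import Data.Integer using (_+_; _*_; -_; _-_; _≤_)
  open import Data.Fin using (punchOut)
  open import Data.Fin.Properties using (any?; punchOut-injective; injective⇒≤)
  open import Data.Vec.Properties using (insertAt-removeAt)
  open import Data.List using (_++_)
  open import Data.List.Membership.Propositional using (_∈_)
  open import Data.List.Relation.Unary.Any using (here; there)

  open ≡-Reasoning

  injective⇒surjective : ∀ {n} (f : Fin n → Fin n) → (∀ {i j} → f i ≡ f j → i ≡ j) → ∀ k → ∃ λ i → f i ≡ k
  injective⇒surjective {suc n} f inj k with any? (λ i → f i ≟ᶠ k)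
  ... | yes h = h
  ... | no h  = ⊥-elim (ℕP.1+n≰n (injective⇒≤ {f = λ i → punchOut {i = k} {f i} (λ e → h (i , sym e))}
   (λ e → inj (punchOut-injective (λ e → h (_ , sym e)) (λ e → h (_ , sym e)) e))))

  record Tracks {n : ℕ} (M : Mat (Fin n ⊎ Fin n)) (B : Q n) (C : Rows n) : Set where
   field
    arrows : ∀ i j → M (inj₁ i) (inj₁ j) ≡ B i j
    out    : ∀ i j → M (inj₁ i) (inj₂ j) ≡ C i j
    into   : ∀ j i → M (inj₂ j) (inj₁ i) ≡ - C i j

  pos-nonneg : ∀ {z} → 0ℤ ≤ z → pos z ≡ z
  pos-nonneg = ℤP.i≥j⇒i⊔j≡i

  pos-nonpos : ∀ {z} → z ≤ 0ℤ → pos z ≡ 0ℤ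
  pos-nonpos = ℤP.i≤j⇒i⊔j≡j

  mutate-rows : ∀ {n} {B : Q n} → IsQuiver B → Fin n → Rows n → Rows n
  mutate-rows {B = B} q k C i j = C i j + (weightIn {B = B} q k i - ⁺ 2 * unit k i) * C k j

  -- At a green vertex `pos (C k j)` is `C k j` and `pos (- C k j)` is 0, which makes the mutation
  -- rule linear in the rows of `C`.
  mutate-tracks : ∀ {n} {M} {B : Q n} {C} (q : IsQuiver B) k → NonNegative (C k) → Tracks M B C →
   Tracks (mutate decV (inj₁ k) M) (μ k B) (mutate-rows {B = B} q k C)
  mutate-tracks {n} {M} {B} {C} q k green T = record { arrows = ar ; out = o ; into = in′ }
   where
   open Tracks T
   ar : ∀ i j → mutate decV (inj₁ k) M (inj₁ i) (inj₁ j) ≡ μ k B i j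
   ar i j with i ≟ᶠ k | j ≟ᶠ k
   ... | yes _ | yes _ = cong -_ (arrows i j)
   ... | yes _ | no _  = cong -_ (arrows i j)
   ... | no _  | yes _ = cong -_ (arrows i j)
   ... | no _  | no _  = cong₂ (λ u v → u + - v) (cong₂ (λ u v → u + v) (arrows i j) (cong₂ (λ u v → pos u * pos v) (arrows i k) (arrows k j)))
    (cong₂ (λ u v → pos (- u) * pos (- v)) (arrows i k) (arrows k j))
   Ck≤0 : ∀ j → - C k j ≤ 0ℤ
   Ck≤0 j = ℤP.neg-mono-≤ (green j)
   o : ∀ i j → mutate decV (inj₁ k) M (inj₁ i) (inj₂ j) ≡ C i j + (pos (B i k) - ⁺ 2 * unit k i) * C k j
   o i j with i ≟ᶠ k
   ... | yes refl = trans (cong -_ (out i j)) (trans (lem (C i j)) (cong (λ z → C i j + (pos z - ⁺ 2 * 1ℤ) * C i j) (sym (diag-zero q i))))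
    where
    lem : ∀ c → - c ≡ c + (0ℤ - ⁺ 2 * 1ℤ) * c
    lem = solve-∀
   ... | no _ = trans (cong₂ (λ u v → u + - v) (cong₂ (λ u v → u + v) (out i j) (cong₂ (λ u v → pos u * v) (arrows i k) (trans (cong pos (out k j)) (pos-nonneg (green j)))))
     (cong (pos (- M (inj₁ i) (inj₁ k)) *_) (trans (cong (λ z → pos (- z)) (out k j)) (pos-nonpos (Ck≤0 j)))))
     (lem (C i j) (pos (B i k)) (C k j) (pos (- M (inj₁ i) (inj₁ k))))
    where
    lem : ∀ c b d e → c + b * d + - (e * 0ℤ) ≡ c + (b - ⁺ 2 * 0ℤ) * d
    lem = solve-∀
   in′ : ∀ j i → mutate decV (inj₁ k) M (inj₂ j) (inj₁ i) ≡ - (C i j + (pos (B i k) - ⁺ 2 * unit k i) * C k j)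
   in′ j i with i ≟ᶠ k
   ... | yes refl = trans (cong -_ (into j i)) (trans (lem (C i j)) (cong (λ z → - (C i j + (pos z - ⁺ 2 * 1ℤ) * C i j)) (sym (diag-zero q i))))
    where
    lem : ∀ c → - (- c) ≡ - (c + (0ℤ - ⁺ 2 * 1ℤ) * c)
    lem = solve-∀
   ... | no _ = trans (cong₂ (λ u v → u + - v) (cong₂ (λ u v → u + v) (into j i) (cong (_* pos (M (inj₁ k) (inj₁ i))) (trans (cong pos (into j k)) (pos-nonpos (Ck≤0 j)))))
     (cong₂ (λ u v → u * v) (trans (cong (λ z → pos (- z)) (into j k)) (trans (cong pos (ℤP.neg-involutive (C k j))) (pos-nonneg (green j))))
      (cong pos (trans (cong -_ (arrows k i)) (sym (q i k))))))
     (lem (C i j) (pos (B i k)) (C k j) (pos (M (inj₁ k) (inj₁ i))))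
    where
    lem : ∀ c b d e → - c + 0ℤ * e + - (d * b) ≡ - (c + (b - ⁺ 2 * 0ℤ) * d)
    lem = solve-∀

  ray-irrelevant : ∀ {n} {x x′ : Vec ℕ n} h h′ → x ≡ x′ → ray x h ≗ ray x′ h′
  ray-irrelevant {x = x} h h′ refl y = go (multiple? x y h)
   where
   go : (∃ λ j → y ≡ j · x) ⊎ (∀ j → y ≢ j · x) → ray x h y ≡ ray x h′ y
   go (inj₁ (j , refl)) = trans (ray-on x h j) (sym (ray-on x h′ j))
   go (inj₂ f)          = trans (ray-off x h y f) (sym (ray-off x h′ y f))

  -- The last quiver is the initial one up to `τ`. The factorization is stated for the last quiver
  -- because it lives in the lattice of that quiver.
  record Final {m : ℕ} (B₀ : Q (suc m)) : Set where
   field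
    {B}         : Q (suc m)
    q           : IsQuiver B
    τ           : Fin (suc m) → Fin (suc m)
    τ-injective : ∀ {i j} → τ i ≡ τ j → i ≡ j
    relabelled  : ∀ i j → B (τ i) (τ j) ≡ B₀ i j
    {xs ys zs}  : List (Exponent (suc m))
    {f l}       : Fin (suc m)
    factored    : Factored {B = B} q xs
    first       : xs ≡ ê (τ f) ∷ ys
    last        : xs ≡ zs ++ ê (τ l) ∷ []

  zero-vector? : ∀ {n} (x : Vec ℕ n) → x ≢ 𝟘 → ∃ λ i → ∃ λ J → lookup x i ≡ suc J
  zero-vector? []          h = ⊥-elim (h refl)
  zero-vector? (suc J ∷ x) h = zero , J , refl
  zero-vector? (zero ∷ x)  h with zero-vector? x (λ e → h (cong (0 ∷_) e))
  ... | i , J , e = suc i , J , e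

  -- With nonpositive rows all images are nonpositive, which leaves `z` only its constant term.
  -- Hence every initial generator has been crossed, by `row` in a simple exponent, and `C` is minus
  -- a permutation matrix.
  final : ∀ {m} {B₀ B : Q (suc m)} (q : IsQuiver B) (C : Rows (suc m)) → State B₀ q C → (∀ i j → C i j ≤ 0ℤ) → Final B₀
  final {m} {B₀} {B} q C S red = build first last (proj₂ (flipped zero))
   where
   open State S
   z≗δ : z ≗ Sums.δ
   z≗δ a = go (𝟘? a) (z-support a)
    where
    go : a ≡ 𝟘 ⊎ a ≢ 𝟘 → z a ≡ 0F ⊎ NonNegative (image C ⟦ a ⟧) → z a ≡ Sums.δ a
    go (inj₁ e) _        = trans (cong z e) (trans z-𝟘 (sym (trans (cong Sums.δ e) (δ-𝟘 (suc m)))))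
    go (inj₂ h) (inj₁ v) = trans v (sym (δ-≢ a h))
    go (inj₂ h) (inj₂ v) = ⊥-elim (h (faithful-≡ a 𝟘 (λ j → trans (ℤP.≤-antisym (image-nonpos C j (λ i → red i j) a) (v j)) (sym (image-𝟘 C j)))))
   -- Nonpositive rows add up to a negated unit vector; by `unit-part` a row that occurs is that
   -- vector, and faithfulness then makes x simple.
   row : ∀ l x → x ≢ 𝟘 → (∀ j → image C ⟦ x ⟧ j ≡ - unit l j) → ∃ λ i → (∀ j → C i j ≡ - unit l j) × x ≡ e i
   row l x x≢ h = go (zero-vector? x x≢)
    where
    go : (∃ λ i → ∃ λ J → lookup x i ≡ suc J) → ∃ λ i → (∀ j → C i j ≡ - unit l j) × x ≡ e i
    go (i , J , eq) = i , Ci , faithful-≡ x (e i) (λ j → trans (h j) (sym (trans (image-cong C (λ t → trans (lattice-axis i 1 t) (ℤP.*-identityˡ (unit i t))) j) (trans (image-unit C i j) (Ci j)))))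
     where
     a = removeAt x i
     x≡ : insertAt a i (suc J) ≡ x
     x≡ = trans (cong (insertAt a i) (sym eq)) (insertAt-removeAt x i)
     Ci : ∀ j → C i j ≡ - unit l j
     Ci j = trans (sym (ℤP.neg-involutive (C i j))) (cong -_ (unit-part l J (λ j → - C i j) (λ j → - image C ⟦ insertAt a i 0 ⟧ j)
      (λ j → neg-nonneg (red i j)) (λ j → neg-nonneg (image-nonpos C j (λ i → red i j) (insertAt a i 0)))
      (λ j → trans (lem (⁺ suc J) (C i j) (image C ⟦ insertAt a i 0 ⟧ j)) (trans (cong -_ (sym (image-insert C i (suc J) a j)))
       (trans (cong (λ v → - image C ⟦ v ⟧ j) x≡) (trans (cong -_ (h j)) (ℤP.neg-involutive (unit l j))))))
      (λ z → row≢0 i (λ j → trans (sym (ℤP.neg-involutive (C i j))) (cong -_ (z j)))) j))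
      where
      lem : ∀ s c d → s * (- c) + (- d) ≡ - (s * c + d)
      lem = solve-∀
   flipped : ∀ l → ∃ λ i → (∀ j → C i j ≡ - unit l j) × ∃ λ x → x ∈ xs
   flipped l = go (seen l)
    where
    go : _ ⊎ _ → ∃ λ i → (∀ j → C i j ≡ - unit l j) × ∃ λ x → x ∈ xs
    go (inj₁ (α , h , _)) = ⊥-elim (¬1≤0 (subst (_≤ 0ℤ) (trans (h l) (unit-same l)) (image-nonpos C l (λ i → red i l) α)))
     where
     ¬1≤0 : ¬ 1ℤ ≤ 0ℤ
     ¬1≤0 (ℤ.+≤+ ())
    go (inj₂ ((x , x≢) , ix , h)) = let (i , g , _) = row l x x≢ h in i , g , (x , x≢) , ix
   τ : Fin (suc m) → Fin (suc m)
   τ l = proj₁ (flipped l)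
   τ-row : ∀ l j → C (τ l) j ≡ - unit l j
   τ-row l = proj₁ (proj₂ (flipped l))
   τ-injective : ∀ {i j} → τ i ≡ τ j → i ≡ j
   τ-injective {i} {j} h = go (i ≟ᶠ j)
    where
    go : Dec (i ≡ j) → i ≡ j
    go (yes e) = e
    go (no ne) with trans (sym (unit-same i)) (trans (ℤP.neg-injective (trans (sym (τ-row i i)) (trans (cong (λ t → C t i) h) (τ-row j i)))) (unit-≢ ne))
    ... | ()
   τ-unique : ∀ l i → (∀ j → C i j ≡ - unit l j) → i ≡ τ l
   τ-unique l i h = go (i ≟ᶠ τ l)
    where
    go : Dec (i ≡ τ l) → i ≡ τ l
    go (yes eq) = eq
    go (no ne) with trans (sym (trans (lattice-axis i 1 i) (trans (ℤP.*-identityˡ (unit i i)) (unit-same i)))) (trans (cong (λ v → ⟦ v ⟧ i) ee) ez)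
     where
     ee : e i ≡ e (τ l)
     ee = faithful-≡ (e i) (e (τ l)) (λ j → trans (im i j) (trans (h j) (sym (trans (im (τ l) j) (τ-row l j)))))
      where
      im : ∀ i j → image C ⟦ e i ⟧ j ≡ C i j
      im i j = trans (image-cong C (λ t → trans (lattice-axis i 1 t) (ℤP.*-identityˡ (unit i t))) j) (image-unit C i j)
     ez : ⟦ e (τ l) ⟧ i ≡ 0ℤ
     ez = trans (lattice-axis (τ l) 1 i) (trans (ℤP.*-identityˡ (unit (τ l) i)) (unit-≢ ne))
    ... | ()
   p≗ : p ≗ Products.product B xs
   p≗ y = trans (factors y) (trans (Conv.⋆-cong (twist B) {g = Products.product B xs} z≗δ (λ _ → refl) y) (Conv.⋆-identityˡ (twist B) (Products.product B xs) y))
   -- The rows concerned are negated unit vectors, and in a bilinear form the two signs cancel.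
   B-rel : ∀ i j → B (τ i) (τ j) ≡ B₀ i j
   B-rel i j = trans (sym (form-units B (τ i) (τ j))) (trans (isometric (unit (τ i)) (unit (τ j))) (trans (form-cong B₀ {y′ = λ t → - 1ℤ * unit j t} (im i) (im j))
    (trans (form-*ˡ B₀ (- 1ℤ) (unit i) (λ t → - 1ℤ * unit j t)) (trans (cong (- 1ℤ *_) (form-*ʳ B₀ (- 1ℤ) (unit i) (unit j))) (trans (lem (form B₀ (unit i) (unit j))) (form-units B₀ i j))))))
    where
    lem : ∀ b → - 1ℤ * (- 1ℤ * b) ≡ b
    lem = solve-∀
    im : ∀ i j → image C (unit (τ i)) j ≡ - 1ℤ * unit i j
    im i j = trans (image-unit C (τ i) j) (trans (τ-row i j) (lem′ (unit i j)))
     where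
     lem′ : ∀ b → - b ≡ - 1ℤ * b
     lem′ = solve-∀
   nonempty : ∀ {x} {ys : List (Exponent (suc m))} → ys ≡ [] → x ∈ ys → ⊥
   nonempty refl ()
   build : (xs ≡ [] × (∀ i → C i ≗ unit i)) ⊎ (∃ λ x → ∃ λ ys → ∃ λ l → xs ≡ x ∷ ys × (∀ j → image C ⟦ proj₁ x ⟧ j ≡ - unit l j)) →
    xs ≡ [] ⊎ (∃ λ ys → ∃ λ k → xs ≡ ys ++ ê k ∷ []) → _ → Final B₀
   build (inj₁ (e , _)) _ (_ , x , i) = ⊥-elim (nonempty e i)
   build (inj₂ _) (inj₁ e) (_ , x , i) = ⊥-elim (nonempty e i)
   build (inj₂ ((x , x≢) , ys , f , ef , hf)) (inj₂ (zs , k , el)) _ = pick zs el (injective⇒surjective τ τ-injective k)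
    where
    x≡ : x ≡ e (τ f)
    x≡ = let (i , g , h) = row f x x≢ hf in trans h (cong e (τ-unique f i g))
    pick : ∀ zs → xs ≡ zs ++ ê k ∷ [] → (∃ λ l → τ l ≡ k) → Final B₀
    pick [] eq (l , refl) = record { q = q ; τ = τ ; τ-injective = τ-injective ; relabelled = B-rel
     ; factored = record { series = p ; good = good ; factors = λ y → trans (p≗ y) (cong (λ l → Products.product B l y) eq) }
     ; ys = [] ; zs = [] ; f = l ; l = l ; first = refl ; last = refl }
    pick (w ∷ zs) eq (l , refl) = record { q = q ; τ = τ ; τ-injective = τ-injective ; relabelled = B-rel
     ; factored = record { series = p ; good = good ; factors = λ y → trans (p≗ y) (trans (cong (λ l → Products.product B l y) ef)
        (Conv.⋆-cong (twist B) {g = Products.product B ys} (ray-irrelevant x≢ (e≢𝟘 (τ f)) x≡) (λ _ → refl) y)) }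
     ; ys = ys ; zs = ê (τ f) ∷ zs ; f = f ; l = l ; first = refl ; last = cong (ê (τ f) ∷_) (tails (trans (sym ef) eq)) }
     where
     tails : (x , x≢) ∷ ys ≡ w ∷ zs ++ ê (τ l) ∷ [] → ys ≡ zs ++ ê (τ l) ∷ []
     tails refl = refl

  μ-row : ∀ {n} (B : Q n) k j → μ k B k j ≡ - B k j
  μ-row B k j with k ≟ᶠ k
  ... | yes _ = refl
  ... | no h  = ⊥-elim (h refl)

  run : ∀ {m} {B₀ : Q (suc m)} ks {M} {B} {C} (q : IsQuiver B) → Tracks M B C → State B₀ q C → GreenSeq M ks → Final B₀
  run [] {C = C} q T S red = final q C S (λ i j → subst (_≤ 0ℤ) (Tracks.out T i j) (red i j))
  run {B₀ = B₀} (k ∷ ks) {B = B} {C} q T S (green , rest) = run ks (μ-quiver q k) (mutate-tracks {C = C} q k g T)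
    (Step.next B₀ q (μ-quiver q k) k (isometryIn q k) (isometryOut q k) (μ-row B k) C (mutate-rows {B = B} q k C) g (λ _ _ → refl) S) rest
   where
   g : NonNegative (C k)
   g j = subst (0ℤ ≤_) (ℤP.neg-involutive (C k j)) (ℤP.neg-mono-≤ (subst (_≤ 0ℤ) (Tracks.into T j k) (green j)))

  HasMGS⇒Final : ∀ {m} {B : Q (suc m)} → IsQuiver B → HasMGS B → Final B
  HasMGS⇒Final {B = B} q (ks , h) = run ks q tracks (initial q Defs.δ δ-unit) h
   where
   δ-unit : ∀ {n} (i j : Fin n) → Defs.δ i j ≡ unit i j
   δ-unit i j with i ≟ᶠ j | j ≟ᶠ i
   ... | yes _ | yes _ = refl
   ... | no _  | no _  = refl
   ... | yes e | no h  = ⊥-elim (h (sym e))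
   ... | no h  | yes e = ⊥-elim (h (sym e))
   tracks : Tracks (framed B) B Defs.δ
   tracks = record { arrows = λ _ _ → refl ; out = λ _ _ → refl ; into = λ j i → cong -_ (trans (δ-unit j i) (trans (unit-sym i j) (sym (δ-unit i j)))) }
    where
    unit-sym : ∀ {n} (i j : Fin n) → unit j i ≡ unit i j
    unit-sym i j with j ≟ᶠ i | i ≟ᶠ j
    ... | yes _ | yes _ = refl
    ... | no _  | no _  = refl
    ... | yes h | no g  = ⊥-elim (g (sym h))
    ... | no g  | yes h = ⊥-elim (g (sym h))

 -- Restriction to coordinate faces, and the order forced by multiple arrows.

 module Faces where
  open import Defs using (Q; IsQuiver; μ; pos; HasMGS)
  open Scalars
  open Sums
  open Convolution
  open Lines
  open Forms
  open Axes
  open Cuts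
  open Mutations
  open Rays
  open Reflections
  open Framings
  open import Algebra.Bundles using (CommutativeRing)
  import Algebra.Solver.Ring.NaturalCoefficients.Default (CommutativeRing.commutativeSemiring commutativeRing) as FS
  open import Data.Fin using (punchIn; punchOut)
  open import Data.Fin.Properties using (punchIn-punchOut)
  open import Data.Vec using (map)
  open import Data.Vec.Properties using (≡-dec; insertAt-lookup; insertAt-punchIn; removeAt-insertAt; lookup-map)
  import Data.Vec.Functional as Fun
  import Algebra.Properties.Semiring.Sum ℤP.+-*-semiring as Sum

  open FS using (solve; _:=_; _:+_; _:*_)
  open ≡-Reasoning

  1·-identity : ∀ {n} (x : Vec ℕ n) → 1 · x ≡ x
  1·-identity x = trans (·-suc 0 x) (trans (cong (x ⊕_) (·-zero x)) (⊕-identityʳ x))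

  ∑₁-one : ∀ {t} (h : Line) → (E t ∗ h) 1 ≡ h 1 + ε 1 * pw t * h 0
  ∑₁-one {t} h = cong₂ _+_ (trans (*ʳ (trans (cong₂ _*_ ε-0 (trans (cong pw (ℤP.*-zeroʳ t)) pw-0)) (*-identityˡ 1F))) (*-identityˡ (h 1)))
   (*ʳ (cong (λ z → ε 1 * pw z) (ℤP.*-identityʳ t)))

  module Source {m : ℕ} {B : Q (suc m)} (q : IsQuiver B) {p : Series (suc m)} (good : Good {B = B} q p) where
   abstract
    -- Without arrows from the support of a into k the bound on the left remainder is 0 along the
    -- line, so the linear term in y_k comes from E(y_k) alone.
    source-insert : ∀ k a → dot (λ i → pos (B i k)) ⟦ insertAt a k 0 ⟧ ≡ 0ℤ →
     p (insertAt a k 1) ≡ ε 1 * pw (form B (unit k) ⟦ insertAt a k 0 ⟧) * p (insertAt a k 0)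
    source-insert k a h = trans (sym (M.lineR a 1)) (trans (∑₁-one (line k a M.R))
      (trans (cong₂ _+_ (M.R-bounded a 1 (subst (ℕ._< 1) (sym β0) ℕP.≤-refl)) (*ˡ (trans (sym (E-head (form B (unit k) ⟦ insertAt a k 0 ⟧) (line k a M.R))) (M.lineR a 0)))) (+-identityˡ _)))
     where
     module M = Mutation {B = B} {μ k B} q (μ-quiver q k) k (isometryIn q k) (isometryOut q k) (μ-row B k) {p} good
     β0 : M.In.β a ≡ 0
     β0 = ℤP.+-injective (trans (M.In.β-eq a) h)

   source : ∀ k y → lookup y k ≡ 0 → dot (λ i → pos (B i k)) ⟦ y ⟧ ≡ 0ℤ → p (e k ⊕ y) ≡ ε 1 * pw (dot (B k) ⟦ y ⟧) * p y
   source k = insert-view k _ go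
    where
    go : ∀ J a → lookup (insertAt a k J) k ≡ 0 → dot (λ i → pos (B i k)) ⟦ insertAt a k J ⟧ ≡ 0ℤ →
     p (e k ⊕ insertAt a k J) ≡ ε 1 * pw (dot (B k) ⟦ insertAt a k J ⟧) * p (insertAt a k J)
    go J a z h = at0 J (trans (sym (insertAt-lookup a k J)) z) h
     where
     at0 : ∀ J → J ≡ 0 → dot (λ i → pos (B i k)) ⟦ insertAt a k J ⟧ ≡ 0ℤ →
      p (e k ⊕ insertAt a k J) ≡ ε 1 * pw (dot (B k) ⟦ insertAt a k J ⟧) * p (insertAt a k J)
     at0 .0 refl h = trans (cong p (trans (insert-⊕ k 1 0 𝟘 a) (cong (λ v → insertAt v k 1) (⊕-identityˡ a))))
      (trans (source-insert k a h) (cong (λ z → ε 1 * pw z * p (insertAt a k 0)) (form-unitˡ B k ⟦ insertAt a k 0 ⟧)))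

  -- A list of distinct vertices; each entry is a position among the vertices that remain.
  data Face : ℕ → ℕ → Set where
   []  : ∀ {n} → Face 0 n
   _∷_ : ∀ {r n} → Fin (suc n) → Face r n → Face (suc r) (suc n)

  vertex : ∀ {r n} → Face r n → Fin r → Fin n
  vertex (k ∷ S) zero    = k
  vertex (k ∷ S) (suc i) = punchIn k (vertex S i)

  embed : ∀ {r n} → Face r n → Vec ℕ r → Vec ℕ n
  embed []      v       = 𝟘
  embed (k ∷ S) (x ∷ v) = insertAt (embed S v) k x

  embed-𝟘 : ∀ {r n} (S : Face r n) → embed S 𝟘 ≡ 𝟘
  embed-𝟘 []      = refl
  embed-𝟘 (k ∷ S) = trans (cong (λ v → insertAt v k 0) (embed-𝟘 S)) (insert-𝟘 k)

  embed-⊕ : ∀ {r n} (S : Face r n) u v → embed S (u ⊕ v) ≡ embed S u ⊕ embed S v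
  embed-⊕ []      [] []           = sym (⊕-identityˡ 𝟘)
  embed-⊕ (k ∷ S) (x ∷ u) (y ∷ v) = trans (cong (λ z → insertAt z k (x ℕ.+ y)) (embed-⊕ S u v)) (sym (insert-⊕ k x y (embed S u) (embed S v)))

  embed-· : ∀ {r n} (S : Face r n) t v → embed S (t · v) ≡ t · embed S v
  embed-· S zero    v = trans (cong (embed S) (·-zero v)) (trans (embed-𝟘 S) (sym (·-zero (embed S v))))
  embed-· S (suc t) v = trans (cong (embed S) (·-suc t v)) (trans (embed-⊕ S v (t · v)) (trans (cong (embed S v ⊕_) (embed-· S t v)) (sym (·-suc t (embed S v)))))

  embed-injective : ∀ {r n} (S : Face r n) u v → embed S u ≡ embed S v → u ≡ v
  embed-injective []      [] []           h = refl
  embed-injective (k ∷ S) (x ∷ u) (y ∷ v) h with insert-injective k h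
  ... | a , b = cong₂ _∷_ a (embed-injective S u v b)

  lookup-embed : ∀ {r n} (S : Face r n) v i → lookup (embed S v) (vertex S i) ≡ lookup v i
  lookup-embed (k ∷ S) (x ∷ v) zero    = insertAt-lookup (embed S v) k x
  lookup-embed (k ∷ S) (x ∷ v) (suc i) = trans (insertAt-punchIn (embed S v) k x (vertex S i)) (lookup-embed S v i)

  insert-e : ∀ {m} (k : Fin (suc (suc m))) (j : Fin (suc m)) → insertAt (e j) k 0 ≡ e (punchIn k j)
  insert-e         zero    j       = refl
  insert-e         (suc k) zero    = cong (1 ∷_) (insert-𝟘 k)
  insert-e {suc m} (suc k) (suc j) = cong (0 ∷_) (insert-e k j)

  embed-e : ∀ {r m} (S : Face (suc r) (suc m)) i → embed S (e i) ≡ e (vertex S i)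
  embed-e (k ∷ S) zero = cong (λ v → insertAt v k 1) (embed-𝟘 S)
  embed-e {suc r} {suc m} (k ∷ S) (suc i) = trans (cong (λ v → insertAt v k 0) (embed-e S i)) (insert-e k (vertex S i))

  dot-insert : ∀ {m} (φ : Lattice (suc m)) k J (a : Vec ℕ m) → dot φ ⟦ insertAt a k J ⟧ ≡ φ k ℤ.* ⁺ J ℤ.+ dot (λ i → φ (punchIn k i)) ⟦ a ⟧
  dot-insert φ k J a = trans (Sum.sum-remove {i = k} (λ i → φ i ℤ.* ⟦ insertAt a k J ⟧ i)) (cong₂ ℤ._+_ (cong (λ z → φ k ℤ.* ⁺ z) (insertAt-lookup a k J))
   (Sum.sum-cong-≗ (λ i → cong (λ z → φ (punchIn k i) ℤ.* ⁺ z) (insertAt-punchIn a k J i))))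

  dot-embed : ∀ {r n} (S : Face r n) (φ : Lattice n) v → dot φ ⟦ embed S v ⟧ ≡ dot (λ i → φ (vertex S i)) ⟦ v ⟧
  dot-embed []      φ []      = trans (dot-cong {φ = φ} (λ _ → refl) ⟦𝟘⟧) (dot-0ʳ φ)
  dot-embed (k ∷ S) φ (x ∷ v) = trans (dot-insert φ k x (embed S v)) (cong (λ z → φ k ℤ.* ⁺ x ℤ.+ z) (dot-embed S (λ i → φ (punchIn k i)) v))

  ∑-𝟘 : ∀ n (G : Vec ℕ n → Vec ℕ n → F) → ∑ 𝟘 G ≡ G 𝟘 𝟘
  ∑-𝟘 zero    G = refl
  ∑-𝟘 (suc n) G = ∑-𝟘 n (λ a b → G (0 ∷ a) (0 ∷ b))

  ∑-embed : ∀ {r n} (S : Face r n) v (G : Vec ℕ n → Vec ℕ n → F) → ∑ (embed S v) G ≡ ∑ v (λ a b → G (embed S a) (embed S b))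
  ∑-embed {n = n} [] [] G     = ∑-𝟘 n G
  ∑-embed (k ∷ S) (x ∷ v) G = trans (∑-insert k x (embed S v) G) (∑₁-cong x (λ i j _ → ∑-embed S v (λ a b → G (insertAt a k i) (insertAt b k j))))

  ray-embed : ∀ {r n} (S : Face r n) y h h′ → (λ v → ray (embed S y) h (embed S v)) ≗ ray y h′
  ray-embed S y h h′ v = go (multiple? y v h′)
   where
   go : (∃ λ j → v ≡ j · y) ⊎ (∀ j → v ≢ j · y) → ray (embed S y) h (embed S v) ≡ ray y h′ v
   go (inj₁ (j , refl)) = trans (cong (ray (embed S y) h) (embed-· S j y)) (trans (ray-on (embed S y) h j) (sym (ray-on y h′ j)))
   go (inj₂ f) = trans (ray-off (embed S y) h (embed S v) (λ j eq → f j (embed-injective S v (j · y) (trans eq (sym (embed-· S j y)))))) (sym (ray-off y h′ v f))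

  dilog-embed : ∀ {r m} (S : Face (suc r) (suc m)) i → (λ v → ray (e (vertex S i)) (e≢𝟘 (vertex S i)) (embed S v)) ≗ dilog i
  dilog-embed S i v = trans (ray-irrelevant (e≢𝟘 (vertex S i)) (λ z → e≢𝟘 (vertex S i) (trans (sym (embed-e S i)) z)) (sym (embed-e S i)) (embed S v))
   (trans (ray-embed S (e i) _ (e≢𝟘 i) v) (sym (dilog≗ray i v)))

  module Restrict {r m : ℕ} {B : Q (suc m)} (q : IsQuiver B) (S : Face (suc r) (suc m)) (T : Q (suc r))
   (match : ∀ i j → B (vertex S i) (vertex S j) ≡ T i j) where

   form-embed : ∀ u v → form B ⟦ embed S u ⟧ ⟦ embed S v ⟧ ≡ form T ⟦ u ⟧ ⟦ v ⟧
   form-embed u v = trans (dot-comm ⟦ embed S u ⟧ row) (trans (dot-embed S row u) (trans (dot-comm (λ i → row (vertex S i)) ⟦ u ⟧)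
    (dot-cong {φ = ⟦ u ⟧} {x = λ i → row (vertex S i)} {y = λ i → dot (T i) ⟦ v ⟧} (λ _ → refl)
     (λ i → trans (dot-embed S (B (vertex S i)) v) (dot-cong {φ = λ j → B (vertex S i) (vertex S j)} {x = ⟦ v ⟧} (match i) (λ _ → refl))))))
    where
    row : Lattice (suc m)
    row i = dot (B i) ⟦ embed S v ⟧

   ⋆-embed : ∀ f g v → Conv._⋆_ (twist B) f g (embed S v) ≡ Conv._⋆_ (twist T) (λ u → f (embed S u)) (λ u → g (embed S u)) v
   ⋆-embed f g v = trans (∑-embed S v (λ a b → f a * g b * Twist.χ (twist B) a b)) (∑-cong v (λ a b _ → *ˡ (cong pw (form-embed a b))))

   module _ {p : Series (suc m)} (good : Good {B = B} q p) where
    face-unit : ∀ i → p (embed S (e i)) ≡ ε 1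
    face-unit i = trans (cong p (embed-e S i)) (Good.axis good (vertex S i) 1)

    face-source : ∀ i v → lookup v i ≡ 0 → dot (λ j → pos (T j i)) ⟦ v ⟧ ≡ 0ℤ → p (embed S (e i ⊕ v)) ≡ ε 1 * pw (dot (T i) ⟦ v ⟧) * p (embed S v)
    face-source i v z h = trans (cong p (trans (embed-⊕ S (e i) v) (cong (_⊕ embed S v) (embed-e S i))))
     (trans (Source.source {B = B} q good (vertex S i) (embed S v) (trans (lookup-embed S v i) z)
      (trans (dot-embed S (λ j → pos (B j (vertex S i))) v) (trans (dot-cong {φ = λ j → pos (B (vertex S j) (vertex S i))} {x = ⟦ v ⟧} (λ j → cong pos (match j i)) (λ _ → refl)) h)))
     (cong (λ z → ε 1 * pw z * p (embed S v)) (trans (dot-embed S (B (vertex S i)) v) (dot-cong {φ = λ j → B (vertex S i) (vertex S j)} {x = ⟦ v ⟧} (match i) (λ _ → refl)))))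

  _≟ᵛ_ : ∀ {n} (x y : Vec ℕ n) → Dec (x ≡ y)
  _≟ᵛ_ = ≡-dec ℕ._≟_

  -- An exponent with an entry 1 is no proper multiple, so E(y^x) has a term there only if it is x
  -- itself.
  ray-off-primitive : ∀ {n} (x y : Vec ℕ n) h i → lookup y i ≡ 1 → x ≢ y → ray x h y ≡ 0F
  ray-off-primitive x y h i one x≢y = ray-off x h y (λ j eq → x≢y (sym (trans eq (trans (cong (_· x)
   (ℕP.m*n≡1⇒m≡1 j (lookup x i) (trans (sym (lookup-map i (j ℕ.*_) x)) (trans (cong (λ v → lookup v i) (sym eq)) one)))) (1·-identity x)))))

  tally : ∀ {A : Set} → Dec A → ℕ → ℕ
  tally (yes _) c = suc c
  tally (no _)  c = c

  count index : ∀ {n} → Vec ℕ n → List (Exponent n) → ℕ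
  count y []       = 0
  count y (x ∷ xs) = tally (proj₁ x ≟ᵛ y) (count y xs)

  place : ∀ {A : Set} → Dec A → ℕ → ℕ
  place (yes _) j = 0
  place (no _)  j = suc j

  index y []       = 0
  index y (x ∷ xs) = place (proj₁ x ≟ᵛ y) (index y xs)

  T₂ : ℤ → Q 2
  T₂ w zero       zero       = 0ℤ
  T₂ w zero       (suc zero) = w
  T₂ w (suc zero) zero       = ℤ.- w
  T₂ w (suc zero) (suc zero) = 0ℤ

  module Two (w : ℤ) where
   open Conv (twist (T₂ w))

   private
    χ₁₂ : form (T₂ w) ⟦ 1 ∷ 0 ∷ [] ⟧ ⟦ 0 ∷ 1 ∷ [] ⟧ ≡ w
    χ₁₂ = trans (form-cong (T₂ w) {⟦ 1 ∷ 0 ∷ [] ⟧} {unit zero} {⟦ 0 ∷ 1 ∷ [] ⟧} {unit (suc zero)} (λ { zero → refl ; (suc zero) → refl }) (λ { zero → refl ; (suc zero) → refl })) (form-units (T₂ w) zero (suc zero))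
    χ₂₁ : form (T₂ w) ⟦ 0 ∷ 1 ∷ [] ⟧ ⟦ 1 ∷ 0 ∷ [] ⟧ ≡ ℤ.- w
    χ₂₁ = trans (form-cong (T₂ w) {⟦ 0 ∷ 1 ∷ [] ⟧} {unit (suc zero)} {⟦ 1 ∷ 0 ∷ [] ⟧} {unit zero} (λ { zero → refl ; (suc zero) → refl }) (λ { zero → refl ; (suc zero) → refl })) (form-units (T₂ w) (suc zero) zero)
    leftmost : ∀ (f g : Series 2) v → f 𝟘 ≡ 1F → f 𝟘 * g v * Twist.χ (twist (T₂ w)) 𝟘 v ≡ g v
    leftmost f g v h = trans (cong₂ _*_ (trans (*ʳ h) (*-identityˡ (g v))) (Twist.χ-0ˡ (twist (T₂ w)) v)) (*-identityʳ (g v))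
    rightmost : ∀ (f g : Series 2) v → g 𝟘 ≡ 1F → f v * g 𝟘 * Twist.χ (twist (T₂ w)) v 𝟘 ≡ f v
    rightmost f g v h = trans (cong₂ _*_ (trans (*ˡ h) (*-identityʳ (f v))) (Twist.χ-0ʳ (twist (T₂ w)) v)) (*-identityʳ (f v))

   expand₁ : ∀ f g → f 𝟘 ≡ 1F → g 𝟘 ≡ 1F → (f ⋆ g) (1 ∷ 0 ∷ []) ≡ g (1 ∷ 0 ∷ []) + f (1 ∷ 0 ∷ [])
   expand₁ f g hf hg = cong₂ _+_ (leftmost f g (1 ∷ 0 ∷ []) hf) (rightmost f g (1 ∷ 0 ∷ []) hg)

   expand₂ : ∀ f g → f 𝟘 ≡ 1F → g 𝟘 ≡ 1F → (f ⋆ g) (0 ∷ 1 ∷ []) ≡ g (0 ∷ 1 ∷ []) + f (0 ∷ 1 ∷ [])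
   expand₂ f g hf hg = cong₂ _+_ (leftmost f g (0 ∷ 1 ∷ []) hf) (rightmost f g (0 ∷ 1 ∷ []) hg)

   expand₁₂ : ∀ f g → f 𝟘 ≡ 1F → g 𝟘 ≡ 1F → (f ⋆ g) (1 ∷ 1 ∷ []) ≡
    (g (1 ∷ 1 ∷ []) + f (0 ∷ 1 ∷ []) * g (1 ∷ 0 ∷ []) * pw (ℤ.- w)) + (f (1 ∷ 0 ∷ []) * g (0 ∷ 1 ∷ []) * pw w + f (1 ∷ 1 ∷ []))
   expand₁₂ f g hf hg = cong₂ _+_ (cong₂ _+_ (leftmost f g (1 ∷ 1 ∷ []) hf) (*ˡ {f (0 ∷ 1 ∷ []) * g (1 ∷ 0 ∷ [])} (cong pw χ₂₁))) (cong₂ _+_ (*ˡ {f (1 ∷ 0 ∷ []) * g (0 ∷ 1 ∷ [])} (cong pw χ₁₂)) (rightmost f g (1 ∷ 1 ∷ []) hg))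

  Big : ℤ → Set
  Big z = ∃ λ n → z ≡ ⁺ (2 ℕ.+ n)

  module Pair {m : ℕ} {B : Q (suc (suc m))} (q : IsQuiver B) (a b : Fin (suc (suc m))) (a≢b : a ≢ b) (w : ℤ) (Bab : B a b ≡ w) where
   S : Face 2 (suc (suc m))
   S = a ∷ punchOut a≢b ∷ []

   private
    b≡ : vertex S (suc zero) ≡ b
    b≡ = punchIn-punchOut a≢b

    match : ∀ i j → B (vertex S i) (vertex S j) ≡ T₂ w i j
    match zero       zero       = diag-zero q a
    match zero       (suc zero) = trans (cong (B a) b≡) Bab
    match (suc zero) zero       = trans (cong (λ t → B t a) b≡) (trans (q b a) (cong ℤ.-_ Bab))
    match (suc zero) (suc zero) = diag-zero q _

    module R = Restrict {B = B} q S (T₂ w) match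
    module P = Products B
    open Two w

    v₁ v₂ v₁₂ : Vec ℕ 2
    v₁  = 1 ∷ 0 ∷ []
    v₂  = 0 ∷ 1 ∷ []
    v₁₂ = 1 ∷ 1 ∷ []

    y₁ y₂ y₁₂ : Vec ℕ (suc (suc m))
    y₁  = embed S v₁
    y₂  = embed S v₂
    y₁₂ = embed S v₁₂

    y₁≡ : y₁ ≡ e a
    y₁≡ = embed-e S zero
    y₂≡ : y₂ ≡ e b
    y₂≡ = trans (embed-e S (suc zero)) (cong e b≡)

    y₁≢y₂ : y₁ ≢ y₂
    y₁≢y₂ h with embed-injective S v₁ v₂ h
    ... | ()
    ... | ()
    y₂≢y₁₂ : y₂ ≢ y₁₂
    y₂≢y₁₂ h with embed-injective S v₂ v₁₂ h
    ... | ()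

    r : Exponent (suc (suc m)) → Series 2
    r x v = ray (proj₁ x) (proj₂ x) (embed S v)
    P : List (Exponent (suc (suc m))) → Series 2
    P xs v = P.product xs (embed S v)

    r-𝟘 : ∀ x → r x 𝟘 ≡ 1F
    r-𝟘 (x , h) = trans (cong (ray x h) (embed-𝟘 S)) (ray-𝟘 x h)
    P-𝟘 : ∀ xs → P xs 𝟘 ≡ 1F
    P-𝟘 xs = trans (cong (P.product xs) (embed-𝟘 S)) (P.product-𝟘 xs)

    r-hit : ∀ x v → proj₁ x ≡ embed S v → r x v ≡ ε 1
    r-hit (.(embed S v) , h) v refl = ray-at (embed S v) h
    r₁-miss : ∀ x → proj₁ x ≢ y₁ → r x v₁ ≡ 0F
    r₁-miss (x , h) = ray-off-primitive x y₁ h (vertex S zero) (lookup-embed S v₁ zero)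
    r₂-miss : ∀ x → proj₁ x ≢ y₂ → r x v₂ ≡ 0F
    r₂-miss (x , h) = ray-off-primitive x y₂ h (vertex S (suc zero)) (lookup-embed S v₂ (suc zero))
    r₁₂-miss : ∀ x → proj₁ x ≢ y₁₂ → r x v₁₂ ≡ 0F
    r₁₂-miss (x , h) = ray-off-primitive x y₁₂ h (vertex S zero) (lookup-embed S v₁₂ zero)

    add-one : ∀ c → natF c * ε 1 + ε 1 ≡ natF (suc c) * ε 1
    add-one c = solve 2 (λ a e → a :* e :+ e := (FS.con 1 :+ a) :* e) refl (natF c) (ε 1)

    empty : ∀ i → P [] (e i) ≡ 0F
    empty i = δ-≢ (embed S (e i)) (λ z → e≢𝟘 (vertex S i) (trans (sym (embed-e S i)) z))

    count₁ : ∀ xs → P xs v₁ ≡ natF (count y₁ xs) * ε 1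
    count₁ [] = trans (empty zero) (sym (*-zeroˡ (ε 1)))
    count₁ (x ∷ xs) = trans (R.⋆-embed (ray (proj₁ x) (proj₂ x)) (P.product xs) v₁) (trans (expand₁ (r x) (P xs) (r-𝟘 x) (P-𝟘 xs)) (go (proj₁ x ≟ᵛ y₁)))
     where
     go : (d : Dec (proj₁ x ≡ y₁)) → P xs v₁ + r x v₁ ≡ natF (tally d (count y₁ xs)) * ε 1
     go (yes h) = trans (cong₂ _+_ (count₁ xs) (r-hit x v₁ h)) (add-one (count y₁ xs))
     go (no h)  = trans (cong₂ _+_ (count₁ xs) (r₁-miss x h)) (+-identityʳ _)

    count₂ : ∀ xs → P xs v₂ ≡ natF (count y₂ xs) * ε 1
    count₂ [] = trans (empty (suc zero)) (sym (*-zeroˡ (ε 1)))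
    count₂ (x ∷ xs) = trans (R.⋆-embed (ray (proj₁ x) (proj₂ x)) (P.product xs) v₂) (trans (expand₂ (r x) (P xs) (r-𝟘 x) (P-𝟘 xs)) (go (proj₁ x ≟ᵛ y₂)))
     where
     go : (d : Dec (proj₁ x ≡ y₂)) → P xs v₂ + r x v₂ ≡ natF (tally d (count y₂ xs)) * ε 1
     go (yes h) = trans (cong₂ _+_ (count₂ xs) (r-hit x v₂ h)) (add-one (count y₂ xs))
     go (no h)  = trans (cong₂ _+_ (count₂ xs) (r₂-miss x h)) (+-identityʳ _)

    r₁₂ : ∀ x → ∃ λ N → r x v₁₂ ≡ natF N * ε 1
    r₁₂ x = go (proj₁ x ≟ᵛ y₁₂)
     where
     go : Dec (proj₁ x ≡ y₁₂) → ∃ λ N → r x v₁₂ ≡ natF N * ε 1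
     go (yes h) = 1 , trans (r-hit x v₁₂ h) (sym (trans (*ʳ natF-1) (*-identityˡ (ε 1))))
     go (no h)  = 0 , trans (r₁₂-miss x h) (sym (*-zeroˡ (ε 1)))

    zero-count : ∀ {c z} → z ≡ natF c * ε 1 → c ≡ 0 → z ≡ 0F
    zero-count h refl = trans h (*-zeroˡ (ε 1))

    -- Without the second generator the coefficient of the pair is a multiple of ε 1.
    unpaired : ∀ xs → count y₂ xs ≡ 0 → ∃ λ N → P xs v₁₂ ≡ natF N * ε 1
    unpaired [] _ = 0 , trans (δ-≢ y₁₂ (λ z → 1≢0 (trans (sym (lookup-embed S v₁₂ zero)) (trans (cong (λ v → lookup v a) (trans z (sym (embed-𝟘 S)))) (lookup-embed S 𝟘 zero))))) (sym (*-zeroˡ (ε 1)))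
     where
     1≢0 : 1 ≢ 0
     1≢0 ()
    unpaired (x ∷ xs) h = go (proj₁ x ≟ᵛ y₂) h
     where
     go : (d : Dec (proj₁ x ≡ y₂)) → tally d (count y₂ xs) ≡ 0 → ∃ λ N → P (x ∷ xs) v₁₂ ≡ natF N * ε 1
     go (no ne) c0 = let (N , eq) = unpaired xs c0 ; (N′ , eq′) = r₁₂ x in N ℕ.+ N′ ,
      trans (R.⋆-embed (ray (proj₁ x) (proj₂ x)) (P.product xs) v₁₂) (trans (expand₁₂ (r x) (P xs) (r-𝟘 x) (P-𝟘 xs))
       (trans (cong₂ _+_ (trans (cong₂ _+_ eq (trans (*ʳ (trans (*ʳ (r₂-miss x ne)) (*-zeroˡ _))) (*-zeroˡ _))) (+-identityʳ _))
        (trans (cong₂ _+_ (trans (*ʳ (trans (*ˡ (zero-count (count₂ xs) c0)) (*-zeroʳ _))) (*-zeroˡ (pw w))) eq′) (+-identityˡ _)))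
       (trans (sym (distribʳ (ε 1) (natF N) (natF N′))) (*ʳ (sym (natF-sum N N′))))))

    expand : ∀ x xs → P (x ∷ xs) v₁₂ ≡ (P xs v₁₂ + r x v₂ * P xs v₁ * pw (ℤ.- w)) + (r x v₁ * P xs v₂ * pw w + r x v₁₂)
    expand x xs = trans (R.⋆-embed (ray (proj₁ x) (proj₂ x)) (P.product xs) v₁₂) (expand₁₂ (r x) (P xs) (r-𝟘 x) (P-𝟘 xs))

   -- The coefficient at e_a + e_b when E(y_b) precedes E(y_a): N counts the factors with exactly
   -- that exponent, the other term is the product of the two generators in the wrong order.
   Inverted : List (Exponent (suc (suc m))) → Set
   Inverted xs = ∃ λ N → P xs v₁₂ ≡ natF N * ε 1 + ε 1 * ε 1 * pw (ℤ.- w)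

   private
    sum-inverted : ∀ {p r₂ p₁ r₁ p₂ r₁₂} N → p ≡ natF N * ε 1 → r₂ ≡ ε 1 → p₁ ≡ ε 1 → r₁ ≡ 0F → r₁₂ ≡ 0F →
     (p + r₂ * p₁ * pw (ℤ.- w)) + (r₁ * p₂ * pw w + r₁₂) ≡ natF N * ε 1 + ε 1 * ε 1 * pw (ℤ.- w)
    sum-inverted {p₂ = p₂} N refl refl refl refl refl =
     trans (+ˡ (trans (+ʳ (trans (*ʳ (*-zeroˡ p₂)) (*-zeroˡ (pw w)))) (+-identityˡ 0F))) (+-identityʳ _)

    sum-kept : ∀ {p r₂ p₁ r₁ p₂ r₁₂} N N′ → p ≡ natF N * ε 1 + ε 1 * ε 1 * pw (ℤ.- w) → r₂ ≡ 0F → r₁ ≡ 0F → r₁₂ ≡ natF N′ * ε 1 →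
     (p + r₂ * p₁ * pw (ℤ.- w)) + (r₁ * p₂ * pw w + r₁₂) ≡ natF (N ℕ.+ N′) * ε 1 + ε 1 * ε 1 * pw (ℤ.- w)
    sum-kept {p₁ = p₁} {p₂ = p₂} N N′ refl refl refl refl =
     trans (cong₂ _+_ (trans (+ˡ (trans (*ʳ (*-zeroˡ p₁)) (*-zeroˡ _))) (+-identityʳ _)) (trans (+ʳ (trans (*ʳ (*-zeroˡ p₂)) (*-zeroˡ (pw w)))) (+-identityˡ _)))
     (trans (solve 3 (λ x t y → (x :+ t) :+ y := (x :+ y) :+ t) refl (natF N * ε 1) (ε 1 * ε 1 * pw (ℤ.- w)) (natF N′ * ε 1))
      (+ʳ (trans (sym (distribʳ (ε 1) (natF N) (natF N′))) (*ʳ (sym (natF-sum N N′))))))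

    inverted-here : ∀ x xs → proj₁ x ≢ y₁ → proj₁ x ≡ y₂ → count y₁ xs ≡ 1 → count y₂ xs ≡ 0 → Inverted (x ∷ xs)
    inverted-here x xs ne h c c′ = go (unpaired xs c′)
     where
     P₁ : P xs v₁ ≡ ε 1
     P₁ = trans (count₁ xs) (trans (cong (λ z → natF z * ε 1) c) (trans (*ʳ natF-1) (*-identityˡ (ε 1))))
     go : (∃ λ N → P xs v₁₂ ≡ natF N * ε 1) → Inverted (x ∷ xs)
     go (N , eq) = N , trans (expand x xs) (sum-inverted N eq (r-hit x v₂ h) P₁ (r₁-miss x ne) (r₁₂-miss x (λ z → y₂≢y₁₂ (trans (sym h) z))))

    inverted-there : ∀ x xs → proj₁ x ≢ y₁ → proj₁ x ≢ y₂ → Inverted xs → Inverted (x ∷ xs)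
    inverted-there x xs ne ne′ (N , eq) = go (r₁₂ x)
     where
     go : (∃ λ N → r x v₁₂ ≡ natF N * ε 1) → Inverted (x ∷ xs)
     go (N′ , eq′) = N ℕ.+ N′ , trans (expand x xs) (sum-kept N N′ eq (r₂-miss x ne′) (r₁-miss x ne) eq′)

    order : ∀ xs → count y₁ xs ≡ 1 → count y₂ xs ≡ 1 → index y₁ xs ℕ.< index y₂ xs ⊎ Inverted xs
    order [] ()
    order (x ∷ xs) = go (proj₁ x ≟ᵛ y₁) (proj₁ x ≟ᵛ y₂)
     where
     up : index y₁ xs ℕ.< index y₂ xs ⊎ Inverted xs → proj₁ x ≢ y₁ → proj₁ x ≢ y₂ → suc (index y₁ xs) ℕ.< suc (index y₂ xs) ⊎ Inverted (x ∷ xs)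
     up (inj₁ h) _  _   = inj₁ (ℕ.s≤s h)
     up (inj₂ h) ne ne′ = inj₂ (inverted-there x xs ne ne′ h)
     go : (d : Dec (proj₁ x ≡ y₁)) (d′ : Dec (proj₁ x ≡ y₂)) → tally d (count y₁ xs) ≡ 1 → tally d′ (count y₂ xs) ≡ 1 →
      place d (index y₁ xs) ℕ.< place d′ (index y₂ xs) ⊎ Inverted (x ∷ xs)
     go (yes h) (yes h′) _ _ = ⊥-elim (y₁≢y₂ (trans (sym h) h′))
     go (yes h) (no _)   _ _ = inj₁ (ℕ.s≤s ℕ.z≤n)
     go (no ne) (yes h)  c c′ = inj₂ (inverted-here x xs ne h c (ℕP.suc-injective c′))
     go (no ne) (no ne′) c c′ = up (order xs c c′) ne ne′

   module _ {xs : List (Exponent (suc (suc m)))} (f : Factored {B = B} q xs) where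
    open Factored f
    private
     at : ∀ v → series (embed S v) ≡ P xs v
     at v = factors (embed S v)

    -- The coefficient at e_a is `ε 1` times the number of factors with this exponent, and for a
    -- good series it is `ε 1`.
    count-first : count (e a) xs ≡ 1
    count-first = trans (cong (λ y → count y xs) (sym y₁≡)) (natF-cancel (count y₁ xs) (trans (sym (count₁ xs)) (trans (sym (at v₁)) (R.face-unit good zero))))

    count-second : count (e b) xs ≡ 1
    count-second = trans (cong (λ y → count y xs) (sym y₂≡)) (natF-cancel (count y₂ xs) (trans (sym (count₂ xs)) (trans (sym (at v₂)) (R.face-unit good (suc zero)))))

    -- In the other order the quantum integer [w]_v would have to be a natural number.
    heavy-order : Big w → index (e a) xs ℕ.< index (e b) xs
    heavy-order (n , wn) = subst₂ (λ u v → index u xs ℕ.< index v xs) y₁≡ y₂≡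
      (go (order xs (trans (cong (λ y → count y xs) y₁≡) count-first) (trans (cong (λ y → count y xs) y₂≡) count-second)))
     where
     -- On the face spanned by a and b the vertex a is a source, so `face-source` evaluates the
     -- coefficient.
     value : series y₁₂ ≡ ε 1 * ε 1 * pw w
     value = trans (R.face-source good zero v₂ refl (trans (cong (λ z → 0ℤ ℤ.* ⁺ 0 ℤ.+ (pos (ℤ.- z) ℤ.* ⁺ 1 ℤ.+ 0ℤ)) wn) refl))
      (trans (cong₂ (λ s t → ε 1 * pw s * t) (dw w) (R.face-unit good (suc zero))) (solve 2 (λ e t → e :* t :* e := e :* e :* t) refl (ε 1) (pw w)))
      where
      dw : ∀ w → 0ℤ ℤ.* ⁺ 0 ℤ.+ (w ℤ.* ⁺ 1 ℤ.+ 0ℤ) ≡ w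
      dw w = trans (ℤP.+-identityˡ _) (trans (ℤP.+-identityʳ _) (ℤP.*-identityʳ w))
     go : index y₁ xs ℕ.< index y₂ xs ⊎ Inverted xs → index y₁ xs ℕ.< index y₂ xs
     go (inj₁ h) = h
     go (inj₂ (N , eq)) = ⊥-elim (quantum-nonintegral N n (subst (λ z → natF N * ε 1 + (ε 1 * ε 1) * pw (ℤ.- z) ≡ (ε 1 * ε 1) * pw z) wn
      (trans (sym eq) (trans (sym (at v₁₂)) value))))

  Big-≢ : ∀ {n} {B : Q n} → IsQuiver B → ∀ {a b} → Big (B a b) → a ≢ b
  Big-≢ q {a} (n , h) refl with trans (sym h) (diag-zero q a)
  ... | ()

  Heavy : ∀ {n} → Q n → Set
  Heavy B = ∃ λ a → ∃ λ b → ∃ λ c → Big (B a b) × Big (B b c) × Big (B c a)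

  -- The three relations of `heavy-order` around the triangle form a cycle.
  heavy-unfactored : ∀ {m} {B : Q (suc (suc m))} (q : IsQuiver B) {xs} → Factored {B = B} q xs → ¬ Heavy B
  heavy-unfactored {B = B} q f (a , b , c , ab , bc , ca) = ℕP.<-irrefl refl
   (ℕP.<-trans (Pair.heavy-order {B = B} q a b (Big-≢ q ab) (B a b) refl f ab)
    (ℕP.<-trans (Pair.heavy-order {B = B} q b c (Big-≢ q bc) (B b c) refl f bc) (Pair.heavy-order {B = B} q c a (Big-≢ q ca) (B c a) refl f ca)))

  heavy⇒¬MGS : ∀ {m} {B : Q (suc (suc m))} → IsQuiver B → Heavy B → ¬ HasMGS B
  heavy⇒¬MGS {B = B} q (a , b , c , ab , bc , ca) h = heavy-unfactored (Final.q fin) (Final.factored fin)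
   (Final.τ fin a , Final.τ fin b , Final.τ fin c , subst Big (sym (Final.relabelled fin a b)) ab , subst Big (sym (Final.relabelled fin b c)) bc , subst Big (sym (Final.relabelled fin c a)) ca)
   where fin = HasMGS⇒Final q h

 -- The acyclic triangle, and quivers next to heavy ones.

 module Barriers where
  open import Defs using (Mat; Q; IsQuiver; mutate; μ; pos; HasMGS)
  open import Relation.Binary.Definitions using (DecidableEquality)
  open Scalars
  open Sums
  open Convolution
  open Lines
  open Forms
  open Axes
  open Cuts
  open Mutations
  open Rays
  open Reflections
  open Framings
  open Faces
  open import Algebra.Bundles using (CommutativeRing)
  import Algebra.Solver.Ring.NaturalCoefficients.Default (CommutativeRing.commutativeSemiring commutativeRing) as FS
  import Algebra.Properties.Group (CommutativeRing.+-group commutativeRing) as FG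
  open import Data.Integer using (-1ℤ)
  open import Data.Fin using (punchIn; punchOut)
  open import Data.Fin.Properties using (punchIn-punchOut; punchOut-injective)
  open import Data.List using (_++_)
  open import Data.List.Membership.Propositional using (_∈_)
  open import Data.List.Relation.Unary.Any using (here; there)

  open FS using (solve; _:=_; _:+_; _:*_)
  open ≡-Reasoning

  T₃ : Q 3
  T₃ zero             zero             = 0ℤ
  T₃ zero             (suc _)          = 1ℤ
  T₃ (suc zero)       zero             = -1ℤ
  T₃ (suc zero)       (suc zero)       = 0ℤ
  T₃ (suc zero)       (suc (suc zero)) = 1ℤ
  T₃ (suc (suc zero)) (suc (suc zero)) = 0ℤ
  T₃ (suc (suc zero)) zero             = -1ℤ
  T₃ (suc (suc zero)) (suc zero)       = -1ℤ

  T₃-quiver : IsQuiver T₃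
  T₃-quiver zero             zero             = refl
  T₃-quiver zero             (suc zero)       = refl
  T₃-quiver zero             (suc (suc zero)) = refl
  T₃-quiver (suc zero)       zero             = refl
  T₃-quiver (suc zero)       (suc zero)       = refl
  T₃-quiver (suc zero)       (suc (suc zero)) = refl
  T₃-quiver (suc (suc zero)) zero             = refl
  T₃-quiver (suc (suc zero)) (suc zero)       = refl
  T₃-quiver (suc (suc zero)) (suc (suc zero)) = refl

  open Conv (twist T₃) using () renaming (_⋆_ to _⋆₃_)

  private
   -- The inverse of `ε 1` is v - v⁻¹; this form of it drives the computations in degrees 2 and 3.
   κ : ε 1 * pw (⁺ 1) ≡ ε 1 * pw (ℤ.- ⁺ 1) + 1F
   κ = trans (ε-suc 0) (+ˡ (trans (cong₂ _*_ ε-0 pw-0) (*-identityˡ 1F)))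

  -- Values on {0,1}³ of a product of rays none of which is the first or the last coordinate axis.
  record Middle (f : Series 3) : Set where
   field
    {c₂ c₁₃ c} : ℕ
    at-000 : f (0 ∷ 0 ∷ 0 ∷ []) ≡ 1F
    at-100 : f (1 ∷ 0 ∷ 0 ∷ []) ≡ 0F
    at-001 : f (0 ∷ 0 ∷ 1 ∷ []) ≡ 0F
    at-010 : f (0 ∷ 1 ∷ 0 ∷ []) ≡ natF c₂ * ε 1
    at-101 : f (1 ∷ 0 ∷ 1 ∷ []) ≡ natF c₁₃ * ε 1
    -- The exponents 010 and 101 pair to 0 under `T₃`, so their products count alike in either
    -- order; the other proper splits of 111 involve 100 or 001, where the series vanishes.
    at-111 : f (1 ∷ 1 ∷ 1 ∷ []) ≡ natF c * ε 1 + natF (c₂ ℕ.* c₁₃) * (ε 1 * ε 1)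

  private
   leftmost : ∀ (f g : Series 3) v → f 𝟘 ≡ 1F → f 𝟘 * g v * Twist.χ (twist T₃) 𝟘 v ≡ g v
   leftmost f g v h = trans (cong₂ _*_ (trans (*ʳ h) (*-identityˡ (g v))) (Twist.χ-0ˡ (twist T₃) v)) (*-identityʳ (g v))
   rightmost : ∀ (f g : Series 3) v → g 𝟘 ≡ 1F → f v * g 𝟘 * Twist.χ (twist T₃) v 𝟘 ≡ f v
   rightmost f g v h = trans (cong₂ _*_ (trans (*ˡ h) (*-identityʳ (f v))) (Twist.χ-0ʳ (twist T₃) v)) (*-identityʳ (f v))

   vanish-left : ∀ {a b c} → a ≡ 0F → a * b * c ≡ 0F
   vanish-left {b = b} {c} refl = trans (*ʳ (*-zeroˡ b)) (*-zeroˡ c)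
   vanish-right : ∀ {a b c} → b ≡ 0F → a * b * c ≡ 0F
   vanish-right {a} {c = c} refl = trans (*ʳ (*-zeroʳ a)) (*-zeroˡ c)

  Middle-⋆ : ∀ f g (hf : Middle f) → Middle.c₂ hf ℕ.* Middle.c₁₃ hf ≡ 0 → Middle g → Middle (f ⋆₃ g)
  Middle-⋆ f g hf h0 hg = record
   { c₂ = G.c₂ ℕ.+ H.c₂ ; c₁₃ = G.c₁₃ ℕ.+ H.c₁₃ ; c = G.c ℕ.+ H.c
   ; at-000 = Conv.⋆-𝟘 (twist T₃) f g H.at-000 G.at-000
   ; at-100 = trans (cong₂ _+_ (trans (lm _) G.at-100) (trans (rm _) H.at-100)) (+-identityˡ 0F)
   ; at-001 = trans (cong₂ _+_ (trans (lm _) G.at-001) (trans (rm _) H.at-001)) (+-identityˡ 0F)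
   ; at-010 = trans (cong₂ _+_ (trans (lm _) G.at-010) (trans (rm _) H.at-010)) (sum-ε G.c₂ H.c₂)
   ; at-101 = trans (cong₂ _+_ (cong₂ _+_ (trans (lm _) G.at-101) (vanish-left H.at-001)) (cong₂ _+_ (vanish-left H.at-100) (trans (rm _) H.at-101)))
     (trans (cong₂ _+_ (+-identityʳ _) (+-identityˡ _)) (sum-ε G.c₁₃ H.c₁₃))
   ; at-111 = trans (cong₂ _+_
      (cong₂ _+_ (cong₂ _+_ (trans (lm _) G.at-111) (vanish-left H.at-001)) (cong₂ _+_ (trans (cong₂ _*_ (cong₂ _*_ H.at-010 G.at-101) pw-0) (*-identityʳ _)) (vanish-right G.at-100)))
      (cong₂ _+_ (cong₂ _+_ (vanish-left H.at-100) (trans (cong₂ _*_ (cong₂ _*_ H.at-101 G.at-010) pw-0) (*-identityʳ _))) (cong₂ _+_ (vanish-right G.at-001) (trans (rm _) H.at-111))))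
     (trans (cong₂ _+_ (cong₂ _+_ (+-identityʳ _) (+-identityʳ _)) (cong₂ _+_ (+-identityˡ _) (+-identityˡ _)))
     (trans (cong₂ _+_ (+ˡ (square (natF H.c₂) (natF G.c₁₃))) (+ʳ (square (natF H.c₁₃) (natF G.c₂))))
     (trans (gather (natF G.c * ε 1) (natF H.c * ε 1) (natF (G.c₂ ℕ.* G.c₁₃)) (natF H.c₂ * natF G.c₁₃) (natF H.c₁₃ * natF G.c₂) (natF (H.c₂ ℕ.* H.c₁₃)))
      (cong₂ _+_ (sum-ε G.c H.c) (*ʳ (trans (+ʳ (+ˡ (*-comm (natF H.c₁₃) (natF G.c₂)))) cross)))))) }
   where
   module H = Middle hf
   module G = Middle hg
   square : ∀ a b → a * ε 1 * (b * ε 1) ≡ a * b * (ε 1 * ε 1)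
   square a b = solve 3 (λ a b e → a :* e :* (b :* e) := a :* b :* (e :* e)) refl a b (ε 1)
   gather : ∀ x y a b c d → ((x + a * (ε 1 * ε 1)) + b * (ε 1 * ε 1)) + (c * (ε 1 * ε 1) + (y + d * (ε 1 * ε 1))) ≡ (x + y) + (a + b + c + d) * (ε 1 * ε 1)
   gather x y a b c d = trans (solve 6 (λ x y a b c d → ((x :+ a) :+ b) :+ (c :+ (y :+ d)) := (x :+ y) :+ (((a :+ b) :+ c) :+ d)) refl
     x y (a * (ε 1 * ε 1)) (b * (ε 1 * ε 1)) (c * (ε 1 * ε 1)) (d * (ε 1 * ε 1)))
    (+ˡ (sym (trans (distribʳ _ (a + b + c) d) (+ʳ (trans (distribʳ _ (a + b) c) (+ʳ (distribʳ _ a b)))))))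
   lm : ∀ v → f 𝟘 * g v * Twist.χ (twist T₃) 𝟘 v ≡ g v
   lm v = leftmost f g v H.at-000
   rm : ∀ v → f v * g 𝟘 * Twist.χ (twist T₃) v 𝟘 ≡ f v
   rm v = rightmost f g v G.at-000
   sum-ε : ∀ a b → natF a * ε 1 + natF b * ε 1 ≡ natF (a ℕ.+ b) * ε 1
   sum-ε a b = trans (sym (distribʳ (ε 1) (natF a) (natF b))) (*ʳ (sym (natF-sum a b)))
   cross : natF (G.c₂ ℕ.* G.c₁₃) + natF H.c₂ * natF G.c₁₃ + natF G.c₂ * natF H.c₁₃ + natF (H.c₂ ℕ.* H.c₁₃) ≡ natF ((G.c₂ ℕ.+ H.c₂) ℕ.* (G.c₁₃ ℕ.+ H.c₁₃))
   cross = trans (cong₂ _+_ (cong (λ z → z + natF H.c₂ * natF G.c₁₃ + natF G.c₂ * natF H.c₁₃) (natF-prod G.c₂ G.c₁₃)) (natF-prod H.c₂ H.c₁₃))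
    (trans (solve 4 (λ a b a′ b′ → (a :* b :+ a′ :* b :+ a :* b′) :+ a′ :* b′ := (a :+ a′) :* (b :+ b′)) refl (natF G.c₂) (natF G.c₁₃) (natF H.c₂) (natF H.c₁₃))
    (trans (cong₂ _*_ (sym (natF-sum G.c₂ H.c₂)) (sym (natF-sum G.c₁₃ H.c₁₃))) (sym (natF-prod (G.c₂ ℕ.+ H.c₂) (G.c₁₃ ℕ.+ H.c₁₃)))))

  record Values (f : Series 3) : Set where
   field
    at-100 : f (1 ∷ 0 ∷ 0 ∷ []) ≡ ε 1
    at-010 : f (0 ∷ 1 ∷ 0 ∷ []) ≡ ε 1
    at-001 : f (0 ∷ 0 ∷ 1 ∷ []) ≡ ε 1
    at-110 : f (1 ∷ 1 ∷ 0 ∷ []) ≡ ε 1 * pw (⁺ 1) * ε 1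
    at-101 : f (1 ∷ 0 ∷ 1 ∷ []) ≡ ε 1 * pw (⁺ 1) * ε 1
    at-111 : f (1 ∷ 1 ∷ 1 ∷ []) ≡ ε 1 * pw (⁺ 2) * (ε 1 * pw (⁺ 1) * ε 1)
    at-011 : f (0 ∷ 1 ∷ 1 ∷ []) ≡ ε 1 * pw (⁺ 1) * ε 1

  module Sandwich (f M : Series 3) (M0 : M 𝟘 ≡ 1F) (f≗ : f ≗ dilog (suc (suc zero)) ⋆₃ (M ⋆₃ dilog zero)) (v : Values f) where
   open Values v
   private
    module L₂ = Pairing {B = T₃} T₃-quiver (suc (suc zero))
    module L₀ = Pairing {B = T₃} T₃-quiver zero
    g : Series 3
    g = M ⋆₃ dilog zero

    left₀ : ∀ a b → f (a ∷ b ∷ 0 ∷ []) ≡ g (a ∷ b ∷ 0 ∷ [])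
    left₀ a b = trans (f≗ _) (trans (L₂.dilog-⋆ g (a ∷ b ∷ []) 0) (E-head (L₂.s (a ∷ b ∷ [])) (line (suc (suc zero)) (a ∷ b ∷ []) g)))
    left₁ : ∀ a b → f (a ∷ b ∷ 1 ∷ []) ≡ g (a ∷ b ∷ 1 ∷ []) + ε 1 * pw (L₂.s (a ∷ b ∷ [])) * g (a ∷ b ∷ 0 ∷ [])
    left₁ a b = trans (f≗ _) (trans (L₂.dilog-⋆ g (a ∷ b ∷ []) 1) (∑₁-one (line (suc (suc zero)) (a ∷ b ∷ []) g)))
    right₀ : ∀ a b → g (0 ∷ a ∷ b ∷ []) ≡ M (0 ∷ a ∷ b ∷ [])
    right₀ a b = trans (L₀.⋆-dilog M (a ∷ b ∷ []) 0) (E-head (ℤ.- L₀.s (a ∷ b ∷ [])) (line zero (a ∷ b ∷ []) M))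
    right₁ : ∀ a b → g (1 ∷ a ∷ b ∷ []) ≡ M (1 ∷ a ∷ b ∷ []) + ε 1 * pw (ℤ.- L₀.s (a ∷ b ∷ [])) * M (0 ∷ a ∷ b ∷ [])
    right₁ a b = trans (L₀.⋆-dilog M (a ∷ b ∷ []) 1) (∑₁-one (line zero (a ∷ b ∷ []) M))

    cancel : ∀ {x y z} → x + z ≡ y + z → x ≡ y
    cancel {x} {y} {z} = FG.∙-cancelʳ z x y
    ε′ = ε 1 * pw (ℤ.- ⁺ 1)

    absorb : ∀ {x} → x + ε 1 * pw (⁺ 0) * 1F ≡ ε 1 → x ≡ 0F
    absorb {x} h = cancel (trans (+ˡ (sym (trans (*-identityʳ _) (trans (*ˡ pw-0) (*-identityʳ (ε 1)))))) (trans h (sym (+-identityˡ (ε 1)))))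

    M100 : M (1 ∷ 0 ∷ 0 ∷ []) ≡ 0F
    M100 = absorb (trans (+ˡ (*ˡ (sym M0))) (trans (sym (right₁ 0 0)) (trans (sym (left₀ 1 0)) at-100)))
    M001 : M (0 ∷ 0 ∷ 1 ∷ []) ≡ 0F
    M001 = absorb (trans (cong₂ _+_ (sym (right₀ 0 1)) (*ˡ (sym (trans (right₀ 0 0) M0)))) (trans (sym (left₁ 0 0)) at-001))
    M010 : M (0 ∷ 1 ∷ 0 ∷ []) ≡ ε 1
    M010 = trans (sym (right₀ 1 0)) (trans (sym (left₀ 0 1)) at-010)

    pair : ∀ {x} → x + ε′ * ε 1 ≡ ε 1 * pw (⁺ 1) * ε 1 → x ≡ ε 1
    pair {x} h = cancel (trans h (trans (*ʳ κ) (solve 2 (λ d e → (d :+ FS.con 1) :* e := e :+ d :* e) refl ε′ (ε 1))))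

    M011 : M (0 ∷ 1 ∷ 1 ∷ []) ≡ ε 1
    M011 = pair (trans (cong₂ _+_ (sym (right₀ 1 1)) (*ˡ (sym (trans (right₀ 1 0) M010)))) (trans (sym (left₁ 0 1)) at-011))
    g100 : g (1 ∷ 0 ∷ 0 ∷ []) ≡ ε 1
    g100 = trans (sym (left₀ 1 0)) at-100
    g110 : g (1 ∷ 1 ∷ 0 ∷ []) ≡ ε 1 * pw (⁺ 1) * ε 1
    g110 = trans (sym (left₀ 1 1)) at-110
    g101 : g (1 ∷ 0 ∷ 1 ∷ []) ≡ M (1 ∷ 0 ∷ 1 ∷ [])
    g101 = trans (right₁ 0 1) (trans (+ˡ (trans (*ˡ M001) (*-zeroʳ _))) (+-identityʳ _))
    M101 : M (1 ∷ 0 ∷ 1 ∷ []) ≡ ε 1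
    M101 = pair (trans (cong₂ _+_ (sym g101) (*ˡ (sym g100))) (trans (sym (left₁ 1 0)) at-101))

    -- The value at 111 is the cube of `ε 1` times v³. Both outer dilogarithms are removed from it;
    -- `κ`, used twice, exposes the contribution of the left one so that it cancels.
    M111 : M (1 ∷ 1 ∷ 1 ∷ []) + ε 1 * pw (ℤ.- ⁺ 2) * ε 1 ≡ ε 1 * ε 1 + ε 1 * ε 1 * pw (⁺ 2)
    M111 = cancel (trans (trans (+ˡ (*ˡ (sym g110))) (trans (+ʳ (trans (+ˡ (*ˡ (sym M011))) (sym (right₁ 1 1)))) (trans (sym (left₁ 1 1)) at-111)))
     (trans (*ˡ (*ʳ κ)) (trans (solve 3 (λ e d t → e :* t :* ((d :+ FS.con 1) :* e) := (e :* d) :* (e :* t) :+ e :* e :* t) refl (ε 1) ε′ (pw (⁺ 2)))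
     (trans (+ʳ (trans (solve 3 (λ e n t → e :* (e :* n) :* (e :* t) := e :* e :* (e :* (n :* t))) refl (ε 1) (pw (ℤ.- ⁺ 1)) (pw (⁺ 2)))
      (*ˡ (trans (*ˡ (sym (pw-+ (ℤ.- ⁺ 1) (⁺ 2)))) κ))))
     (trans (solve 3 (λ e n t → e :* e :* (e :* n :+ FS.con 1) :+ e :* e :* t := (e :* e :+ e :* e :* t) :+ e :* e :* (e :* n)) refl (ε 1) (pw (ℤ.- ⁺ 1)) (pw (⁺ 2)))
      (+ˡ (trans (*ˡ (*ˡ (pw-+ (ℤ.- ⁺ 2) (⁺ 1)))) (solve 3 (λ e n p → e :* e :* (e :* (n :* p)) := e :* n :* (e :* p :* e)) refl (ε 1) (pw (ℤ.- ⁺ 2)) (pw (⁺ 1))))))))))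

   middle-100 : M (1 ∷ 0 ∷ 0 ∷ []) ≡ 0F
   middle-100 = M100
   middle-001 : M (0 ∷ 0 ∷ 1 ∷ []) ≡ 0F
   middle-001 = M001

   -- The values of `M` force exactly one factor at 010 and one at 101; then `M111` says that the
   -- number of factors at 111 is [2]_v.
   not-middle : ¬ Middle M
   not-middle h = quantum-nonintegral H.c 0 (cancel (trans (trans (solve 3 (λ n e t → (n :* e :+ e :* e :* t) :+ e :* e := (n :* e :+ FS.con 1 :* (e :* e)) :+ e :* t :* e) refl (natF H.c) (ε 1) (pw (ℤ.- ⁺ 2)))
     (+ʳ (trans (cong (λ z → natF H.c * ε 1 + z * (ε 1 * ε 1)) (sym one)) (sym H.at-111)))) (trans M111 (+-comm (ε 1 * ε 1) (ε 1 * ε 1 * pw (⁺ 2))))))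
    where
    module H = Middle h
    one : natF (H.c₂ ℕ.* H.c₁₃) ≡ 1F
    one = trans (cong natF (cong₂ ℕ._*_ (natF-cancel H.c₂ (trans (sym H.at-010) M010)) (natF-cancel H.c₁₃ (trans (sym H.at-101) M101)))) natF-1

  Middle-cong : ∀ {f g} → f ≗ g → Middle g → Middle f
  Middle-cong h m = record { c₂ = Middle.c₂ m ; c₁₃ = Middle.c₁₃ m ; c = Middle.c m ; at-000 = trans (h _) (Middle.at-000 m) ; at-100 = trans (h _) (Middle.at-100 m) ; at-001 = trans (h _) (Middle.at-001 m)
   ; at-010 = trans (h _) (Middle.at-010 m) ; at-101 = trans (h _) (Middle.at-101 m) ; at-111 = trans (h _) (Middle.at-111 m) }

  module Triple {m : ℕ} {B : Q (suc m)} (q : IsQuiver B) (S : Face 3 (suc m)) (match : ∀ i j → B (vertex S i) (vertex S j) ≡ T₃ i j) where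
   private
    module R = Restrict {B = B} q S T₃ match
    module P = Products B

    v₁ v₂ v₃ : Fin (suc m)
    v₁ = vertex S zero
    v₂ = vertex S (suc zero)
    v₃ = vertex S (suc (suc zero))

    ray-middle : ∀ (x : Exponent (suc m)) → proj₁ x ≢ e v₁ → proj₁ x ≢ e v₃ →
     Σ (Middle (λ v → ray (proj₁ x) (proj₂ x) (embed S v))) (λ h → Middle.c₂ h ℕ.* Middle.c₁₃ h ≡ 0)
    ray-middle (x , x≢) n₁ n₃ = go (hit (0 ∷ 1 ∷ 0 ∷ []) (suc zero) refl) (hit (1 ∷ 0 ∷ 1 ∷ []) zero refl) (hit (1 ∷ 1 ∷ 1 ∷ []) zero refl)
     where
     Hit : Vec ℕ 3 → Set
     Hit v = ∃ λ N → ray x x≢ (embed S v) ≡ natF N * ε 1 × (N ≡ 0 ⊎ x ≡ embed S v)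
     hit : ∀ v i → lookup v i ≡ 1 → Hit v
     hit v i one = cases (x ≟ᵛ embed S v)
      where
      cases : Dec (x ≡ embed S v) → Hit v
      cases (yes h) = 1 , trans (trans (cong (ray x x≢) (sym h)) (ray-at x x≢)) (sym (trans (*ʳ natF-1) (*-identityˡ (ε 1)))) , inj₂ h
      cases (no h)  = 0 , trans (ray-off-primitive x (embed S v) x≢ (vertex S i) (trans (lookup-embed S v i) one) h) (sym (*-zeroˡ (ε 1))) , inj₁ refl
     zero-product : ∀ {N N′} → N ≡ 0 ⊎ x ≡ embed S (0 ∷ 1 ∷ 0 ∷ []) → N′ ≡ 0 ⊎ x ≡ embed S (1 ∷ 0 ∷ 1 ∷ []) → N ℕ.* N′ ≡ 0
     zero-product (inj₁ refl) _ = refl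
     zero-product {N} (inj₂ _) (inj₁ refl) = ℕP.*-zeroʳ N
     zero-product (inj₂ h) (inj₂ h′) with embed-injective S (0 ∷ 1 ∷ 0 ∷ []) (1 ∷ 0 ∷ 1 ∷ []) (trans (sym h) h′)
     ... | ()
     go : Hit (0 ∷ 1 ∷ 0 ∷ []) → Hit (1 ∷ 0 ∷ 1 ∷ []) → Hit (1 ∷ 1 ∷ 1 ∷ []) → Σ (Middle (λ v → ray x x≢ (embed S v))) (λ h → Middle.c₂ h ℕ.* Middle.c₁₃ h ≡ 0)
     go (c₂ , e₂ , h₂) (c₁₃ , e₁₃ , h₁₃) (c , eq , _) = record
      { c₂ = c₂ ; c₁₃ = c₁₃ ; c = c
      ; at-000 = trans (cong (ray x x≢) (embed-𝟘 S)) (ray-𝟘 x x≢)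
      ; at-100 = ray-off-primitive x (embed S (1 ∷ 0 ∷ 0 ∷ [])) x≢ v₁ (lookup-embed S (1 ∷ 0 ∷ 0 ∷ []) zero) (λ h → n₁ (trans h (embed-e S zero)))
      ; at-001 = ray-off-primitive x (embed S (0 ∷ 0 ∷ 1 ∷ [])) x≢ v₃ (lookup-embed S (0 ∷ 0 ∷ 1 ∷ []) (suc (suc zero))) (λ h → n₃ (trans h (embed-e S (suc (suc zero)))))
      ; at-010 = e₂ ; at-101 = e₁₃
      ; at-111 = trans eq (sym (trans (+ˡ (trans (*ʳ (cong natF (zero-product h₂ h₁₃))) (*-zeroˡ _))) (+-identityʳ _))) } , zero-product h₂ h₁₃

    product-middle : ∀ xs → (∀ {x} → x ∈ xs → proj₁ x ≢ e v₁ × proj₁ x ≢ e v₃) → Middle (λ v → P.product xs (embed S v))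
    product-middle [] _ = record
     { c₂ = 0 ; c₁₃ = 0 ; c = 0
     ; at-000 = trans (cong δ (embed-𝟘 S)) (δ-𝟘 (suc m))
     ; at-100 = off (1 ∷ 0 ∷ 0 ∷ []) zero refl ; at-001 = off (0 ∷ 0 ∷ 1 ∷ []) (suc (suc zero)) refl
     ; at-010 = trans (off (0 ∷ 1 ∷ 0 ∷ []) (suc zero) refl) (sym (*-zeroˡ (ε 1)))
     ; at-101 = trans (off (1 ∷ 0 ∷ 1 ∷ []) zero refl) (sym (*-zeroˡ (ε 1)))
     ; at-111 = trans (off (1 ∷ 1 ∷ 1 ∷ []) zero refl) (sym (trans (cong₂ _+_ (*-zeroˡ (ε 1)) (*-zeroˡ (ε 1 * ε 1))) (+-identityˡ 0F))) }
     where
     off : ∀ v i → lookup v i ≡ 1 → δ (embed S v) ≡ 0F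
     off v i one = δ-≢ (embed S v) (λ z → 1≢0 (trans (sym one) (trans (sym (lookup-embed S v i)) (trans (cong (λ u → lookup u (vertex S i)) (trans z (sym (embed-𝟘 S))))
      (trans (lookup-embed S 𝟘 i) (zeros i))))))
      where
      1≢0 : 1 ≢ 0
      1≢0 ()
      zeros : ∀ (i : Fin 3) → lookup 𝟘 i ≡ 0
      zeros zero             = refl
      zeros (suc zero)       = refl
      zeros (suc (suc zero)) = refl
    product-middle (x ∷ xs) h = Middle-cong (λ v → R.⋆-embed (ray (proj₁ x) (proj₂ x)) (P.product xs) v)
     (Middle-⋆ (λ v → ray (proj₁ x) (proj₂ x) (embed S v)) (λ v → P.product xs (embed S v)) (proj₁ r) (proj₂ r) (product-middle xs (λ i → h (there i))))
     where r = ray-middle x (proj₁ (h (here refl))) (proj₂ (h (here refl)))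

   -- The values on the face make the coefficients of the inner product at both outer generators
   -- vanish, so by positivity neither occurs in `mid`. The inner product then has the shape
   -- `Middle`, which `not-middle` refutes.
   sandwich-unfactored : ∀ {mid} → ¬ Factored {B = B} q (ê v₃ ∷ mid ++ ê v₁ ∷ [])
   sandwich-unfactored {mid} f = W.not-middle (product-middle mid (λ {x} i →
     (λ h → Pos⇒≢0 (P.product-pos mid i) (trans (cong (P.product mid) (trans h (sym (embed-e S zero)))) W.middle-100)) ,
     (λ h → Pos⇒≢0 (P.product-pos mid i) (trans (cong (P.product mid) (trans h (sym (embed-e S (suc (suc zero)))))) W.middle-001))))
    where
    open Factored f
    g M : Series 3
    g v = series (embed S v)
    M v = P.product mid (embed S v)
    g≗ : g ≗ dilog (suc (suc zero)) ⋆₃ (M ⋆₃ dilog zero)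
    g≗ v = trans (factors (embed S v)) (trans (R.⋆-embed (ray (e v₃) (e≢𝟘 v₃)) (P.product (mid ++ ê v₁ ∷ [])) v)
     (Conv.⋆-cong (twist T₃) (dilog-embed S (suc (suc zero))) (λ u → trans (P.product-snoc mid v₁ (embed S u)) (trans (R.⋆-embed (P.product mid) (dilog v₁) u)
      (Conv.⋆-cong (twist T₃) {f = M} (λ _ → refl) (λ t → trans (dilog≗ray v₁ (embed S t)) (dilog-embed S zero t)) u))) v))
    g011 : g (0 ∷ 1 ∷ 1 ∷ []) ≡ ε 1 * pw (⁺ 1) * ε 1
    g011 = trans (R.face-source good (suc zero) (0 ∷ 0 ∷ 1 ∷ []) refl refl) (*ˡ (R.face-unit good (suc (suc zero))))
    values : Values g
    values = record
     { at-100 = R.face-unit good zero ; at-010 = R.face-unit good (suc zero) ; at-001 = R.face-unit good (suc (suc zero))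
     ; at-110 = trans (R.face-source good zero (0 ∷ 1 ∷ 0 ∷ []) refl refl) (*ˡ (R.face-unit good (suc zero)))
     ; at-101 = trans (R.face-source good zero (0 ∷ 0 ∷ 1 ∷ []) refl refl) (*ˡ (R.face-unit good (suc (suc zero))))
     ; at-011 = g011
     ; at-111 = trans (R.face-source good zero (0 ∷ 1 ∷ 1 ∷ []) refl refl) (*ˡ g011) }
    module W = Sandwich g M (trans (cong (P.product mid) (embed-𝟘 S)) (P.product-𝟘 mid)) g≗ values

  -- Stated for arbitrary vertex sets, to serve quivers and framed quivers alike.
  mutate-relabel : ∀ {V W : Set} (_≟ⱽ_ : DecidableEquality V) (_≟ᵂ_ : DecidableEquality W) {B : Mat W} {A : Mat V} (τ : V → W) →
   (∀ {i j} → τ i ≡ τ j → i ≡ j) → (∀ i j → B (τ i) (τ j) ≡ A i j) → ∀ k i j → mutate _≟ᵂ_ (τ k) B (τ i) (τ j) ≡ mutate _≟ⱽ_ k A i j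
  mutate-relabel _≟ⱽ_ _≟ᵂ_ τ inj h k i j with τ i ≟ᵂ τ k | i ≟ⱽ k | τ j ≟ᵂ τ k | j ≟ⱽ k
  ... | yes _ | yes _ | _     | _     = cong ℤ.-_ (h i j)
  ... | no _  | no _  | yes _ | yes _ = cong ℤ.-_ (h i j)
  ... | no _  | no _  | no _  | no _  = cong₂ (λ u v → u ℤ.+ ℤ.- v) (cong₂ (λ u v → u ℤ.+ v) (h i j) (cong₂ (λ u v → pos u ℤ.* pos v) (h i k) (h k j)))
    (cong₂ (λ u v → pos (ℤ.- u) ℤ.* pos (ℤ.- v)) (h i k) (h k j))
  ... | yes p | no n  | _     | _     = ⊥-elim (n (inj p))
  ... | no n  | yes p | _     | _     = ⊥-elim (n (cong τ p))
  ... | no _  | no _  | yes p | no n  = ⊥-elim (n (inj p))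
  ... | no _  | no _  | no n  | yes p = ⊥-elim (n (cong τ p))

  μ-relabel : ∀ {m n} {B : Q n} {A : Q m} (τ : Fin m → Fin n) → (∀ {i j} → τ i ≡ τ j → i ≡ j) → (∀ i j → B (τ i) (τ j) ≡ A i j) →
   ∀ k i j → μ (τ k) B (τ i) (τ j) ≡ μ k A i j
  μ-relabel = mutate-relabel _≟ᶠ_ _≟ᶠ_

  Heavy-relabel : ∀ {m n} {B : Q n} {A : Q m} (τ : Fin m → Fin n) → (∀ i j → B (τ i) (τ j) ≡ A i j) → Heavy A → Heavy B
  Heavy-relabel τ h (a , b , c , ab , bc , ca) = τ a , τ b , τ c , subst Big (sym (h a b)) ab , subst Big (sym (h b c)) bc , subst Big (sym (h c a)) ca

  -- Rotating k to the other end yields a factorization for `μ k B`, which a heavy triangle forbids.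
  first-light : ∀ {m} {B : Q (suc (suc m))} (q : IsQuiver B) {k ys} → Factored {B = B} q (ê k ∷ ys) → ¬ Heavy (μ k B)
  first-light {B = B} q {k} f = heavy-unfactored (μ-quiver q k) (proj₂ (Rotation.rotate-first {B = B} {μ k B} q (μ-quiver q k) k (isometryIn q k) (isometryOut q k) (μ-row B k) f))

  last-light : ∀ {m} {B : Q (suc (suc m))} (q : IsQuiver B) {k ys} → Factored {B = B} q (ys ++ ê k ∷ []) → ¬ Heavy (μ k B)
  last-light {B = B} q {k} f = heavy-unfactored (μ-quiver q k) (proj₂ (Rotation.rotate-last {B = B} {μ k B} q (μ-quiver q k) k (isometryIn q k) (isometryOut q k) (μ-row B k) f))

  -- The final entry is the only one equal to y, so any other exponent that occurs stands before it.
  last-index : ∀ {n} (y y′ : Vec ℕ n) zs x → proj₁ x ≡ y → y′ ≢ y → count y (zs ++ x ∷ []) ≡ 1 → count y′ (zs ++ x ∷ []) ≡ 1 →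
   index y′ (zs ++ x ∷ []) ℕ.< index y (zs ++ x ∷ [])
  last-index y y′ [] x refl y′≢y _ c with proj₁ x ≟ᵛ y′ 
  ... | yes h = ⊥-elim (y′≢y (sym h))
  last-index y y′ [] x refl y′≢y _ () | no _
  last-index y y′ (z ∷ zs) x x≡ y′≢y c c′ with proj₁ z ≟ᵛ y | proj₁ z ≟ᵛ y′
  ... | yes _ | _     = ⊥-elim (occurs zs (ℕP.suc-injective c))
   where
   occurs : ∀ zs → count y (zs ++ x ∷ []) ≢ 0
   occurs [] h with proj₁ x ≟ᵛ y
   occurs [] () | yes _
   ... | no ne = ne x≡
   occurs (z ∷ zs) h with proj₁ z ≟ᵛ y
   occurs (z ∷ zs) () | yes _
   ... | no _ = occurs zs h
  ... | no _  | yes _ = ℕ.s≤s ℕ.z≤n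
  ... | no _  | no _  = ℕ.s≤s (last-index y y′ zs x x≡ y′≢y c c′)

  -- A quiver without a heavy triangle whose mutations at o and y have one.
  record Blocked {m : ℕ} (B : Q (suc (suc (suc m)))) : Set where
   field
    o x y z : Fin (suc (suc (suc m)))
    cover   : ∀ i → i ≡ o ⊎ i ≡ x ⊎ i ≡ y ⊎ i ≡ z
    xy      : B x y ≡ 1ℤ
    yz      : B y z ≡ 1ℤ
    xz      : B x z ≡ 1ℤ
    ox      : Big (B o x)
    zo      : Big (B z o)
    heavy-o : Heavy (μ o B)
    heavy-y : Heavy (μ y B)

  module _ {m : ℕ} {B : Q (suc (suc (suc m)))} (q : IsQuiver B) where
   one-≢ : ∀ {a b} → B a b ≡ 1ℤ → a ≢ b
   one-≢ {a} h refl with trans (sym h) (diag-zero q a)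
   ... | ()

   triangle-unfactored : ∀ {x y z mid} → B x y ≡ 1ℤ → B y z ≡ 1ℤ → B x z ≡ 1ℤ → ¬ Factored {B = B} q (ê z ∷ mid ++ ê x ∷ [])
   triangle-unfactored {x} {y} {z} {mid} xy yz xz f = Triple.sandwich-unfactored {B = B} q S match {mid}
     (subst (λ v → Factored {B = B} q (ê v ∷ mid ++ ê x ∷ [])) (sym z≡) f)
    where
    j₁ j₂ : Fin (suc (suc m))
    j₁ = punchOut (one-≢ xy)
    j₂ = punchOut (one-≢ xz)
    j₁≢j₂ : j₁ ≢ j₂
    j₁≢j₂ h = one-≢ yz (punchOut-injective (one-≢ xy) (one-≢ xz) h)
    S : Face 3 (suc (suc (suc m)))
    S = x ∷ j₁ ∷ punchOut j₁≢j₂ ∷ []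
    y≡ : vertex S (suc zero) ≡ y
    y≡ = punchIn-punchOut (one-≢ xy)
    z≡ : vertex S (suc (suc zero)) ≡ z
    z≡ = trans (cong (punchIn x) (punchIn-punchOut j₁≢j₂)) (punchIn-punchOut (one-≢ xz))
    flip-sign : ∀ {a b} → B a b ≡ 1ℤ → B b a ≡ -1ℤ
    flip-sign {a} {b} h = trans (q b a) (cong ℤ.-_ h)
    match : ∀ i j → B (vertex S i) (vertex S j) ≡ T₃ i j
    match zero             zero             = diag-zero q x
    match zero             (suc zero)       = trans (cong (B x) y≡) xy
    match zero             (suc (suc zero)) = trans (cong (B x) z≡) xz
    match (suc zero)       zero             = trans (cong (λ t → B t x) y≡) (flip-sign xy)
    match (suc zero)       (suc zero)       = diag-zero q _
    match (suc zero)       (suc (suc zero)) = trans (cong₂ B y≡ z≡) yz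
    match (suc (suc zero)) zero             = trans (cong (λ t → B t x) z≡) (flip-sign xz)
    match (suc (suc zero)) (suc zero)       = trans (cong₂ B z≡ y≡) (flip-sign yz)
    match (suc (suc zero)) (suc (suc zero)) = diag-zero q _

  e-injective : ∀ {m} {i j : Fin (suc m)} → e i ≡ e j → i ≡ j
  e-injective {i = i} {j} h = go (i ≟ᶠ j)
   where
   go : Dec (i ≡ j) → i ≡ j
   go (yes p) = p
   go (no ne) with trans (sym (trans (lattice-axis i 1 i) (trans (ℤP.*-identityˡ (unit i i)) (unit-same i))))
            (trans (cong (λ v → ⟦ v ⟧ i) h) (trans (lattice-axis j 1 i) (trans (ℤP.*-identityˡ (unit j i)) (unit-≢ ne))))
   ... | ()

  -- Heaviness of the mutations excludes o and y at both ends. The multiple arrow o → x keeps x from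
  -- being first, and z → o keeps z from being last. So the factorization starts at z and ends at x,
  -- against the triangle x → y → z, x → z.
  blocked⇒¬MGS : ∀ {m} {B : Q (suc (suc (suc m)))} → IsQuiver B → Blocked B → ¬ HasMGS B
  blocked⇒¬MGS {m} {B₀} q₀ b h = ends (cover f) (cover l)
   where
   open Blocked b
   open Final (HasMGS⇒Final q₀ h)
   zo′ : Big (B (τ z) (τ o))
   zo′ = subst Big (sym (relabelled z o)) zo
   ox′ : Big (B (τ o) (τ x))
   ox′ = subst Big (sym (relabelled o x)) ox
   module ZO = Pair {B = B} q (τ z) (τ o) (Big-≢ q zo′) (B (τ z) (τ o)) refl
   module OX = Pair {B = B} q (τ o) (τ x) (Big-≢ q ox′) (B (τ o) (τ x)) refl
   z<o : index (e (τ z)) xs ℕ.< index (e (τ o)) xs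
   z<o = ZO.heavy-order factored zo′
   o<x : index (e (τ o)) xs ℕ.< index (e (τ x)) xs
   o<x = OX.heavy-order factored ox′
   at-first : Factored {B = B} q (ê (τ f) ∷ ys)
   at-first = subst (Factored {B = B} q) first factored
   at-last : Factored {B = B} q (zs ++ ê (τ l) ∷ [])
   at-last = subst (Factored {B = B} q) last factored
   heavy-μ : ∀ k → Heavy (μ k B₀) → Heavy (μ (τ k) B)
   heavy-μ k = Heavy-relabel τ (μ-relabel τ τ-injective relabelled k)
   not-first : ∀ k → Heavy (μ k B₀) → f ≢ k
   not-first k H refl = first-light q at-first (heavy-μ k H)
   not-last : ∀ k → Heavy (μ k B₀) → l ≢ k
   not-last k H refl = last-light q at-last (heavy-μ k H)
   first≢x : f ≢ x
   first≢x refl = ℕP.n≮0 (subst (index (e (τ o)) xs ℕ.<_) (trans (cong (index (e (τ x))) first) head-index) o<x)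
    where
    head-index : index (e (τ x)) (ê (τ x) ∷ ys) ≡ 0
    head-index with e (τ x) ≟ᵛ e (τ x)
    ... | yes _ = refl
    ... | no ne = ⊥-elim (ne refl)
   last≢z : l ≢ z
   last≢z refl = ℕP.<-asym z<o (subst (λ xs → index (e (τ o)) xs ℕ.< index (e (τ z)) xs) (sym last)
    (last-index (e (τ z)) (e (τ o)) zs (ê (τ z)) refl (λ p → Big-≢ q zo′ (sym (e-injective p)))
     (trans (cong (count (e (τ z))) (sym last)) (ZO.count-first factored)) (trans (cong (count (e (τ o))) (sym last)) (ZO.count-second factored))))
   final-step : ∀ zs ys → ê (τ z) ∷ ys ≡ zs ++ ê (τ x) ∷ [] → Factored {B = B} q (ê (τ z) ∷ ys) → ⊥
   final-step [] ys p _ = z≢x (τ-injective (e-injective (cong heads p)))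
    where
    heads : List (Exponent (suc (suc (suc m)))) → Vec ℕ (suc (suc (suc m)))
    heads []      = 𝟘
    heads (x ∷ _) = proj₁ x
    z≢x : z ≢ x
    z≢x p = one-≢ q₀ xz (sym p)
   final-step (w ∷ mid) _ refl g = triangle-unfactored q {τ x} {τ y} {τ z} {mid} (trans (relabelled x y) xy) (trans (relabelled y z) yz) (trans (relabelled x z) xz) g
   ends : f ≡ o ⊎ f ≡ x ⊎ f ≡ y ⊎ f ≡ z → l ≡ o ⊎ l ≡ x ⊎ l ≡ y ⊎ l ≡ z → ⊥
   ends (inj₁ p) _                      = not-first o heavy-o p
   ends (inj₂ (inj₁ p)) _               = first≢x p
   ends (inj₂ (inj₂ (inj₁ p))) _        = not-first y heavy-y p
   ends (inj₂ (inj₂ (inj₂ _))) (inj₁ p) = not-last o heavy-o p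
   ends (inj₂ (inj₂ (inj₂ p))) (inj₂ (inj₁ p′)) = final-step zs ys
    (trans (cong (λ k → ê (τ k) ∷ ys) (sym p)) (trans (sym first) (trans last (cong (λ k → zs ++ ê (τ k) ∷ []) p′))))
    (subst (λ k → Factored {B = B} q (ê (τ k) ∷ ys)) p at-first)
   ends (inj₂ (inj₂ (inj₂ _))) (inj₂ (inj₂ (inj₁ p))) = not-last y heavy-y p
   ends (inj₂ (inj₂ (inj₂ _))) (inj₂ (inj₂ (inj₂ p))) = last≢z p

 -- Invariance under isomorphism, closed lists, and unbounded multiplicities.

 module Isomorphisms where
  open import Defs
  open Forms using (diag-zero)
  open Mutations using (μ-quiver)
  open Framings using (pos-nonneg; pos-nonpos)
  open Barriers using (mutate-relabel; μ-relabel)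
  open import Data.Integer using (_+_; _*_; -_; _-_; _≤_; _<_; ∣_∣)
  open import Data.Fin.Permutation as Perm using (Permutation′; _⟨$⟩ʳ_; _⟨$⟩ˡ_; inverseʳ; inverseˡ; flip; _∘ₚ_)
  open import Data.Vec.Properties using (lookup∘tabulate)
  open import Data.List using (map)
  open import Data.List.Relation.Unary.Any as Any using (Any; here; there)
  open import Data.List.Relation.Unary.All as All using (All)
  open import Data.List.Membership.Propositional using (_∈_; find; lose)
  open import Data.List.Membership.Propositional.Properties using (∈-map⁺; ∈-++⁺ˡ; ∈-++⁺ʳ)
  import Data.Sum as Sum
  open import Data.Sum.Properties using (inj₁-injective; inj₂-injective)

  module _ {n : ℕ} where
   ≅-pointwise : {B C : Q n} → (∀ i j → C i j ≡ B i j) → B ≅ C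
   ≅-pointwise h = Perm.id , h

   ≅-sym : {B C : Q n} → B ≅ C → C ≅ B
   ≅-sym {B} {C} (σ , h) = flip σ , λ i j → trans (sym (h (σ ⟨$⟩ˡ i) (σ ⟨$⟩ˡ j))) (cong₂ C (inverseʳ σ) (inverseʳ σ))

   ≅-trans : {B C D : Q n} → B ≅ C → C ≅ D → B ≅ D
   ≅-trans (σ , h) (τ , g) = σ ∘ₚ τ , λ i j → trans (g (σ ⟨$⟩ʳ i) (σ ⟨$⟩ʳ j)) (h i j)

   permutation-injective : (σ : Permutation′ n) → ∀ {i j} → σ ⟨$⟩ʳ i ≡ σ ⟨$⟩ʳ j → i ≡ j
   permutation-injective σ e = trans (sym (inverseˡ σ)) (trans (cong (σ ⟨$⟩ˡ_) e) (inverseˡ σ))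

   μ-≅ : {B C : Q n} (i : B ≅ C) → ∀ k → μ k B ≅ μ (proj₁ i ⟨$⟩ʳ k) C
   μ-≅ (σ , h) k = σ , μ-relabel (σ ⟨$⟩ʳ_) (permutation-injective σ) h k

   μs-≅ : {B C : Q n} (i : B ≅ C) → ∀ ks → μs ks B ≅ μs (map (proj₁ i ⟨$⟩ʳ_) ks) C
   μs-≅ i []       = i
   μs-≅ i (k ∷ ks) = μs-≅ (μ-≅ i k) ks

   private
    relabel⊎ : Permutation′ n → Fin n ⊎ Fin n → Fin n ⊎ Fin n
    relabel⊎ σ = Sum.map (σ ⟨$⟩ʳ_) (σ ⟨$⟩ʳ_)

    relabel⊎-injective : ∀ σ {u v} → relabel⊎ σ u ≡ relabel⊎ σ v → u ≡ v
    relabel⊎-injective σ {inj₁ _} {inj₁ _} e = cong inj₁ (permutation-injective σ (inj₁-injective e))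
    relabel⊎-injective σ {inj₂ _} {inj₂ _} e = cong inj₂ (permutation-injective σ (inj₂-injective e))

    GreenSeq-relabel : ∀ σ ks {M M′} → (∀ u v → M′ (relabel⊎ σ u) (relabel⊎ σ v) ≡ M u v) → GreenSeq M ks → GreenSeq M′ (map (σ ⟨$⟩ʳ_) ks)
    GreenSeq-relabel σ [] {M} {M′} h red k j = subst (_≤ 0ℤ) (trans (sym (h (inj₁ (σ ⟨$⟩ˡ k)) (inj₂ (σ ⟨$⟩ˡ j)))) (cong₂ (λ k j → M′ (inj₁ k) (inj₂ j)) (inverseʳ σ) (inverseʳ σ))) (red (σ ⟨$⟩ˡ k) (σ ⟨$⟩ˡ j))
    GreenSeq-relabel σ (k ∷ ks) {M} {M′} h (green , rest) =
     (λ j → subst (_≤ 0ℤ) (trans (sym (h (inj₂ (σ ⟨$⟩ˡ j)) (inj₁ k))) (cong (λ j → M′ (inj₂ j) (inj₁ (σ ⟨$⟩ʳ k))) (inverseʳ σ))) (green (σ ⟨$⟩ˡ j))) ,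
     GreenSeq-relabel σ ks (mutate-relabel decV decV {M′} {M} (relabel⊎ σ) (relabel⊎-injective σ) h (inj₁ k)) rest

   HasMGS-≅ : {B C : Q n} → B ≅ C → HasMGS B → HasMGS C
   HasMGS-≅ {B} {C} (σ , h) (ks , g) = map (σ ⟨$⟩ʳ_) ks , GreenSeq-relabel σ ks framed-relabel g
    where
    δ-relabel : ∀ i j → δ (σ ⟨$⟩ʳ i) (σ ⟨$⟩ʳ j) ≡ δ i j
    δ-relabel i j with (σ ⟨$⟩ʳ i) ≟ᶠ (σ ⟨$⟩ʳ j) | i ≟ᶠ j
    ... | yes _ | yes _ = refl
    ... | no _  | no _  = refl
    ... | yes p | no ¬p = ⊥-elim (¬p (permutation-injective σ p))
    ... | no ¬p | yes p = ⊥-elim (¬p (cong (σ ⟨$⟩ʳ_) p))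
    framed-relabel : ∀ u v → framed C (relabel⊎ σ u) (relabel⊎ σ v) ≡ framed B u v
    framed-relabel (inj₁ i) (inj₁ j) = h i j
    framed-relabel (inj₁ i) (inj₂ j) = δ-relabel i j
    framed-relabel (inj₂ i) (inj₁ j) = cong -_ (δ-relabel i j)
    framed-relabel (inj₂ i) (inj₂ j) = refl

   MutFinite-≅ : {B C : Q n} → B ≅ C → MutFinite C → MutFinite B
   MutFinite-≅ {B} {C} i (L , h) = L , λ ks → Any.map (λ {D} → ≅-trans {μs ks B} {μs (map (proj₁ i ⟨$⟩ʳ_) ks) C} {D} (μs-≅ {B} {C} i ks)) (h (map (proj₁ i ⟨$⟩ʳ_) ks))

   closed⇒MutFinite : (L : List (Q n)) → (∀ {D} → D ∈ L → ∀ k → Any (μ k D ≅_) L) → ∀ {B} → Any (B ≅_) L → MutFinite B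
   closed⇒MutFinite L closed {B} b = L , λ ks → go ks b
    where
    go : ∀ ks {B} → Any (B ≅_) L → Any (μs ks B ≅_) L
    go []       b = b
    go (k ∷ ks) {B} b = let (D , D∈L , i) = find b in go ks (Any.map (λ {E} → ≅-trans {μ k B} {μ (proj₁ i ⟨$⟩ʳ k) D} {E} (μ-≅ {B} {D} i k)) (closed D∈L (proj₁ i ⟨$⟩ʳ k)))

   -- A step leaving the list would end at a quiver without a maximal green sequence, hence outside
   -- Ψ.
   closed⇒PsiCompFinite : (L : List (Q n)) → (∀ {D} → D ∈ L → ∀ k → Any (μ k D ≅_) L ⊎ ¬ HasMGS (μ k D)) → ∀ {B} → Any (B ≅_) L → PsiCompFinite B
   closed⇒PsiCompFinite L closed {B} b = L , λ C → go
    where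
    go : ∀ {C} → InPsiComp B C → Any (C ≅_) L
    go (here _) = b
    go (step {C} r k h) with find (go r)
    ... | D , D∈L , i with closed D∈L (proj₁ i ⟨$⟩ʳ k)
    ...   | inj₁ a  = Any.map (λ {E} → ≅-trans {μ k C} {μ (proj₁ i ⟨$⟩ʳ k) D} {E} (μ-≅ {C} {D} i k)) a
    ...   | inj₂ ¬h = ⊥-elim (¬h (HasMGS-≅ {μ k C} {μ (proj₁ i ⟨$⟩ʳ k) D} (μ-≅ {C} {D} i k) h))

   PsiProper-≅ : {B C : Q n} → B ≅ C → ∀ ks → ¬ HasMGS (μs ks C) → PsiProper B
   PsiProper-≅ {B} {C} i ks ¬h = ks′ , λ h → ¬h (HasMGS-≅ {μs ks′ B} {μs ks C} (≅-sym {μs ks C} {μs ks′ B} (μs-≅ {C} {B} (≅-sym {B} {C} i) ks)) h)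
    where ks′ = map (proj₁ (≅-sym {B} {C} i) ⟨$⟩ʳ_) ks

   -- Steps in Ψ act on labelled quivers, while walks are certified only up to relabelling. This
   -- relation absorbs the difference and composes.
   Linked : Q n → Q n → Set
   Linked B C = ∃ λ D → InPsiComp B D × (D ≅ C)

   linked-≅ : {B C : Q n} → HasMGS B → B ≅ C → Linked B C
   linked-≅ h i = _ , here h , i

   linked-step : {B C : Q n} → Linked B C → ∀ k → HasMGS (μ k C) → Linked B (μ k C)
   linked-step {B} {C} (D , r , i) k h = μ j D , step r j (HasMGS-≅ {μ k C} {μ j D} (≅-sym {μ j D} {μ k C} e) h) , e
    where
    j : Fin n
    j = proj₁ i ⟨$⟩ˡ k
    e : μ j D ≅ μ k C
    e = subst (λ t → μ j D ≅ μ t C) (inverseʳ (proj₁ i)) (μ-≅ {D} {C} i j)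

   linked-trans : {B C E : Q n} → Linked B C → Linked C E → Linked B E
   linked-trans {B} {C} {E} l (D , r , i) = let (D′ , r′ , i′) = go r in D′ , r′ , ≅-trans {D′} {D} {E} i′ i
    where
    go : ∀ {D} → InPsiComp C D → Linked B D
    go (here _)     = l
    go (step r k h) = linked-step (go r) k h

  μ-involutive : ∀ {n} (B : Q n) k i j → μ k (μ k B) i j ≡ B i j
  μ-involutive B k i j with i ≟ᶠ k in p | j ≟ᶠ k in r
  ... | yes refl | _ rewrite p = ℤP.neg-involutive (B i j)
  ... | no _ | yes refl rewrite p | r = ℤP.neg-involutive (B i j)
  ... | no _ | no _ with k ≟ᶠ k
  ...   | no ne = ⊥-elim (ne refl)
  ...   | yes _ rewrite p | r = trans (cong₂ (λ u v → B i j + pos (B i k) * pos (B k j) + - (pos (- B i k) * pos (- B k j)) + pos (- B i k) * pos (- B k j) + - (pos u * pos v))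
      (ℤP.neg-involutive (B i k)) (ℤP.neg-involutive (B k j))) (lem (B i j) (pos (B i k) * pos (B k j)) (pos (- B i k) * pos (- B k j)))
   where
   lem : ∀ b x y → b + x + - y + y + - x ≡ b
   lem = solve-∀

  bounded-fin : ∀ n (f : Fin n → ℕ) → ∃ λ N → ∀ i → f i ℕ.≤ N
  bounded-fin zero    f = 0 , λ ()
  bounded-fin (suc n) f = let (N , h) = bounded-fin n (λ i → f (suc i)) in f zero ℕ.+ N ,
   λ { zero → ℕP.m≤m+n (f zero) N ; (suc i) → ℕP.≤-trans (h i) (ℕP.m≤n+m N (f zero)) }

  -- Finitely many representatives bound all multiplicities in the class, so unbounded growth
  -- refutes finiteness.
  MutFinite⇒bounded : ∀ {n} {B : Q n} → MutFinite B → ∃ λ N → ∀ ks i j → ∣ μs ks B i j ∣ ℕ.≤ N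
  MutFinite⇒bounded {n} {B} (L , h) = let (N , g) = bound L in N , λ ks i j → g (h ks) i j
   where
   bound : ∀ L → ∃ λ N → ∀ {C : Q n} → Any (C ≅_) L → ∀ i j → ∣ C i j ∣ ℕ.≤ N
   bound [] = 0 , λ ()
   bound (D ∷ L) = let (N , g) = bound L ; (M , f) = bounded-fin n (λ i → proj₁ (bounded-fin n (λ j → ∣ D i j ∣))) in M ℕ.+ N ,
    λ { (here (σ , e)) i j → ℕP.≤-trans (subst (λ z → ∣ z ∣ ℕ.≤ M) (e i j) (ℕP.≤-trans (proj₂ (bounded-fin n (λ j → ∣ D (σ ⟨$⟩ʳ i) j ∣)) (σ ⟨$⟩ʳ j)) (f (σ ⟨$⟩ʳ i)))) (ℕP.m≤m+n M N)
     ; (there a) i j → ℕP.≤-trans (g a i j) (ℕP.m≤n+m N M) }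

  -- An arrow p → r of multiplicity x ≥ 3 and a third vertex c. Mutating at p and exchanging the roles of p and r
  -- turns (u , v) = (B c p , B c r) into (v + x [u]₊ , − u).
  record Growing {n : ℕ} (B : Q n) (x u v : ℤ) : Set where
   field
    skew  : IsQuiver B
    p r c : Fin n
    c≢p   : c ≢ p
    r≢p   : r ≢ p
    c≢r   : c ≢ r
    pr    : B p r ≡ x
    cp    : B c p ≡ u
    cr    : B c r ≡ v

  module Growth {n : ℕ} (x : ℤ) (x≥3 : ⁺ 3 ≤ x) where
   private
    x≥0 : 0ℤ ≤ x
    x≥0 = ℤP.≤-trans (ℤ.+≤+ ℕ.z≤n) x≥3

    grow : ∀ {B : Q n} {u v} → Growing B x u v → ∃ λ k → Growing (μ k B) x (v + x * pos u) (- u)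
    grow {B} {u} {v} g = p , record { skew = μ-quiver skew p ; p = r ; r = p ; c = c ; c≢p = c≢r ; r≢p = λ e → r≢p (sym e) ; c≢r = c≢p
      ; pr = trans (edge r p (inj₂ refl)) (trans (sym (skew p r)) pr)
      ; cp = far ; cr = trans (edge c p (inj₂ refl)) (cong -_ cp) }
     where
     open Growing g
     edge : ∀ i j → i ≡ p ⊎ j ≡ p → μ p B i j ≡ - B i j
     edge i j h with i ≟ᶠ p | j ≟ᶠ p | h
     ... | yes _ | _     | _      = refl
     ... | no _  | yes _ | _      = refl
     ... | no ne | no _  | inj₁ e = ⊥-elim (ne e)
     ... | no _  | no ne | inj₂ e = ⊥-elim (ne e)
     far : μ p B c r ≡ v + x * pos u
     far with c ≟ᶠ p | r ≟ᶠ p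
     ... | yes e | _     = ⊥-elim (c≢p e)
     ... | no _  | yes e = ⊥-elim (r≢p e)
     ... | no _  | no _  = trans (cong₂ (λ s t → s + - t) (cong₂ _+_ cr (cong₂ _*_ (cong pos cp) (trans (cong pos pr) (pos-nonneg x≥0))))
       (cong (pos (- B c p) *_) (trans (cong (λ z → pos (- z)) pr) (pos-nonpos (ℤP.neg-mono-≤ x≥0)))))
       (lem v (pos u) x (pos (- B c p)))
      where
      lem : ∀ v u x y → v + u * x + - (y * 0ℤ) ≡ v + x * u
      lem = solve-∀

    Unbounded : Q n → Set
    Unbounded B = ∀ N → ∃ λ ks → ∃ λ i → ∃ λ j → ⁺ N ≤ μs ks B i j

    unbounded-step : ∀ {B : Q n} {u v} (g : Growing B x u v) → Unbounded (μ (proj₁ (grow g)) B) → Unbounded B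
    unbounded-step g h N = let (ks , i , j , b) = h N in proj₁ (grow g) ∷ ks , i , j , b

    pos-suc : ∀ t → pos (⁺ t) ≡ ⁺ t
    pos-suc t = pos-nonneg {⁺ t} (ℤ.+≤+ ℕ.z≤n)

    -- The cone u > − v ≥ 0, on which u + v increases.
    cone : ∀ d N {B : Q n} {u v} → Growing B x (⁺ suc u) v → v ≤ 0ℤ → 1ℤ ≤ ⁺ suc u + v → ⁺ N ≤ ⁺ suc u + v + ⁺ d →
     ∃ λ ks → ∃ λ i → ∃ λ j → ⁺ N ≤ μs ks B i j
    cone zero N {B} {u} {v} g v≤0 _ h = [] , c , p , subst (⁺ N ≤_) (sym cp) (ℤP.≤-trans (subst (⁺ N ≤_) (ℤP.+-identityʳ (⁺ suc u + v)) h)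
      (subst (⁺ suc u + v ≤_) (ℤP.+-identityʳ (⁺ suc u)) (ℤP.+-monoʳ-≤ (⁺ suc u) v≤0)))
     where open Growing g
    cone (suc d) N {B} {u} {v} g v≤0 s≥1 h = next (v + x * pos (⁺ suc u)) refl w≥1 (proj₂ (grow g))
     where
     U = ⁺ suc u
     prepend : (∃ λ ks → ∃ λ i → ∃ λ j → ⁺ N ≤ μs ks (μ (proj₁ (grow g)) B) i j) → ∃ λ ks → ∃ λ i → ∃ λ j → ⁺ N ≤ μs ks B i j
     prepend (ks , i , j , b) = proj₁ (grow g) ∷ ks , i , j , b
     U≥1 : 1ℤ ≤ U
     U≥1 = ℤ.+≤+ (ℕ.s≤s ℕ.z≤n)
     -- Here x ≥ 3 is decisive: for x = 2 the sum u + v would stay constant.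
     sum≥ : (U + v) + U ≤ (v + x * pos U) + (- U)
     sum≥ = subst₂ _≤_ (lem₁ U v) (trans (cong (λ z → v + x * z + - U) (sym (pos-suc (suc u)))) refl)
      (ℤP.+-monoˡ-≤ (- U) (ℤP.+-monoʳ-≤ v (ℤP.*-monoʳ-≤-nonNeg U x≥3)))
      where
      lem₁ : ∀ U v → v + ⁺ 3 * U + - U ≡ (U + v) + U
      lem₁ = solve-∀
     s′≥ : (U + v) + 1ℤ ≤ (v + x * pos U) + (- U)
     s′≥ = ℤP.≤-trans (ℤP.+-monoʳ-≤ (U + v) U≥1) sum≥
     w≥1 : 1ℤ ≤ v + x * pos U
     w≥1 = ℤP.≤-trans (ℤP.≤-trans s≥1 (subst (_≤ U + v + 1ℤ) (ℤP.+-identityʳ (U + v)) (ℤP.+-monoʳ-≤ (U + v) (ℤ.+≤+ ℕ.z≤n))))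
      (ℤP.≤-trans s′≥ (subst (v + x * pos U + - U ≤_) (ℤP.+-identityʳ (v + x * pos U)) (ℤP.+-monoʳ-≤ (v + x * pos U) (ℤP.neg-mono-≤ (ℤ.+≤+ (ℕ.z≤n {suc u}))))))
     next : ∀ w → w ≡ v + x * pos U → 1ℤ ≤ w → Growing (μ (proj₁ (grow g)) B) x (v + x * pos U) (- U) → ∃ λ ks → ∃ λ i → ∃ λ j → ⁺ N ≤ μs ks B i j
     next (⁺ suc u′) e _ g′ = prepend (cone d N (subst (λ z → Growing (μ (proj₁ (grow g)) B) x z (- U)) (sym e) g′) (ℤP.neg-mono-≤ (ℤ.+≤+ (ℕ.z≤n {suc u})))
         (subst (λ z → 1ℤ ≤ z + - U) (sym e) (ℤP.≤-trans s≥1 (ℤP.≤-trans (subst (_≤ U + v + 1ℤ) (ℤP.+-identityʳ (U + v)) (ℤP.+-monoʳ-≤ (U + v) (ℤ.+≤+ ℕ.z≤n))) s′≥)))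
         (subst (λ z → ⁺ N ≤ z + - U + ⁺ d) (sym e) (ℤP.≤-trans h (subst (_≤ (v + x * pos U) + - U + ⁺ d) (trans (ℤP.+-assoc (U + v) 1ℤ (⁺ d)) (cong (U + v +_) (sym (ℤP.pos-+ 1 d)))) (ℤP.+-monoˡ-≤ (⁺ d) s′≥)))))
     next (⁺ zero) e (ℤ.+≤+ ()) g′

    in-cone : ∀ {B : Q n} {u v} → Growing B x (⁺ suc u) v → v ≤ 0ℤ → 1ℤ ≤ ⁺ suc u + v → Unbounded B
    in-cone {u = u} {v} g v≤0 s N = cone N N g v≤0 s (subst (_≤ ⁺ suc u + v + ⁺ N) (ℤP.+-identityˡ (⁺ N)) (ℤP.+-monoˡ-≤ (⁺ N) (ℤP.≤-trans (ℤ.+≤+ ℕ.z≤n) s)))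

    positive : ∀ {B : Q n} {u v} → Growing B x (⁺ suc u) (⁺ v) → Unbounded B
    positive {B} {u} {v} g = unbounded-step g (go (⁺ v + x * pos (⁺ suc u)) refl (proj₂ (grow g)))
     where
     big : ⁺ 3 * ⁺ suc u ≤ ⁺ v + x * pos (⁺ suc u)
     big = subst (λ z → ⁺ 3 * ⁺ suc u ≤ ⁺ v + x * z) (sym (pos-suc (suc u))) (subst (_≤ ⁺ v + x * ⁺ suc u) (ℤP.+-identityˡ _) (ℤP.+-mono-≤ (ℤ.+≤+ (ℕ.z≤n {v})) (ℤP.*-monoʳ-≤-nonNeg (⁺ suc u) x≥3)))
     go : ∀ w → w ≡ ⁺ v + x * pos (⁺ suc u) → ∀ {C} → Growing C x (⁺ v + x * pos (⁺ suc u)) (- ⁺ suc u) → Unbounded C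
     go (⁺ suc w) e {C} g′ = in-cone (subst (λ z → Growing C x z (- ⁺ suc u)) (sym e) g′) (ℤP.neg-mono-≤ (ℤ.+≤+ (ℕ.z≤n {suc u})))
      (subst (λ z → 1ℤ ≤ z + - ⁺ suc u) (sym e) (ℤP.≤-trans (ℤP.≤-trans (ℤ.+≤+ {1} {suc u ℕ.+ suc u} (ℕ.s≤s ℕ.z≤n)) (ℤP.≤-reflexive (trans (ℤP.pos-+ (suc u) (suc u)) (lem (⁺ suc u))))) (ℤP.+-monoˡ-≤ (- ⁺ suc u) big)))
      where
      lem : ∀ U → U + U ≡ ⁺ 3 * U + - U
      lem = solve-∀
     go (⁺ zero) e g′ = ⊥-elim (ℤP.<⇒≱ (ℤ.+<+ (ℕ.s≤s ℕ.z≤n)) (ℤP.≤-trans (subst (⁺ 3 * ⁺ suc u ≤_) (sym e) big) ℤP.≤-refl))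
     go -[1+ w ] e g′ = ⊥-elim (ℤP.<⇒≱ { -[1+ w ] } ℤ.-<+ (subst (⁺ 3 * ⁺ suc u ≤_) (sym e) big))

    shift : ∀ {B : Q n} {u v} → u ≤ 0ℤ → (g : Growing B x u v) → Growing (μ (proj₁ (grow g)) B) x v (- u)
    shift {B} {u} {v} h g = subst (λ z → Growing (μ (proj₁ (grow g)) B) x z (- u)) (trans (cong (λ z → v + x * z) (pos-nonpos h)) (trans (cong (v +_) (ℤP.*-zeroʳ x)) (ℤP.+-identityʳ v))) (proj₂ (grow g))

    -- For u ≤ 0 the mutation is the quarter turn (u , v) ↦ (v , - u). After at most three turns the
    -- first entry is positive and the second nonnegative.
    flat : ∀ {B : Q n} {u v} → u ≤ 0ℤ → u ≢ 0ℤ ⊎ v ≢ 0ℤ → Growing B x u v → Unbounded B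
    flat {u = u} {⁺ suc v} h _ g = unbounded-step g (go u h (shift h g))
     where
     go : ∀ u → u ≤ 0ℤ → ∀ {C} → Growing C x (⁺ suc v) (- u) → Unbounded C
     go (⁺ zero)  _ = positive
     go -[1+ u ]  _ = positive
     go (⁺ suc u) (ℤ.+≤+ ())
    flat {u = ⁺ zero} {⁺ zero} h (inj₁ ne) = ⊥-elim (ne refl)
    flat {u = ⁺ zero} {⁺ zero} h (inj₂ ne) = ⊥-elim (ne refl)
    flat {u = ⁺ suc u} (ℤ.+≤+ ())
    flat {u = -[1+ u ]} {⁺ zero} h _ g = unbounded-step g (unbounded-step (shift h g) (positive (shift ℤP.≤-refl (shift h g))))
    flat {u = ⁺ zero} { -[1+ v ] } h _ g = unbounded-step g (unbounded-step g₁ (unbounded-step g₂ (positive (shift ℤP.≤-refl g₂))))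
     where
     g₁ = shift h g
     g₂ = shift ℤ.-≤+ g₁
    flat {u = -[1+ u ]} { -[1+ v ] } h _ g = unbounded-step g (unbounded-step (shift h g) (positive (shift ℤ.-≤+ (shift h g))))

    -- In the remaining region, u > 0 > v with u + v ≤ 0, the sum u + v still increases by at least
    -- 1 per step. So the bound d for its deficit decreases until the cone is reached.
    unbounded : ∀ d {B : Q n} {u v} → - (u + v) ≤ ⁺ d → u ≢ 0ℤ ⊎ v ≢ 0ℤ → Growing B x u v → Unbounded B
    unbounded d {u = ⁺ zero}   _ = flat ℤP.≤-refl
    unbounded d {u = -[1+ _ ]} _ = flat ℤ.-≤+
    unbounded d {u = ⁺ suc u} {⁺ v} _ _ g = positive g
    unbounded d {u = ⁺ suc u} { -[1+ v ] } h _ g = cases (1ℤ ℤ.≤? ⁺ suc u + -[1+ v ]) d h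
     where
     U = ⁺ suc u
     V = -[1+ v ]
     cases : Dec (1ℤ ≤ U + V) → ∀ d → - (U + V) ≤ ⁺ d → Unbounded _
     cases (yes s) _ _ = in-cone g ℤ.-≤+ s
     cases (no s) d h = unbounded-step g (descend d h)
      where
      grown : - ((V + x * pos U) + (- U)) ≤ - (U + V) - 1ℤ
      grown = subst₂ _≤_ (cong (λ z → - ((V + x * z) + (- U))) (sym (pos-suc (suc u)))) (lem U V) (ℤP.neg-mono-≤ (ℤP.≤-trans {j = V + ⁺ 3 * U + - U}
        (ℤP.≤-trans {j = U + V + U} (ℤP.+-monoʳ-≤ (U + V) (ℤ.+≤+ (ℕ.s≤s ℕ.z≤n))) (ℤP.≤-reflexive (lem₁ U V)))
        (ℤP.+-monoˡ-≤ (- U) (ℤP.+-monoʳ-≤ V (ℤP.*-monoʳ-≤-nonNeg U x≥3)))))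
       where
       lem : ∀ U V → - (U + V + 1ℤ) ≡ - (U + V) - 1ℤ
       lem = solve-∀
       lem₁ : ∀ U V → U + V + U ≡ V + ⁺ 3 * U + - U
       lem₁ = solve-∀
      nonzero : (V + x * pos U) ≢ 0ℤ ⊎ - U ≢ 0ℤ
      nonzero = inj₂ (λ ())
      descend : ∀ d → - (U + V) ≤ ⁺ d → Unbounded _
      descend (suc d) h = unbounded d (ℤP.≤-trans grown (subst (- (U + V) - 1ℤ ≤_) (lem (⁺ d)) (ℤP.+-monoˡ-≤ (- 1ℤ) (subst (- (U + V) ≤_) (ℤP.pos-+ 1 d) h)))) nonzero (proj₂ (grow g))
       where
       lem : ∀ d → 1ℤ + d - 1ℤ ≡ d
       lem = solve-∀
      descend zero h = step-zero (1ℤ ℤ.≤? (V + x * pos U) + - U)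
       where
       s0 : U + V ≡ 0ℤ
       s0 = ℤP.≤-antisym (below (U + V) s) (subst (0ℤ ≤_) (ℤP.neg-involutive (U + V)) (ℤP.neg-mono-≤ h))
        where
        below : ∀ z → ¬ 1ℤ ≤ z → z ≤ 0ℤ
        below (⁺ zero)  _ = ℤP.≤-refl
        below (⁺ suc z) n = ⊥-elim (n (ℤ.+≤+ (ℕ.s≤s ℕ.z≤n)))
        below -[1+ z ]  _ = ℤ.-≤+
       step-zero : Dec _ → Unbounded _
       step-zero _ = grown-cone (V + x * pos U) refl (proj₂ (grow g))
        where
        sum≥1 : 1ℤ ≤ (V + x * pos U) + - U
        sum≥1 = subst (1ℤ ≤_) (ℤP.neg-involutive _) (ℤP.neg-mono-≤ (ℤP.≤-trans grown (ℤP.≤-reflexive (cong (λ z → - z - 1ℤ) s0))))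
        grown-cone : ∀ w → w ≡ V + x * pos U → ∀ {C} → Growing C x (V + x * pos U) (- U) → Unbounded C
        grown-cone (⁺ suc w) e {C} g′ = in-cone (subst (λ z → Growing C x z (- U)) (sym e) g′) ℤ.-≤+ (subst (λ z → 1ℤ ≤ z + - U) (sym e) sum≥1)
        grown-cone (⁺ zero) e g′ = ⊥-elim (ℤP.<⇒≱ (ℤ.+<+ (ℕ.s≤s ℕ.z≤n)) (ℤP.≤-trans (subst (λ z → 1ℤ ≤ z + - U) (sym e) sum≥1) ℤ.-≤+))
        grown-cone -[1+ w ] e g′ = ⊥-elim (ℤP.<⇒≱ (ℤ.+<+ (ℕ.s≤s ℕ.z≤n)) (ℤP.≤-trans (subst (λ z → 1ℤ ≤ z + - U) (sym e) sum≥1) (ℤP.≤-trans ℤ.-≤+ ℤP.≤-refl)))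

   growing-infinite : ∀ {B : Q n} {u v} → u ≢ 0ℤ ⊎ v ≢ 0ℤ → Growing B x u v → ¬ MutFinite B
   growing-infinite {B} {u} {v} ne g fin = let (N , h) = MutFinite⇒bounded fin ; (ks , i , j , b) = unbounded ∣ - (u + v) ∣ (i≤∣i∣ _) ne g (suc N)
     in ℕP.<⇒≱ (ℕP.n<1+n N) (ℕP.≤-trans (abs-≥ b) (h ks i j))
    where
    i≤∣i∣ : ∀ z → z ≤ ⁺ ∣ z ∣
    i≤∣i∣ (⁺ z)    = ℤP.≤-refl
    i≤∣i∣ -[1+ z ] = ℤ.-≤+
    abs-≥ : ∀ {N z} → ⁺ N ≤ z → N ℕ.≤ ∣ z ∣
    abs-≥ (ℤ.+≤+ h) = h

 -- Bounds on multiplicities, and invariants of the mutation class.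

 module Invariants where
  open import Defs
  open Forms using (diag-zero; pos-neg)
  open Mutations using (μ-quiver)
  open Framings using (pos-nonneg; pos-nonpos)
  open Barriers using (μ-relabel)
  open Isomorphisms
  open import Data.Integer using (_+_; _*_; -_; _-_; _≤_; _<_; ∣_∣; _⊖_)
  open import Data.Sign as Sign using (Sign; opposite) renaming (_*_ to _⊗_)
  open import Data.Fin.Properties using (injective⇒≤)
  open import Data.Fin.Permutation as Perm using ()
  open import Data.Vec using (_[_]%=_; replicate)
  open import Data.Vec.Properties using (lookup∘updateAt; lookup∘updateAt′; lookup-replicate)
  open import Data.Vec.Relation.Unary.AllPairs using ([]; _∷_)
  open import Data.Vec.Relation.Unary.All using ([]; _∷_)
  open import Data.Vec.Relation.Unary.Unique.Propositional.Properties using (lookup-injective)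
  open import Data.List using (_++_; map)
  open import Data.List.Relation.Unary.Any using (Any; here; there)
  open import Data.List.Membership.Propositional using (_∈_; lose)
  open import Data.List.Membership.Propositional.Properties using (∈-map⁺; ∈-++⁺ˡ; ∈-++⁺ʳ)

  five-vertices : ∀ {a b c d e : Fin 4} → a ≢ b → a ≢ c → a ≢ d → a ≢ e → b ≢ c → b ≢ d → b ≢ e → c ≢ d → c ≢ e → d ≢ e → ⊥
  five-vertices {a} {b} {c} {d} {e} ab ac ad ae bc bd be cd ce de = ℕP.<-irrefl refl (injective⇒≤ {f = lookup (a ∷ b ∷ c ∷ d ∷ e ∷ [])}
   (λ {i} {j} → lookup-injective ((ab ∷ ac ∷ ad ∷ ae ∷ []) ∷ (bc ∷ bd ∷ be ∷ []) ∷ (cd ∷ ce ∷ []) ∷ (de ∷ []) ∷ [] ∷ []) i j))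

  Matching : ∀ {n} → Q n → Set
  Matching B = ∀ i j k → i ≢ j → i ≢ k → j ≢ k → B i k ≡ 0ℤ ⊎ B k j ≡ 0ℤ

  μ-entry : ∀ {n} {B : Q n} → IsQuiver B → ∀ k i j → i ≢ k → j ≢ k → μ k B i j ≡ B i j + (pos (B j k) * B i k - pos (B i k) * B j k)
  μ-entry {B = B} q k i j i≢k j≢k with i ≟ᶠ k | j ≟ᶠ k
  ... | yes e | _     = ⊥-elim (i≢k e)
  ... | no _  | yes e = ⊥-elim (j≢k e)
  ... | no _  | no _  = trans (cong₂ (λ u v → B i j + pos (B i k) * pos u + - (pos (- B i k) * pos v)) (q k j) (trans (cong -_ (q k j)) (ℤP.neg-involutive (B j k))))
    (trans (lem (B i j) (pos (B i k)) (pos (- B i k)) (pos (B j k)) (pos (- B j k)))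
    (cong₂ (λ u v → B i j + (pos (B j k) * u - pos (B i k) * v)) (sym (pos-neg (B i k))) (sym (pos-neg (B j k)))))
   where
   lem : ∀ b p p′ r r′ → b + p * r′ + - (p′ * r) ≡ b + (r * (p - p′) - p * (r - r′))
   lem = solve-∀

  μ-reverse : ∀ {n} (B : Q n) k i j → i ≡ k ⊎ j ≡ k → μ k B i j ≡ - B i j
  μ-reverse B k i j h with i ≟ᶠ k | j ≟ᶠ k | h
  ... | yes _ | _     | _      = refl
  ... | no _  | yes _ | _      = refl
  ... | no ne | no _  | inj₁ e = ⊥-elim (ne e)
  ... | no _  | no ne | inj₂ e = ⊥-elim (ne e)

  module _ {n : ℕ} {B : Q n} (q : IsQuiver B) (matching : Matching B) where
   private
    unit-of : Bool → ℤ
    unit-of true  = - 1ℤ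
    unit-of false = 1ℤ

    variant : Vec Bool n → Q n
    variant s i j = unit-of (lookup s i) * unit-of (lookup s j) * B i j

    variant-quiver : ∀ s → IsQuiver (variant s)
    variant-quiver s i j = trans (cong (unit-of (lookup s i) * unit-of (lookup s j) *_) (q i j)) (lem (unit-of (lookup s i)) (unit-of (lookup s j)) (B j i))
     where
     lem : ∀ s t b → s * t * (- b) ≡ - (t * s * b)
     lem = solve-∀

    reverse-at : Fin n → Vec Bool n → Vec Bool n
    reverse-at k s = s [ k ]%= not

    unit-of-not : ∀ b → unit-of (not b) ≡ - unit-of b
    unit-of-not true  = refl
    unit-of-not false = refl

    at-k : ∀ k s → unit-of (lookup (reverse-at k s) k) ≡ - unit-of (lookup s k)
    at-k k s = trans (cong unit-of (lookup∘updateAt k s)) (unit-of-not (lookup s k))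
    off-k : ∀ k s i → i ≢ k → unit-of (lookup (reverse-at k s) i) ≡ unit-of (lookup s i)
    off-k k s i ne = cong unit-of (lookup∘updateAt′ i k ne s)

    μ-variant : ∀ k s i j → μ k (variant s) i j ≡ variant (reverse-at k s) i j
    μ-variant k s i j = go (i ≟ᶠ k) (j ≟ᶠ k) (i ≟ᶠ j)
     where
     lem₁ : ∀ s t b → - (s * t * b) ≡ (- s) * t * b
     lem₁ = solve-∀
     lem₂ : ∀ s t b → - (s * t * b) ≡ s * (- t) * b
     lem₂ = solve-∀
     zeroˡ : ∀ b x r w → b + (x * (w * 0ℤ) - r * x) ≡ b - r * x
     zeroˡ = solve-∀
     vanishes : ∀ i → B i k ≡ 0ℤ → variant s i k ≡ 0ℤ
     vanishes i e = trans (cong (unit-of (lookup s i) * unit-of (lookup s k) *_) e) (ℤP.*-zeroʳ (unit-of (lookup s i) * unit-of (lookup s k)))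
     keep : variant s i j ≡ variant (reverse-at k s) i j → μ k (variant s) i j ≡ variant s i j → μ k (variant s) i j ≡ variant (reverse-at k s) i j
     keep p r = trans r p
     lem₅ : ∀ v p x → v + (p * x - p * x) ≡ v
     lem₅ = solve-∀
     go : Dec (i ≡ k) → Dec (j ≡ k) → Dec (i ≡ j) → μ k (variant s) i j ≡ variant (reverse-at k s) i j
     go (yes refl) (yes refl) _ = trans (μ-reverse (variant s) i i i (inj₁ refl)) (trans (cong (λ b → - (unit-of (lookup s i) * unit-of (lookup s i) * b)) (diag-zero q i))
      (trans (cong -_ (ℤP.*-zeroʳ (unit-of (lookup s i) * unit-of (lookup s i)))) (sym (trans (cong (unit-of (lookup (reverse-at i s) i) * unit-of (lookup (reverse-at i s) i) *_) (diag-zero q i)) (ℤP.*-zeroʳ (unit-of (lookup (reverse-at i s) i) * unit-of (lookup (reverse-at i s) i)))))))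
     go (yes refl) (no ne) _ = trans (μ-reverse (variant s) i i j (inj₁ refl)) (trans (lem₁ (unit-of (lookup s i)) (unit-of (lookup s j)) (B i j))
      (cong₂ (λ u v → u * v * B i j) (sym (at-k i s)) (sym (off-k i s j ne))))
     go (no ne) (yes refl) _ = trans (μ-reverse (variant s) j i j (inj₂ refl)) (trans (lem₂ (unit-of (lookup s i)) (unit-of (lookup s j)) (B i j))
      (cong₂ (λ u v → u * v * B i j) (sym (off-k j s i ne)) (sym (at-k j s))))
     go (no ne) (no ne′) e = keep (cong₂ (λ u v → u * v * B i j) (sym (off-k k s i ne)) (sym (off-k k s j ne′))) (trans (μ-entry (variant-quiver s) k i j ne ne′) (rest e))
      where
      V = variant s
      rest : Dec (i ≡ j) → V i j + (pos (V j k) * V i k - pos (V i k) * V j k) ≡ V i j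
      rest (yes refl) = lem₅ (V i i) (pos (V i k)) (V i k)
      rest (no i≢j) = cases (matching i j k i≢j ne ne′)
       where
       cases : B i k ≡ 0ℤ ⊎ B k j ≡ 0ℤ → V i j + (pos (V j k) * V i k - pos (V i k) * V j k) ≡ V i j
       cases (inj₁ z) = trans (cong (λ t → V i j + (pos (V j k) * t - pos t * V j k)) (vanishes i z)) (lem₆ (V i j) (pos (V j k)) (V j k))
        where
        lem₆ : ∀ v x y → v + (x * 0ℤ - 0ℤ * y) ≡ v
        lem₆ = solve-∀
       cases (inj₂ z) = trans (cong (λ t → V i j + (pos t * V i k - pos (V i k) * t)) (vanishes j (trans (q j k) (cong -_ z)))) (lem₆ (V i j) (V i k) (pos (V i k)))
        where
        lem₆ : ∀ v x y → v + (0ℤ * x - y * 0ℤ) ≡ v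
        lem₆ = solve-∀

    vectors : ∀ m → List (Vec Bool m)
    vectors zero    = [] ∷ []
    vectors (suc m) = map (true ∷_) (vectors m) ++ map (false ∷_) (vectors m)

    vectors-complete : ∀ {m} (s : Vec Bool m) → s ∈ vectors m
    vectors-complete []          = here refl
    vectors-complete (true ∷ s)  = ∈-++⁺ˡ (∈-map⁺ (true ∷_) (vectors-complete s))
    vectors-complete (false ∷ s) = ∈-++⁺ʳ (map (true ∷_) (vectors _)) (∈-map⁺ (false ∷_) (vectors-complete s))

    reach : ∀ ks {C : Q n} s → (∀ i j → C i j ≡ variant s i j) → ∃ λ s′ → ∀ i j → μs ks C i j ≡ variant s′ i j
    reach []       s h = s , h
    reach (k ∷ ks) s h = reach ks (reverse-at k s) (λ i j → trans (μ-relabel (λ i → i) (λ e → e) h k i j) (μ-variant k s i j))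

   -- No vertex has two neighbours, so mutation only reverses what is at the vertex. The class stays
   -- within the finitely many sign changes of `B`.
   matching⇒MutFinite : MutFinite B
   matching⇒MutFinite = map variant (vectors n) , λ ks → let (s , h) = reach ks {B} (replicate n false) start in
     lose (∈-map⁺ variant (vectors-complete s)) (Perm.id , λ i j → sym (h i j))
    where
    start : ∀ i j → B i j ≡ variant (replicate n false) i j
    start i j = sym (trans (cong₂ (λ u v → unit-of u * unit-of v * B i j) (lookup-replicate i false) (lookup-replicate j false)) (ℤP.*-identityˡ (B i j)))

  module _ {B : Q 4} (m : MinMutInf B) where
   private
    q : IsQuiver B
    q = proj₁ m

   restrict-finite : ∀ {a b c : Fin 4} → a ≢ b → a ≢ c → b ≢ c → MutFinite (restrict (lookup (a ∷ b ∷ c ∷ [])) B)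
   restrict-finite ab ac bc = proj₂ (proj₂ m) 3 _ ℕP.≤-refl (λ {i} {j} → lookup-injective ((ab ∷ ac ∷ []) ∷ (bc ∷ []) ∷ [] ∷ []) i j)

   private
    -- A third vertex joined to p or r would make multiplicities on these three vertices grow
    -- without bound, against finiteness of the restriction.
    isolated : ∀ {p r} → p ≢ r → ⁺ 3 ≤ B p r → ∀ c → c ≢ p → c ≢ r → B c p ≡ 0ℤ × B c r ≡ 0ℤ
    isolated {p} {r} p≢r big c c≢p c≢r = go (B c p ℤ.≟ 0ℤ) (B c r ℤ.≟ 0ℤ)
     where
     contra : B c p ≢ 0ℤ ⊎ B c r ≢ 0ℤ → ⊥
     contra h = Growth.growing-infinite (B p r) big h (record { skew = λ i j → q _ _ ; p = zero ; r = suc zero ; c = suc (suc zero)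
      ; c≢p = λ () ; r≢p = λ () ; c≢r = λ () ; pr = refl ; cp = refl ; cr = refl }) (restrict-finite p≢r (λ e → c≢p (sym e)) (λ e → c≢r (sym e)))
     go : Dec (B c p ≡ 0ℤ) → Dec (B c r ≡ 0ℤ) → B c p ≡ 0ℤ × B c r ≡ 0ℤ
     go (yes a) (yes b) = a , b
     go (no a)  _       = ⊥-elim (contra (inj₁ a))
     go (yes _) (no b)  = ⊥-elim (contra (inj₂ b))

   -- An arrow of multiplicity at least 3 is cut off from the other two vertices by `isolated`, so
   -- `B` would be a matching and mutation-finite.
   entry≤2 : ∀ p r → B p r ≤ ⁺ 2
   entry≤2 p r with ⁺ 3 ℤ.≤? B p r
   ... | no h    = below (B p r) h
    where
    below : ∀ z → ¬ ⁺ 3 ≤ z → z ≤ ⁺ 2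
    below (⁺ 0) _ = ℤ.+≤+ ℕ.z≤n
    below (⁺ 1) _ = ℤ.+≤+ (ℕ.s≤s ℕ.z≤n)
    below (⁺ 2) _ = ℤP.≤-refl
    below (⁺ suc (suc (suc z))) h = ⊥-elim (h (ℤ.+≤+ (ℕ.s≤s (ℕ.s≤s (ℕ.s≤s ℕ.z≤n)))))
    below -[1+ z ] _ = ℤ.-≤+
   ... | yes big = ⊥-elim (proj₁ (proj₂ m) (matching⇒MutFinite q matching))
    where
    p≢r : p ≢ r
    p≢r refl with subst (⁺ 3 ≤_) (diag-zero q p) big
    ... | ℤ.+≤+ ()
    iso : ∀ c → c ≢ p → c ≢ r → B c p ≡ 0ℤ × B c r ≡ 0ℤ
    iso = isolated p≢r big
    swap : ∀ {a b} → B a b ≡ 0ℤ → B b a ≡ 0ℤ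
    swap {a} {b} h = trans (q b a) (cong -_ h)
    matching : Matching B
    matching i j k i≢j i≢k j≢k = go (k ≟ᶠ p) (k ≟ᶠ r) (i ≟ᶠ p) (i ≟ᶠ r) (j ≟ᶠ p) (j ≟ᶠ r)
     where
     go : Dec (k ≡ p) → Dec (k ≡ r) → Dec (i ≡ p) → Dec (i ≡ r) → Dec (j ≡ p) → Dec (j ≡ r) → B i k ≡ 0ℤ ⊎ B k j ≡ 0ℤ
     go (yes refl) _ _ (no ir) _ _        = inj₁ (proj₁ (iso i i≢k ir))
     go (yes refl) _ _ (yes refl) _ _     = inj₂ (swap (proj₁ (iso j j≢k (λ e → i≢j (sym e)))))
     go (no _) (yes refl) (no ip) _ _ _   = inj₁ (proj₂ (iso i ip i≢k))
     go (no _) (yes refl) (yes refl) _ _ _ = inj₂ (swap (proj₂ (iso j (λ e → i≢j (sym e)) j≢k)))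
     go (no kp) (no kr) (yes refl) _ _ _  = inj₁ (swap (proj₁ (iso k kp kr)))
     go (no kp) (no kr) _ (yes refl) _ _  = inj₁ (swap (proj₂ (iso k kp kr)))
     go (no kp) (no kr) _ _ (yes refl) _  = inj₂ (proj₁ (iso k kp kr))
     go (no kp) (no kr) _ _ _ (yes refl)  = inj₂ (proj₂ (iso k kp kr))
     go (no kp) (no kr) (no ip) (no ir) (no jp) (no jr) = ⊥-elim (five-vertices p≢r (λ e → kp (sym e)) (λ e → ip (sym e)) (λ e → jp (sym e)) (λ e → kr (sym e)) (λ e → ir (sym e)) (λ e → jr (sym e))
      (λ e → i≢k (sym e)) (λ e → j≢k (sym e)) i≢j)

  Pf : Q 4 → (x k y z : Fin 4) → ℤ
  Pf B x k y z = B x k * B y z - B x y * B k z + B x z * B k y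

  Distinct : (x k y z : Fin 4) → Set
  Distinct x k y z = x ≢ k × x ≢ y × x ≢ z × k ≢ y × k ≢ z × y ≢ z

  -- Up to sign the Pfaffian does not depend on the order of the vertices. Stating it for every
  -- order lets later arguments pick the one that fits their configuration.
  PfIs : ℕ → Q 4 → Set
  PfIs P B = ∀ x k y z → Distinct x k y z → ∣ Pf B x k y z ∣ ≡ P

  -- The reflection realising a mutation has determinant -1. The proof expands the three products
  -- for each of the four positions of v.
  Pf-μ : ∀ {B} → IsQuiver B → ∀ v x k y z → Distinct x k y z → Pf (μ v B) x k y z ≡ - Pf B x k y z
  Pf-μ {B} q v x k y z (xk , xy , xz , ky , kz , yz) = go (x ≟ᶠ v) (k ≟ᶠ v) (y ≟ᶠ v) (z ≟ᶠ v)
   where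
   r : ∀ i j → i ≡ v ⊎ j ≡ v → μ v B i j ≡ - B i j
   r = μ-reverse B v
   n : ∀ i j → i ≢ v → j ≢ v → μ v B i j ≡ B i j + (pos (B j v) * B i v - pos (B i v) * B j v)
   n = μ-entry q v
   cong₆ : ∀ {a a′ b b′ c c′ d d′ e e′ f f′ : ℤ} → a ≡ a′ → b ≡ b′ → c ≡ c′ → d ≡ d′ → e ≡ e′ → f ≡ f′ → a * b - c * d + e * f ≡ a′ * b′ - c′ * d′ + e′ * f′
   cong₆ refl refl refl refl refl refl = refl
   go : Dec (x ≡ v) → Dec (k ≡ v) → Dec (y ≡ v) → Dec (z ≡ v) → Pf (μ v B) x k y z ≡ - Pf B x k y z
   go (yes refl) _ _ _ = trans (cong₆ (trans (r x k (inj₁ refl)) (sym (q k x))) (n y z (λ e → xy (sym e)) (λ e → xz (sym e))) (trans (r x y (inj₁ refl)) (sym (q y x))) (n k z (λ e → xk (sym e)) (λ e → xz (sym e)))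
     (trans (r x z (inj₁ refl)) (sym (q z x))) (n k y (λ e → xk (sym e)) (λ e → xy (sym e))))
    (trans (lem (B k x) (B y x) (B z x) (pos (B k x)) (pos (B y x)) (pos (B z x)) (B y z) (B k z) (B k y)) (cong -_ (sym (cong₆ {B x k} {_} {B y z} {B y z} {B x y} {_} {B k z} {B k z} {B x z} {_} {B k y} {B k y} (q x k) refl (q x y) refl (q x z) refl))))
    where
    lem : ∀ a b c p r s d e f → a * (d + (s * b - r * c)) - b * (e + (s * a - p * c)) + c * (f + (r * a - p * b)) ≡ - ((- a) * d - (- b) * e + (- c) * f)
    lem = solve-∀
   go (no xv) (yes refl) _ _ = trans (cong₆ (r x k (inj₂ refl)) (n y z (λ e → ky (sym e)) (λ e → kz (sym e))) (n x y xk (λ e → ky (sym e))) (trans (r k z (inj₁ refl)) (sym (q z k)))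
     (n x z xk (λ e → kz (sym e))) (trans (r k y (inj₁ refl)) (sym (q y k))))
    (trans (lem (B x k) (B y k) (B z k) (pos (B x k)) (pos (B y k)) (pos (B z k)) (B y z) (B x y) (B x z)) (cong -_ (sym (cong₆ {B x k} {B x k} {B y z} {B y z} {B x y} {B x y} {B k z} {_} {B x z} {B x z} refl refl refl (q k z) refl (q k y)))))
    where
    lem : ∀ a b c p r s d e f → (- a) * (d + (s * b - r * c)) - (e + (r * a - p * b)) * c + (f + (s * a - p * c)) * b ≡ - (a * d - e * (- c) + f * (- b))
    lem = solve-∀
   go (no xv) (no kv) (yes refl) _ = trans (cong₆ (n x k xy ky) (trans (r y z (inj₁ refl)) (sym (q z y))) (r x y (inj₂ refl)) (n k z ky (λ e → yz (sym e))) (n x z xy (λ e → yz (sym e))) (r k y (inj₂ refl)))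
    (trans (lem (B x y) (B k y) (B z y) (pos (B x y)) (pos (B k y)) (pos (B z y)) (B x k) (B k z) (B x z)) (cong -_ (sym (cong₆ {B x k} {B x k} {B y z} {_} {B x y} {B x y} {B k z} {B k z} {B x z} {B x z} {B k y} {B k y} refl (q y z) refl refl refl refl))))
    where
    lem : ∀ a b c p r s d e f → (d + (r * a - p * b)) * c - (- a) * (e + (s * b - r * c)) + (f + (s * a - p * c)) * (- b) ≡ - (d * (- c) - a * e + f * b)
    lem = solve-∀
   go (no xv) (no kv) (no yv) (yes refl) = trans (cong₆ (n x k xz kz) (r y z (inj₂ refl)) (n x y xz yz) (r k z (inj₂ refl)) (r x z (inj₂ refl)) (n k y kz yz))
    (lem (B x z) (B k z) (B y z) (pos (B x z)) (pos (B k z)) (pos (B y z)) (B x k) (B x y) (B k y))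
    where
    lem : ∀ a b c p r s d e f → (d + (r * a - p * b)) * (- c) - (e + (s * a - p * c)) * (- b) + (- a) * (f + (s * b - r * c)) ≡ - (d * c - e * b + a * f)
    lem = solve-∀
   go (no xv) (no kv) (no yv) (no zv) = ⊥-elim (five-vertices xv xk xy xz (λ e → kv (sym e)) (λ e → yv (sym e)) (λ e → zv (sym e)) ky kz yz)

  PfIs-μ : ∀ {P B} → IsQuiver B → PfIs P B → ∀ v → PfIs P (μ v B)
  PfIs-μ {B = B} q h v x k y z d = trans (cong ∣_∣ (Pf-μ q v x k y z d)) (trans (ℤP.∣-i∣≡∣i∣ (Pf B x k y z)) (h x k y z d))

  -- Residues modulo 3.

  data ℤ/3 : Set where
   zer one two : ℤ/3

  private
   infixl 6 _⊹_
   _⊹_ : ℤ/3 → ℤ/3 → ℤ/3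
   zer ⊹ y   = y
   one ⊹ zer = one
   one ⊹ one = two
   one ⊹ two = zer
   two ⊹ zer = two
   two ⊹ one = zer
   two ⊹ two = one

   minus : ℤ/3 → ℤ/3
   minus zer = zer
   minus one = two
   minus two = one

   infixl 7 _⊛_
   _⊛_ : ℤ/3 → ℤ/3 → ℤ/3
   zer ⊛ y = zer
   one ⊛ y = y
   two ⊛ y = minus y

   ρℕ : ℕ → ℤ/3
   ρℕ zero    = zer
   ρℕ (suc n) = one ⊹ ρℕ n

  ρ : ℤ → ℤ/3
  ρ (⁺ n)    = ρℕ n
  ρ -[1+ n ] = minus (ρℕ (suc n))

  -- The value at `zer` is a placeholder; in a `Multiplicative` quiver the entries off the diagonal
  -- avoid it.
  residue : ℤ/3 → Sign
  residue zer = Sign.+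
  residue one = Sign.+
  residue two = Sign.-

  private
   one-⊹ : ∀ x y → (one ⊹ x) ⊹ y ≡ one ⊹ (x ⊹ y)
   one-⊹ zer y   = refl
   one-⊹ one zer = refl
   one-⊹ one one = refl
   one-⊹ one two = refl
   one-⊹ two zer = refl
   one-⊹ two one = refl
   one-⊹ two two = refl

   ρℕ-+ : ∀ m n → ρℕ (m ℕ.+ n) ≡ ρℕ m ⊹ ρℕ n
   ρℕ-+ zero    n = refl
   ρℕ-+ (suc m) n = trans (cong (one ⊹_) (ρℕ-+ m n)) (sym (one-⊹ (ρℕ m) (ρℕ n)))

   cancel-one : ∀ x y → (one ⊹ x) ⊹ minus (one ⊹ y) ≡ x ⊹ minus y
   cancel-one zer zer = refl
   cancel-one zer one = refl
   cancel-one zer two = refl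
   cancel-one one zer = refl
   cancel-one one one = refl
   cancel-one one two = refl
   cancel-one two zer = refl
   cancel-one two one = refl
   cancel-one two two = refl

   ⊹-zer : ∀ x → x ⊹ zer ≡ x
   ⊹-zer zer = refl
   ⊹-zer one = refl
   ⊹-zer two = refl

   ρ-⊖ : ∀ m n → ρ (m ⊖ n) ≡ ρℕ m ⊹ minus (ρℕ n)
   ρ-⊖ zero    zero    = refl
   ρ-⊖ (suc m) zero    = sym (⊹-zer (ρℕ (suc m)))
   ρ-⊖ zero    (suc n) = refl
   ρ-⊖ (suc m) (suc n) = trans (cong ρ (ℤP.[1+m]⊖[1+n]≡m⊖n m n)) (trans (ρ-⊖ m n) (sym (cancel-one (ρℕ m) (ρℕ n))))

   ⊹-comm : ∀ x y → x ⊹ y ≡ y ⊹ x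
   ⊹-comm zer y   = sym (⊹-zer y)
   ⊹-comm one zer = refl
   ⊹-comm one one = refl
   ⊹-comm one two = refl
   ⊹-comm two zer = refl
   ⊹-comm two one = refl
   ⊹-comm two two = refl

   ρ-+ : ∀ x n → ρ (x + ⁺ n) ≡ ρ x ⊹ ρℕ n
   ρ-+ (⁺ m)    n = ρℕ-+ m n
   ρ-+ -[1+ m ] n = trans (ρ-⊖ n (suc m)) (⊹-comm (ρℕ n) (minus (ρℕ (suc m))))

   minus-minus : ∀ x → minus (minus x) ≡ x
   minus-minus zer = refl
   minus-minus one = refl
   minus-minus two = refl

   ρ-neg : ∀ x → ρ (- x) ≡ minus (ρ x)
   ρ-neg (⁺ zero)  = refl
   ρ-neg (⁺ suc n) = refl
   ρ-neg -[1+ n ]  = sym (minus-minus (ρℕ (suc n)))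

   ⊛-distrib : ∀ x y → (one ⊹ x) ⊛ y ≡ y ⊹ x ⊛ y
   ⊛-distrib zer zer = refl
   ⊛-distrib zer one = refl
   ⊛-distrib zer two = refl
   ⊛-distrib one zer = refl
   ⊛-distrib one one = refl
   ⊛-distrib one two = refl
   ⊛-distrib two zer = refl
   ⊛-distrib two one = refl
   ⊛-distrib two two = refl

   ρℕ-* : ∀ m n → ρℕ (m ℕ.* n) ≡ ρℕ m ⊛ ρℕ n
   ρℕ-* zero    n = refl
   ρℕ-* (suc m) n = trans (ρℕ-+ n (m ℕ.* n)) (trans (cong (ρℕ n ⊹_) (ρℕ-* m n)) (sym (⊛-distrib (ρℕ m) (ρℕ n))))

   residue-minus : ∀ x → x ≢ zer → residue (minus x) ≡ opposite (residue x)
   residue-minus zer h = ⊥-elim (h refl)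
   residue-minus one h = refl
   residue-minus two h = refl

   -- The hypothesis means b = x y modulo 3, and then b + x y = 2 b = -b: mutation along such a path
   -- negates the residue.
   path-residue : ∀ b x y → b ≢ zer → x ≢ zer → y ≢ zer → residue b ≡ residue x ⊗ residue y → b ⊹ x ⊛ y ≡ minus b
   path-residue zer _ _ h _ _ _ = ⊥-elim (h refl)
   path-residue _ zer _ _ h _ _ = ⊥-elim (h refl)
   path-residue _ _ zer _ _ h _ = ⊥-elim (h refl)
   path-residue one one one _ _ _ _ = refl
   path-residue one two two _ _ _ _ = refl
   path-residue two one two _ _ _ _ = refl
   path-residue two two one _ _ _ _ = refl

   -- This and the following are identities in the group of order two, needed for the various
   -- positions of a path relative to the mutated vertex.
   s₁ : ∀ a b c → opposite (a ⊗ (b ⊗ c)) ≡ opposite (a ⊗ b) ⊗ c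
   s₁ Sign.+ Sign.+ Sign.+ = refl
   s₁ Sign.+ Sign.+ Sign.- = refl
   s₁ Sign.+ Sign.- Sign.+ = refl
   s₁ Sign.+ Sign.- Sign.- = refl
   s₁ Sign.- Sign.+ Sign.+ = refl
   s₁ Sign.- Sign.+ Sign.- = refl
   s₁ Sign.- Sign.- Sign.+ = refl
   s₁ Sign.- Sign.- Sign.- = refl
   s₂ : ∀ a c d → opposite d ≡ (a ⊗ (c ⊗ d)) ⊗ opposite (a ⊗ c)
   s₂ Sign.+ Sign.+ Sign.+ = refl
   s₂ Sign.+ Sign.+ Sign.- = refl
   s₂ Sign.+ Sign.- Sign.+ = refl
   s₂ Sign.+ Sign.- Sign.- = refl
   s₂ Sign.- Sign.+ Sign.+ = refl
   s₂ Sign.- Sign.+ Sign.- = refl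
   s₂ Sign.- Sign.- Sign.+ = refl
   s₂ Sign.- Sign.- Sign.- = refl
   s₃ : ∀ a c d → a ⊗ c ≡ d ⊗ (a ⊗ (c ⊗ d))
   s₃ Sign.+ Sign.+ Sign.+ = refl
   s₃ Sign.+ Sign.+ Sign.- = refl
   s₃ Sign.+ Sign.- Sign.+ = refl
   s₃ Sign.+ Sign.- Sign.- = refl
   s₃ Sign.- Sign.+ Sign.+ = refl
   s₃ Sign.- Sign.+ Sign.- = refl
   s₃ Sign.- Sign.- Sign.+ = refl
   s₃ Sign.- Sign.- Sign.- = refl
   s₄ : ∀ b c d → c ⊗ b ≡ ((d ⊗ c) ⊗ b) ⊗ d
   s₄ Sign.+ Sign.+ Sign.+ = refl
   s₄ Sign.+ Sign.+ Sign.- = refl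
   s₄ Sign.+ Sign.- Sign.+ = refl
   s₄ Sign.+ Sign.- Sign.- = refl
   s₄ Sign.- Sign.+ Sign.+ = refl
   s₄ Sign.- Sign.+ Sign.- = refl
   s₄ Sign.- Sign.- Sign.+ = refl
   s₄ Sign.- Sign.- Sign.- = refl
   s₅ : ∀ a b d → opposite d ≡ opposite (a ⊗ b) ⊗ ((d ⊗ a) ⊗ b)
   s₅ Sign.+ Sign.+ Sign.+ = refl
   s₅ Sign.+ Sign.+ Sign.- = refl
   s₅ Sign.+ Sign.- Sign.+ = refl
   s₅ Sign.+ Sign.- Sign.- = refl
   s₅ Sign.- Sign.+ Sign.+ = refl
   s₅ Sign.- Sign.+ Sign.- = refl
   s₅ Sign.- Sign.- Sign.+ = refl
   s₅ Sign.- Sign.- Sign.- = refl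
   s₆ : ∀ a b d → opposite ((d ⊗ a) ⊗ b) ≡ d ⊗ opposite (a ⊗ b)
   s₆ Sign.+ Sign.+ Sign.+ = refl
   s₆ Sign.+ Sign.+ Sign.- = refl
   s₆ Sign.+ Sign.- Sign.+ = refl
   s₆ Sign.+ Sign.- Sign.- = refl
   s₆ Sign.- Sign.+ Sign.+ = refl
   s₆ Sign.- Sign.+ Sign.- = refl
   s₆ Sign.- Sign.- Sign.+ = refl
   s₆ Sign.- Sign.- Sign.- = refl
   s₇ : ∀ a b → a ⊗ b ≡ b ⊗ a
   s₇ Sign.+ Sign.+ = refl
   s₇ Sign.+ Sign.- = refl
   s₇ Sign.- Sign.+ = refl
   s₇ Sign.- Sign.- = refl
   s₈ : ∀ a b → a ≡ (b ⊗ a) ⊗ b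
   s₈ Sign.+ Sign.+ = refl
   s₈ Sign.+ Sign.- = refl
   s₈ Sign.- Sign.+ = refl
   s₈ Sign.- Sign.- = refl
   s₉ : ∀ a b → opposite b ≡ a ⊗ opposite (a ⊗ b)
   s₉ Sign.+ Sign.+ = refl
   s₉ Sign.+ Sign.- = refl
   s₉ Sign.- Sign.+ = refl
   s₉ Sign.- Sign.- = refl
   s₁₀ : ∀ a b → a ≡ b ⊗ (a ⊗ b)
   s₁₀ Sign.+ Sign.+ = refl
   s₁₀ Sign.+ Sign.- = refl
   s₁₀ Sign.- Sign.+ = refl
   s₁₀ Sign.- Sign.- = refl
   s₁₁ : ∀ a b → opposite a ≡ opposite (a ⊗ b) ⊗ b
   s₁₁ Sign.+ Sign.+ = refl
   s₁₁ Sign.+ Sign.- = refl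
   s₁₁ Sign.- Sign.+ = refl
   s₁₁ Sign.- Sign.- = refl
   s₁₂ : ∀ a → opposite (opposite a) ≡ a
   s₁₂ Sign.+ = refl
   s₁₂ Sign.- = refl

  residue-of : ∀ {n} → Q n → Fin n → Fin n → Sign
  residue-of B i j = residue (ρ (B i j))

  -- Separates the two mutation classes with |Pf B| = 1.
  record Multiplicative (B : Q 4) : Set where
   field
    nonzero : ∀ i j → i ≢ j → ρ (B i j) ≢ zer
    path    : ∀ i k j → 0ℤ < B i k → 0ℤ < B k j → residue-of B i j ≡ residue-of B i k ⊗ residue-of B k j

  private
   -- Since c₁ (A c₂ + 1) + c₂ (1 - A c₁) = c₁ + c₂, the sum is at least A D + c₁ + c₂, a sum of
   -- three positive integers.
   pf-large : ∀ A D c₁ c₂ U V → 0ℤ < A → 0ℤ < D → 0ℤ < c₁ → 0ℤ < c₂ → A * c₂ + 1ℤ ≤ U → 1ℤ - A * c₁ ≤ V → ⁺ 3 ≤ A * D + c₁ * U + c₂ * V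
   pf-large A@(⁺ suc a) D@(⁺ suc d) c₁@(⁺ suc m) c₂@(⁺ suc n) U V _ _ _ _ hU hV = ℤP.≤-trans start
     (ℤP.+-mono-≤ (ℤP.+-monoʳ-≤ (A * D) (ℤP.*-monoˡ-≤-nonNeg c₁ hU)) (ℤP.*-monoˡ-≤-nonNeg c₂ hV))
    where
    lem : ∀ A D c₁ c₂ → A * D + c₁ + c₂ ≡ A * D + c₁ * (A * c₂ + 1ℤ) + c₂ * (1ℤ - A * c₁)
    lem = solve-∀
    start : ⁺ 3 ≤ A * D + c₁ * (A * c₂ + 1ℤ) + c₂ * (1ℤ - A * c₁)
    start = subst (⁺ 3 ≤_) (lem A D c₁ c₂) (ℤP.+-mono-≤ (ℤP.+-mono-≤ {1ℤ} {A * D} (ℤ.+≤+ (ℕ.s≤s ℕ.z≤n)) (ℤ.+≤+ {1} {suc m} (ℕ.s≤s ℕ.z≤n))) (ℤ.+≤+ {1} {suc n} (ℕ.s≤s ℕ.z≤n)))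
   pf-large (⁺ zero) _ _ _ _ _ (ℤ.+<+ ())
   pf-large (⁺ suc _) (⁺ zero) _ _ _ _ _ (ℤ.+<+ ())
   pf-large (⁺ suc _) (⁺ suc _) (⁺ zero) _ _ _ _ _ (ℤ.+<+ ())
   pf-large (⁺ suc _) (⁺ suc _) (⁺ suc _) (⁺ zero) _ _ _ _ _ (ℤ.+<+ ())

   small : ∀ {z} → ∣ z ∣ ≡ 1 → ¬ ⁺ 3 ≤ z
   small {⁺ 1} refl (ℤ.+≤+ (ℕ.s≤s ()))
   small { -[1+ 0 ]} refl ()

   positive-neg : ∀ {z} → 0ℤ < - z → z < 0ℤ
   positive-neg {z} h = subst (_< 0ℤ) (ℤP.neg-involutive z) (ℤP.neg-mono-< h)

  module _ {B : Q 4} (q : IsQuiver B) (pf : PfIs 1 B) (T : Multiplicative B) (k : Fin 4) where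
   open Multiplicative T
   private
    B′ : Q 4
    B′ = μ k B
    q′ : IsQuiver B′
    q′ = μ-quiver q k
    r r′ : Fin 4 → Fin 4 → Sign
    r  = residue-of B
    r′ = residue-of B′

    proper : ∀ {C : Q 4} → IsQuiver C → ∀ {i j} → 0ℤ < C i j → i ≢ j
    proper c {i} h refl with subst (0ℤ <_) (diag-zero c i) h
    ... | ℤ.+<+ ()

    asym : ∀ {C : Q 4} → IsQuiver C → ∀ {i j} → 0ℤ < C i j → ¬ 0ℤ < C j i
    asym c {i} {j} h h′ = ℤP.<-asym h (positive-neg (subst (0ℤ <_) (c j i) h′))

    -- Residues off the diagonal are nonzero, so any two vertices are joined by an arrow.
    dir : ∀ i j → i ≢ j → 0ℤ < B i j ⊎ 0ℤ < B j i
    dir i j i≢j = go (B i j) refl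
     where
     go : ∀ z → B i j ≡ z → 0ℤ < B i j ⊎ 0ℤ < B j i
     go (⁺ zero)  e = ⊥-elim (nonzero i j i≢j (cong ρ e))
     go (⁺ suc n) e = inj₁ (subst (0ℤ <_) (sym e) (ℤ.+<+ (ℕ.s≤s ℕ.z≤n)))
     go -[1+ n ]  e = inj₂ (subst (0ℤ <_) (sym (trans (q j i) (cong -_ e))) (ℤ.+<+ (ℕ.s≤s ℕ.z≤n)))

    pos-of : ∀ {z} → 0ℤ < z → pos z ≡ z
    pos-of h = pos-nonneg (ℤP.<⇒≤ h)
    pos-rev : ∀ {i j} → 0ℤ < B j i → pos (B i j) ≡ 0ℤ
    pos-rev {i} {j} h = pos-nonpos (subst (_≤ 0ℤ) (sym (q i j)) (ℤP.neg-mono-≤ (ℤP.<⇒≤ h)))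

    through : ∀ {i j} → 0ℤ < B i k → 0ℤ < B k j → B′ i j ≡ B i j + B i k * B k j
    through {i} {j} ik kj = trans (μ-entry q k i j (proper q ik) (λ e → proper q kj (sym e))) (trans (cong₂ (λ u v → B i j + (u * B i k - v * B j k)) (pos-rev kj) (pos-of ik))
     (trans (cong (λ u → B i j + (0ℤ * B i k - B i k * u)) (q j k)) (lem (B i j) (B i k) (B k j))))
     where
     lem : ∀ b x y → b + (0ℤ * x - x * (- y)) ≡ b + x * y
     lem = solve-∀
    both-in : ∀ {i j} → 0ℤ < B i k → 0ℤ < B j k → B′ i j ≡ B i j
    both-in {i} {j} ik jk = trans (μ-entry q k i j (proper q ik) (proper q jk)) (trans (cong₂ (λ u v → B i j + (u * B i k - v * B j k)) (pos-of jk) (pos-of ik)) (lem (B i j) (B i k) (B j k)))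
     where
     lem : ∀ b x y → b + (y * x - x * y) ≡ b
     lem = solve-∀
    both-out : ∀ {i j} → 0ℤ < B k i → 0ℤ < B k j → B′ i j ≡ B i j
    both-out {i} {j} ki kj = trans (μ-entry q k i j (λ e → proper q ki (sym e)) (λ e → proper q kj (sym e))) (trans (cong₂ (λ u v → B i j + (u * B i k - v * B j k)) (pos-rev kj) (pos-rev ki)) (lem (B i j) (B i k) (B j k)))
     where
     lem : ∀ b x y → b + (0ℤ * x - 0ℤ * y) ≡ b
     lem = solve-∀
    from-k : ∀ j → B′ k j ≡ B j k
    from-k j = trans (μ-reverse B k k j (inj₁ refl)) (sym (q j k))
    to-k : ∀ j → B′ j k ≡ B k j
    to-k j = trans (μ-reverse B k j k (inj₂ refl)) (sym (q k j))

    ρ-through : ∀ {i j} → i ≢ j → 0ℤ < B i k → 0ℤ < B k j → ρ (B′ i j) ≡ minus (ρ (B i j))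
    ρ-through {i} {j} i≢j ik kj = trans (cong ρ (through ik kj)) (go (B i k) (B k j) refl refl ik kj)
     where
     go : ∀ x y → B i k ≡ x → B k j ≡ y → 0ℤ < x → 0ℤ < y → ρ (B i j + x * y) ≡ minus (ρ (B i j))
     go (⁺ a) (⁺ b) ea eb _ _ = trans (cong (λ z → ρ (B i j + z)) (sym (ℤP.pos-* a b))) (trans (ρ-+ (B i j) (a ℕ.* b)) (trans (cong (ρ (B i j) ⊹_) (ρℕ-* a b))
      (path-residue (ρ (B i j)) (ρℕ a) (ρℕ b) (nonzero i j i≢j) (λ h → nonzero i k (proper q ik) (trans (cong ρ ea) h)) (λ h → nonzero k j (proper q kj) (trans (cong ρ eb) h))
       (trans (path i k j ik kj) (cong₂ (λ u v → residue (ρ u) ⊗ residue (ρ v)) ea eb)))))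
     go -[1+ _ ] _ _ _ () _
     go (⁺ _) -[1+ _ ] _ _ _ ()

    minus-zer : ∀ {x} → minus x ≡ zer → x ≡ zer
    minus-zer {zer} _ = refl

    skew-nonzero : ∀ {C : Q 4} → IsQuiver C → ∀ {i j} → ρ (C i j) ≢ zer → ρ (C j i) ≢ zer
    skew-nonzero {C} c {i} {j} h e = h (trans (cong ρ (c i j)) (trans (ρ-neg (C j i)) (cong minus e)))

    nonzero′ : ∀ i j → i ≢ j → ρ (B′ i j) ≢ zer
    nonzero′ i j i≢j = go (i ≟ᶠ k) (j ≟ᶠ k)
     where
     go : Dec (i ≡ k) → Dec (j ≡ k) → ρ (B′ i j) ≢ zer
     go (yes refl) _ h = nonzero j i (λ e → i≢j (sym e)) (trans (cong ρ (sym (from-k j))) h)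
     go (no _) (yes refl) h = nonzero j i (λ e → i≢j (sym e)) (trans (cong ρ (sym (to-k i))) h)
     go (no ik) (no jk) = cases (dir i k ik) (dir j k jk)
      where
      cases : 0ℤ < B i k ⊎ 0ℤ < B k i → 0ℤ < B j k ⊎ 0ℤ < B k j → ρ (B′ i j) ≢ zer
      cases (inj₁ a) (inj₁ b) h = nonzero i j i≢j (trans (cong ρ (sym (both-in a b))) h)
      cases (inj₂ a) (inj₂ b) h = nonzero i j i≢j (trans (cong ρ (sym (both-out a b))) h)
      cases (inj₁ a) (inj₂ b) h = nonzero i j i≢j (minus-zer (trans (sym (ρ-through i≢j a b)) h))
      cases (inj₂ a) (inj₁ b) = skew-nonzero q′ {j} {i} (λ h → nonzero j i (λ e → i≢j (sym e)) (minus-zer (trans (sym (ρ-through (λ e → i≢j (sym e)) b a)) h)))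

    r-skew : ∀ {C : Q 4} → IsQuiver C → ∀ {i j} → ρ (C j i) ≢ zer → residue-of C i j ≡ opposite (residue-of C j i)
    r-skew {C} c {i} {j} h = trans (cong (λ z → residue (ρ z)) (c i j)) (trans (cong residue (ρ-neg (C j i))) (residue-minus (ρ (C j i)) h))

    r-opp : ∀ {i j} → 0ℤ < B j i → r i j ≡ opposite (r j i)
    r-opp {i} {j} h = r-skew q {i} {j} (nonzero j i (proper q h))

    r-through : ∀ {i j} → i ≢ j → 0ℤ < B i k → 0ℤ < B k j → r′ i j ≡ opposite (r i k ⊗ r k j)
    r-through {i} {j} i≢j ik kj = trans (cong residue (ρ-through i≢j ik kj)) (trans (residue-minus _ (nonzero i j i≢j)) (cong opposite (path i k j ik kj)))

    r-back : ∀ {i j} → i ≢ j → 0ℤ < B j k → 0ℤ < B k i → r′ i j ≡ r j k ⊗ r k i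
    r-back {i} {j} i≢j jk ki = trans (r-skew q′ {i} {j} (nonzero′ j i (λ e → i≢j (sym e)))) (trans (cong opposite (r-through (λ e → i≢j (sym e)) jk ki)) (s₁₂ (r j k ⊗ r k i)))

    r-same : ∀ {i j} → B′ i j ≡ B i j → r′ i j ≡ r i j
    r-same e = cong (λ z → residue (ρ z)) e

    gap : ∀ {x y} → 0ℤ < x + y → 1ℤ - y ≤ x
    gap {x} {y} h = subst (1ℤ - y ≤_) (lem x y) (ℤP.+-monoˡ-≤ (- y) (ℤP.i<j⇒suc[i]≤j h))
     where
     lem : ∀ x y → (x + y) - y ≡ x
     lem = solve-∀

    gap-neg : ∀ {x y} → 0ℤ < - (x + y) → y + 1ℤ ≤ - x
    gap-neg {x} {y} h = subst₂ _≤_ (ℤP.+-comm 1ℤ y) (lem x y) (ℤP.+-monoˡ-≤ y (ℤP.i<j⇒suc[i]≤j h))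
     where
     lem : ∀ x y → - (x + y) + y ≡ - x
     lem = solve-∀

    -- In this configuration the residues would fail to multiply after the mutation. Its
    -- inequalities are those of `pf-large`, so |Pf B| would be at least 3. `no-outward` is the same
    -- with all arrows reversed.
    no-inward : ∀ {i m j} → Distinct m k i j → 0ℤ < B m k → 0ℤ < B k i → 0ℤ < B k j → 0ℤ < B i j → 0ℤ < B′ i m → ¬ 0ℤ < B′ m j
    no-inward {i} {m} {j} d mk ki kj ij h h′ = small (pf m k i j d) (subst (⁺ 3 ≤_) (lem (B m k) (B i j) (B k j) (B k i) (B m i) (B m j))
     (pf-large (B m k) (B i j) (B k j) (B k i) (- B m i) (B m j) mk ij kj ki (gap-neg (subst (0ℤ <_) (trans (q′ i m) (cong -_ (through mk ki))) h)) (gap (subst (0ℤ <_) (through mk kj) h′))))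
     where
     lem : ∀ A D c₁ c₂ u v → A * D + c₁ * (- u) + c₂ * v ≡ A * D - u * c₁ + v * c₂
     lem = solve-∀

    no-outward : ∀ {i m j} → Distinct m k j i → 0ℤ < B k m → 0ℤ < B i k → 0ℤ < B j k → 0ℤ < B i j → 0ℤ < B′ i m → ¬ 0ℤ < B′ m j
    no-outward {i} {m} {j} d km ik jk ij h h′ = small (pf m k j i d) (subst (⁺ 3 ≤_)
     (trans (lem (B k m) (B i j) (B i k) (B j k) (B j m) (B i m)) (sym (trans (cong₂ (λ u v → u - v + B m i * B k j) (cong₂ _*_ (q m k) (q j i)) (cong₂ _*_ (q m j) (q k i))) (cong (λ u → (- B k m) * (- B i j) - (- B j m) * (- B i k) + u) (cong₂ _*_ (q m i) (q k j))))))
     (pf-large (B k m) (B i j) (B i k) (B j k) (- B j m) (B i m) km ij ik jk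
      (subst (_≤ - B j m) (cong (_+ 1ℤ) (ℤP.*-comm (B j k) (B k m))) (gap-neg (subst (0ℤ <_) (trans (q′ m j) (cong -_ (through jk km))) h′)))
      (subst (_≤ B i m) (cong (λ z → 1ℤ - z) (ℤP.*-comm (B i k) (B k m))) (gap (subst (0ℤ <_) (through ik km) h)))))
     where
     lem : ∀ A D c₁ c₂ u v → A * D + c₁ * (- u) + c₂ * v ≡ (- A) * (- D) - (- u) * (- c₁) + (- v) * (- c₂)
     lem = solve-∀

    -- Cases by the position of k: in the middle or at an end of the path, or outside it with each
    -- of i, m, j on the incoming or the outgoing side of k. Two of the outside cases contain a
    -- configuration that the Pfaffian rules out.
    path′ : ∀ i m j → 0ℤ < B′ i m → 0ℤ < B′ m j → r′ i j ≡ r′ i m ⊗ r′ m j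
    path′ i m j im mj = go (i ≟ᶠ k) (m ≟ᶠ k) (j ≟ᶠ k)
     where
     i≢m : i ≢ m
     i≢m = proper q′ {i} {m} im
     m≢j : m ≢ j
     m≢j = proper q′ {m} {j} mj
     i≢j : i ≢ j
     i≢j e = asym q′ {i} {m} im (subst (λ t → 0ℤ < B′ m t) (sym e) mj)
     kept : ∀ {i j} → B′ i j ≡ B i j → 0ℤ < B′ i j → 0ℤ < B i j
     kept e = subst (0ℤ <_) e
     outside : i ≢ k → m ≢ k → j ≢ k → 0ℤ < B i k ⊎ 0ℤ < B k i → 0ℤ < B m k ⊎ 0ℤ < B k m → 0ℤ < B j k ⊎ 0ℤ < B k j → r′ i j ≡ r′ i m ⊗ r′ m j
     outside _ _ _ (inj₁ ik) (inj₁ mk) (inj₁ jk) = trans (r-same (both-in ik jk)) (trans (path i m j (kept (both-in ik mk) im) (kept (both-in mk jk) mj))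
      (sym (cong₂ _⊗_ (r-same (both-in ik mk)) (r-same (both-in mk jk)))))
     outside _ _ _ (inj₂ ki) (inj₂ km) (inj₂ kj) = trans (r-same (both-out ki kj)) (trans (path i m j (kept (both-out ki km) im) (kept (both-out km kj) mj))
      (sym (cong₂ _⊗_ (r-same (both-out ki km)) (r-same (both-out km kj)))))
     outside _ _ _ (inj₁ ik) (inj₂ km) (inj₂ kj) = trans (r-through i≢j ik kj) (trans (cong (λ z → opposite (r i k ⊗ z)) (path k m j km (kept (both-out km kj) mj)))
      (trans (s₁ (r i k) (r k m) (r m j)) (sym (cong₂ _⊗_ (r-through i≢m ik km) (r-same (both-out km kj))))))
     outside ik≢ mk≢ jk≢ (inj₂ ki) (inj₁ mk) (inj₂ kj) = cases (dir i j i≢j)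
      where
      cases : 0ℤ < B i j ⊎ 0ℤ < B j i → r′ i j ≡ r′ i m ⊗ r′ m j
      cases (inj₁ ij) = ⊥-elim (no-inward (mk≢ , (λ e → i≢m (sym e)) , m≢j , (λ e → ik≢ (sym e)) , (λ e → jk≢ (sym e)) , i≢j) mk ki kj ij im mj)
      cases (inj₂ ji) = trans (r-same (both-out ki kj)) (trans (r-opp ji) (trans (s₂ (r m k) (r k j) (r j i))
       (sym (cong₂ _⊗_ (trans (r-back i≢m mk ki) (cong (r m k ⊗_) (path k j i kj ji))) (r-through m≢j mk kj)))))
     outside _ _ _ (inj₂ ki) (inj₂ km) (inj₁ jk) = trans (r-back i≢j jk ki) (trans (s₃ (r j k) (r k i) (r i m))
      (sym (cong₂ _⊗_ (r-same (both-out ki km)) (trans (r-back m≢j jk km) (cong (r j k ⊗_) (path k i m ki (kept (both-out ki km) im)))))))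
     outside _ _ _ (inj₂ ki) (inj₁ mk) (inj₁ jk) = trans (r-back i≢j jk ki) (trans (s₄ (r k i) (r j k) (r m j))
      (sym (cong₂ _⊗_ (trans (r-back i≢m mk ki) (cong (_⊗ r k i) (path m j k (kept (both-in mk jk) mj) jk))) (r-same (both-in mk jk)))))
     outside ik≢ mk≢ jk≢ (inj₁ ik) (inj₂ km) (inj₁ jk) = cases (dir i j i≢j)
      where
      cases : 0ℤ < B i j ⊎ 0ℤ < B j i → r′ i j ≡ r′ i m ⊗ r′ m j
      cases (inj₁ ij) = ⊥-elim (no-outward (mk≢ , m≢j , (λ e → i≢m (sym e)) , (λ e → jk≢ (sym e)) , (λ e → ik≢ (sym e)) , (λ e → i≢j (sym e))) km ik jk ij im mj)
      cases (inj₂ ji) = trans (r-same (both-in ik jk)) (trans (r-opp ji) (trans (s₅ (r i k) (r k m) (r j i))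
       (sym (cong₂ _⊗_ (r-through i≢m ik km) (trans (r-back m≢j jk km) (cong (_⊗ r k m) (path j i k ji ik)))))))
     outside _ _ _ (inj₁ ik) (inj₁ mk) (inj₂ kj) = trans (r-through i≢j ik kj) (trans (cong (λ z → opposite (z ⊗ r k j)) (path i m k (kept (both-in ik mk) im) mk))
      (trans (s₆ (r m k) (r k j) (r i m)) (sym (cong₂ _⊗_ (r-same (both-in ik mk)) (r-through m≢j mk kj)))))
     go : Dec (i ≡ k) → Dec (m ≡ k) → Dec (j ≡ k) → r′ i j ≡ r′ i m ⊗ r′ m j
     go _ (yes refl) _ = trans (r-back i≢j (subst (0ℤ <_) (from-k j) mj) (subst (0ℤ <_) (to-k i) im)) (trans (s₇ (r j m) (r m i))
      (sym (cong₂ _⊗_ (cong (λ z → residue (ρ z)) (to-k i)) (cong (λ z → residue (ρ z)) (from-k j)))))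
     go (yes refl) (no mk≢) _ = cases (dir j i (λ e → i≢j (sym e)))
      where
      mk : 0ℤ < B m i
      mk = subst (0ℤ <_) (from-k m) im
      cases : 0ℤ < B j i ⊎ 0ℤ < B i j → r′ i j ≡ r′ i m ⊗ r′ m j
      cases (inj₁ jk) = trans (cong (λ z → residue (ρ z)) (from-k j)) (trans (s₈ (r j i) (r m j))
       (sym (cong₂ _⊗_ (trans (cong (λ z → residue (ρ z)) (from-k m)) (path m j i (kept (both-in mk jk) mj) jk)) (r-same (both-in mk jk)))))
      cases (inj₂ kj) = trans (cong (λ z → residue (ρ z)) (from-k j)) (trans (r-opp kj) (trans (s₉ (r m i) (r i j))
       (sym (cong₂ _⊗_ (cong (λ z → residue (ρ z)) (from-k m)) (r-through m≢j mk kj)))))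
     go (no ik≢) (no mk≢) (yes refl) = cases (dir i j i≢j)
      where
      km : 0ℤ < B j m
      km = subst (0ℤ <_) (to-k m) mj
      cases : 0ℤ < B i j ⊎ 0ℤ < B j i → r′ i j ≡ r′ i m ⊗ r′ m j
      cases (inj₂ ki) = trans (cong (λ z → residue (ρ z)) (to-k i)) (trans (s₁₀ (r j i) (r i m))
       (sym (cong₂ _⊗_ (r-same (both-out ki km)) (trans (cong (λ z → residue (ρ z)) (to-k m)) (path j i m ki (kept (both-out ki km) im))))))
      cases (inj₁ ik) = trans (cong (λ z → residue (ρ z)) (to-k i)) (trans (r-opp ik) (trans (s₁₁ (r i j) (r j m))
       (sym (cong₂ _⊗_ (r-through i≢m ik km) (cong (λ z → residue (ρ z)) (to-k m))))))
     go (no ik≢) (no mk≢) (no jk≢) = outside ik≢ mk≢ jk≢ (dir i k ik≢) (dir m k mk≢) (dir j k jk≢)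

   Multiplicative-μ : Multiplicative (μ k B)
   Multiplicative-μ = record { nonzero = nonzero′ ; path = path′ }

 -- Codes, certificates and decidable checks.

 module Computation where
  open import Defs
  open Forms using (unit; diag-zero)
  open Mutations using (μ-quiver)
  open GreenSteps using (Rows)
  open Framings using (Tracks; mutate-tracks; mutate-rows)
  open Faces using (Big; Heavy; heavy⇒¬MGS)
  open Barriers using (Blocked; blocked⇒¬MGS; μ-relabel)
  open Isomorphisms
  open Invariants
  open import Data.Nat using (_/_; _%_)
  open import Data.Integer using (_+_; -_; _-_; _≤_; _<_; ∣_∣; _⊖_)
  open import Data.Sign as Sign using (Sign) renaming (_*_ to _⊗_; _≟_ to _≟ˢ_)
  open import Data.Fin.Permutation as Perm using (Permutation′; _⟨$⟩ʳ_; _⟨$⟩ˡ_; inverseʳ)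
  open import Data.Vec using (tabulate)
  open import Data.Vec.Properties using (lookup∘tabulate)
  open import Data.List using (_++_; map; concatMap; allFin)
  open import Data.List.Relation.Unary.Any as Any using (Any; here; there)
  open import Data.List.Membership.Propositional using (_∈_; lose)
  open import Data.List.Membership.Propositional.Properties using (∈-map⁻; ∈-map⁺; ∈-allFin)
  open import Relation.Nullary using (does)

  data Code : Set where
   code : (a b c d e f : ℤ) → Code

  quiver : Code → Q 4
  quiver (code a b c d e f) zero zero = 0ℤ
  quiver (code a b c d e f) zero (suc zero) = a
  quiver (code a b c d e f) zero (suc (suc zero)) = b
  quiver (code a b c d e f) zero (suc (suc (suc zero))) = c
  quiver (code a b c d e f) (suc zero) zero = - a
  quiver (code a b c d e f) (suc zero) (suc zero) = 0ℤ
  quiver (code a b c d e f) (suc zero) (suc (suc zero)) = d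
  quiver (code a b c d e f) (suc zero) (suc (suc (suc zero))) = e
  quiver (code a b c d e f) (suc (suc zero)) zero = - b
  quiver (code a b c d e f) (suc (suc zero)) (suc zero) = - d
  quiver (code a b c d e f) (suc (suc zero)) (suc (suc zero)) = 0ℤ
  quiver (code a b c d e f) (suc (suc zero)) (suc (suc (suc zero))) = f
  quiver (code a b c d e f) (suc (suc (suc zero))) zero = - c
  quiver (code a b c d e f) (suc (suc (suc zero))) (suc zero) = - e
  quiver (code a b c d e f) (suc (suc (suc zero))) (suc (suc zero)) = - f
  quiver (code a b c d e f) (suc (suc (suc zero))) (suc (suc (suc zero))) = 0ℤ

  pattern v₀ = zero
  pattern v₁ = suc zero
  pattern v₂ = suc (suc zero)
  pattern v₃ = suc (suc (suc zero))

  codeOf : Q 4 → Code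
  codeOf B = code (B v₀ v₁) (B v₀ v₂) (B v₀ v₃) (B v₁ v₂) (B v₁ v₃) (B v₂ v₃)

  quiver-codeOf : ∀ {B} → IsQuiver B → ∀ i j → quiver (codeOf B) i j ≡ B i j
  quiver-codeOf q v₀ v₀ = sym (diag-zero q v₀)
  quiver-codeOf q v₀ v₁ = refl
  quiver-codeOf q v₀ v₂ = refl
  quiver-codeOf q v₀ v₃ = refl
  quiver-codeOf q v₁ v₀ = sym (q v₁ v₀)
  quiver-codeOf q v₁ v₁ = sym (diag-zero q v₁)
  quiver-codeOf q v₁ v₂ = refl
  quiver-codeOf q v₁ v₃ = refl
  quiver-codeOf q v₂ v₀ = sym (q v₂ v₀)
  quiver-codeOf q v₂ v₁ = sym (q v₂ v₁)
  quiver-codeOf q v₂ v₂ = sym (diag-zero q v₂)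
  quiver-codeOf q v₂ v₃ = refl
  quiver-codeOf q v₃ v₀ = sym (q v₃ v₀)
  quiver-codeOf q v₃ v₁ = sym (q v₃ v₁)
  quiver-codeOf q v₃ v₂ = sym (q v₃ v₂)
  quiver-codeOf q v₃ v₃ = sym (diag-zero q v₃)

  quiver-skew : ∀ c → IsQuiver (quiver c)
  quiver-skew (code a b c d e f) v₀ v₀ = refl
  quiver-skew (code a b c d e f) v₀ v₁ = sym (ℤP.neg-involutive a)
  quiver-skew (code a b c d e f) v₀ v₂ = sym (ℤP.neg-involutive b)
  quiver-skew (code a b c d e f) v₀ v₃ = sym (ℤP.neg-involutive c)
  quiver-skew (code a b c d e f) v₁ v₀ = refl
  quiver-skew (code a b c d e f) v₁ v₁ = refl
  quiver-skew (code a b c d e f) v₁ v₂ = sym (ℤP.neg-involutive d)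
  quiver-skew (code a b c d e f) v₁ v₃ = sym (ℤP.neg-involutive e)
  quiver-skew (code a b c d e f) v₂ v₀ = refl
  quiver-skew (code a b c d e f) v₂ v₁ = refl
  quiver-skew (code a b c d e f) v₂ v₂ = refl
  quiver-skew (code a b c d e f) v₂ v₃ = sym (ℤP.neg-involutive f)
  quiver-skew (code a b c d e f) v₃ v₀ = refl
  quiver-skew (code a b c d e f) v₃ v₁ = refl
  quiver-skew (code a b c d e f) v₃ v₂ = refl
  quiver-skew (code a b c d e f) v₃ v₃ = refl

  -- Every mutation is stored again as six integers, so iterated mutations are evaluated on numbers
  -- and not on nested functions.
  μᶜ : Fin 4 → Code → Code
  μᶜ k c = codeOf (μ k (quiver c))

  quiver-μᶜ : ∀ k c i j → quiver (μᶜ k c) i j ≡ μ k (quiver c) i j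
  quiver-μᶜ k c = quiver-codeOf (μ-quiver (quiver-skew c) k)

  -- Opaque, so that p can be read off from every p xs even when xs is a literal list.
  opaque
   infixr 6 _∧_
   infixr 5 _∨_
   _∧_ _∨_ : Bool → Bool → Bool
   true  ∧ b = b
   false ∧ b = false
   true  ∨ b = true
   false ∨ b = b

   every some : ∀ {A : Set} → (A → Bool) → List A → Bool
   every p []       = true
   every p (x ∷ xs) = p x ∧ every p xs
   some p []       = false
   some p (x ∷ xs) = p x ∨ some p xs

   ∧-true : ∀ {a b} → a ∧ b ≡ true → a ≡ true × b ≡ true
   ∧-true {true} h = refl , h

   ∨-true : ∀ {a b} → a ∨ b ≡ true → a ≡ true ⊎ b ≡ true
   ∨-true {true}  h = inj₁ refl
   ∨-true {false} h = inj₂ h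

   every-true : ∀ {A : Set} {p : A → Bool} {xs} → every p xs ≡ true → ∀ {x} → x ∈ xs → p x ≡ true
   every-true {xs = x ∷ xs} h (here refl) = proj₁ (∧-true h)
   every-true {p = p} {x ∷ xs} h (there i) = every-true (proj₂ (∧-true {p x} h)) i

   some-true : ∀ {A : Set} {p : A → Bool} {xs} → some p xs ≡ true → ∃ λ x → x ∈ xs × p x ≡ true
   some-true {p = p} {x ∷ xs} h with ∨-true {p x} h
   ... | inj₁ e = x , here refl , e
   ... | inj₂ e = let (y , i , g) = some-true e in y , there i , g

  does-true : ∀ {A : Set} (d : Dec A) → does d ≡ true → A
  does-true (yes a) _ = a

  not-does : ∀ {A : Set} (d : Dec A) → not (does d) ≡ true → ¬ A
  not-does (no h) _ = h

  does-yes : ∀ {A : Set} (d : Dec A) → A → does d ≡ true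
  does-yes (yes _) _ = refl
  does-yes (no h)  a = ⊥-elim (h a)

  not-∨ : ∀ {a b} → a ≡ true → not a ∨ b ≡ true → b ≡ true
  not-∨ e h with ∨-true h
  not-∨ refl h | inj₁ ()
  ... | inj₂ g = g

  vertices : List (Fin 4)
  vertices = v₀ ∷ v₁ ∷ v₂ ∷ v₃ ∷ []

  ∈-vertices : ∀ i → i ∈ vertices
  ∈-vertices v₀ = here refl
  ∈-vertices v₁ = there (here refl)
  ∈-vertices v₂ = there (there (here refl))
  ∈-vertices v₃ = there (there (there (here refl)))

  everyᵛ : (Fin 4 → Bool) → Bool
  everyᵛ p = every p vertices

  everyᵛ-true : ∀ {p} → everyᵛ p ≡ true → ∀ i → p i ≡ true
  everyᵛ-true h i = every-true h (∈-vertices i)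

  _==ᶜ_ : Code → Code → Bool
  code a b c d e f ==ᶜ code a′ b′ c′ d′ e′ f′ =
   does (a ℤ.≟ a′) ∧ does (b ℤ.≟ b′) ∧ does (c ℤ.≟ c′) ∧ does (d ℤ.≟ d′) ∧ does (e ℤ.≟ e′) ∧ does (f ℤ.≟ f′)

  ==ᶜ-true : ∀ x y → x ==ᶜ y ≡ true → x ≡ y
  ==ᶜ-true (code a b c d e f) (code a′ b′ c′ d′ e′ f′) h
   with ∧-true {does (a ℤ.≟ a′)} h
  ... | ha , h with ∧-true {does (b ℤ.≟ b′)} h
  ... | hb , h with ∧-true {does (c ℤ.≟ c′)} h
  ... | hc , h with ∧-true {does (d ℤ.≟ d′)} h
  ... | hd , h with ∧-true {does (e ℤ.≟ e′)} h
  ... | he , hf with does-true (a ℤ.≟ a′) ha | does-true (b ℤ.≟ b′) hb | does-true (c ℤ.≟ c′) hc | does-true (d ℤ.≟ d′) hd | does-true (e ℤ.≟ e′) he | does-true (f ℤ.≟ f′) hf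
  ... | refl | refl | refl | refl | refl | refl = refl

  permutations : ∀ n → List (Permutation′ n)
  permutations zero    = Perm.id ∷ []
  permutations (suc n) = concatMap (λ j → map (Perm.insert zero j) (permutations n)) (allFin (suc n))

  table : Permutation′ 4 → Vec (Fin 4) 4
  table π = tabulate (π ⟨$⟩ʳ_)

  Tables : Set
  Tables = List (Vec (Fin 4) 4)

  permute : Vec (Fin 4) 4 → Code → Code
  permute t c = codeOf (λ i j → quiver c (lookup t i) (lookup t j))

  isoTo : Tables → List Code → Code → Bool
  isoTo ts ds c = some (λ t → let p = permute t c in some (p ==ᶜ_) ds) ts

  RowTable : Set
  RowTable = Vec (Vec ℤ 4) 4

  rowsᵗ : RowTable → Rows 4
  rowsᵗ R i j = lookup (lookup R i) j

  -- The c-vectors are tabulated after each step for the same reason as the quivers are coded.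
  tabulate² : Rows 4 → RowTable
  tabulate² C = tabulate (λ i → tabulate (C i))

  greenRun : Code → RowTable → List (Fin 4) → Bool
  greenRun c R []       = everyᵛ (λ i → everyᵛ (λ j → does (rowsᵗ R i j ℤ.≤? 0ℤ)))
  greenRun c R (k ∷ ks) = everyᵛ (λ j → does (0ℤ ℤ.≤? rowsᵗ R k j)) ∧
   greenRun (μᶜ k c) (tabulate² (mutate-rows {B = quiver c} (quiver-skew c) k (rowsᵗ R))) ks

  mgs? : Code → List (Fin 4) → Bool
  mgs? c ks = greenRun c (tabulate² Defs.δ) ks

  -- Entries are stored with offset 5, and a sequence of vertices as a decimal numeral whose digits, read from the
  -- right, are the vertices counted from 1.
  cd : (a b c d e f : ℕ) → Code
  cd a b c d e f = code (a ⊖ 5) (b ⊖ 5) (c ⊖ 5) (d ⊖ 5) (e ⊖ 5) (f ⊖ 5)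

  digit : ℕ → Fin 4
  digit 0 = v₀
  digit 1 = v₁
  digit 2 = v₂
  digit _ = v₃

  word : ℕ → List (Fin 4)
  -- A bound on the number of digits; the numerals below have at most five, so nothing is truncated.
  word = go 30
   where
   go : ℕ → ℕ → List (Fin 4)
   go zero    n    = []
   go (suc l) zero = []
   go (suc l) n    = digit ((n % 10) ℕ.∸ 1) ∷ go l (n / 10)

  Steps : Set
  Steps = List (ℕ × ℕ)

  -- One isomorphism class of the classification with its certificates. `to` and `from` are walks in
  -- Ψ to the hub and back; each step consists of a vertex, counted from 0, and of a maximal green
  -- sequence, its vertices counted from 1, of the quiver reached. `exit` leads to a quiver without
  -- a maximal green sequence.
  record Member : Set where
   constructor member
   field
    start   : Code
    mgs     : ℕ
    to from : Steps
    exit    : ℕ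

  data Mod3 : Set where
   holds fails unknown : Mod3

  -- The hub makes two walks per member enough to connect any two members. `component` contains the
  -- members up to isomorphism and is closed under mutation, except for quivers without a maximal
  -- green sequence. `mod3` is `unknown` where `pfaffian` alone identifies the family.
  record Family : Set where
   field
    pfaffian  : ℕ
    mod3      : Mod3
    hub       : Code
    members   : List Member
    component : List Code

  -- Candidates with entries at most 2 whose triples are all good but which are mutation-finite
  -- themselves; up to isomorphism the list is closed under mutation.
  finiteCodes : List Code
  finiteCodes =
   cd 5 5 5 5 5 5 ∷ cd 6 5 4 5 6 5 ∷ cd 6 5 4 6 5 6 ∷ cd 6 5 5 4 4 5 ∷ cd 6 5 5 5 4 5 ∷ cd 6 5 5 5 5 5 ∷
   cd 6 5 5 5 5 6 ∷ cd 6 5 5 6 4 5 ∷ cd 6 5 5 6 4 6 ∷ cd 6 5 5 6 5 4 ∷ cd 6 5 5 6 5 5 ∷ cd 6 5 5 6 5 6 ∷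
   cd 6 6 4 5 5 5 ∷ cd 6 6 4 5 6 5 ∷ cd 6 6 4 5 6 6 ∷ cd 6 6 4 6 5 6 ∷ cd 6 6 4 6 6 5 ∷ cd 6 6 5 5 4 4 ∷
   cd 6 6 5 5 5 4 ∷ cd 6 6 5 5 5 5 ∷ cd 6 6 5 5 6 4 ∷ cd 6 6 5 5 6 5 ∷ cd 6 6 5 5 6 6 ∷ cd 6 6 5 6 4 6 ∷
   cd 6 6 5 6 5 5 ∷ cd 6 6 6 5 5 5 ∷ cd 7 4 4 6 6 5 ∷ cd 7 4 4 6 6 6 ∷ cd 7 5 3 5 7 5 ∷ cd 7 5 4 5 6 4 ∷
   cd 7 5 4 5 6 5 ∷ cd 7 5 4 5 6 6 ∷ cd 7 5 5 5 5 5 ∷ cd 7 5 5 5 5 6 ∷ cd 7 5 5 5 5 7 ∷ []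

  -- The entries `B x y`, `B x z`, `B y z` on three vertices, with offset 5. Every other triple with
  -- entries between -2 and 2 has a growth certificate and is mutation-infinite.
  goodTriples : List (ℕ × ℕ × ℕ)
  goodTriples =
   (3 , 5 , 5) ∷ (3 , 6 , 4) ∷ (3 , 7 , 3) ∷ (4 , 4 , 4) ∷ (4 , 4 , 5) ∷ (4 , 4 , 6) ∷ (4 , 5 , 4) ∷ (4 , 5 , 5) ∷
   (4 , 5 , 6) ∷ (4 , 6 , 3) ∷ (4 , 6 , 4) ∷ (4 , 6 , 5) ∷ (4 , 6 , 6) ∷ (4 , 7 , 4) ∷ (5 , 3 , 5) ∷ (5 , 4 , 4) ∷
   (5 , 4 , 5) ∷ (5 , 4 , 6) ∷ (5 , 5 , 3) ∷ (5 , 5 , 4) ∷ (5 , 5 , 5) ∷ (5 , 5 , 6) ∷ (5 , 5 , 7) ∷ (5 , 6 , 4) ∷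
   (5 , 6 , 5) ∷ (5 , 6 , 6) ∷ (5 , 7 , 5) ∷ (6 , 3 , 6) ∷ (6 , 4 , 4) ∷ (6 , 4 , 5) ∷ (6 , 4 , 6) ∷ (6 , 4 , 7) ∷
   (6 , 5 , 4) ∷ (6 , 5 , 5) ∷ (6 , 5 , 6) ∷ (6 , 6 , 4) ∷ (6 , 6 , 5) ∷ (6 , 6 , 6) ∷ (7 , 3 , 7) ∷ (7 , 4 , 6) ∷
   (7 , 5 , 5) ∷ []

  family0 : Family
  family0 = record
   { pfaffian = 1 ; mod3 = fails ; hub = cd 6 6 4 6 5 5
   ; members =
    member (cd 6 6 4 6 5 5) 3214 ([]) ([]) 312 ∷
    member (cd 6 6 4 6 6 6) 14321 ((3 , 3241) ∷ []) ((0 , 43214) ∷ []) 132 ∷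
    member (cd 6 6 5 6 4 5) 3241 ((0 , 1324) ∷ []) ((2 , 2143) ∷ []) 1231 ∷
    member (cd 6 6 5 6 5 4) 3421 ((0 , 1342) ∷ (1 , 2134) ∷ []) ((2 , 2143) ∷ (1 , 1432) ∷ []) 1312 ∷
    member (cd 6 6 5 6 5 6) 4321 ((2 , 34213) ∷ (3 , 2143) ∷ []) ((0 , 43214) ∷ (3 , 1432) ∷ []) 132 ∷
    member (cd 6 6 5 6 6 5) 4321 ((0 , 4132) ∷ (3 , 1324) ∷ []) ((2 , 2143) ∷ (3 , 4213) ∷ []) 3132 ∷
    member (cd 6 6 6 6 5 5) 4321 ((3 , 3214) ∷ []) ((3 , 4321) ∷ []) 3132 ∷
    []
   ; component =
    cd 6 6 4 6 5 5 ∷ cd 6 6 4 6 6 6 ∷ cd 6 6 5 6 4 5 ∷ cd 6 6 5 6 5 4 ∷ cd 6 6 5 6 5 6 ∷ cd 6 6 5 6 6 5 ∷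
    cd 6 6 6 6 5 5 ∷ cd 7 4 4 6 5 5 ∷ cd 7 4 4 6 5 6 ∷ cd 7 4 4 7 4 6 ∷ cd 7 5 4 4 6 4 ∷ cd 7 5 4 4 6 5 ∷
    cd 7 5 4 4 7 4 ∷ cd 7 5 4 6 5 6 ∷ cd 7 5 4 6 6 5 ∷ cd 7 5 4 6 6 6 ∷ cd 7 6 3 5 6 6 ∷ cd 7 6 3 6 6 6 ∷
    cd 7 6 4 5 6 5 ∷ cd 7 6 4 5 6 6 ∷ [] }

  family1 : Family
  family1 = record
   { pfaffian = 3 ; mod3 = unknown ; hub = cd 6 6 4 6 6 4
   ; members =
    member (cd 6 6 4 6 6 4) 31421 ([]) ([]) 4321 ∷
    member (cd 6 6 6 6 4 6) 24321 ((0 , 12432) ∷ []) ((2 , 14213) ∷ []) 3132 ∷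
    []
   ; component =
    cd 6 6 4 6 6 4 ∷ cd 6 6 6 6 4 6 ∷ cd 7 4 4 6 5 4 ∷ cd 7 5 4 4 6 6 ∷ cd 7 5 4 6 6 4 ∷ cd 7 5 4 6 6 7 ∷
    cd 7 6 3 4 6 6 ∷ cd 7 6 3 7 6 6 ∷ cd 7 6 4 4 7 4 ∷ cd 7 6 4 5 6 4 ∷ cd 7 6 4 5 6 7 ∷ cd 7 6 4 6 5 7 ∷
    cd 7 6 4 7 4 7 ∷ cd 8 3 3 6 6 6 ∷ cd 8 4 3 7 6 5 ∷ cd 8 4 4 6 6 6 ∷ cd 8 4 4 7 7 6 ∷ [] }

  family2 : Family
  family2 = record
   { pfaffian = 0 ; mod3 = unknown ; hub = cd 6 6 5 6 4 4
   ; members =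
    member (cd 6 6 5 6 4 4) 3241 ([]) ([]) 312 ∷
    member (cd 6 6 5 6 6 6) 4321 ((3 , 3241) ∷ []) ((0 , 1324) ∷ []) 132 ∷
    member (cd 6 6 6 6 5 4) 3421 ((0 , 1342) ∷ []) ((2 , 2413) ∷ []) 1231 ∷
    member (cd 6 6 6 6 6 5) 4321 ((0 , 1432) ∷ (1 , 2143) ∷ []) ((0 , 1324) ∷ (3 , 4132) ∷ []) 132 ∷
    []
   ; component =
    cd 6 6 5 6 4 4 ∷ cd 6 6 5 6 6 6 ∷ cd 6 6 6 6 5 4 ∷ cd 6 6 6 6 6 5 ∷ cd 7 4 4 6 4 6 ∷ cd 7 5 4 3 6 4 ∷
    cd 7 5 4 7 4 6 ∷ cd 7 6 3 6 5 6 ∷ cd 7 6 4 4 6 5 ∷ cd 7 6 4 6 6 6 ∷ cd 7 7 4 5 6 6 ∷ cd 8 3 3 6 6 5 ∷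
    cd 8 4 4 6 6 5 ∷ cd 8 4 4 7 4 6 ∷ cd 8 4 4 7 7 5 ∷ cd 8 6 3 6 6 6 ∷ [] }

  family3 : Family
  family3 = record
   { pfaffian = 2 ; mod3 = unknown ; hub = cd 6 6 5 6 6 4
   ; members =
    member (cd 6 6 5 6 6 4) 3421 ([]) ([]) 324 ∷
    member (cd 6 6 6 6 5 6) 4321 ((0 , 1432) ∷ []) ((0 , 1342) ∷ []) 132 ∷
    []
   ; component =
    cd 6 6 5 6 6 4 ∷ cd 6 6 6 6 5 6 ∷ cd 7 4 4 6 4 5 ∷ cd 7 6 4 4 6 4 ∷ cd 7 6 4 4 6 6 ∷ cd 7 6 4 6 6 5 ∷
    cd 7 6 4 6 6 7 ∷ cd 8 4 3 7 4 6 ∷ cd 8 4 4 6 5 6 ∷ cd 8 4 4 8 3 6 ∷ cd 8 5 4 4 7 4 ∷ cd 8 5 4 6 6 6 ∷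
    cd 8 6 3 5 6 6 ∷ cd 8 6 3 7 6 6 ∷ cd 8 7 2 6 6 6 ∷ [] }

  family4 : Family
  family4 = record
   { pfaffian = 1 ; mod3 = holds ; hub = cd 6 6 6 6 6 6
   ; members =
    member (cd 6 6 6 6 6 6) 4321 ([]) ([]) 132 ∷
    []
   ; component =
    cd 6 6 6 6 6 6 ∷ cd 7 6 4 3 6 4 ∷ cd 7 6 4 7 6 7 ∷ cd 7 7 4 6 6 6 ∷ cd 9 4 4 7 4 6 ∷ cd 9 6 3 6 6 6 ∷
    [] }

  family : Fin 5 → Family
  family zero                         = family0
  family (suc zero)                   = family1
  family (suc (suc zero))             = family2
  family (suc (suc (suc zero)))       = family3
  family (suc (suc (suc (suc zero)))) = family4

  big? : ℤ → Bool
  big? (⁺ suc (suc n)) = true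
  big? _               = false

  heavy? : Code → Bool
  heavy? c = some (λ i → some (λ j → big? (quiver c i j) ∧ some (λ k → big? (quiver c j k) ∧ big? (quiver c k i)) vertices) vertices) vertices

  blockedAt? : Code → Fin 4 → Fin 4 → Fin 4 → Fin 4 → Bool
  blockedAt? c o x y z = does (quiver c x y ℤ.≟ 1ℤ) ∧ does (quiver c y z ℤ.≟ 1ℤ) ∧ does (quiver c x z ℤ.≟ 1ℤ) ∧
   big? (quiver c o x) ∧ big? (quiver c z o) ∧ heavy? (μᶜ o c) ∧ heavy? (μᶜ y c)

  -- The permutations in `ts` supply all assignments of the roles o, x, y, z.
  stuck? : Tables → Code → Bool
  stuck? ts c = heavy? c ∨ some (λ t → blockedAt? c (lookup t v₀) (lookup t v₁) (lookup t v₂) (lookup t v₃)) ts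

  μsᶜ : List (Fin 4) → Code → Code
  μsᶜ []       c = c
  μsᶜ (k ∷ ks) c = μsᶜ ks (μᶜ k c)

  chain? : Tables → Code → Steps → Code → Bool
  chain? ts c []            d = isoTo ts (d ∷ []) c
  chain? ts c ((k , g) ∷ s) d = let c′ = μᶜ (digit k) c in mgs? c′ (word g) ∧ chain? ts c′ s d

  member? : Tables → Family → Member → Bool
  member? ts F M = mgs? start (word mgs) ∧ chain? ts start to hub ∧ chain? ts hub from start ∧ stuck? ts (μsᶜ (word exit) start) ∧ isoTo ts component start
   where
   open Family F
   open Member M

  closed? : Tables → List Code → Bool
  closed? ts L = every (λ c → everyᵛ (λ k → let c′ = μᶜ k c in isoTo ts L c′ ∨ stuck? ts c′)) L

  finiteClosed? : Tables → List Code → Bool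
  finiteClosed? ts L = every (λ c → everyᵛ (λ k → isoTo ts L (μᶜ k c))) L

  zero? : ℤ/3 → Bool
  zero? zer = true
  zero? _   = false

  zero-true : ∀ r → zero? r ≡ true → r ≡ zer
  zero-true zer _ = refl

  not-zero : ∀ r → not (zero? r) ≡ true → r ≢ zer
  not-zero one _ ()
  not-zero two _ ()

  multiplicative? violates? : Code → Bool
  multiplicative? c = everyᵛ (λ i → everyᵛ (λ j → does (i ≟ᶠ j) ∨ not (zero? (ρ (quiver c i j))))) ∧
   everyᵛ (λ i → everyᵛ (λ k → everyᵛ (λ j → not (does (0ℤ ℤ.<? quiver c i k)) ∨ (not (does (0ℤ ℤ.<? quiver c k j)) ∨
    does (residue-of (quiver c) i j ≟ˢ (residue-of (quiver c) i k ⊗ residue-of (quiver c) k j))))))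
  violates? c = some (λ i → some (λ j → not (does (i ≟ᶠ j)) ∧ zero? (ρ (quiver c i j))) vertices) vertices ∨
   some (λ i → some (λ k → some (λ j → does (0ℤ ℤ.<? quiver c i k) ∧ (does (0ℤ ℤ.<? quiver c k j) ∧
    not (does (residue-of (quiver c) i j ≟ˢ (residue-of (quiver c) i k ⊗ residue-of (quiver c) k j))))) vertices) vertices) vertices

  mod3? : Mod3 → Code → Bool
  mod3? holds   = multiplicative?
  mod3? fails   = violates?
  mod3? unknown = λ _ → true

  pfaffian? : Tables → ℕ → Code → Bool
  pfaffian? ts P c = every (λ t → does (∣ Pf (quiver c) (lookup t v₀) (lookup t v₁) (lookup t v₂) (lookup t v₃) ∣ ℕ.≟ P)) ts

  inFamily? : Tables → Code → Fin 5 → Bool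
  inFamily? ts c i = isoTo ts (map Member.start (Family.members (family i))) c ∧ pfaffian? ts (Family.pfaffian (family i)) c ∧ mod3? (Family.mod3 (family i)) c

  known? : Tables → Code → Bool
  known? ts c = isoTo ts finiteCodes c ∨ some (inFamily? ts c) (allFin 5)

  ints : List ℤ
  ints = -[1+ 1 ] ∷ -[1+ 0 ] ∷ ⁺ 0 ∷ ⁺ 1 ∷ ⁺ 2 ∷ []

  triple : ℤ → ℤ → ℤ → Q 3
  triple x y z v₀ v₀ = 0ℤ
  triple x y z v₀ v₁ = x
  triple x y z v₀ v₂ = y
  triple x y z v₁ v₀ = - x
  triple x y z v₁ v₁ = 0ℤ
  triple x y z v₁ v₂ = z
  triple x y z v₂ v₀ = - y
  triple x y z v₂ v₁ = - z
  triple x y z v₂ v₂ = 0ℤ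

  good? : ℤ → ℤ → ℤ → Bool
  good? x y z = some (λ { (a , b , c) → does (x ℤ.≟ (a ⊖ 5)) ∧ does (y ℤ.≟ (b ⊖ 5)) ∧ does (z ℤ.≟ (c ⊖ 5)) }) goodTriples

  -- Three mutations alternating between two vertices. The last component is the vertex mutated
  -- last, and an arrow of multiplicity at least 3 is sought between the other two, in either
  -- direction.
  certificates : List (List (Fin 3) × Fin 3 × Fin 3 × Fin 3)
  certificates =
   (v₀ ∷ v₁ ∷ v₀ ∷ [] , v₁ , v₂ , v₀) ∷ (v₀ ∷ v₁ ∷ v₀ ∷ [] , v₂ , v₁ , v₀) ∷ (v₁ ∷ v₂ ∷ v₁ ∷ [] , v₀ , v₂ , v₁) ∷ (v₁ ∷ v₂ ∷ v₁ ∷ [] , v₂ , v₀ , v₁) ∷ (v₂ ∷ v₀ ∷ v₂ ∷ [] , v₀ , v₁ , v₂) ∷ (v₂ ∷ v₀ ∷ v₂ ∷ [] , v₁ , v₀ , v₂) ∷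
   (v₀ ∷ v₂ ∷ v₀ ∷ [] , v₁ , v₂ , v₀) ∷ (v₀ ∷ v₂ ∷ v₀ ∷ [] , v₂ , v₁ , v₀) ∷ (v₁ ∷ v₀ ∷ v₁ ∷ [] , v₀ , v₂ , v₁) ∷ (v₁ ∷ v₀ ∷ v₁ ∷ [] , v₂ , v₀ , v₁) ∷ (v₂ ∷ v₁ ∷ v₂ ∷ [] , v₀ , v₁ , v₂) ∷ (v₂ ∷ v₁ ∷ v₂ ∷ [] , v₁ , v₀ , v₂) ∷
   []

  grows? : Q 3 → List (Fin 3) × Fin 3 × Fin 3 × Fin 3 → Bool
  grows? B (ks , p , r , c) = does (⁺ 3 ℤ.≤? μs ks B p r) ∧ not (does (c ≟ᶠ p)) ∧ not (does (r ≟ᶠ p)) ∧ not (does (c ≟ᶠ r)) ∧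
   (not (does (μs ks B c p ℤ.≟ 0ℤ)) ∨ not (does (μs ks B c r ℤ.≟ 0ℤ)))

  triples? : List (List (Fin 3) × Fin 3 × Fin 3 × Fin 3) → List ℤ → Bool
  triples? ws xs = every (λ x → every (λ y → every (λ z → good? x y z ∨ some (grows? (triple x y z)) ws) xs) xs) xs

  -- Triangles are tested as soon as their entries are chosen, which prunes the enumeration: a, b, d
  -- belong to the vertices 0, 1, 2, then c and e complete 0, 1, 3, and f completes the other two.
  classified? : Tables → List ℤ → Bool
  classified? ts xs = every (λ a → every (λ b → every (λ d → not (good? a b d) ∨ every (λ c → every (λ e → not (good? a c e) ∨
   every (λ f → not (good? b c f) ∨ (not (good? d e f) ∨ known? ts (code a b c d e f))) xs) xs) xs) xs) xs) xs

  members? : Tables → List (Fin 5) → Bool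
  members? ts is = every (λ i → every (member? ts (family i)) (Family.members (family i))) is

  components? : Tables → List (Fin 5) → Bool
  components? ts is = every (λ i → closed? ts (Family.component (family i))) is

  match? : Fin 4 → Fin 4 → Fin 4 → Fin 4 → Vec (Fin 4) 4 → Bool
  match? x k y z t = does (lookup t v₀ ≟ᶠ x) ∧ does (lookup t v₁ ≟ᶠ k) ∧ does (lookup t v₂ ≟ᶠ y) ∧ does (lookup t v₃ ≟ᶠ z)

  complete? : Tables → Bool
  complete? ts = everyᵛ (λ x → everyᵛ (λ k → everyᵛ (λ y → everyᵛ (λ z → does (x ≟ᶠ k) ∨ does (x ≟ᶠ y) ∨ does (x ≟ᶠ z) ∨ does (k ≟ᶠ y) ∨ does (k ≟ᶠ z) ∨ does (y ≟ᶠ z) ∨ some (match? x k y z) ts))))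

  tables : Tables
  tables =
   (v₀ ∷ v₁ ∷ v₂ ∷ v₃ ∷ []) ∷  (v₀ ∷ v₁ ∷ v₃ ∷ v₂ ∷ []) ∷  (v₀ ∷ v₂ ∷ v₁ ∷ v₃ ∷ []) ∷  (v₀ ∷ v₂ ∷ v₃ ∷ v₁ ∷ []) ∷
   (v₀ ∷ v₃ ∷ v₁ ∷ v₂ ∷ []) ∷  (v₀ ∷ v₃ ∷ v₂ ∷ v₁ ∷ []) ∷  (v₁ ∷ v₀ ∷ v₂ ∷ v₃ ∷ []) ∷  (v₁ ∷ v₀ ∷ v₃ ∷ v₂ ∷ []) ∷
   (v₁ ∷ v₂ ∷ v₀ ∷ v₃ ∷ []) ∷  (v₁ ∷ v₂ ∷ v₃ ∷ v₀ ∷ []) ∷  (v₁ ∷ v₃ ∷ v₀ ∷ v₂ ∷ []) ∷  (v₁ ∷ v₃ ∷ v₂ ∷ v₀ ∷ []) ∷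
   (v₂ ∷ v₀ ∷ v₁ ∷ v₃ ∷ []) ∷  (v₂ ∷ v₀ ∷ v₃ ∷ v₁ ∷ []) ∷  (v₂ ∷ v₁ ∷ v₀ ∷ v₃ ∷ []) ∷  (v₂ ∷ v₁ ∷ v₃ ∷ v₀ ∷ []) ∷
   (v₂ ∷ v₃ ∷ v₀ ∷ v₁ ∷ []) ∷  (v₂ ∷ v₃ ∷ v₁ ∷ v₀ ∷ []) ∷  (v₃ ∷ v₀ ∷ v₁ ∷ v₂ ∷ []) ∷  (v₃ ∷ v₀ ∷ v₂ ∷ v₁ ∷ []) ∷
   (v₃ ∷ v₁ ∷ v₀ ∷ v₂ ∷ []) ∷  (v₃ ∷ v₁ ∷ v₂ ∷ v₀ ∷ []) ∷  (v₃ ∷ v₂ ∷ v₀ ∷ v₁ ∷ []) ∷  (v₃ ∷ v₂ ∷ v₁ ∷ v₀ ∷ []) ∷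
   []

  abstract
   -- Ties the literal list to genuine permutations, so that the checks can run on plain vectors.
   tables-permutations : map table (permutations 4) ≡ tables
   tables-permutations = refl

  tables-sound : ∀ {t} → t ∈ tables → ∃ λ (π : Permutation′ 4) → ∀ i → lookup t i ≡ π ⟨$⟩ʳ i
  tables-sound {t} i = go (∈-map⁻ table (subst (t ∈_) (sym tables-permutations) i))
   where
   go : ∀ {t} → (∃ λ π → π ∈ permutations 4 × t ≡ table π) → ∃ λ (π : Permutation′ 4) → ∀ i → lookup t i ≡ π ⟨$⟩ʳ i
   go (π , _ , refl) = π , lookup∘tabulate (π ⟨$⟩ʳ_)

  -- Soundness of the checks.

  module Checked (ts : Tables) (ts-sound : ∀ {t} → t ∈ ts → ∃ λ (π : Permutation′ 4) → ∀ i → lookup t i ≡ π ⟨$⟩ʳ i) (ts-complete : complete? ts ≡ true) where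
   isoTo-true : ∀ ds c → isoTo ts ds c ≡ true → ∃ λ d → d ∈ ds × (quiver c ≅ quiver d)
   isoTo-true ds c h with some-true h
   ... | t , t∈ , h with some-true h | ts-sound t∈
   ... | d , d∈ , e | π , hπ = d , d∈ , ≅-sym {B = quiver d} {quiver c} (π , λ i j → trans (cong₂ (quiver c) (sym (hπ i)) (sym (hπ j)))
     (trans (sym (quiver-codeOf (λ i j → quiver-skew c (lookup t i) (lookup t j)) i j)) (cong (λ z → quiver z i j) (==ᶜ-true (permute t c) d e))))

   any-quiver : ∀ {B : Q 4} {ds d} → d ∈ ds → B ≅ quiver d → Any (B ≅_) (map quiver ds)
   any-quiver d∈ i = lose (∈-map⁺ quiver d∈) i

   rowsᵗ-tabulate² : ∀ C i j → rowsᵗ (tabulate² C) i j ≡ C i j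
   rowsᵗ-tabulate² C i j = trans (cong (λ r → lookup r j) (lookup∘tabulate (λ i → tabulate (C i)) i)) (lookup∘tabulate (C i) j)

   -- The run mutates only the quiver and its c-vectors; by `mutate-tracks` this follows the framed
   -- quiver as long as the vertices are green.
   greenRun-true : ∀ {M} c R ks → Tracks M (quiver c) (rowsᵗ R) → greenRun c R ks ≡ true → GreenSeq M ks
   greenRun-true c R [] T h k j = subst (_≤ 0ℤ) (sym (Tracks.out T k j)) (does-true (rowsᵗ R k j ℤ.≤? 0ℤ) (everyᵛ-true (everyᵛ-true h k) j))
   greenRun-true c R (k ∷ ks) T h = (λ j → subst (_≤ 0ℤ) (sym (Tracks.into T j k)) (ℤP.neg-mono-≤ (green j))) ,
    greenRun-true (μᶜ k c) (tabulate² C′) ks (record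
     { arrows = λ i j → trans (Tracks.arrows T′ i j) (sym (quiver-μᶜ k c i j))
     ; out    = λ i j → trans (Tracks.out T′ i j) (sym (rowsᵗ-tabulate² C′ i j))
     ; into   = λ j i → trans (Tracks.into T′ j i) (cong -_ (sym (rowsᵗ-tabulate² C′ i j))) }) (proj₂ (∧-true {everyᵛ (λ j → does (0ℤ ℤ.≤? rowsᵗ R k j))} h))
    where
    C′ = mutate-rows {B = quiver c} (quiver-skew c) k (rowsᵗ R)
    green : ∀ j → 0ℤ ≤ rowsᵗ R k j
    green j = does-true (0ℤ ℤ.≤? rowsᵗ R k j) (everyᵛ-true (proj₁ (∧-true h)) j)
    T′ = mutate-tracks {C = rowsᵗ R} (quiver-skew c) k green T

   mgs-true : ∀ c ks → mgs? c ks ≡ true → HasMGS (quiver c)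
   mgs-true c ks h = ks , greenRun-true c (tabulate² Defs.δ) ks (record { arrows = λ _ _ → refl ; out = λ i j → sym (rowsᵗ-tabulate² Defs.δ i j)
    ; into = λ j i → cong -_ (trans (δ-sym j i) (sym (rowsᵗ-tabulate² Defs.δ i j))) }) h
    where
    δ-sym : ∀ {n} (i j : Fin n) → Defs.δ i j ≡ Defs.δ j i
    δ-sym i j with i ≟ᶠ j | j ≟ᶠ i
    ... | yes _ | yes _ = refl
    ... | no _  | no _  = refl
    ... | yes e | no h  = ⊥-elim (h (sym e))
    ... | no h  | yes e = ⊥-elim (h (sym e))

   big-true : ∀ z → big? z ≡ true → Big z
   big-true (⁺ suc (suc n)) _ = n , refl

   heavy-true : ∀ c → heavy? c ≡ true → Heavy (quiver c)
   heavy-true c h with some-true h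
   ... | i , _ , h with some-true h
   ... | j , _ , h with ∧-true {big? (quiver c i j)} h
   ... | ij , h with some-true h
   ... | k , _ , h with ∧-true {big? (quiver c j k)} h
   ... | jk , ki = i , j , k , big-true _ ij , big-true _ jk , big-true _ ki

   heavy-pointwise : ∀ {B C : Q 4} → (∀ i j → B i j ≡ C i j) → Heavy B → Heavy C
   heavy-pointwise h (a , b , c , ab , bc , ca) = a , b , c , subst Big (h a b) ab , subst Big (h b c) bc , subst Big (h c a) ca

   blocked-true : ∀ c o x y z → (∀ i → i ≡ o ⊎ i ≡ x ⊎ i ≡ y ⊎ i ≡ z) → blockedAt? c o x y z ≡ true → Blocked (quiver c)
   blocked-true c o x y z cover h with ∧-true {does (quiver c x y ℤ.≟ 1ℤ)} h
   ... | xy , h with ∧-true {does (quiver c y z ℤ.≟ 1ℤ)} h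
   ... | yz , h with ∧-true {does (quiver c x z ℤ.≟ 1ℤ)} h
   ... | xz , h with ∧-true {big? (quiver c o x)} h
   ... | ox , h with ∧-true {big? (quiver c z o)} h
   ... | zo , h with ∧-true {heavy? (μᶜ o c)} h
   ... | ho , hy = record { o = o ; x = x ; y = y ; z = z ; cover = cover
    ; xy = does-true (quiver c x y ℤ.≟ 1ℤ) xy ; yz = does-true (quiver c y z ℤ.≟ 1ℤ) yz ; xz = does-true (quiver c x z ℤ.≟ 1ℤ) xz ; ox = big-true _ ox ; zo = big-true _ zo
    ; heavy-o = heavy-pointwise (quiver-μᶜ o c) (heavy-true (μᶜ o c) ho)
    ; heavy-y = heavy-pointwise (quiver-μᶜ y c) (heavy-true (μᶜ y c) hy) }

   stuck-true : ∀ c → stuck? ts c ≡ true → ¬ HasMGS (quiver c)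
   stuck-true c h with ∨-true {heavy? c} h
   ... | inj₁ h = heavy⇒¬MGS (quiver-skew c) (heavy-true c h)
   ... | inj₂ h with some-true h
   ... | t , t∈ , h with ts-sound t∈
   ... | π , hπ = blocked⇒¬MGS (quiver-skew c) (blocked-true c (lookup t v₀) (lookup t v₁) (lookup t v₂) (lookup t v₃) cover h)
    where
    at : ∀ i j → π ⟨$⟩ˡ i ≡ j → i ≡ lookup t j
    at i j e = trans (sym (inverseʳ π)) (trans (cong (π ⟨$⟩ʳ_) e) (sym (hπ j)))
    cover : ∀ i → i ≡ lookup t v₀ ⊎ i ≡ lookup t v₁ ⊎ i ≡ lookup t v₂ ⊎ i ≡ lookup t v₃
    cover i = go (π ⟨$⟩ˡ i) refl
     where
     go : ∀ j → π ⟨$⟩ˡ i ≡ j → i ≡ lookup t v₀ ⊎ i ≡ lookup t v₁ ⊎ i ≡ lookup t v₂ ⊎ i ≡ lookup t v₃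
     go v₀ e = inj₁ (at i v₀ e)
     go v₁ e = inj₂ (inj₁ (at i v₁ e))
     go v₂ e = inj₂ (inj₂ (inj₁ (at i v₂ e)))
     go v₃ e = inj₂ (inj₂ (inj₂ (at i v₃ e)))

   μs-cong : ∀ {n} ks {B C : Q n} → (∀ i j → B i j ≡ C i j) → ∀ i j → μs ks B i j ≡ μs ks C i j
   μs-cong []       h = h
   μs-cong (k ∷ ks) h = μs-cong ks (μ-relabel (λ i → i) (λ e → e) h k)

   quiver-μsᶜ : ∀ ks c i j → quiver (μsᶜ ks c) i j ≡ μs ks (quiver c) i j
   quiver-μsᶜ []       c i j = refl
   quiver-μsᶜ (k ∷ ks) c i j = trans (quiver-μsᶜ ks (μᶜ k c) i j) (μs-cong ks (quiver-μᶜ k c) i j)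

   μs-++ : ∀ {n} ks js (B : Q n) → μs (ks ++ js) B ≡ μs js (μs ks B)
   μs-++ []       js B = refl
   μs-++ (k ∷ ks) js B = μs-++ ks js (μ k B)

   linked-end : ∀ {n} {B C : Q n} → Linked B C → HasMGS C
   linked-end {B = B} {C} (D , r , i) = HasMGS-≅ {B = D} {C} i (go r)
    where
    go : ∀ {D} → InPsiComp B D → HasMGS D
    go (here h)     = h
    go (step _ _ h) = h

   linked-iso : ∀ {n} {B C E : Q n} → Linked B C → C ≅ E → Linked B E
   linked-iso {C = C} {E} (D , r , i) e = D , r , ≅-trans {B = D} {C} {E} i e

   chain-true : ∀ {B} c s d → Linked B (quiver c) → chain? ts c s d ≡ true → Linked B (quiver d)
   chain-true c [] d l h with isoTo-true (d ∷ []) c h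
   ... | .d , here refl , i = linked-iso {C = quiver c} {quiver d} l i
   chain-true c ((k , g) ∷ s) d l h = chain-true c′ s d
     (linked-iso {C = μ (digit k) (quiver c)} {quiver c′} (linked-step l (digit k) (HasMGS-≅ {B = quiver c′} {μ (digit k) (quiver c)} pointwise (mgs-true c′ (word g) (proj₁ (∧-true {mgs? c′ (word g)} h)))))
      (≅-sym {B = quiver c′} {μ (digit k) (quiver c)} pointwise)) (proj₂ (∧-true {mgs? c′ (word g)} h))
    where
    c′ = μᶜ (digit k) c
    pointwise : quiver c′ ≅ μ (digit k) (quiver c)
    pointwise = ≅-pointwise (λ i j → sym (quiver-μᶜ (digit k) c i j))

   record MemberFacts (F : Family) (M : Member) : Set where
    open Family F
    open Member M
    field
     start-mgs    : HasMGS (quiver start)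
     to-hub       : Linked (quiver start) (quiver hub)
     from-hub     : Linked (quiver hub) (quiver start)
     exit-stuck   : ¬ HasMGS (μs (word exit) (quiver start))
     in-component : Any (quiver start ≅_) (map quiver component)

   member-true : ∀ F M → member? ts F M ≡ true → MemberFacts F M
   member-true F M h with ∧-true {mgs? (Member.start M) (word (Member.mgs M))} h
   ... | g , h with ∧-true {chain? ts (Member.start M) (Member.to M) (Family.hub F)} h
   ... | t , h with ∧-true {chain? ts (Family.hub F) (Member.from M) (Member.start M)} h
   ... | f , h with ∧-true {stuck? ts (μsᶜ (word (Member.exit M)) (Member.start M))} h
   ... | x , i = record
    { start-mgs = g′ ; to-hub = to′
    ; from-hub = chain-true hub from start (linked-≅ {B = quiver hub} {quiver hub} (linked-end to′) (≅-pointwise (λ _ _ → refl))) f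
    ; exit-stuck = λ m → stuck-true (μsᶜ (word exit) start) x (HasMGS-≅ {B = μs (word exit) (quiver start)} {quiver (μsᶜ (word exit) start)} (≅-pointwise (quiver-μsᶜ (word exit) start)) m)
    ; in-component = let (d , d∈ , e) = isoTo-true component start i in any-quiver {quiver start} {d = d} d∈ e }
    where
    open Family F
    open Member M
    g′ : HasMGS (quiver start)
    g′ = mgs-true start (word mgs) g
    to′ : Linked (quiver start) (quiver hub)
    to′ = chain-true start to hub (linked-≅ {B = quiver start} {quiver start} g′ (≅-pointwise (λ _ _ → refl))) t

   map-∈ : ∀ {ds D} → D ∈ map quiver ds → ∃ λ d → d ∈ ds × D ≡ quiver d
   map-∈ i = ∈-map⁻ quiver i

   any-μ : ∀ {ds d} k c → d ∈ ds → quiver (μᶜ k c) ≅ quiver d → Any (μ k (quiver c) ≅_) (map quiver ds)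
   any-μ {ds} {d} k c d∈ e = any-quiver {μ k (quiver c)} {d = d} d∈ (≅-trans {B = μ k (quiver c)} {quiver (μᶜ k c)} {quiver d} (≅-pointwise (quiver-μᶜ k c)) e)

   closed-true : ∀ L → closed? ts L ≡ true → ∀ {D} → D ∈ map quiver L → ∀ k → Any (μ k D ≅_) (map quiver L) ⊎ ¬ HasMGS (μ k D)
   closed-true L h {D} D∈ k with map-∈ {L} D∈
   ... | c , c∈ , refl with ∨-true {isoTo ts L (μᶜ k c)} (everyᵛ-true (every-true h c∈) k)
   ...   | inj₁ g = let (d , d∈ , e) = isoTo-true L (μᶜ k c) g in inj₁ (any-μ {d = d} k c d∈ e)
   ...   | inj₂ g = inj₂ (λ m → stuck-true (μᶜ k c) g (HasMGS-≅ {B = μ k (quiver c)} {quiver (μᶜ k c)} (≅-pointwise (quiver-μᶜ k c)) m))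

   finite-true : ∀ L → finiteClosed? ts L ≡ true → ∀ {c} → isoTo ts L c ≡ true → MutFinite (quiver c)
   finite-true L h {c} g = closed⇒MutFinite (map quiver L) closed {quiver c} (let (d , d∈ , e) = isoTo-true L c g in any-quiver {quiver c} {d = d} d∈ e)
    where
    closed : ∀ {D} → D ∈ map quiver L → ∀ k → Any (μ k D ≅_) (map quiver L)
    closed D∈ k with map-∈ {L} D∈
    ... | c , c∈ , refl = let (d , d∈ , e) = isoTo-true L (μᶜ k c) (everyᵛ-true (every-true h c∈) k) in any-μ {d = d} k c d∈ e

   multiplicative-true : ∀ c → multiplicative? c ≡ true → Multiplicative (quiver c)
   multiplicative-true c h with ∧-true h
   ... | h₁ , h₂ = record
    { nonzero = λ i j i≢j → nz i j i≢j (∨-true (everyᵛ-true (everyᵛ-true h₁ i) j))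
    ; path = λ i k j ik kj → does-true (residue-of B i j ≟ˢ (residue-of B i k ⊗ residue-of B k j)) (not-∨ (does-yes (0ℤ ℤ.<? B k j) kj)
      (not-∨ (does-yes (0ℤ ℤ.<? B i k) ik) (everyᵛ-true (everyᵛ-true (everyᵛ-true h₂ i) k) j))) }
    where
    B = quiver c
    nz : ∀ i j → i ≢ j → does (i ≟ᶠ j) ≡ true ⊎ not (zero? (ρ (B i j))) ≡ true → ρ (B i j) ≢ zer
    nz i j i≢j (inj₁ e) = ⊥-elim (i≢j (does-true (i ≟ᶠ j) e))
    nz i j i≢j (inj₂ e) = not-zero (ρ (B i j)) e

   violates-true : ∀ c → violates? c ≡ true → ¬ Multiplicative (quiver c)
   violates-true c h m with ∨-true h
   violates-true c h m | inj₁ h′ with some-true h′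
   ... | i , _ , h with some-true h
   ... | j , _ , h with ∧-true h
   ... | ne , z = Multiplicative.nonzero m i j (not-does (i ≟ᶠ j) ne) (zero-true (ρ (quiver c i j)) z)
   violates-true c h m | inj₂ h′ with some-true h′
   ... | i , _ , h with some-true h
   ... | k , _ , h with some-true h
   ... | j , _ , h with ∧-true h
   ... | ik , h with ∧-true h
   ... | kj , ne = not-does (residue-of (quiver c) i j ≟ˢ (residue-of (quiver c) i k ⊗ residue-of (quiver c) k j)) ne
     (Multiplicative.path m i k j (does-true (0ℤ ℤ.<? quiver c i k) ik) (does-true (0ℤ ℤ.<? quiver c k j) kj))

   Satisfies : Mod3 → Q 4 → Set
   Satisfies holds   B = Multiplicative B
   Satisfies fails   B = ¬ Multiplicative B
   Satisfies unknown B = ⊤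

   mod3-true : ∀ m c → mod3? m c ≡ true → Satisfies m (quiver c)
   mod3-true holds   c h = multiplicative-true c h
   mod3-true fails   c h = violates-true c h
   mod3-true unknown c h = tt

   complete-true : ∀ x k y z → Distinct x k y z → ∃ λ t → t ∈ ts × lookup t v₀ ≡ x × lookup t v₁ ≡ k × lookup t v₂ ≡ y × lookup t v₃ ≡ z
   complete-true x k y z (xk , xy , xz , ky , kz , yz) with some-true (skip (y ≟ᶠ z) yz (skip (k ≟ᶠ z) kz (skip (k ≟ᶠ y) ky (skip (x ≟ᶠ z) xz (skip (x ≟ᶠ y) xy (skip (x ≟ᶠ k) xk
     (everyᵛ-true (everyᵛ-true (everyᵛ-true (everyᵛ-true ts-complete x) k) y) z)))))))
    where
    skip : ∀ {A : Set} {b} (d : Dec A) → ¬ A → does d ∨ b ≡ true → b ≡ true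
    skip d h e with ∨-true e
    ... | inj₁ t = ⊥-elim (h (does-true d t))
    ... | inj₂ g = g
   ... | t , t∈ , h with ∧-true {does (lookup t v₀ ≟ᶠ x)} h
   ... | e₀ , h with ∧-true {does (lookup t v₁ ≟ᶠ k)} h
   ... | e₁ , h with ∧-true {does (lookup t v₂ ≟ᶠ y)} h
   ... | e₂ , e₃ = t , t∈ , does-true (lookup t v₀ ≟ᶠ x) e₀ , does-true (lookup t v₁ ≟ᶠ k) e₁ , does-true (lookup t v₂ ≟ᶠ y) e₂ , does-true (lookup t v₃ ≟ᶠ z) e₃

   pfaffian-true : ∀ P c → pfaffian? ts P c ≡ true → PfIs P (quiver c)
   pfaffian-true P c h x k y z d with complete-true x k y z d
   ... | t , t∈ , refl , refl , refl , refl = does-true (∣ Pf (quiver c) (lookup t v₀) (lookup t v₁) (lookup t v₂) (lookup t v₃) ∣ ℕ.≟ P) (every-true h t∈)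

   ∈-ints : ∀ z → z ≤ ⁺ 2 → - z ≤ ⁺ 2 → z ∈ ints
   ∈-ints (⁺ 0) _ _ = there (there (here refl))
   ∈-ints (⁺ 1) _ _ = there (there (there (here refl)))
   ∈-ints (⁺ 2) _ _ = there (there (there (there (here refl))))
   ∈-ints (⁺ suc (suc (suc z))) (ℤ.+≤+ (ℕ.s≤s (ℕ.s≤s ()))) _
   ∈-ints -[1+ 0 ] _ _ = there (here refl)
   ∈-ints -[1+ 1 ] _ _ = here refl
   ∈-ints -[1+ suc (suc z) ] _ (ℤ.+≤+ (ℕ.s≤s (ℕ.s≤s ())))

   triple-skew : ∀ x y z → IsQuiver (triple x y z)
   triple-skew x y z v₀ v₀ = refl
   triple-skew x y z v₀ v₁ = sym (ℤP.neg-involutive x)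
   triple-skew x y z v₀ v₂ = sym (ℤP.neg-involutive y)
   triple-skew x y z v₁ v₀ = refl
   triple-skew x y z v₁ v₁ = refl
   triple-skew x y z v₁ v₂ = sym (ℤP.neg-involutive z)
   triple-skew x y z v₂ v₀ = refl
   triple-skew x y z v₂ v₁ = refl
   triple-skew x y z v₂ v₂ = refl

   μs-quiver : ∀ {n} ks {B : Q n} → IsQuiver B → IsQuiver (μs ks B)
   μs-quiver []       q = q
   μs-quiver (k ∷ ks) q = μs-quiver ks (μ-quiver q k)

   -- The large arrow appears only after `ks`, but representatives for the class of `B` serve
   -- `μs ks B` as well.
   grows-true : ∀ {B} → IsQuiver B → ∀ w → grows? B w ≡ true → ¬ MutFinite B
   grows-true {B} q (ks , p , r , c) h (L , fin) with ∧-true {does (⁺ 3 ℤ.≤? μs ks B p r)} h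
   ... | big , h with ∧-true {not (does (c ≟ᶠ p))} h
   ... | cp , h with ∧-true {not (does (r ≟ᶠ p))} h
   ... | rp , h with ∧-true {not (does (c ≟ᶠ r))} h
   ... | cr , h = Growth.growing-infinite (μs ks B p r) (does-true (⁺ 3 ℤ.≤? μs ks B p r) big) (nonzero (∨-true h))
     (record { skew = μs-quiver ks q ; p = p ; r = r ; c = c ; c≢p = not-does (c ≟ᶠ p) cp ; r≢p = not-does (r ≟ᶠ p) rp ; c≢r = not-does (c ≟ᶠ r) cr ; pr = refl ; cp = refl ; cr = refl })
     (L , λ js → subst (λ X → Any (X ≅_) L) (μs-++ ks js B) (fin (ks ++ js)))
    where
    nonzero : not (does (μs ks B c p ℤ.≟ 0ℤ)) ≡ true ⊎ not (does (μs ks B c r ℤ.≟ 0ℤ)) ≡ true → μs ks B c p ≢ 0ℤ ⊎ μs ks B c r ≢ 0ℤ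
    nonzero (inj₁ e) = inj₁ (not-does (μs ks B c p ℤ.≟ 0ℤ) e)
    nonzero (inj₂ e) = inj₂ (not-does (μs ks B c r ℤ.≟ 0ℤ) e)

   triples-true : ∀ ws xs → triples? ws xs ≡ true → ∀ {x y z} → x ∈ xs → y ∈ xs → z ∈ xs → good? x y z ≡ true ⊎ some (grows? (triple x y z)) ws ≡ true
   triples-true ws xs h {x} {y} {z} i j k = ∨-true {good? x y z} (every-true (every-true (every-true h i) j) k)

   classified-true : ∀ xs → classified? ts xs ≡ true → ∀ {a b c d e f} → a ∈ xs → b ∈ xs → c ∈ xs → d ∈ xs → e ∈ xs → f ∈ xs →
    good? a b d ≡ true → good? a c e ≡ true → good? b c f ≡ true → good? d e f ≡ true → known? ts (code a b c d e f) ≡ true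
   classified-true xs h {a} {b} {c} {d} {e} {f} ia ib ic id ie if abd ace bcf def = not-∨ def (not-∨ bcf (every-true (not-∨ ace (every-true (every-true (not-∨ abd
    (every-true (every-true (every-true h ia) ib) id)) ic) ie)) if))

   members-true : ∀ is → members? ts is ≡ true → ∀ {i} → i ∈ is → ∀ {M} → M ∈ Family.members (family i) → MemberFacts (family i) M
   members-true is h {i} i∈ {M} M∈ = member-true (family i) M (every-true (every-true h i∈) M∈)

   components-true : ∀ is → components? ts is ≡ true → ∀ {i} → i ∈ is → closed? ts (Family.component (family i)) ≡ true
   components-true is h i∈ = every-true h i∈

 -- The classification and the assertions on Ψ.

 module Classification where
  open import Defs
  open Forms using (diag-zero)
  open Mutations using (μ-quiver)
  open Barriers using (μ-relabel)
  open Isomorphisms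
  open Invariants
  open Computation
  open import Data.Integer using (-_; _≤_)
  open import Data.Fin.Permutation using (Permutation′; _⟨$⟩ʳ_)
  open import Data.List using (_++_; map; allFin)
  open import Data.List.Relation.Unary.Any as Any using (Any; here; there)
  open import Data.List.Membership.Propositional using (_∈_; find)
  open import Data.List.Membership.Propositional.Properties using (∈-map⁻; ∈-allFin)
  open import Relation.Binary.Construct.Closure.ReflexiveTransitive using (Star; ε; _◅_)

  module Main (ts : Tables) (ts-sound : ∀ {t} → t ∈ ts → ∃ λ (π : Permutation′ 4) → ∀ i → lookup t i ≡ π ⟨$⟩ʳ i) (ts-complete : complete? ts ≡ true)
   (triples-checked : triples? certificates ints ≡ true) (finite-checked : finiteClosed? ts finiteCodes ≡ true) (members-checked : members? ts (allFin 5) ≡ true)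
   (components-checked : components? ts (allFin 5) ≡ true) (codes-checked : classified? ts ints ≡ true) where
   open Checked ts ts-sound ts-complete

   record Classified (B : Q 4) : Set where
    field
     i         : Fin 5
     M         : Member
     M∈        : M ∈ Family.members (family i)
     iso       : B ≅ quiver (Member.start M)
     pfaffian  : PfIs (Family.pfaffian (family i)) B
     residues  : Satisfies (Family.mod3 (family i)) B

    facts : MemberFacts (family i) M
    facts = members-true (allFin 5) members-checked (∈-allFin i) M∈

   PfIs-cong : ∀ {P B C} → (∀ i j → B i j ≡ C i j) → PfIs P B → PfIs P C
   PfIs-cong {B = B} {C} h p x k y z d = trans (cong ∣_∣ᶻ (sym (cong₂ (λ u v → u ℤ.+ v) (cong₂ ℤ._-_ (cong₂ ℤ._*_ (h x k) (h y z)) (cong₂ ℤ._*_ (h x y) (h k z))) (cong₂ ℤ._*_ (h x z) (h k y))))) (p x k y z d)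
    where ∣_∣ᶻ = ℤ.∣_∣

   Multiplicative-cong : ∀ {B C} → (∀ i j → B i j ≡ C i j) → Multiplicative B → Multiplicative C
   Multiplicative-cong {B} {C} h m = record
    { nonzero = λ i j ne z → Multiplicative.nonzero m i j ne (trans (cong ρ (h i j)) z)
    ; path = λ i k j ik kj → trans (sym (r i j)) (trans (Multiplicative.path m i k j (subst (0ℤ ℤ.<_) (sym (h i k)) ik) (subst (0ℤ ℤ.<_) (sym (h k j)) kj)) (cong₂ Data.Sign._*_ (r i k) (r k j))) }
    where
    import Data.Sign
    r : ∀ i j → residue-of B i j ≡ residue-of C i j
    r i j = cong (λ z → residue (ρ z)) (h i j)

   Satisfies-cong : ∀ m {B C} → (∀ i j → B i j ≡ C i j) → Satisfies m B → Satisfies m C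
   Satisfies-cong holds   h s   = Multiplicative-cong h s
   Satisfies-cong fails   h s t = s (Multiplicative-cong (λ i j → sym (h i j)) t)
   Satisfies-cong unknown h s   = tt

   module _ {B : Q 4} (m : MinMutInf B) where
    private
     q : IsQuiver B
     q = proj₁ m

     entry∈ : ∀ i j → B i j ∈ ints
     entry∈ i j = ∈-ints (B i j) (entry≤2 m i j) (subst (_≤ ⁺ 2) (q j i) (entry≤2 m j i))

     -- A growth certificate would make a restriction to three vertices mutation-infinite, against
     -- minimality.
     good-triple : ∀ x y z → x ≢ y → x ≢ z → y ≢ z → good? (B x y) (B x z) (B y z) ≡ true
     good-triple x y z xy xz yz = go (triples-true certificates ints triples-checked (entry∈ x y) (entry∈ x z) (entry∈ y z))
      where
      T : Q 3
      T = triple (B x y) (B x z) (B y z)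
      same : ∀ i j → restrict (lookup (x ∷ y ∷ z ∷ [])) B i j ≡ T i j
      same zero zero = diag-zero q x
      same zero (suc zero) = refl
      same zero (suc (suc zero)) = refl
      same (suc zero) zero = q y x
      same (suc zero) (suc zero) = diag-zero q y
      same (suc zero) (suc (suc zero)) = refl
      same (suc (suc zero)) zero = q z x
      same (suc (suc zero)) (suc zero) = q z y
      same (suc (suc zero)) (suc (suc zero)) = diag-zero q z
      go : good? (B x y) (B x z) (B y z) ≡ true ⊎ some (grows? T) certificates ≡ true → good? (B x y) (B x z) (B y z) ≡ true
      go (inj₁ h) = h
      go (inj₂ h) = let (w , _ , g) = some-true h in
       ⊥-elim (grows-true (triple-skew (B x y) (B x z) (B y z)) w g (MutFinite-≅ {B = T} {restrict (lookup (x ∷ y ∷ z ∷ [])) B} (≅-pointwise same) (restrict-finite m xy xz yz)))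

     c : Code
     c = codeOf B

     B≅c : B ≅ quiver c
     B≅c = ≅-pointwise (quiver-codeOf q)

     known : known? ts c ≡ true
     known = classified-true ints codes-checked (entry∈ v₀ v₁) (entry∈ v₀ v₂) (entry∈ v₀ v₃) (entry∈ v₁ v₂) (entry∈ v₁ v₃) (entry∈ v₂ v₃)
      (good-triple v₀ v₁ v₂ (λ ()) (λ ()) (λ ())) (good-triple v₀ v₁ v₃ (λ ()) (λ ()) (λ ())) (good-triple v₀ v₂ v₃ (λ ()) (λ ()) (λ ())) (good-triple v₁ v₂ v₃ (λ ()) (λ ()) (λ ()))

    abstract
     -- The enumeration leaves either a mutation-finite code, impossible for `B`, or a member of one
     -- of the five families together with its invariants.
     classify : Classified B
     classify = go (∨-true {isoTo ts finiteCodes c} known)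
      where
      go : isoTo ts finiteCodes c ≡ true ⊎ some (inFamily? ts c) (allFin 5) ≡ true → Classified B
      go (inj₁ h) = ⊥-elim (proj₁ (proj₂ m) (MutFinite-≅ {B = B} {quiver c} B≅c (finite-true finiteCodes finite-checked {c} h)))
      go (inj₂ h) = build (some-true h)
       where
       build : (∃ λ i → i ∈ allFin 5 × inFamily? ts c i ≡ true) → Classified B
       build (i , _ , h) = parts (isoTo-true (map Member.start (Family.members (family i))) c (proj₁ p)) (∧-true {pfaffian? ts (Family.pfaffian (family i)) c} (proj₂ p))
        where
        p : isoTo ts (map Member.start (Family.members (family i))) c ≡ true ×
         (pfaffian? ts (Family.pfaffian (family i)) c ∧ mod3? (Family.mod3 (family i)) c) ≡ true
        p = ∧-true {isoTo ts (map Member.start (Family.members (family i))) c} h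
        parts : (∃ λ d → d ∈ map Member.start (Family.members (family i)) × (quiver c ≅ quiver d)) → pfaffian? ts (Family.pfaffian (family i)) c ≡ true × mod3? (Family.mod3 (family i)) c ≡ true → Classified B
        parts (d , d∈ , e) (pf , r) = finish (∈-map⁻ Member.start d∈)
         where
         finish : (∃ λ M → M ∈ Family.members (family i) × d ≡ Member.start M) → Classified B
         finish (M , M∈ , refl) = record { i = i ; M = M ; M∈ = M∈ ; iso = ≅-trans {B = B} {quiver c} {quiver d} B≅c e
          ; pfaffian = PfIs-cong (quiver-codeOf q) (pfaffian-true (Family.pfaffian (family i)) c pf)
          ; residues = Satisfies-cong (Family.mod3 (family i)) (quiver-codeOf q) (mod3-true (Family.mod3 (family i)) c r) }

    psi-proper : PsiProper B
    psi-proper = PsiProper-≅ {B = B} {quiver (Member.start M)} iso (word (Member.exit M)) (MemberFacts.exit-stuck facts)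
     where open Classified classify

    psi-component-finite : PsiCompFinite B
    psi-component-finite = closed⇒PsiCompFinite (map quiver L) (closed-true L (components-true (allFin 5) components-checked (∈-allFin i))) {B}
      (Any.map (λ {D} → ≅-trans {B = B} {quiver (Member.start M)} {D} iso) (MemberFacts.in-component facts))
     where
     open Classified classify
     L = Family.component (family i)

   PfIs-μs : ∀ {P} ks {B} → IsQuiver B → PfIs P B → PfIs P (μs ks B)
   PfIs-μs []       q h = h
   PfIs-μs (k ∷ ks) q h = PfIs-μs ks (μ-quiver q k) (PfIs-μ q h k)

   Multiplicative-μs : ∀ ks {B} → IsQuiver B → PfIs 1 B → Multiplicative B → Multiplicative (μs ks B)
   Multiplicative-μs []       q h t = t
   Multiplicative-μs (k ∷ ks) q h t = Multiplicative-μs ks (μ-quiver q k) (PfIs-μ q h k) (Multiplicative-μ q h t k)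

   -- Mutation is an involution, so preservation of the property also gives the converse.
   Multiplicative-μs⁻ : ∀ ks {B} → IsQuiver B → PfIs 1 B → Multiplicative (μs ks B) → Multiplicative B
   Multiplicative-μs⁻ []       q h t = t
   Multiplicative-μs⁻ (k ∷ ks) {B} q h t = Multiplicative-cong (μ-involutive B k)
    (Multiplicative-μ (μ-quiver q k) (PfIs-μ q h k) (Multiplicative-μs⁻ ks (μ-quiver q k) (PfIs-μ q h k) t) k)

   -- |Pf B| is constant on a mutation class and separates all but two families. Those two differ in
   -- `Multiplicative`, which mutation preserves when |Pf B| = 1.
   same-family : ∀ {B C} i j ks → IsQuiver B → (∀ x y → μs ks B x y ≡ C x y) →
    PfIs (Family.pfaffian (family i)) B → Satisfies (Family.mod3 (family i)) B → PfIs (Family.pfaffian (family j)) C → Satisfies (Family.mod3 (family j)) C → i ≡ j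
   same-family {B} {C} i j ks q h pB sB pC sC = go i j pB sB pC sC
     (trans (sym (PfIs-cong h (PfIs-μs ks q pB) v₀ v₁ v₂ v₃ d)) (pC v₀ v₁ v₂ v₃ d))
    where
    d : Distinct v₀ v₁ v₂ v₃
    d = (λ ()) , (λ ()) , (λ ()) , (λ ()) , (λ ()) , (λ ())
    go : ∀ i j → PfIs (Family.pfaffian (family i)) B → Satisfies (Family.mod3 (family i)) B → PfIs (Family.pfaffian (family j)) C → Satisfies (Family.mod3 (family j)) C →
     Family.pfaffian (family i) ≡ Family.pfaffian (family j) → i ≡ j
    go zero zero _ _ _ _ _ = refl
    go zero (suc zero) _ _ _ _ ()
    go zero (suc (suc zero)) _ _ _ _ ()
    go zero (suc (suc (suc zero))) _ _ _ _ ()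
    -- Both families have |Pf B| = 1; the property holds for `C` and would be carried back to `B`,
    -- where it fails.
    go zero (suc (suc (suc (suc zero)))) p s _ t _ = ⊥-elim (s (Multiplicative-μs⁻ ks q p (Multiplicative-cong (λ i j → sym (h i j)) t)))
    go (suc zero) zero _ _ _ _ ()
    go (suc zero) (suc zero) _ _ _ _ _ = refl
    go (suc zero) (suc (suc zero)) _ _ _ _ ()
    go (suc zero) (suc (suc (suc zero))) _ _ _ _ ()
    go (suc zero) (suc (suc (suc (suc zero)))) _ _ _ _ ()
    go (suc (suc zero)) zero _ _ _ _ ()
    go (suc (suc zero)) (suc zero) _ _ _ _ ()
    go (suc (suc zero)) (suc (suc zero)) _ _ _ _ _ = refl
    go (suc (suc zero)) (suc (suc (suc zero))) _ _ _ _ ()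
    go (suc (suc zero)) (suc (suc (suc (suc zero)))) _ _ _ _ ()
    go (suc (suc (suc zero))) zero _ _ _ _ ()
    go (suc (suc (suc zero))) (suc zero) _ _ _ _ ()
    go (suc (suc (suc zero))) (suc (suc zero)) _ _ _ _ ()
    go (suc (suc (suc zero))) (suc (suc (suc zero))) _ _ _ _ _ = refl
    go (suc (suc (suc zero))) (suc (suc (suc (suc zero)))) _ _ _ _ ()
    go (suc (suc (suc (suc zero)))) zero p s _ t _ = ⊥-elim (t (Multiplicative-cong h (Multiplicative-μs ks q p s)))
    go (suc (suc (suc (suc zero)))) (suc zero) _ _ _ _ ()
    go (suc (suc (suc (suc zero)))) (suc (suc zero)) _ _ _ _ ()
    go (suc (suc (suc (suc zero)))) (suc (suc (suc zero))) _ _ _ _ ()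
    go (suc (suc (suc (suc zero)))) (suc (suc (suc (suc zero)))) _ _ _ _ _ = refl

   Reached : Q 4 → Q 4 → Set
   Reached B C = MinMutInf C × ∃ λ ks → ∀ i j → μs ks B i j ≡ C i j

   -- The moves are merged into a single mutation sequence; the quivers it passes may lie outside Ψ.
   reached : ∀ {B C} → MinMutInf B → MoveEquiv B C → Reached B C
   reached m ε = m , [] , λ _ _ → refl
   reached {B} {C} m (_◅_ {j = D} (_ , mD , ks , h) rest) with reached mD rest
   ... | mC , js , g = mC , ks ++ js , λ i j → trans (cong (λ X → X i j) (μs-++ ks js B)) (trans (μs-cong js h i j) (g i j))

   -- Both quivers belong to one family, and its hub joins them inside Ψ.
   move-class : ∀ {B} → MinMutInf B → MoveClassInComp B
   move-class {B} m C e = go (reached m e)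
    where
    go : Reached B C → ∃ λ D → InPsiComp B D × (D ≅ C)
    go (mC , ks , h) = linked (same-family X.i Y.i ks (proj₁ m) h X.pfaffian X.residues Y.pfaffian Y.residues) Y.M X.facts Y.facts Y.iso
     where
     module X = Classified (classify m)
     module Y = Classified (classify mC)
     linked : ∀ {j} → X.i ≡ j → ∀ M → MemberFacts (family X.i) X.M → MemberFacts (family j) M → C ≅ quiver (Member.start M) → Linked B C
     linked refl M f g iC = linked-iso {B = B} {quiver (Member.start M)} {C}
       (linked-trans {B = B} {quiver (Family.hub (family X.i))} {quiver (Member.start M)}
        (linked-trans {B = B} {quiver (Member.start X.M)} {quiver (Family.hub (family X.i))}
         (linked-≅ {B = B} {quiver (Member.start X.M)} (HasMGS-≅ {B = quiver (Member.start X.M)} {B} (≅-sym {B = B} {quiver (Member.start X.M)} X.iso) (MemberFacts.start-mgs f)) X.iso)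
         (MemberFacts.to-hub f))
        (MemberFacts.from-hub g)) (≅-sym {B = C} {quiver (Member.start M)} iC)

   main : (B : Q 4) → MinMutInf B → PsiProper B × PsiCompFinite B × MoveClassInComp B
   main B m = psi-proper m , psi-component-finite m , move-class m

open import Defs
open import Data.List using (allFin)
open Computation
open Classification

-- Evaluation of the checks.

opaque
  unfolding every

  complete-checked : complete? tables ≡ true
  complete-checked = refl

  triples-checked : triples? certificates ints ≡ true
  triples-checked = refl

  finite-checked : finiteClosed? tables finiteCodes ≡ true
  finite-checked = refl

  members-checked : members? tables (allFin 5) ≡ true
  members-checked = refl

  components-checked : components? tables (allFin 5) ≡ true
  components-checked = refl

  codes-checked : classified? tables ints ≡ true
  codes-checked = refl

theorem7p10 : (B : Q 4) → MinMutInf B →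
  PsiProper B × PsiCompFinite B × MoveClassInComp B
theorem7p10 = Main.main tables tables-sound complete-checked triples-checked finite-checked members-checked components-checked codes-checked
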